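{- Let $T$ be a primitive recursively axiomatized consistent extension of Peano arithmetic $\mathsf{PA}$ in the language of first-order arithmetic. For each $L \in \{\mathsf{EN}, \mathsf{ENP}, \mathsf{END}\}$, there exists a $\Sigma_1$ provability predicate $\mathrm{Pr}_T(x)$ of $T$ satisfying condition $\mathbf{E}$ such that (1) for any modal formula $A$ and any arithmetical interpretation $f$ based on $\mathrm{Pr}_T(x)$, if $L \vdash A$, then $T \vdash f(A)$; and (2) there exists an arithmetical interpretation $f$ based on $\mathrm{Pr}_T(x)$ such that for any modal formula $A$, $L \vdash A$ if and only if $T \vdash f(A)$.
   Context: For a formula $\varphi$, $\ulcorner \varphi \urcorner$ denotes the numeral of its Gödel number. A formula $\mathrm{Pr}_T(x)$ is a provability predicate of $T$ if for every formula $\varphi$: $T \vdash \varphi$ iff $\mathsf{PA} \vdash \mathrm{Pr}_T(\ulcorner \varphi \urcorner)$. Condition $\mathbf{E}$: for all formulas $\varphi,\psi$, if $T \vdash \varphi \leftrightarrow \psi$ then $T \vdash \mathrm{Pr}_T(\ulcorner\varphi\urcorner) \leftrightarrow \mathrm{Pr}_T(\ulcorner\psi\urcorner)$. Modal formulas are built from propositional variables, $\bot$, $\neg,\wedge,\vee,\to$ and $\Box$. An arithmetical interpretation based on $\mathrm{Pr}_T(x)$ is a map $f$ from modal formulas to arithmetical sentences with $f(\bot) = (0=1)$, $f(\neg A) = \neg f(A)$, $f(A \circ B) = f(A) \circ f(B)$ for $\circ \in \{\wedge,\vee,\to\}$, and $f(\Box A) = \mathrm{Pr}_T(\ulcorner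 f(A) \urcorner)$ (values on propositional variables arbitrary sentences). The modal logic $\mathsf{EN}$ is axiomatized by all propositional tautologies and closed under modus ponens, necessitation ($A / \Box A$) and the rule $\mathsf{RE}$: from $A \leftrightarrow B$ infer $\Box A \leftrightarrow \Box B$. $\mathsf{ENP} = \mathsf{EN} + \neg\Box\bot$ and $\mathsf{END} = \mathsf{EN} + \neg(\Box A \wedge \Box\neg A)$ (axiom schemes). -}

module Defs where

open import Data.Nat using (ℕ; zero; suc; _+_; _*_; _^_; _<_)
open import Data.Fin using (Fin)
open import Data.Vec using (Vec; []; _∷_; lookup)
open import Data.Bool using (Bool; true; false; not; _∧_; _∨_)
open import Data.Product using (Σ; _×_; _,_)
open import Relation.Binary.PropositionalEquality using (_≡_)
open import Relation.Nullary using (¬_)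

data PR : ℕ → Set where
  pr-zero : ∀ {n} → PR n
  pr-succ : PR 1
  pr-proj : ∀ {n} → Fin n → PR n
  pr-comp : ∀ {m n} → PR m → Vec (PR n) m → PR n
  pr-rec  : ∀ {n} → PR n → PR (suc (suc n)) → PR (suc n)

mutual
  evalPR : ∀ {n} → PR n → Vec ℕ n → ℕ
  evalPR pr-zero xs = 0
  evalPR pr-succ (x ∷ []) = suc x
  evalPR (pr-proj i) xs = lookup xs i
  evalPR (pr-comp f gs) xs = evalPR f (evalPRs gs xs)
  evalPR (pr-rec g h) (zero ∷ xs) = evalPR g xs
  evalPR (pr-rec g h) (suc k ∷ xs) = evalPR h (k ∷ evalPR (pr-rec g h) (k ∷ xs) ∷ xs)

  evalPRs : ∀ {m n} → Vec (PR n) m → Vec ℕ n → Vec ℕ m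
  evalPRs [] xs = []
  evalPRs (g ∷ gs) xs = evalPR g xs ∷ evalPRs gs xs

-- Syntax of first-order arithmetic (language 0, S, +, ×, =),
-- de Bruijn indices for variables.

infix 5 _⇔'_
infixr 6 _⇒'_
infixr 7 _∨'_
infixr 8 _∧'_
infix 9 ¬'_
infix 10 _≐_
infixl 12 _⊕_
infixl 13 _⊗_
infix 15 _⟨_⟩

data Term : Set where
  var  : ℕ → Term
  zr   : Term
  S    : Term → Term
  _⊕_  : Term → Term → Term
  _⊗_  : Term → Term → Term

data Formula : Set where
  _≐_   : Term → Term → Formula
  ⊥'    : Formula
  ¬'_   : Formula → Formula
  _∧'_  : Formula → Formula → Formula
  _∨'_  : Formula → Formula → Formula
  _⇒'_  : Formula → Formula → Formula
  ∀'    : Formula → Formula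
  ∃'    : Formula → Formula

_⇔'_ : Formula → Formula → Formula
φ ⇔' ψ = (φ ⇒' ψ) ∧' (ψ ⇒' φ)

Subst : Set
Subst = ℕ → Term

substT : Subst → Term → Term
substT σ (var k) = σ k
substT σ zr = zr
substT σ (S t) = S (substT σ t)
substT σ (t ⊕ u) = substT σ t ⊕ substT σ u
substT σ (t ⊗ u) = substT σ t ⊗ substT σ u

shiftT : Term → Term
shiftT = substT (λ k → var (suc k))

lift : Subst → Subst
lift σ zero = var zero
lift σ (suc k) = shiftT (σ k)

subst : Subst → Formula → Formula
subst σ (t ≐ u) = substT σ t ≐ substT σ u
subst σ ⊥' = ⊥'
subst σ (¬' φ) = ¬' subst σ φ
subst σ (φ ∧' ψ) = subst σ φ ∧' subst σ ψ
subst σ (φ ∨' ψ) = subst σ φ ∨' subst σ ψ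
subst σ (φ ⇒' ψ) = subst σ φ ⇒' subst σ ψ
subst σ (∀' φ) = ∀' (subst (lift σ) φ)
subst σ (∃' φ) = ∃' (subst (lift σ) φ)

shift : Formula → Formula
shift = subst (λ k → var (suc k))

inst : Term → Formula → Formula
inst t = subst σ
  where
  σ : Subst
  σ zero = t
  σ (suc k) = var k

FVBelowT : ℕ → Term → Set
FVBelowT n (var k) = k < n
FVBelowT n zr = Data.Unit.⊤ where import Data.Unit
FVBelowT n (S t) = FVBelowT n t
FVBelowT n (t ⊕ u) = FVBelowT n t × FVBelowT n u
FVBelowT n (t ⊗ u) = FVBelowT n t × FVBelowT n u

FVBelow : ℕ → Formula → Set
FVBelow n (t ≐ u) = FVBelowT n t × FVBelowT n u
FVBelow n ⊥' = Data.Unit.⊤ where import Data.Unit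
FVBelow n (¬' φ) = FVBelow n φ
FVBelow n (φ ∧' ψ) = FVBelow n φ × FVBelow n ψ
FVBelow n (φ ∨' ψ) = FVBelow n φ × FVBelow n ψ
FVBelow n (φ ⇒' ψ) = FVBelow n φ × FVBelow n ψ
FVBelow n (∀' φ) = FVBelow (suc n) φ
FVBelow n (∃' φ) = FVBelow (suc n) φ

Sentence : Formula → Set
Sentence = FVBelow 0

numeral : ℕ → Term
numeral zero = zr
numeral (suc n) = S (numeral n)

pair : ℕ → ℕ → ℕ
pair a b = (2 ^ a) * (2 * b + 1)

codeT : Term → ℕ
codeT (var k) = pair 0 k
codeT zr = pair 1 0
codeT (S t) = pair 2 (codeT t)
codeT (t ⊕ u) = pair 3 (pair (codeT t) (codeT u))
codeT (t ⊗ u) = pair 4 (pair (codeT t) (codeT u))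

code : Formula → ℕ
code (t ≐ u) = pair 0 (pair (codeT t) (codeT u))
code ⊥' = pair 1 0
code (¬' φ) = pair 2 (code φ)
code (φ ∧' ψ) = pair 3 (pair (code φ) (code ψ))
code (φ ∨' ψ) = pair 4 (pair (code φ) (code ψ))
code (φ ⇒' ψ) = pair 5 (pair (code φ) (code ψ))
code (∀' φ) = pair 6 (code φ)
code (∃' φ) = pair 7 (code φ)

⌜_⌝ : Formula → Term
⌜ φ ⌝ = numeral (code φ)

evalB : (Formula → Bool) → Formula → Bool
evalB w (t ≐ u) = w (t ≐ u)
evalB w ⊥' = false
evalB w (¬' φ) = not (evalB w φ)
evalB w (φ ∧' ψ) = evalB w φ ∧ evalB w ψ
evalB w (φ ∨' ψ) = evalB w φ ∨ evalB w ψ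
evalB w (φ ⇒' ψ) = not (evalB w φ) ∨ evalB w ψ
evalB w (∀' φ) = w (∀' φ)
evalB w (∃' φ) = w (∃' φ)

Tautology : Formula → Set
Tautology φ = (w : Formula → Bool) → evalB w φ ≡ true

-- a theory is given by its set of (nonlogical) axioms
Theory : Set₁
Theory = Formula → Set

infix 4 _⊢_

data _⊢_ (T : Theory) : Formula → Set where
  ax     : ∀ {φ} → T φ → T ⊢ φ
  taut   : ∀ {φ} → Tautology φ → T ⊢ φ
  ∀-elim : ∀ φ t → T ⊢ ∀' φ ⇒' inst t φ
  ∀-intro : ∀ φ ψ → T ⊢ ∀' (shift ψ ⇒' φ) ⇒' (ψ ⇒' ∀' φ)
  ∃-intro : ∀ φ t → T ⊢ inst t φ ⇒' ∃' φ
  ∃-elim : ∀ φ ψ → T ⊢ ∀' (φ ⇒' shift ψ) ⇒' (∃' φ ⇒' ψ)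
  eq-refl : ∀ t → T ⊢ t ≐ t
  eq-subst : ∀ φ t u → T ⊢ t ≐ u ⇒' (inst t φ ⇒' inst u φ)
  mp     : ∀ {φ ψ} → T ⊢ φ ⇒' ψ → T ⊢ φ → T ⊢ ψ
  gen    : ∀ {φ} → T ⊢ φ → T ⊢ ∀' φ

private
  v0 v1 : Term
  v0 = var 0
  v1 = var 1

succInst : Formula → Formula
succInst = subst σ
  where
  σ : Subst
  σ zero = S (var zero)
  σ (suc k) = var (suc k)

data PA : Theory where
  pa1 : PA (∀' (¬' (S v0 ≐ zr)))
  pa2 : PA (∀' (∀' (S v1 ≐ S v0 ⇒' v1 ≐ v0)))
  pa3 : PA (∀' (v0 ⊕ zr ≐ v0))
  pa4 : PA (∀' (∀' (v1 ⊕ S v0 ≐ S (v1 ⊕ v0))))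
  pa5 : PA (∀' (v0 ⊗ zr ≐ zr))
  pa6 : PA (∀' (∀' (v1 ⊗ S v0 ≐ (v1 ⊗ v0) ⊕ v1)))
  pa-ind : ∀ φ → PA (inst zr φ ⇒' (∀' (φ ⇒' succInst φ) ⇒' ∀' φ))

Consistent : Theory → Set
Consistent T = ¬ (T ⊢ ⊥')

Extends : Theory → Theory → Set   -- Extends T U : U extends T
Extends T U = ∀ φ → T ⊢ φ → U ⊢ φ

PrimRecAxiomatized : Theory → Set
PrimRecAxiomatized T =
  Σ (PR 1) λ χ → ∀ φ → (T φ → evalPR χ (code φ ∷ []) ≡ 1) × (evalPR χ (code φ ∷ []) ≡ 1 → T φ)

_≤'_ : Term → Term → Formula
t ≤' u = ∃' (var 0 ⊕ shiftT t ≐ shiftT u)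

data Δ₀ : Formula → Set where
  d-eq  : ∀ t u → Δ₀ (t ≐ u)
  d-bot : Δ₀ ⊥'
  d-neg : ∀ {φ} → Δ₀ φ → Δ₀ (¬' φ)
  d-and : ∀ {φ ψ} → Δ₀ φ → Δ₀ ψ → Δ₀ (φ ∧' ψ)
  d-or  : ∀ {φ ψ} → Δ₀ φ → Δ₀ ψ → Δ₀ (φ ∨' ψ)
  d-imp : ∀ {φ ψ} → Δ₀ φ → Δ₀ ψ → Δ₀ (φ ⇒' ψ)
  d-ball : ∀ {φ} t → Δ₀ φ → Δ₀ (∀' ((var 0 ≤' shiftT t) ⇒' φ))
  d-bex  : ∀ {φ} t → Δ₀ φ → Δ₀ (∃' ((var 0 ≤' shiftT t) ∧' φ))

data Σ₁ : Formula → Set where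
  s-d₀ : ∀ {φ} → Δ₀ φ → Σ₁ φ
  s-ex : ∀ {φ} → Σ₁ φ → Σ₁ (∃' φ)

-- Pr(x) has x = var 0 as its only free variable;  Pr(⌜φ⌝) = inst ⌜φ⌝ Pr
_⟨_⟩ : Formula → Formula → Formula
Pr ⟨ φ ⟩ = inst ⌜ φ ⌝ Pr

IsProvabilityPredicate : Theory → Formula → Set
IsProvabilityPredicate T Pr =
  FVBelow 1 Pr ×
  (∀ φ → (T ⊢ φ → PA ⊢ Pr ⟨ φ ⟩) × (PA ⊢ Pr ⟨ φ ⟩ → T ⊢ φ))

ConditionE : Theory → Formula → Set
ConditionE T Pr = ∀ φ ψ → T ⊢ φ ⇔' ψ → T ⊢ Pr ⟨ φ ⟩ ⇔' Pr ⟨ ψ ⟩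

infix 5 _⇔ₘ_
infixr 6 _⇒ₘ_
infixr 7 _∨ₘ_
infixr 8 _∧ₘ_
infix 9 ¬ₘ_
infix 9 □_

data MFormula : Set where
  pv   : ℕ → MFormula
  ⊥ₘ   : MFormula
  ¬ₘ_  : MFormula → MFormula
  _∧ₘ_ : MFormula → MFormula → MFormula
  _∨ₘ_ : MFormula → MFormula → MFormula
  _⇒ₘ_ : MFormula → MFormula → MFormula
  □_   : MFormula → MFormula

_⇔ₘ_ : MFormula → MFormula → MFormula
A ⇔ₘ B = (A ⇒ₘ B) ∧ₘ (B ⇒ₘ A)

evalM : (ℕ → Bool) → (MFormula → Bool) → MFormula → Bool
evalM v w (pv n) = v n
evalM v w ⊥ₘ = false
evalM v w (¬ₘ A) = not (evalM v w A)
evalM v w (A ∧ₘ B) = evalM v w A ∧ evalM v w B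
evalM v w (A ∨ₘ B) = evalM v w A ∨ evalM v w B
evalM v w (A ⇒ₘ B) = not (evalM v w A) ∨ evalM v w B
evalM v w (□ A) = w A

MTautology : MFormula → Set
MTautology A = (v : ℕ → Bool) (w : MFormula → Bool) → evalM v w A ≡ true

data Logic : Set where
  EN ENP END : Logic

data ExtraAx : Logic → MFormula → Set where
  P-ax : ExtraAx ENP (¬ₘ (□ ⊥ₘ))
  D-ax : ∀ A → ExtraAx END (¬ₘ ((□ A) ∧ₘ (□ (¬ₘ A))))

infix 4 _⊢ₘ_

data _⊢ₘ_ (L : Logic) : MFormula → Set where
  m-taut : ∀ {A} → MTautology A → L ⊢ₘ A
  m-ax   : ∀ {A} → ExtraAx L A → L ⊢ₘ A
  m-mp   : ∀ {A B} → L ⊢ₘ A ⇒ₘ B → L ⊢ₘ A → L ⊢ₘ B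
  m-nec  : ∀ {A} → L ⊢ₘ A → L ⊢ₘ □ A
  m-re   : ∀ {A B} → L ⊢ₘ A ⇔ₘ B → L ⊢ₘ (□ A) ⇔ₘ (□ B)

record Valuation : Set where
  field
    val      : ℕ → Formula
    val-sent : ∀ n → Sentence (val n)
open Valuation public

interp : Formula → Valuation → MFormula → Formula
interp Pr f (pv n) = val f n
interp Pr f ⊥ₘ = zr ≐ S zr
interp Pr f (¬ₘ A) = ¬' interp Pr f A
interp Pr f (A ∧ₘ B) = interp Pr f A ∧' interp Pr f B
interp Pr f (A ∨ₘ B) = interp Pr f A ∨' interp Pr f B
interp Pr f (A ⇒ₘ B) = interp Pr f A ⇒' interp Pr f B
interp Pr f (□ A) = Pr ⟨ interp Pr f A ⟩

{-# OPTIONS --safe #-}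
-- Formal derivations are recorded in finite databases coded by numbers, in which every fact is justified by a Horn rule
-- from earlier facts. "w is a correct database" is then Δ₀, and arithmetic only has to decide closed instances of Δ₀-formulas:
-- nothing is computed inside arithmetic.
--
-- The predicate Pr(x) says that some valid stage w puts x in, where w is either a verified stage or the first fire.
-- A verified stage of level k puts in exactly the formulas linked to ⊤ by the T-proofs of equivalences below k, and certifies
-- that these equivalences identify two interpretations of modal formulas only if the modal formulas are equivalent in L.
-- A fire is a stage assigning truth values to finitely many boxes and variables in a way that T refutes. Every stage must
-- respect the equivalences already found and contain the earlier verified stages (which gives E), and must satisfy P or D.
--
-- No fire occurs: at the first one, T would prove each of the chosen literals. Hence Pr is correct. Conversely, let T prove
-- the interpretation of C. An assignment of truth values to the atoms of C that makes C false and obeys the rules of L yields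
-- a fire, unless a verified stage of high level comes first, which already certifies C in L. So C follows in L from each
-- assignment, hence is a theorem of L; by induction on the level, verified stages of every level exist.
--
-- Consistency of T does not make PA-proofs of Σ₁-sentences true constructively; the witness is extracted from the PA-proof
-- by Friedman's translation.
module Submission where

open import Defs
open import Data.Bool as Bool using (true; false; not; _∧_; _∨_; Bool)
open import Data.Bool.Properties using (∨-zeroʳ)
open import Data.Empty using (⊥; ⊥-elim)
open import Data.Fin as Fin using (Fin; zero; suc; toℕ; _↑ˡ_)
open import Data.Fin.Patterns using (0F; 1F; 2F; 3F; 4F; 5F; 6F; 7F)
import Data.Fin.Properties as Finₚ
open import Data.List as List using (List; []; _∷_; _++_; map; upTo; filter; cartesianProduct; cartesianProductWith)
open import Data.List.Membership.Propositional using (_∈_; find)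
open import Data.List.Membership.Propositional.Properties using (∈-map⁺; ∈-map⁻; ∈-++⁺ˡ; ∈-++⁺ʳ; ∈-++⁻; ∈-upTo⁺; ∈-upTo⁻; ∈-filter⁺; ∈-filter⁻; ∈-cartesianProduct⁺; ∈-cartesianProduct⁻; ∈-cartesianProductWith⁺)
open import Data.List.Relation.Unary.All as All using (All; []; _∷_)
import Data.List.Relation.Unary.All.Properties as Allₚ
open import Data.List.Relation.Unary.Any as Any using (Any; here; there)
open import Data.Nat hiding (_/_)
import Data.Nat.Coprimality as Coprimality
open import Data.Nat.Coprimality using (Coprime; coprime-divisor)
open import Data.Nat.Induction using (<-rec)
open import Data.Nat.ListAction using (sum)
open import Data.Nat.Properties
open import Data.Product using (∃; _×_; _,_; proj₁; proj₂; Σ)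
open import Data.Sum using (_⊎_; inj₁; inj₂)
open import Data.Unit using (tt)
open import Data.Vec as Vec using (Vec; _∷_; lookup; tabulate; [])
open import Data.Vec.Properties using (tabulate-cong; tabulate∘lookup; lookup∘tabulate; lookup-++ˡ)
open import Function using (_∘_; id; case_of_; _$_)
open import Relation.Binary.Definitions using (tri<; tri≈; tri>)
open import Relation.Binary.PropositionalEquality renaming (subst to ≡subst)
open import Relation.Nullary using (¬_; Dec; yes; no)
open import Relation.Nullary.Decidable using (¬?; decidable-stable; map′; _×-dec_)

-- Condition E and the fires pull against each other. A fire would have to respect every equivalence
-- that T proves, while its truth values respect only those of L; that T-equivalent interpretations
-- are L-equivalent is the completeness statement itself. Levels break this circle. A stage has to
-- respect an equivalence only once some verified stage not above it has a level exceeding the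
-- proof. Every actual proof is eventually covered, and this gives E because T decides the finitely
-- many earlier stages. Conversely, at level k the induction hypothesis makes an assignment
-- compatible with everything imposed on it, so its fire is legitimate unless a level above k has
-- been verified, and such a level already carries the wanted proof in L.
--
-- For D the hypothesis must also speak of negations. Let x be linked to the interpretation of `A`
-- and the negation of x to that of `B`, where x need not be an interpretation. Then T proves the
-- equivalence of the negation of `A` with `B`, but perhaps only by a proof above level k. Hence the
-- second half of `Claim`, certified separately through `SatN`.

-- Well-scoped bounded formulas, their truth and their translation into arithmetic

module BoundedFormulas where
  -- Numerals are single nodes `l`, so that substitution never walks through one.
  data Tm (n : ℕ) : Set where
    `v   : Fin n → Tm n
    `l   : ℕ → Tm n
    `s   : Tm n → Tm n
    _`+_ : Tm n → Tm n → Tm n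
    _`*_ : Tm n → Tm n → Tm n

  infixr 6 _`⇒_
  infixr 7 _`∨_
  infixr 8 _`∧_
  infix 10 _`=_
  infixl 12 _`+_
  infixl 13 _`*_

  data Δ (n : ℕ) : Set where
    _`=_ : Tm n → Tm n → Δ n
    `⊥   : Δ n
    _`∧_ _`∨_ _`⇒_ : Δ n → Δ n → Δ n
    `∀ `∃ : Tm n → Δ (suc n) → Δ n

  private variable
    k m n : ℕ

  Sub : ℕ → ℕ → Set
  Sub m n = Fin m → Tm n

  subT : Sub m n → Tm m → Tm n
  subT τ (`v i) = τ i
  subT τ (`l k) = `l k
  subT τ (`s t) = `s (subT τ t)
  subT τ (t `+ u) = subT τ t `+ subT τ u
  subT τ (t `* u) = subT τ t `* subT τ u

  wkT : Tm n → Tm (suc n)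
  wkT = subT (`v ∘ suc)

  liftτ : Sub m n → Sub (suc m) (suc n)
  liftτ τ zero = `v zero
  liftτ τ (suc i) = wkT (τ i)

  sub : Sub m n → Δ m → Δ n
  sub τ (t `= u) = subT τ t `= subT τ u
  sub τ `⊥ = `⊥
  sub τ (φ `∧ ψ) = sub τ φ `∧ sub τ ψ
  sub τ (φ `∨ ψ) = sub τ φ `∨ sub τ ψ
  sub τ (φ `⇒ ψ) = sub τ φ `⇒ sub τ ψ
  sub τ (`∀ t φ) = `∀ (subT τ t) (sub (liftτ τ) φ)
  sub τ (`∃ t φ) = `∃ (subT τ t) (sub (liftτ τ) φ)

  consτ : Tm n → Sub m n → Sub (suc m) n
  consτ t τ zero = t
  consτ t τ (suc i) = τ i

  [_]τ : Tm n → Sub (suc n) n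
  [ t ]τ = consτ t `v

  subT-ext : {τ τ′ : Sub m n} → (∀ i → τ i ≡ τ′ i) → ∀ t → subT τ t ≡ subT τ′ t
  subT-ext e (`v i) = e i
  subT-ext e (`l k) = refl
  subT-ext e (`s t) = cong `s (subT-ext e t)
  subT-ext e (t `+ u) = cong₂ _`+_ (subT-ext e t) (subT-ext e u)
  subT-ext e (t `* u) = cong₂ _`*_ (subT-ext e t) (subT-ext e u)

  liftτ-ext : {τ τ′ : Sub m n} → (∀ i → τ i ≡ τ′ i) → ∀ i → liftτ τ i ≡ liftτ τ′ i
  liftτ-ext e zero = refl
  liftτ-ext e (suc i) = cong wkT (e i)

  sub-ext : {τ τ′ : Sub m n} → (∀ i → τ i ≡ τ′ i) → ∀ φ → sub τ φ ≡ sub τ′ φ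
  sub-ext e (t `= u) = cong₂ _`=_ (subT-ext e t) (subT-ext e u)
  sub-ext e `⊥ = refl
  sub-ext e (φ `∧ ψ) = cong₂ _`∧_ (sub-ext e φ) (sub-ext e ψ)
  sub-ext e (φ `∨ ψ) = cong₂ _`∨_ (sub-ext e φ) (sub-ext e ψ)
  sub-ext e (φ `⇒ ψ) = cong₂ _`⇒_ (sub-ext e φ) (sub-ext e ψ)
  sub-ext e (`∀ t φ) = cong₂ `∀ (subT-ext e t) (sub-ext (liftτ-ext e) φ)
  sub-ext e (`∃ t φ) = cong₂ `∃ (subT-ext e t) (sub-ext (liftτ-ext e) φ)

  subT-sub : (τ : Sub m n) (υ : Sub k m) → ∀ t → subT τ (subT υ t) ≡ subT (subT τ ∘ υ) t
  subT-sub τ υ (`v i) = refl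
  subT-sub τ υ (`l k) = refl
  subT-sub τ υ (`s t) = cong `s (subT-sub τ υ t)
  subT-sub τ υ (t `+ u) = cong₂ _`+_ (subT-sub τ υ t) (subT-sub τ υ u)
  subT-sub τ υ (t `* u) = cong₂ _`*_ (subT-sub τ υ t) (subT-sub τ υ u)

  subT-wk : (τ : Sub m n) (t : Tm m) → subT (liftτ τ) (wkT t) ≡ wkT (subT τ t)
  subT-wk τ t = trans (subT-sub (liftτ τ) (`v ∘ suc) t) (sym (subT-sub (`v ∘ suc) τ t))

  liftτ-sub : (τ : Sub m n) (υ : Sub k m) → ∀ i → subT (liftτ τ) (liftτ υ i) ≡ liftτ (subT τ ∘ υ) i
  liftτ-sub τ υ zero = refl
  liftτ-sub τ υ (suc i) = subT-wk τ (υ i)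

  sub-sub : (τ : Sub m n) (υ : Sub k m) → ∀ φ → sub τ (sub υ φ) ≡ sub (subT τ ∘ υ) φ
  sub-sub τ υ (t `= u) = cong₂ _`=_ (subT-sub τ υ t) (subT-sub τ υ u)
  sub-sub τ υ `⊥ = refl
  sub-sub τ υ (φ `∧ ψ) = cong₂ _`∧_ (sub-sub τ υ φ) (sub-sub τ υ ψ)
  sub-sub τ υ (φ `∨ ψ) = cong₂ _`∨_ (sub-sub τ υ φ) (sub-sub τ υ ψ)
  sub-sub τ υ (φ `⇒ ψ) = cong₂ _`⇒_ (sub-sub τ υ φ) (sub-sub τ υ ψ)
  sub-sub τ υ (`∀ t φ) = cong₂ `∀ (subT-sub τ υ t) (trans (sub-sub (liftτ τ) (liftτ υ) φ) (sub-ext (liftτ-sub τ υ) φ))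
  sub-sub τ υ (`∃ t φ) = cong₂ `∃ (subT-sub τ υ t) (trans (sub-sub (liftτ τ) (liftτ υ) φ) (sub-ext (liftτ-sub τ υ) φ))

  subT-id : ∀ (t : Tm n) → subT `v t ≡ t
  subT-id (`v i) = refl
  subT-id (`l k) = refl
  subT-id (`s t) = cong `s (subT-id t)
  subT-id (t `+ u) = cong₂ _`+_ (subT-id t) (subT-id u)
  subT-id (t `* u) = cong₂ _`*_ (subT-id t) (subT-id u)

  []-wk : (s t : Tm n) → subT [ s ]τ (wkT t) ≡ t
  []-wk s t = trans (subT-sub [ s ]τ (`v ∘ suc) t) (subT-id t)

  liftτ-id : ∀ i → liftτ {n} `v i ≡ `v i
  liftτ-id zero = refl
  liftτ-id (suc i) = refl

  sub-id : ∀ (φ : Δ n) → sub `v φ ≡ φ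
  sub-id (t `= u) = cong₂ _`=_ (subT-id t) (subT-id u)
  sub-id `⊥ = refl
  sub-id (φ `∧ ψ) = cong₂ _`∧_ (sub-id φ) (sub-id ψ)
  sub-id (φ `∨ ψ) = cong₂ _`∨_ (sub-id φ) (sub-id ψ)
  sub-id (φ `⇒ ψ) = cong₂ _`⇒_ (sub-id φ) (sub-id ψ)
  sub-id (`∀ t φ) = cong₂ `∀ (subT-id t) (trans (sub-ext liftτ-id φ) (sub-id φ))
  sub-id (`∃ t φ) = cong₂ `∃ (subT-id t) (trans (sub-ext liftτ-id φ) (sub-id φ))

  evT : Vec ℕ n → Tm n → ℕ
  evT ρ (`v i) = lookup ρ i
  evT ρ (`l k) = k
  evT ρ (`s t) = suc (evT ρ t)
  evT ρ (t `+ u) = evT ρ t + evT ρ u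
  evT ρ (t `* u) = evT ρ t * evT ρ u

  Sat : Δ n → Vec ℕ n → Set
  Sat (t `= u) ρ = evT ρ t ≡ evT ρ u
  Sat `⊥ ρ = ⊥
  Sat (φ `∧ ψ) ρ = Sat φ ρ × Sat ψ ρ
  Sat (φ `∨ ψ) ρ = Sat φ ρ ⊎ Sat ψ ρ
  Sat (φ `⇒ ψ) ρ = Sat φ ρ → Sat ψ ρ
  Sat (`∀ t φ) ρ = ∀ x → x ≤ evT ρ t → Sat φ (x ∷ ρ)
  Sat (`∃ t φ) ρ = ∃ λ x → x ≤ evT ρ t × Sat φ (x ∷ ρ)

  decAll≤ : {P : ℕ → Set} → (∀ x → Dec (P x)) → ∀ b → Dec (∀ x → x ≤ b → P x)
  decAll≤ d zero with d 0
  ... | yes p = yes λ { .0 z≤n → p }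
  ... | no ¬p = no λ f → ¬p (f 0 z≤n)
  decAll≤ {P} d (suc b) with decAll≤ d b | d (suc b)
  ... | yes f | yes p = yes λ x x≤ → case-≤ x≤
    where
    case-≤ : ∀ {x} → x ≤ suc b → P x
    case-≤ {x} x≤ with m≤n⇒m<n∨m≡n x≤
    ... | inj₁ x<b = f x (≤-pred x<b)
    ... | inj₂ refl = p
  ... | yes f | no ¬p = no λ g → ¬p (g (suc b) ≤-refl)
  ... | no ¬f | _ = no λ g → ¬f λ x x≤ → g x (m≤n⇒m≤1+n x≤)

  decEx≤ : {P : ℕ → Set} → (∀ x → Dec (P x)) → ∀ b → Dec (∃ λ x → x ≤ b × P x)
  decEx≤ {P} d b with decAll≤ {λ x → ¬ P x} (λ x → ¬? (d x)) b
    where open import Relation.Nullary.Decidable using (¬?)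
  ... | yes f = no λ { (x , x≤ , p) → f x x≤ p }
  ... | no ¬f = yes (search b ¬f)
    where
    search : ∀ b → ¬ (∀ x → x ≤ b → ¬ P x) → ∃ λ x → x ≤ b × P x
    search b ¬f with d b
    search b ¬f | yes p = b , ≤-refl , p
    search zero ¬f | no ¬p = ⊥-elim (¬f λ { .0 z≤n p → ¬p p })
    search (suc b) ¬f | no ¬p with search b (λ f → ¬f λ x x≤ p → helper f x x≤ p)
      where
      helper : (∀ x → x ≤ b → ¬ P x) → ∀ x → x ≤ suc b → ¬ P x
      helper f x x≤ p with m≤n⇒m<n∨m≡n x≤
      ... | inj₁ x<b = f x (≤-pred x<b) p
      ... | inj₂ refl = ¬p p
    ... | x , x≤ , p = x , m≤n⇒m≤1+n x≤ , p

  sat? : (φ : Δ n) (ρ : Vec ℕ n) → Dec (Sat φ ρ)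
  sat? (t `= u) ρ = evT ρ t ≟ evT ρ u
  sat? `⊥ ρ = no λ ()
  sat? (φ `∧ ψ) ρ with sat? φ ρ | sat? ψ ρ
  ... | yes p | yes q = yes (p , q)
  ... | yes p | no ¬q = no (¬q ∘ proj₂)
  ... | no ¬p | _ = no (¬p ∘ proj₁)
  sat? (φ `∨ ψ) ρ with sat? φ ρ | sat? ψ ρ
  ... | yes p | _ = yes (inj₁ p)
  ... | no ¬p | yes q = yes (inj₂ q)
  ... | no ¬p | no ¬q = no λ { (inj₁ p) → ¬p p ; (inj₂ q) → ¬q q }
  sat? (φ `⇒ ψ) ρ with sat? φ ρ | sat? ψ ρ
  ... | _ | yes q = yes λ _ → q
  ... | yes p | no ¬q = no λ f → ¬q (f p)
  ... | no ¬p | no _ = yes λ p → ⊥-elim (¬p p)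
  sat? (`∀ t φ) ρ = decAll≤ (λ x → sat? φ (x ∷ ρ)) (evT ρ t)
  sat? (`∃ t φ) ρ = decEx≤ (λ x → sat? φ (x ∷ ρ)) (evT ρ t)

  _∘τ_ : Vec ℕ n → Sub m n → Vec ℕ m
  ρ ∘τ τ = tabulate (evT ρ ∘ τ)

  evT-sub : (τ : Sub m n) (ρ : Vec ℕ n) → ∀ t → evT ρ (subT τ t) ≡ evT (ρ ∘τ τ) t
  evT-sub τ ρ (`v i) = sym (lookup∘tabulate _ i)
  evT-sub τ ρ (`l k) = refl
  evT-sub τ ρ (`s t) = cong suc (evT-sub τ ρ t)
  evT-sub τ ρ (t `+ u) = cong₂ _+_ (evT-sub τ ρ t) (evT-sub τ ρ u)
  evT-sub τ ρ (t `* u) = cong₂ _*_ (evT-sub τ ρ t) (evT-sub τ ρ u)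

  evT-wk : ∀ x (ρ : Vec ℕ n) t → evT (x ∷ ρ) (wkT t) ≡ evT ρ t
  evT-wk x ρ t = trans (evT-sub (`v ∘ suc) (x ∷ ρ) t) (cong (λ ρ′ → evT ρ′ t) (tabulate∘lookup ρ))

  ∘τ-lift : ∀ x (ρ : Vec ℕ n) (τ : Sub m n) → (x ∷ ρ) ∘τ liftτ τ ≡ x ∷ (ρ ∘τ τ)
  ∘τ-lift x ρ τ = cong (x ∷_) (tabulate-cong λ i → evT-wk x ρ (τ i))

  sat-sub→ : (τ : Sub m n) (φ : Δ m) (ρ : Vec ℕ n) → Sat (sub τ φ) ρ → Sat φ (ρ ∘τ τ)
  sat-sub← : (τ : Sub m n) (φ : Δ m) (ρ : Vec ℕ n) → Sat φ (ρ ∘τ τ) → Sat (sub τ φ) ρ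
  sat-sub→ τ (t `= u) ρ p = trans (sym (evT-sub τ ρ t)) (trans p (evT-sub τ ρ u))
  sat-sub→ τ (φ `∧ ψ) ρ (p , q) = sat-sub→ τ φ ρ p , sat-sub→ τ ψ ρ q
  sat-sub→ τ (φ `∨ ψ) ρ (inj₁ p) = inj₁ (sat-sub→ τ φ ρ p)
  sat-sub→ τ (φ `∨ ψ) ρ (inj₂ q) = inj₂ (sat-sub→ τ ψ ρ q)
  sat-sub→ τ (φ `⇒ ψ) ρ f p = sat-sub→ τ ψ ρ (f (sat-sub← τ φ ρ p))
  sat-sub→ τ (`∀ t φ) ρ f x x≤ = ≡subst (Sat φ) (∘τ-lift x ρ τ)
    (sat-sub→ (liftτ τ) φ (x ∷ ρ) (f x (≡subst (x ≤_) (sym (evT-sub τ ρ t)) x≤)))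
  sat-sub→ τ (`∃ t φ) ρ (x , x≤ , p) = x , ≡subst (x ≤_) (evT-sub τ ρ t) x≤ ,
    ≡subst (Sat φ) (∘τ-lift x ρ τ) (sat-sub→ (liftτ τ) φ (x ∷ ρ) p)
  sat-sub← τ (t `= u) ρ p = trans (evT-sub τ ρ t) (trans p (sym (evT-sub τ ρ u)))
  sat-sub← τ (φ `∧ ψ) ρ (p , q) = sat-sub← τ φ ρ p , sat-sub← τ ψ ρ q
  sat-sub← τ (φ `∨ ψ) ρ (inj₁ p) = inj₁ (sat-sub← τ φ ρ p)
  sat-sub← τ (φ `∨ ψ) ρ (inj₂ q) = inj₂ (sat-sub← τ ψ ρ q)
  sat-sub← τ (φ `⇒ ψ) ρ f p = sat-sub← τ ψ ρ (f (sat-sub→ τ φ ρ p))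
  sat-sub← τ (`∀ t φ) ρ f x x≤ = sat-sub← (liftτ τ) φ (x ∷ ρ) (≡subst (Sat φ) (sym (∘τ-lift x ρ τ))
    (f x (≡subst (x ≤_) (evT-sub τ ρ t) x≤)))
  sat-sub← τ (`∃ t φ) ρ (x , x≤ , p) = x , ≡subst (x ≤_) (sym (evT-sub τ ρ t)) x≤ ,
    sat-sub← (liftτ τ) φ (x ∷ ρ) (≡subst (Sat φ) (sym (∘τ-lift x ρ τ)) p)

  cT : Tm n → Term
  cT (`v i) = var (toℕ i)
  cT (`l k) = numeral k
  cT (`s t) = S (cT t)
  cT (t `+ u) = cT t ⊕ cT u
  cT (t `* u) = cT t ⊗ cT u

  cΔ : Δ n → Formula
  cΔ (t `= u) = cT t ≐ cT u
  cΔ `⊥ = ⊥'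
  cΔ (φ `∧ ψ) = cΔ φ ∧' cΔ ψ
  cΔ (φ `∨ ψ) = cΔ φ ∨' cΔ ψ
  cΔ (φ `⇒ ψ) = cΔ φ ⇒' cΔ ψ
  cΔ (`∀ t φ) = ∀' ((var 0 ≤' shiftT (cT t)) ⇒' cΔ φ)
  cΔ (`∃ t φ) = ∃' ((var 0 ≤' shiftT (cT t)) ∧' cΔ φ)

  cΔ-Δ₀ : (φ : Δ n) → Δ₀ (cΔ φ)
  cΔ-Δ₀ (t `= u) = d-eq _ _
  cΔ-Δ₀ `⊥ = d-bot
  cΔ-Δ₀ (φ `∧ ψ) = d-and (cΔ-Δ₀ φ) (cΔ-Δ₀ ψ)
  cΔ-Δ₀ (φ `∨ ψ) = d-or (cΔ-Δ₀ φ) (cΔ-Δ₀ ψ)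
  cΔ-Δ₀ (φ `⇒ ψ) = d-imp (cΔ-Δ₀ φ) (cΔ-Δ₀ ψ)
  cΔ-Δ₀ (`∀ t φ) = d-ball (cT t) (cΔ-Δ₀ φ)
  cΔ-Δ₀ (`∃ t φ) = d-bex (cT t) (cΔ-Δ₀ φ)

  substT-numeral : ∀ σ k → substT σ (numeral k) ≡ numeral k
  substT-numeral σ zero = refl
  substT-numeral σ (suc k) = cong S (substT-numeral σ k)

  -- Nothing is required of σ beyond the first m variables. On an empty scope every σ matches, which
  -- is why translations of closed formulas are insensitive to substitution.
  Matches : Subst → Sub m n → Set
  Matches σ τ = ∀ i → σ (toℕ i) ≡ cT (τ i)

  cT-sub : {σ : Subst} {τ : Sub m n} → Matches σ τ → ∀ t → substT σ (cT t) ≡ cT (subT τ t)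
  cT-sub e (`v i) = e i
  cT-sub e (`l k) = substT-numeral _ k
  cT-sub e (`s t) = cong S (cT-sub e t)
  cT-sub e (t `+ u) = cong₂ _⊕_ (cT-sub e t) (cT-sub e u)
  cT-sub e (t `* u) = cong₂ _⊗_ (cT-sub e t) (cT-sub e u)

  cT-wk : ∀ (t : Tm n) → shiftT (cT t) ≡ cT (wkT t)
  cT-wk = cT-sub λ i → refl

  lift-match : {σ : Subst} {τ : Sub m n} → Matches σ τ → Matches (lift σ) (liftτ τ)
  lift-match e zero = refl
  lift-match {τ = τ} e (suc i) = trans (cong shiftT (e i)) (cT-wk (τ i))

  ≤'-sub : {σ : Subst} {τ : Sub m n} → Matches σ τ → ∀ s t →
    subst σ (cT s ≤' cT t) ≡ (cT (subT τ s) ≤' cT (subT τ t))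
  ≤'-sub {σ = σ} {τ} e s t = cong ∃' (cong₂ (λ a b → var 0 ⊕ a ≐ b) (h s) (h t))
    where
    h : ∀ t → substT (lift σ) (shiftT (cT t)) ≡ shiftT (cT (subT τ t))
    h t = trans (cong (substT (lift σ)) (cT-wk t)) (trans (cT-sub (lift-match e) (wkT t))
          (trans (cong cT (subT-wk τ t)) (sym (cT-wk (subT τ t)))))

  ≤'-lift : {σ : Subst} {τ : Sub m n} → Matches σ τ → ∀ t →
    subst (lift σ) (var 0 ≤' shiftT (cT t)) ≡ (var 0 ≤' shiftT (cT (subT τ t)))
  ≤'-lift {σ = σ} {τ} e t = trans (cong (λ u → subst (lift σ) (var 0 ≤' u)) (cT-wk t))
    (trans (≤'-sub (lift-match e) (`v zero) (wkT t))
      (cong (var 0 ≤'_) (trans (cong cT (subT-wk τ t)) (sym (cT-wk (subT τ t))))))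

  cΔ-sub : {σ : Subst} {τ : Sub m n} → Matches σ τ → ∀ φ → subst σ (cΔ φ) ≡ cΔ (sub τ φ)
  cΔ-sub e (t `= u) = cong₂ _≐_ (cT-sub e t) (cT-sub e u)
  cΔ-sub e `⊥ = refl
  cΔ-sub e (φ `∧ ψ) = cong₂ _∧'_ (cΔ-sub e φ) (cΔ-sub e ψ)
  cΔ-sub e (φ `∨ ψ) = cong₂ _∨'_ (cΔ-sub e φ) (cΔ-sub e ψ)
  cΔ-sub e (φ `⇒ ψ) = cong₂ _⇒'_ (cΔ-sub e φ) (cΔ-sub e ψ)
  cΔ-sub e (`∀ t φ) = cong ∀' (cong₂ _⇒'_ (≤'-lift e t) (cΔ-sub (lift-match e) φ))
  cΔ-sub e (`∃ t φ) = cong ∃' (cong₂ _∧'_ (≤'-lift e t) (cΔ-sub (lift-match e) φ))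

  cΔ-inst : ∀ (t : Tm n) φ → inst (cT t) (cΔ φ) ≡ cΔ (sub [ t ]τ φ)
  cΔ-inst t = cΔ-sub λ { zero → refl ; (suc i) → refl }

  cΔ-shift : ∀ (φ : Δ n) → shift (cΔ φ) ≡ cΔ (sub (`v ∘ suc) φ)
  cΔ-shift = cΔ-sub λ i → refl

  numeral-FV : ∀ n k → FVBelowT n (numeral k)
  numeral-FV n zero = tt
  numeral-FV n (suc k) = numeral-FV n k

  cT-FV : ∀ (t : Tm n) → FVBelowT n (cT t)
  cT-FV (`v i) = Finₚ.toℕ<n i
  cT-FV (`l k) = numeral-FV _ k
  cT-FV (`s t) = cT-FV t
  cT-FV (t `+ u) = cT-FV t , cT-FV u
  cT-FV (t `* u) = cT-FV t , cT-FV u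

  ≤'-FV : ∀ (s t : Tm n) → FVBelow n (cT s ≤' cT t)
  ≤'-FV s t = (s≤s z≤n , ≡subst (FVBelowT _) (sym (cT-wk s)) (cT-FV (wkT s)))
            , ≡subst (FVBelowT _) (sym (cT-wk t)) (cT-FV (wkT t))

  ≤'-FV-bound : ∀ (t : Tm n) → FVBelow (suc n) (var 0 ≤' shiftT (cT t))
  ≤'-FV-bound t = ≡subst (λ u → FVBelow _ (var 0 ≤' u)) (sym (cT-wk t)) (≤'-FV (`v zero) (wkT t))

  cΔ-FV : ∀ (φ : Δ n) → FVBelow n (cΔ φ)
  cΔ-FV (t `= u) = cT-FV t , cT-FV u
  cΔ-FV `⊥ = tt
  cΔ-FV (φ `∧ ψ) = cΔ-FV φ , cΔ-FV ψ
  cΔ-FV (φ `∨ ψ) = cΔ-FV φ , cΔ-FV ψ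
  cΔ-FV (φ `⇒ ψ) = cΔ-FV φ , cΔ-FV ψ
  cΔ-FV (`∀ t φ) = ≤'-FV-bound t , cΔ-FV φ
  cΔ-FV (`∃ t φ) = ≤'-FV-bound t , cΔ-FV φ

open BoundedFormulas

-- Natural deduction derived in the Hilbert calculus

module NaturalDeduction where
  private variable
    k m n : ℕ

  module ND (U : Theory) where
    infix 3 _⊩_
    -- The context is a single formula, a conjunction of hypotheses. Discharging a hypothesis is
    -- then purely propositional, and no deduction theorem passing through `gen` is needed.
    _⊩_ : Formula → Formula → Set
    γ ⊩ φ = U ⊢ γ ⇒' φ

    private variable
      γ δ φ ψ χ : Formula

    K : U ⊢ φ → γ ⊩ φ
    K {φ} {γ} p = mp (taut λ w → t (evalB w φ) (evalB w γ)) p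
      where
      t : ∀ a b → not a ∨ (not b ∨ a) ≡ true
      t false b = refl
      t true false = refl
      t true true = refl

    hyp : γ ⊩ γ
    hyp {γ} = taut λ w → t (evalB w γ)
      where
      t : ∀ a → not a ∨ a ≡ true
      t false = refl
      t true = refl

    app : γ ⊩ φ ⇒' ψ → γ ⊩ φ → γ ⊩ ψ
    app {γ} {φ} {ψ} p q = mp (mp (taut λ w → t (evalB w γ) (evalB w φ) (evalB w ψ)) p) q
      where
      t : ∀ a b c → not (not a ∨ (not b ∨ c)) ∨ (not (not a ∨ b) ∨ (not a ∨ c)) ≡ true
      t false b c = refl
      t true false c = refl
      t true true false = refl
      t true true true = refl

    cut : γ ⊩ φ → φ ⊩ ψ → γ ⊩ ψ
    cut p q = app (K q) p

    pr₁ : γ ⊩ φ ∧' ψ → γ ⊩ φ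
    pr₁ {γ} {φ} {ψ} p = cut p (taut λ w → t (evalB w φ) (evalB w ψ))
      where
      t : ∀ a b → not (a ∧ b) ∨ a ≡ true
      t false b = refl
      t true false = refl
      t true true = refl

    pr₂ : γ ⊩ φ ∧' ψ → γ ⊩ ψ
    pr₂ {γ} {φ} {ψ} p = cut p (taut λ w → t (evalB w φ) (evalB w ψ))
      where
      t : ∀ a b → not (a ∧ b) ∨ b ≡ true
      t false b = refl
      t true false = refl
      t true true = refl

    lam : γ ∧' φ ⊩ ψ → γ ⊩ φ ⇒' ψ
    lam {γ} {φ} {ψ} p = mp (taut λ w → t (evalB w γ) (evalB w φ) (evalB w ψ)) p
      where
      t : ∀ a b c → not (not (a ∧ b) ∨ c) ∨ (not a ∨ (not b ∨ c)) ≡ true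
      t false b c = refl
      t true false c = refl
      t true true false = refl
      t true true true = refl

    pair' : γ ⊩ φ → γ ⊩ ψ → γ ⊩ φ ∧' ψ
    pair' {γ} {φ} {ψ} p q = app (app (K (taut λ w → t (evalB w φ) (evalB w ψ))) p) q
      where
      t : ∀ a b → not a ∨ (not b ∨ (a ∧ b)) ≡ true
      t false b = refl
      t true false = refl
      t true true = refl

    inl : γ ⊩ φ → γ ⊩ φ ∨' ψ
    inl {γ} {φ} {ψ} p = cut p (taut λ w → t (evalB w φ) (evalB w ψ))
      where
      t : ∀ a b → not a ∨ (a ∨ b) ≡ true
      t false b = refl
      t true b = refl

    inr : γ ⊩ ψ → γ ⊩ φ ∨' ψ
    inr {γ} {ψ} {φ} p = cut p (taut λ w → t (evalB w φ) (evalB w ψ))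
      where
      t : ∀ a b → not b ∨ (a ∨ b) ≡ true
      t false false = refl
      t false true = refl
      t true false = refl
      t true true = refl

    case' : γ ⊩ φ ∨' ψ → γ ∧' φ ⊩ χ → γ ∧' ψ ⊩ χ → γ ⊩ χ
    case' {γ} {φ} {ψ} {χ} p q r =
      app (app (app (K (taut λ w → t (evalB w φ) (evalB w ψ) (evalB w χ))) p) (lam q)) (lam r)
      where
      t : ∀ a b c → not (a ∨ b) ∨ (not (not a ∨ c) ∨ (not (not b ∨ c) ∨ c)) ≡ true
      t false false c = refl
      t false true false = refl
      t false true true = refl
      t true false false = refl
      t true false true = refl
      t true true false = refl
      t true true true = refl

    abs : γ ⊩ ⊥' → γ ⊩ φ
    abs {γ} {φ} p = cut p (taut λ w → refl)

    raa : γ ⊩ (φ ⇒' ⊥') ⇒' ⊥' → γ ⊩ φ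
    raa {γ} {φ} p = cut p (taut λ w → t (evalB w φ))
      where
      t : ∀ a → not (not (not a ∨ false) ∨ false) ∨ a ≡ true
      t false = refl
      t true = refl

    ¬i : U ⊢ φ ⇒' ⊥' → U ⊢ ¬' φ
    ¬i {φ} = mp (taut λ w → t (evalB w φ))
      where
      t : ∀ a → not (not a ∨ false) ∨ not a ≡ true
      t false = refl
      t true = refl

    ∀e : ∀ t → γ ⊩ ∀' φ → γ ⊩ inst t φ
    ∀e {φ = φ} t p = cut p (∀-elim φ t)

    ∃i : ∀ t → γ ⊩ inst t φ → γ ⊩ ∃' φ
    ∃i {φ = φ} t p = cut p (∃-intro φ t)

    ∃e : γ ⊩ ∃' φ → shift γ ∧' φ ⊩ shift χ → γ ⊩ χ
    ∃e {γ} {φ} {χ} p q = app (mp (taut λ w → t (w (∃' φ)) (evalB w γ) (evalB w χ)) r) p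
      where
      swap' : φ ⊩ shift γ ⇒' shift χ
      swap' = mp (taut λ w → t′ (evalB w (shift γ)) (evalB w φ) (evalB w (shift χ))) q
        where
        t′ : ∀ a b c → not (not (a ∧ b) ∨ c) ∨ (not b ∨ (not a ∨ c)) ≡ true
        t′ false false c = refl
        t′ false true c = refl
        t′ true false false = refl
        t′ true false true = refl
        t′ true true false = refl
        t′ true true true = refl
      r : U ⊢ ∃' φ ⇒' (γ ⇒' χ)
      r = mp (∃-elim φ (γ ⇒' χ)) (gen swap')
      t : ∀ a b c → not (not a ∨ (not b ∨ c)) ∨ (not b ∨ (not a ∨ c)) ≡ true
      t false false c = refl
      t false true c = refl
      t true false c = refl
      t true true false = refl
      t true true true = refl

    ∃-left : U ⊢ φ ⇒' shift χ → U ⊢ ∃' φ ⇒' χ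
    ∃-left {φ} {χ} p = mp (∃-elim φ χ) (gen p)

    conv : φ ≡ ψ → γ ⊩ φ → γ ⊩ ψ
    conv e = ≡subst (_ ⊩_) e

    conv⊢ : φ ≡ ψ → U ⊢ φ → U ⊢ ψ
    conv⊢ e = ≡subst (U ⊢_) e

    refl' : (t : Term) → γ ⊩ t ≐ t
    refl' t = K (eq-refl t)

    -- Leibniz's law for a scoped formula whose variable 0 is the hole; symmetry, transitivity and
    -- congruence are all instances of it.
    rep : (φ : Δ (suc n)) (t u : Tm n) → γ ⊩ cT t ≐ cT u → γ ⊩ cΔ (sub [ t ]τ φ) → γ ⊩ cΔ (sub [ u ]τ φ)
    rep φ t u p q = conv (cΔ-inst u φ) (app (app (K (eq-subst (cΔ φ) (cT t) (cT u))) p)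
                          (conv (sym (cΔ-inst t φ)) q))

    sym' : (t u : Tm n) → γ ⊩ cT t ≐ cT u → γ ⊩ cT u ≐ cT t
    sym' t u p = conv (cong (λ x → cT u ≐ cT x) ([]-wk u t))
      (rep (`v zero `= wkT t) t u p (conv (cong (λ x → cT t ≐ cT x) (sym ([]-wk t t))) (refl' (cT t))))

    trans' : (t u v : Tm n) → γ ⊩ cT t ≐ cT u → γ ⊩ cT u ≐ cT v → γ ⊩ cT t ≐ cT v
    trans' t u v p q = conv (cong (λ x → cT x ≐ cT v) ([]-wk v t))
      (rep (wkT t `= `v zero) u v q (conv (cong (λ x → cT x ≐ cT u) (sym ([]-wk u t))) p))

    -- The variable 0 is the hole of the context c.
    cong' : (c : Tm (suc n)) (t u : Tm n) → γ ⊩ cT t ≐ cT u → γ ⊩ cT (subT [ t ]τ c) ≐ cT (subT [ u ]τ c)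
    cong' c t u p = conv (cong (λ x → cT x ≐ cT (subT [ u ]τ c)) ([]-wk u (subT [ t ]τ c)))
      (rep (wkT (subT [ t ]τ c) `= c) t u p
        (conv (cong (λ x → cT x ≐ cT (subT [ t ]τ c)) (sym ([]-wk t (subT [ t ]τ c)))) (refl' _)))

    congS : (t u : Tm n) → γ ⊩ cT t ≐ cT u → γ ⊩ S (cT t) ≐ S (cT u)
    congS t u = cong' (`s (`v zero)) t u

    cong+ : (t u t′ u′ : Tm n) → γ ⊩ cT t ≐ cT t′ → γ ⊩ cT u ≐ cT u′ → γ ⊩ cT t ⊕ cT u ≐ cT t′ ⊕ cT u′
    cong+ t u t′ u′ p q = trans' (t `+ u) (t′ `+ u) (t′ `+ u′)
      (conv (cong₂ (λ x y → cT t ⊕ cT x ≐ cT t′ ⊕ cT y) ([]-wk t u) ([]-wk t′ u)) (cong' (`v zero `+ wkT u) t t′ p))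
      (conv (cong₂ (λ x y → cT x ⊕ cT u ≐ cT y ⊕ cT u′) ([]-wk u t′) ([]-wk u′ t′)) (cong' (wkT t′ `+ `v zero) u u′ q))

    cong* : (t u t′ u′ : Tm n) → γ ⊩ cT t ≐ cT t′ → γ ⊩ cT u ≐ cT u′ → γ ⊩ cT t ⊗ cT u ≐ cT t′ ⊗ cT u′
    cong* t u t′ u′ p q = trans' (t `* u) (t′ `* u) (t′ `* u′)
      (conv (cong₂ (λ x y → cT t ⊗ cT x ≐ cT t′ ⊗ cT y) ([]-wk t u) ([]-wk t′ u)) (cong' (`v zero `* wkT u) t t′ p))
      (conv (cong₂ (λ x y → cT x ⊗ cT u ≐ cT y ⊗ cT u′) ([]-wk u t′) ([]-wk u′ t′)) (cong' (wkT t′ `* `v zero) u u′ q))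

    inst₁ : (φ : Δ 1) → U ⊢ ∀' (cΔ φ) → (t : Tm n) → U ⊢ cΔ (sub (λ _ → t) φ)
    inst₁ φ p t = conv⊢ (cΔ-sub (λ { zero → refl }) φ) (mp (∀-elim (cΔ φ) (cT t)) p)

    inst₂ : (φ : Δ 2) → U ⊢ ∀' (∀' (cΔ φ)) → (s t : Tm n) → U ⊢ cΔ (sub (consτ t λ _ → s) φ)
    inst₂ φ p s t = conv⊢ e₂ (mp (∀-elim _ (cT t)) (conv⊢ e₁ (mp (∀-elim (∀' (cΔ φ)) (cT s)) p)))
      where
      e₁ : inst (cT s) (∀' (cΔ φ)) ≡ ∀' (cΔ (sub (liftτ (λ _ → s)) φ))
      e₁ = cong ∀' (cΔ-sub (lift-match λ { zero → refl }) φ)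
      e₂ : inst (cT t) (cΔ (sub (liftτ (λ _ → s)) φ)) ≡ cΔ (sub (consτ t λ _ → s) φ)
      e₂ = trans (cΔ-inst t _) (cong cΔ (trans (sub-sub [ t ]τ (liftτ (λ _ → s)) φ)
           (sub-ext (λ { zero → refl ; (suc i) → []-wk t s }) φ)))

  -- Order, numerals and closed bounded formulas in extensions of PA

  module Arith (U : Theory) (ext : Extends PA U) where
    open ND U public

    private variable
      γ χ : Formula

    pa : ∀ {φ} → PA φ → U ⊢ φ
    pa p = ext _ (ax p)

    x₀ : Tm (suc n)
    x₀ = `v zero
    x₁ : Tm (2 + n)
    x₁ = `v (suc zero)
    x₂ : Tm (3 + n)
    x₂ = `v (suc (suc zero))
    x₃ : Tm (4 + n)
    x₃ = `v (suc (suc (suc zero)))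

    +0 : (t : Tm n) → U ⊢ cT t ⊕ zr ≐ cT t
    +0 = inst₁ (x₀ `+ `l 0 `= x₀) (pa pa3)

    +S : (t u : Tm n) → U ⊢ cT t ⊕ S (cT u) ≐ S (cT t ⊕ cT u)
    +S = inst₂ (x₁ `+ `s x₀ `= `s (x₁ `+ x₀)) (pa pa4)

    *0 : (t : Tm n) → U ⊢ cT t ⊗ zr ≐ zr
    *0 = inst₁ (x₀ `* `l 0 `= `l 0) (pa pa5)

    *S : (t u : Tm n) → U ⊢ cT t ⊗ S (cT u) ≐ cT t ⊗ cT u ⊕ cT t
    *S = inst₂ (x₁ `* `s x₀ `= x₁ `* x₀ `+ x₁) (pa pa6)

    S≢0 : (t : Tm n) → U ⊢ S (cT t) ≐ zr ⇒' ⊥'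
    S≢0 t = mp (taut λ w → taut¬ (w (S (cT t) ≐ zr))) (mp (∀-elim (¬' (S (var 0) ≐ zr)) (cT t)) (pa pa1))
      where
      taut¬ : ∀ a → not (not a) ∨ (not a ∨ false) ≡ true
      taut¬ false = refl
      taut¬ true = refl

    S-inj : (t u : Tm n) → U ⊢ S (cT t) ≐ S (cT u) ⇒' cT t ≐ cT u
    S-inj = inst₂ (`s x₁ `= `s x₀ `⇒ x₁ `= x₀) (pa pa2)

    ind : (φ : Formula) → U ⊢ inst zr φ → U ⊢ φ ⇒' succInst φ → U ⊢ ∀' φ
    ind φ p q = mp (mp (pa (pa-ind φ)) p) (gen q)

    0+-all : U ⊢ ∀' (cΔ {1} (`l 0 `+ x₀ `= x₀))
    0+-all = ind _ (+0 {0} (`l 0)) (trans' {1} (`l 0 `+ `s x₀) (`s (`l 0 `+ x₀)) (`s x₀)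
      (K (+S {1} (`l 0) x₀)) (congS {1} (`l 0 `+ x₀) x₀ hyp))

    0+ : (t : Tm n) → U ⊢ zr ⊕ cT t ≐ cT t
    0+ = inst₁ (`l 0 `+ x₀ `= x₀) 0+-all

    S+-all : U ⊢ ∀' (∀' (cΔ {2} (`s x₁ `+ x₀ `= `s (x₁ `+ x₀))))
    S+-all = gen (ind _
      (mp (trans' {1} (`s x₀ `+ `l 0) (`s x₀) (`s (x₀ `+ `l 0)) (K (+0 {1} (`s x₀)))
          (congS {1} x₀ (x₀ `+ `l 0) (sym' {1} (x₀ `+ `l 0) x₀ (K (+0 {1} x₀))))) (eq-refl zr))
      (trans' {2} (`s x₁ `+ `s x₀) (`s (`s x₁ `+ x₀)) (`s (x₁ `+ `s x₀)) (K (+S {2} (`s x₁) x₀))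
        (congS {2} (`s x₁ `+ x₀) (x₁ `+ `s x₀)
          (trans' {2} (`s x₁ `+ x₀) (`s (x₁ `+ x₀)) (x₁ `+ `s x₀) hyp
            (sym' {2} (x₁ `+ `s x₀) (`s (x₁ `+ x₀)) (K (+S {2} x₁ x₀)))))))

    S+ : (t u : Tm n) → U ⊢ S (cT t) ⊕ cT u ≐ S (cT t ⊕ cT u)
    S+ = inst₂ (`s x₁ `+ x₀ `= `s (x₁ `+ x₀)) S+-all

    zero-or-suc-all : U ⊢ ∀' (var 0 ≐ zr ∨' ∃' (var 1 ≐ S (var 0)))
    zero-or-suc-all = ind _ (mp (inl hyp) (eq-refl zr)) (K (mp (inr (∃i (var 0) hyp)) (eq-refl (S (var 0)))))

    leΔ : Tm n → Tm n → Δ (suc n)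
    leΔ s t = x₀ `+ wkT s `= wkT t

    infix 10 _≼_
    _≼_ : Tm n → Tm n → Formula
    s ≼ t = ∃' (cΔ (leΔ s t))

    ≼≡ : (s t : Tm n) → (cT s ≤' cT t) ≡ s ≼ t
    ≼≡ s t = cong₂ (λ a b → ∃' (var 0 ⊕ a ≐ b)) (cT-wk s) (cT-wk t)

    zero-or-suc : (t : Tm n) → U ⊢ cT t ≐ zr ∨' ∃' (cT (wkT t) ≐ S (var 0))
    zero-or-suc t = conv⊢ (cong (λ x → cT t ≐ zr ∨' ∃' (x ≐ S (var 0))) (cT-wk t))
      (mp (∀-elim (var 0 ≐ zr ∨' ∃' (var 1 ≐ S (var 0))) (cT t)) zero-or-suc-all)

    ≼i : (z s t : Tm n) → γ ⊩ cT z ⊕ cT s ≐ cT t → γ ⊩ s ≼ t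
    ≼i z s t p = ∃i (cT z) (conv (sym (trans (cΔ-inst z (leΔ s t))
      (cong₂ (λ a b → cT z ⊕ cT a ≐ cT b) ([]-wk z s) ([]-wk z t)))) p)

    -- Induction on the inner variable x. If z + x = y, then either z is zero and y lies below the
    -- successor of x, or the predecessor of z witnesses that the successor of x lies below y.
    total-all : U ⊢ ∀' (∀' (_≼_ {2} x₀ x₁ ∨' _≼_ {2} x₁ x₀))
    total-all = gen (ind _ (inl-base) (case' hyp caseA caseB))
      where
      inl-base = mp (inl {φ = ∃' (var 0 ⊕ zr ≐ var 1)} (∃i (var 0) (K (+0 {1} x₀)))) (eq-refl zr)
      A B G : Formula
      A = _≼_ {2} x₀ x₁
      B = _≼_ {2} x₁ x₀
      G = succInst (A ∨' B)
      -- variables: z = x₀, x = x₁, y = x₂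
      caseB : (A ∨' B) ∧' B ⊩ G
      caseB = cut (pr₂ hyp) (∃-left (inr (≼i {3} (`s x₀) x₂ (`s x₁)
        (trans' {3} (`s x₀ `+ x₂) (`s (x₀ `+ x₂)) (`s x₁) (K (S+ {3} x₀ x₂)) (congS {3} (x₀ `+ x₂) x₁ hyp)))))
      H : Formula
      H = var 0 ⊕ var 1 ≐ var 2
      zeroc : H ∧' var 0 ≐ zr ⊩ shift G
      zeroc = inr (≼i {3} (`s (`l 0)) x₂ (`s x₁)
        (trans' {3} (`s (`l 0) `+ x₂) (`s (`l 0 `+ x₂)) (`s x₁) (K (S+ {3} (`l 0) x₂))
          (congS {3} (`l 0 `+ x₂) x₁ (trans' {3} (`l 0 `+ x₂) x₂ x₁ (K (0+ {3} x₂))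
            (trans' {3} x₂ (x₀ `+ x₁) x₁ (sym' {3} (x₀ `+ x₁) x₂ (pr₁ hyp))
              (trans' {3} (x₀ `+ x₁) (`l 0 `+ x₁) x₁
                (cong+ {3} x₀ x₁ (`l 0) x₁ (pr₂ hyp) (refl' _)) (K (0+ {3} x₁))))))))
      -- variables: u = x₀, z = x₁, x = x₂, y = x₃
      succ : H ∧' ∃' (var 1 ≐ S (var 0)) ⊩ shift G
      succ = ∃e (pr₂ hyp) (inl (≼i {4} x₀ (`s x₂) x₃
        (trans' {4} (x₀ `+ `s x₂) (`s (x₀ `+ x₂)) x₃ (K (+S {4} x₀ x₂))
          (trans' {4} (`s (x₀ `+ x₂)) (`s x₀ `+ x₂) x₃ (sym' {4} (`s x₀ `+ x₂) (`s (x₀ `+ x₂)) (K (S+ {4} x₀ x₂)))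
            (trans' {4} (`s x₀ `+ x₂) (x₁ `+ x₂) x₃
              (cong+ {4} (`s x₀) x₂ x₁ x₂ (sym' {4} x₁ (`s x₀) (pr₂ hyp)) (refl' _)) (pr₁ (pr₁ hyp)))))))
      caseA : (A ∨' B) ∧' A ⊩ G
      caseA = cut (pr₂ hyp) (∃-left (case' (K (zero-or-suc {3} x₀)) zeroc succ))

    inst₂-∃∨ : (C D : Δ 3) → U ⊢ ∀' (∀' (∃' (cΔ C) ∨' ∃' (cΔ D))) → (s t : Tm n) →
      let υ = consτ (`v zero) (consτ (wkT t) λ _ → wkT s) in U ⊢ ∃' (cΔ (sub υ C)) ∨' ∃' (cΔ (sub υ D))
    inst₂-∃∨ {n} C D p s t = conv⊢ e₂ (mp (∀-elim _ (cT t)) (conv⊢ e₁ (mp (∀-elim _ (cT s)) p)))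
      where
      τ : Sub 3 (2 + n)
      τ = liftτ (liftτ λ _ → s)
      e₁ : inst (cT s) (∀' (∃' (cΔ C) ∨' ∃' (cΔ D))) ≡ ∀' (∃' (cΔ (sub τ C)) ∨' ∃' (cΔ (sub τ D)))
      e₁ = cong ∀' (cong₂ (λ a b → ∃' a ∨' ∃' b) (cΔ-sub (lift-match (lift-match λ { zero → refl })) C)
                                                 (cΔ-sub (lift-match (lift-match λ { zero → refl })) D))
      f : {σ : Subst} → Matches σ [ t ]τ → ∀ C → subst (lift σ) (cΔ (sub τ C)) ≡
                cΔ (sub (consτ (`v zero) (consτ (wkT t) λ _ → wkT s)) C)
      f e C = trans (cΔ-sub (lift-match e) (sub _ C))
          (cong cΔ (trans (sub-sub _ _ C) (sub-ext (λ { zero → refl ; (suc zero) → refl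
            ; (suc (suc i)) → trans (subT-wk [ t ]τ (wkT s)) (cong wkT ([]-wk t s)) }) C)))
      e₂ : inst (cT t) (∃' (cΔ (sub τ C)) ∨' ∃' (cΔ (sub τ D))) ≡ _
      e₂ = cong₂ (λ a b → ∃' a ∨' ∃' b) (f (λ { zero → refl ; (suc i) → refl }) C)
                                        (f (λ { zero → refl ; (suc i) → refl }) D)

    total : (s t : Tm n) → U ⊢ t ≼ s ∨' s ≼ t
    total = inst₂-∃∨ (x₀ `+ x₁ `= x₂) (x₀ `+ x₂ `= x₁) total-all

    ≼-shift : (s t : Tm n) → shift (s ≼ t) ≡ wkT s ≼ wkT t
    ≼-shift s t = cong ∃' (trans (cΔ-sub (lift-match {τ = `v ∘ suc} λ i → refl) (leΔ s t))
      (cong₂ (λ a b → var 0 ⊕ cT a ≐ cT b) (subT-wk (`v ∘ suc) s) (subT-wk (`v ∘ suc) t)))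

    le-pred : (t : Tm n) → ∀ k → γ ⊩ `l (suc k) ≼ t → γ ⊩ `l k ≼ t
    le-pred {n} t k p = cut p (∃-left (conv (sym (≼-shift (`l k) t))
      (≼i (`s x₀) (`l k) (wkT t) (trans' (`s x₀ `+ `l k) (x₀ `+ `l (suc k)) (wkT t)
        (trans' {suc n} (`s x₀ `+ `l k) (`s (x₀ `+ `l k)) (x₀ `+ `l (suc k)) (K (S+ {suc n} x₀ (`l k)))
           (sym' {suc n} (x₀ `+ `l (suc k)) (`s (x₀ `+ `l k)) (K (+S {suc n} x₀ (`l k))))) hyp))))

    le-down : (t : Tm n) → ∀ {j k} → j ≤′ k → γ ⊩ `l k ≼ t → γ ⊩ `l j ≼ t
    le-down t ≤′-refl p = p
    le-down t (≤′-step q) p = le-down t q (le-pred t _ p)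

    numeral-≢ : ∀ i j → i ≢ j → U ⊢ numeral i ≐ numeral j ⇒' ⊥'
    numeral-≢ zero zero ne = ⊥-elim (ne refl)
    numeral-≢ zero (suc j) ne = cut (sym' {0} (`l 0) (`l (suc j)) hyp) (S≢0 {0} (`l j))
    numeral-≢ (suc i) zero ne = S≢0 {0} (`l i)
    numeral-≢ (suc i) (suc j) ne = cut (S-inj {0} (`l i) (`l j)) (numeral-≢ i j (ne ∘ cong suc))

    numeral-+ : ∀ i j → U ⊢ numeral i ⊕ numeral j ≐ numeral (i + j)
    numeral-+ i zero = conv⊢ (cong (λ x → numeral i ⊕ zr ≐ numeral x) (sym (+-identityʳ i))) (+0 {0} (`l i))
    numeral-+ i (suc j) = conv⊢ (cong (λ x → numeral i ⊕ S (numeral j) ≐ numeral x) (sym (+-suc i j)))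
      (mp (trans' {0} (`l i `+ `s (`l j)) (`s (`l i `+ `l j)) (`s (`l (i + j))) (K (+S {0} (`l i) (`l j)))
        (congS {0} (`l i `+ `l j) (`l (i + j)) (K (numeral-+ i j)))) (eq-refl zr))

    numeral-* : ∀ i j → U ⊢ numeral i ⊗ numeral j ≐ numeral (i * j)
    numeral-* i zero = conv⊢ (cong (λ x → numeral i ⊗ zr ≐ numeral x) (sym (*-zeroʳ i))) (*0 {0} (`l i))
    numeral-* i (suc j) = conv⊢ (cong (λ x → numeral i ⊗ S (numeral j) ≐ numeral x) (trans (+-comm (i * j) i) (sym (*-suc i j))))
      (mp (trans' {0} (`l i `* `s (`l j)) (`l i `* `l j `+ `l i) (`l (i * j + i)) (K (*S {0} (`l i) (`l j)))
        (trans' {0} (`l i `* `l j `+ `l i) (`l (i * j) `+ `l i) (`l (i * j + i))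
          (cong+ {0} (`l i `* `l j) (`l i) (`l (i * j)) (`l i) (K (numeral-* i j)) (refl' _))
          (K (numeral-+ (i * j) i)))) (eq-refl zr))

    litτ : Vec ℕ n → Sub n k
    litτ ρ i = `l (lookup ρ i)

    term-value : (ρ : Vec ℕ n) (t : Tm n) → U ⊢ cT (subT {n = 0} (litτ ρ) t) ≐ numeral (evT ρ t)
    term-value ρ (`v i) = eq-refl _
    term-value ρ (`l k) = eq-refl _
    term-value ρ (`s t) = mp (congS {0} (subT (litτ ρ) t) (`l (evT ρ t)) (K (term-value ρ t))) (eq-refl zr)
    term-value ρ (t `+ u) = mp (trans' {0} (t′ `+ u′) (`l (evT ρ t) `+ `l (evT ρ u)) (`l (evT ρ t + evT ρ u))
      (cong+ t′ u′ (`l (evT ρ t)) (`l (evT ρ u)) (K (term-value ρ t)) (K (term-value ρ u)))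
      (K (numeral-+ (evT ρ t) (evT ρ u)))) (eq-refl zr)
      where
      t′ u′ : Tm 0
      t′ = subT (litτ ρ) t
      u′ = subT (litτ ρ) u
    term-value ρ (t `* u) = mp (trans' {0} (t′ `* u′) (`l (evT ρ t) `* `l (evT ρ u)) (`l (evT ρ t * evT ρ u))
      (cong* t′ u′ (`l (evT ρ t)) (`l (evT ρ u)) (K (term-value ρ t)) (K (term-value ρ u)))
      (K (numeral-* (evT ρ t) (evT ρ u)))) (eq-refl zr)
      where
      t′ u′ : Tm 0
      t′ = subT (litτ ρ) t
      u′ = subT (litτ ρ) u

    oneOf : ℕ → Tm n → Formula
    oneOf zero x = cT x ≐ zr
    oneOf (suc k) x = oneOf k x ∨' cT x ≐ numeral (suc k)

    oneOf-suc : ∀ k (x y : Tm n) → γ ⊩ cT x ≐ S (cT y) → γ ⊩ oneOf k y ⇒' oneOf (suc k) x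
    oneOf-suc zero x y p = lam (inr (trans' x (`s y) (`s (`l 0)) (cut (pr₁ hyp) p) (congS y (`l 0) (pr₂ hyp))))
    oneOf-suc (suc k) x y p = lam (case' (pr₂ hyp)
      (inl (app (cut (pr₁ (pr₁ hyp)) (oneOf-suc k x y p)) (pr₂ hyp)))
      (inr (trans' x (`s y) (`s (`l (suc k))) (cut (pr₁ (pr₁ hyp)) p) (congS y (`l (suc k)) (pr₂ hyp)))))

    oneOf-zero : ∀ k (x : Tm n) → γ ⊩ cT x ≐ zr → γ ⊩ oneOf k x
    oneOf-zero zero x p = p
    oneOf-zero (suc k) x p = inl (oneOf-zero k x p)

    oneOf-sub : ∀ {σ} {τ : Sub m n} → Matches σ τ → ∀ k x → subst σ (oneOf k x) ≡ oneOf k (subT τ x)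
    oneOf-sub e zero x = cong (_≐ zr) (cT-sub e x)
    oneOf-sub e (suc k) x = cong₂ _∨'_ (oneOf-sub e k x) (cong₂ _≐_ (cT-sub e x) (substT-numeral _ (suc k)))

    -- Induction on k outside the theory: x is zero, or a successor whose predecessor makes the sum
    -- one less.
    sum-oneOf : ∀ k (z x : Tm n) → U ⊢ cT z ⊕ cT x ≐ numeral k ⇒' oneOf k x
    sum-oneOf k z x = case' (K (zero-or-suc x)) (oneOf-zero k x (pr₂ hyp)) (stepc k)
      where
      E : Formula
      E = ∃' (cT (wkT x) ≐ S (var 0))
      z′ x′ : Tm _
      z′ = wkT z
      x′ = wkT x
      sum′ : ∀ k → subst (λ i → var (suc i)) (cT z ⊕ cT x ≐ numeral k) ≡ cT (z′ `+ x′) ≐ numeral k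
      sum′ k = cong₂ _≐_ (cT-wk (z `+ x)) (substT-numeral _ k)
      Γ : ℕ → Formula
      Γ k = shift (cT z ⊕ cT x ≐ numeral k ∧' E) ∧' cT x′ ≐ S (var 0)
      eq : ∀ k → Γ k ⊩ S (cT z′ ⊕ var 0) ≐ numeral k
      eq k = trans' (`s (z′ `+ x₀)) (z′ `+ `s x₀) (`l k) (sym' (z′ `+ `s x₀) (`s (z′ `+ x₀)) (K (+S z′ x₀)))
        (trans' (z′ `+ `s x₀) (z′ `+ x′) (`l k)
          (cong+ z′ (`s x₀) z′ x′ (refl' _) (sym' x′ (`s x₀) (pr₂ hyp)))
          (conv (sum′ k) (pr₁ (pr₁ hyp))))
      stepc : ∀ k → cT z ⊕ cT x ≐ numeral k ∧' E ⊩ oneOf k x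
      stepc zero = ∃e (pr₂ hyp) (abs (cut (eq 0) (S≢0 (z′ `+ x₀))))
      stepc (suc k) = ∃e (pr₂ hyp) (conv (sym (oneOf-sub {τ = `v ∘ suc} (λ i → refl) (suc k) x))
        (app (oneOf-suc k x′ x₀ (pr₂ hyp))
          (cut (cut (eq (suc k)) (S-inj (z′ `+ x₀) (`l k))) (sum-oneOf k z′ x₀))))

    le-oneOf : ∀ k (x : Tm n) → U ⊢ x ≼ `l k ⇒' oneOf k x
    le-oneOf k x = ∃-left (conv (sym (oneOf-sub {τ = `v ∘ suc} (λ i → refl) k x)) (sum-oneOf k x₀ (wkT x)))

    closed : (ψ : Δ 0) (τ : Sub 0 n) → cΔ (sub τ ψ) ≡ cΔ ψ
    closed ψ τ = trans (sym (cΔ-sub {σ = var} (λ ()) ψ)) (trans (cΔ-sub {σ = var} {τ = `v} (λ ()) ψ) (cong cΔ (sub-id ψ)))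

    closed₁ : (M : Δ 1) (j : ℕ) → cΔ {1} (sub (λ _ → `l j) M) ≡ cΔ (sub [ `l j ]τ M)
    closed₁ M j = trans (cong cΔ (sym (trans (sub-sub (λ ()) [ `l j ]τ M) (sub-ext (λ { zero → refl }) M))))
                        (closed (sub [ `l j ]τ M) (λ ()))

    at-numeral : (M : Δ 1) (j : ℕ) → γ ⊩ var 0 ≐ numeral j → γ ⊩ cΔ M → γ ⊩ cΔ (sub [ `l j ]τ M)
    at-numeral M j p q = conv (trans (cong cΔ (trans (sub-sub [ `l j ]τ _ M) (sub-ext (λ { zero → refl }) M))) (closed₁ M j))
      (rep {n = 1} (sub (λ _ → x₀) M) x₀ (`l j) p
        (conv (cong cΔ (sym (trans (trans (sub-sub [ x₀ ]τ _ M) (sub-ext (λ { zero → refl }) M)) (sub-id M)))) q))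

    oneOf-elim : (M : Δ 1) (χ : Formula) → ∀ k → (∀ j → j ≤ k → U ⊢ cΔ (sub [ `l j ]τ M) ⇒' χ) →
      oneOf {1} k x₀ ⊩ cΔ M ⇒' χ
    oneOf-elim M χ zero f = lam (cut (at-numeral M 0 (pr₁ hyp) (pr₂ hyp)) (f 0 z≤n))
    oneOf-elim M χ (suc k) f = case' hyp
      (cut (pr₂ hyp) (oneOf-elim M χ k λ j j≤ → f j (m≤n⇒m≤1+n j≤)))
      (lam (cut (at-numeral M (suc k) (pr₂ (pr₁ hyp)) (pr₂ hyp)) (f (suc k) ≤-refl)))

    bounded-elim : (M : Δ 1) (χ : Formula) → ∀ k → (∀ j → j ≤ k → U ⊢ cΔ (sub [ `l j ]τ M) ⇒' χ) →
      U ⊢ _≼_ {1} x₀ (`l k) ⇒' (cΔ M ⇒' χ)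
    bounded-elim M χ k f = cut (le-oneOf {1} k x₀) (oneOf-elim M χ k f)

    -- The way in which the theory argues about an unknown stage: up to a standard k the instances
    -- are settled one by one, and above k the conditions imposed on late stages take over.
    standard-or-large : (M : Δ 1) (χ : Formula) → ∀ k → (∀ j → j ≤ k → U ⊢ cΔ (sub [ `l j ]τ M) ⇒' χ) →
      U ⊢ _≼_ {1} (`l k) x₀ ⇒' (cΔ M ⇒' χ) → U ⊢ cΔ M ⇒' χ
    standard-or-large M χ k f g = mp (case' (K (total {1} (`l k) x₀))
      (cut (pr₂ hyp) (bounded-elim M χ k f)) (cut (pr₂ hyp) g)) (eq-refl zr)

    le-numeral : ∀ {i j} → i ≤ j → U ⊢ _≼_ {0} (`l i) (`l j)
    le-numeral {i} {j} i≤j = mp (≼i {0} (`l (j ∸ i)) (`l i) (`l j)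
      (K (conv⊢ (cong (λ x → numeral (j ∸ i) ⊕ numeral i ≐ numeral x) (m∸n+n≡m i≤j)) (numeral-+ (j ∸ i) i)))) (eq-refl zr)

    rep≼ʳ : (s t u : Tm n) → γ ⊩ cT t ≐ cT u → γ ⊩ s ≼ t → γ ⊩ s ≼ u
    rep≼ʳ {n} s t u p q = app (lam′ (∃e (pr₂ hyp) (conv (sym (≼-shift s u)) (≼i x₀ (wkT s) (wkT u)
        (trans' (x₀ `+ wkT s) (wkT t) (wkT u) (pr₂ hyp) (conv (cong₂ _≐_ (cT-wk t) (cT-wk u)) (pr₁ (pr₁ hyp)))))))) q
      where
      lam′ : cT t ≐ cT u ∧' s ≼ t ⊩ s ≼ u → _ ⊩ s ≼ t ⇒' s ≼ u
      lam′ r = cut p (lam r)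

    ∀-inst : (t s : Tm n) (φ : Δ (suc n)) → γ ⊩ cΔ (`∀ t φ) → γ ⊩ s ≼ t → γ ⊩ cΔ (sub [ s ]τ φ)
    ∀-inst {n} t s φ p q = conv (cΔ-inst s φ) (app (conv refl (∀e (cT s) p)) (conv (sym e) q))
      where
      e : inst (cT s) (var 0 ≤' shiftT (cT t)) ≡ s ≼ t
      e = trans (cong (λ x → inst (cT s) (var 0 ≤' x)) (cT-wk t))
          (trans (≤'-sub {τ = [ s ]τ} (λ { zero → refl ; (suc i) → refl }) (`v zero) (wkT t))
            (trans (cong (λ x → cT s ≤' cT x) ([]-wk s t)) (≼≡ s t)))

    ∃-inst : (t s : Tm n) (φ : Δ (suc n)) → γ ⊩ s ≼ t → γ ⊩ cΔ (sub [ s ]τ φ) → γ ⊩ cΔ (`∃ t φ)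
    ∃-inst {n} t s φ q p = ∃i (cT s) (pair' (conv (sym e) q) (conv (sym (cΔ-inst s φ)) p))
      where
      e : inst (cT s) (var 0 ≤' shiftT (cT t)) ≡ s ≼ t
      e = trans (cong (λ x → inst (cT s) (var 0 ≤' x)) (cT-wk t))
          (trans (≤'-sub {τ = [ s ]τ} (λ { zero → refl ; (suc i) → refl }) (`v zero) (wkT t))
            (trans (cong (λ x → cT s ≤' cT x) ([]-wk s t)) (≼≡ s t)))

    cl : Vec ℕ n → Δ n → Δ 0
    cl ρ = sub (litτ ρ)

    cl-cons : ∀ j (ρ : Vec ℕ n) φ → sub [ `l j ]τ (sub (liftτ (litτ ρ)) φ) ≡ cl (j ∷ ρ) φ
    cl-cons j ρ φ = trans (sub-sub [ `l j ]τ (liftτ (litτ ρ)) φ) (sub-ext (λ { zero → refl ; (suc i) → refl }) φ)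

    private
      bound≡ : (t : Tm 0) → (var 0 ≤' shiftT (cT t)) ≡ _≼_ {1} x₀ (wkT t)
      bound≡ t = trans (cong (var 0 ≤'_) (cT-wk t)) (≼≡ {1} x₀ (wkT t))

      closedT : (t : Tm 0) (τ : Sub 0 n) → cT (subT τ t) ≡ cT t
      closedT t τ = trans (sym (cT-sub {σ = var} (λ ()) t)) (trans (cT-sub {σ = var} {τ = `v} (λ ()) t) (cong cT (subT-id t)))

      bound-num : (ρ : Vec ℕ n) (t : Tm n) → _≼_ {1} x₀ (wkT (subT (litτ ρ) t)) ⊩ _≼_ {1} x₀ (`l (evT ρ t))
      bound-num ρ t = rep≼ʳ {1} x₀ (wkT (subT (litτ ρ) t)) (`l (evT ρ t))
        (K (conv⊢ (cong (_≐ numeral (evT ρ t)) (sym (closedT (subT (litτ ρ) t) _))) (term-value ρ t))) hyp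

      num-bound : (ρ : Vec ℕ n) (t : Tm n) → ∀ {j} → j ≤ evT ρ t → U ⊢ `l j ≼ subT {n = 0} (litτ ρ) t
      num-bound ρ t {j} j≤ = mp (rep≼ʳ {0} (`l j) (`l (evT ρ t)) (subT (litτ ρ) t)
        (sym' {0} (subT (litτ ρ) t) (`l (evT ρ t)) (K (term-value ρ t))) (K (le-numeral j≤))) (eq-refl zr)

    -- Truth and falsity are treated together because implication exchanges them; decidability of
    -- `Sat` supplies the case distinctions.
    Δ-true : (φ : Δ n) (ρ : Vec ℕ n) → Sat φ ρ → U ⊢ cΔ (cl ρ φ)
    Δ-false : (φ : Δ n) (ρ : Vec ℕ n) → ¬ Sat φ ρ → U ⊢ cΔ (cl ρ φ) ⇒' ⊥'
    Δ-true (t `= u) ρ p = mp (trans' {0} t′ (`l (evT ρ t)) u′ (K (term-value ρ t))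
        (sym' {0} u′ (`l (evT ρ t)) (conv (cong (λ x → cT u′ ≐ numeral x) (sym p)) (K (term-value ρ u))))) (eq-refl zr)
      where
      t′ u′ : Tm 0
      t′ = subT (litτ ρ) t
      u′ = subT (litτ ρ) u
    Δ-true (φ `∧ ψ) ρ (p , q) = mp (pair' (K (Δ-true φ ρ p)) (K (Δ-true ψ ρ q))) (eq-refl zr)
    Δ-true (φ `∨ ψ) ρ (inj₁ p) = mp (inl (K (Δ-true φ ρ p))) (eq-refl zr)
    Δ-true (φ `∨ ψ) ρ (inj₂ p) = mp (inr (K (Δ-true ψ ρ p))) (eq-refl zr)
    Δ-true (φ `⇒ ψ) ρ f with sat? φ ρ
    ... | yes p = K (Δ-true ψ ρ (f p))
    ... | no ¬p = abs (Δ-false φ ρ ¬p)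
    -- The conclusion of `bounded-elim` is the same in all cases, so the matrix at the bound
    -- variable cannot be that conclusion. Instead its negation is refuted in every case.
    Δ-true (`∀ t φ) ρ f = gen (cut (conv (bound≡ (subT (litτ ρ) t)) hyp)
      (cut (bound-num ρ t) (raa (bounded-elim (M `⇒ `⊥) ⊥' (evT ρ t)
        λ j j≤ → app hyp (K (conv⊢ (cong cΔ (sym (cl-cons j ρ φ))) (Δ-true φ (j ∷ ρ) (f j j≤))))))))
      where
      M : Δ 1
      M = sub (liftτ (litτ ρ)) φ
    Δ-true (`∃ t φ) ρ (j , j≤ , p) = mp (∃-inst {0} (subT (litτ ρ) t) (`l j) (sub (liftτ (litτ ρ)) φ)
      (K (num-bound ρ t j≤)) (K (conv⊢ (cong cΔ (sym (cl-cons j ρ φ))) (Δ-true φ (j ∷ ρ) p)))) (eq-refl zr)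
    Δ-false (t `= u) ρ ¬p = cut (trans' {0} (`l (evT ρ t)) t′ (`l (evT ρ u)) (sym' {0} t′ (`l (evT ρ t)) (K (term-value ρ t)))
        (trans' {0} t′ u′ (`l (evT ρ u)) hyp (K (term-value ρ u)))) (numeral-≢ _ _ ¬p)
      where
      t′ u′ : Tm 0
      t′ = subT (litτ ρ) t
      u′ = subT (litτ ρ) u
    Δ-false `⊥ ρ ¬p = hyp
    Δ-false (φ `∧ ψ) ρ ¬p with sat? φ ρ
    ... | yes p = cut (pr₂ hyp) (Δ-false ψ ρ λ q → ¬p (p , q))
    ... | no ¬q = cut (pr₁ hyp) (Δ-false φ ρ ¬q)
    Δ-false (φ `∨ ψ) ρ ¬p = case' hyp (cut (pr₂ hyp) (Δ-false φ ρ (¬p ∘ inj₁))) (cut (pr₂ hyp) (Δ-false ψ ρ (¬p ∘ inj₂)))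
    Δ-false (φ `⇒ ψ) ρ ¬p with sat? φ ρ
    ... | yes p = cut (app hyp (K (Δ-true φ ρ p))) (Δ-false ψ ρ λ q → ¬p λ _ → q)
    ... | no ¬q = ⊥-elim (¬p λ p → ⊥-elim (¬q p))
    Δ-false (`∀ t φ) ρ ¬p with decEx≤ (λ x → ¬? (sat? φ (x ∷ ρ))) (evT ρ t)
    ... | yes (j , j≤ , ¬q) = cut (conv (cong cΔ (cl-cons j ρ φ)) (∀-inst {0} (subT (litτ ρ) t) (`l j) (sub (liftτ (litτ ρ)) φ)
      hyp (K (num-bound ρ t j≤)))) (Δ-false φ (j ∷ ρ) ¬q)
    ... | no ¬q = ⊥-elim (¬p λ j j≤ → decidable-stable (sat? φ (j ∷ ρ)) λ ¬r → ¬q (j , j≤ , ¬r))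
    Δ-false (`∃ t φ) ρ ¬p = ∃-left (app (cut (pr₁ hyp) (cut (conv (bound≡ (subT (litτ ρ) t)) hyp) (cut (bound-num ρ t)
      (bounded-elim (sub (liftτ (litτ ρ)) φ) ⊥' (evT ρ t)
        λ j j≤ → conv⊢ (cong (λ x → cΔ x ⇒' ⊥') (sym (cl-cons j ρ φ))) (Δ-false φ (j ∷ ρ) λ q → ¬p (j , j≤ , q)))))) (pr₂ hyp))

open NaturalDeduction

-- Codes of terms and formulas, and witness extraction from PA-proofs

module Codes where
  private
    pair-suc : ∀ a b → pair (suc a) b ≡ 2 * pair a b
    pair-suc a b = *-assoc 2 (2 ^ a) (2 * b + 1)

    pair-zero : ∀ b → pair 0 b ≡ suc (2 * b)
    pair-zero b = trans (+-identityʳ (2 * b + 1)) (+-comm (2 * b) 1)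

    pair-inj : ∀ a b a′ b′ → pair a b ≡ pair a′ b′ → a ≡ a′ × b ≡ b′
    pair-inj zero b zero b′ e = refl , *-cancelˡ-≡ b b′ 2 (suc-injective (trans (sym (pair-zero b)) (trans e (pair-zero b′))))
    pair-inj zero b (suc a′) b′ e = ⊥-elim (even≢odd (pair a′ b′) b (trans (sym (pair-suc a′ b′)) (trans (sym e) (pair-zero b))))
    pair-inj (suc a) b zero b′ e = ⊥-elim (even≢odd (pair a b) b′ (trans (sym (pair-suc a b)) (trans e (pair-zero b′))))
    pair-inj (suc a) b (suc a′) b′ e with pair-inj a b a′ b′
      (*-cancelˡ-≡ (pair a b) (pair a′ b′) 2 (trans (sym (pair-suc a b)) (trans e (pair-suc a′ b′))))
    ... | refl , refl = refl , refl

    pair-> : ∀ a b → a < pair a b × b < pair a b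
    pair-> zero b = ≤-trans (s≤s z≤n) (≤-reflexive (sym (pair-zero b))) ,
                    ≤-trans (s≤s (m≤n*m b 2)) (≤-reflexive (sym (pair-zero b)))
    pair-> (suc a) b with pair-> a b
    ... | p , q = ≤-trans (s≤s p) (≤-trans (+-monoˡ-≤ (pair a b) (≤-trans (s≤s z≤n) p)) (≤-trans (+-monoʳ-≤ (pair a b) (≤-reflexive (sym (+-identityʳ (pair a b))))) (≤-reflexive (sym (pair-suc a b)))))
                , ≤-trans q (≤-trans (m≤n*m (pair a b) 2) (≤-reflexive (sym (pair-suc a b))))

  -- Opaque, so that codes are never computed.
  opaque
    ⟪_,_⟫ : ℕ → ℕ → ℕ
    ⟪ a , b ⟫ = pair a b

    ⟪⟫≡pair : ∀ a b → ⟪ a , b ⟫ ≡ pair a b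
    ⟪⟫≡pair a b = refl

    ⟪⟫-inj : ∀ {a b a′ b′} → ⟪ a , b ⟫ ≡ ⟪ a′ , b′ ⟫ → a ≡ a′ × b ≡ b′
    ⟪⟫-inj = pair-inj _ _ _ _

    ⟪⟫-> : ∀ a b → a < ⟪ a , b ⟫ × b < ⟪ a , b ⟫
    ⟪⟫-> = pair->

  kT : Term → ℕ
  kT (var k) = ⟪ 0 , k ⟫
  kT zr = ⟪ 1 , 0 ⟫
  kT (S t) = ⟪ 2 , kT t ⟫
  kT (t ⊕ u) = ⟪ 3 , ⟪ kT t , kT u ⟫ ⟫
  kT (t ⊗ u) = ⟪ 4 , ⟪ kT t , kT u ⟫ ⟫

  kF : Formula → ℕ
  kF (t ≐ u) = ⟪ 0 , ⟪ kT t , kT u ⟫ ⟫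
  kF ⊥' = ⟪ 1 , 0 ⟫
  kF (¬' φ) = ⟪ 2 , kF φ ⟫
  kF (φ ∧' ψ) = ⟪ 3 , ⟪ kF φ , kF ψ ⟫ ⟫
  kF (φ ∨' ψ) = ⟪ 4 , ⟪ kF φ , kF ψ ⟫ ⟫
  kF (φ ⇒' ψ) = ⟪ 5 , ⟪ kF φ , kF ψ ⟫ ⟫
  kF (∀' φ) = ⟪ 6 , kF φ ⟫
  kF (∃' φ) = ⟪ 7 , kF φ ⟫

  private
    pr₂≡ : ∀ {n a b a′ b′} → a ≡ a′ → b ≡ b′ → ⟪ n , ⟪ a , b ⟫ ⟫ ≡ pair n (pair a′ b′)
    pr₂≡ {n} {a} {b} refl refl = trans (⟪⟫≡pair n ⟪ a , b ⟫) (cong (pair n) (⟪⟫≡pair a b))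
    pr₁≡ : ∀ {n a a′} → a ≡ a′ → ⟪ n , a ⟫ ≡ pair n a′
    pr₁≡ {n} {a} refl = ⟪⟫≡pair n a

  kT≡codeT : ∀ t → kT t ≡ codeT t
  kT≡codeT (var k) = ⟪⟫≡pair _ _
  kT≡codeT zr = ⟪⟫≡pair _ _
  kT≡codeT (S t) = pr₁≡ (kT≡codeT t)
  kT≡codeT (t ⊕ u) = pr₂≡ (kT≡codeT t) (kT≡codeT u)
  kT≡codeT (t ⊗ u) = pr₂≡ (kT≡codeT t) (kT≡codeT u)

  kF≡code : ∀ φ → kF φ ≡ code φ
  kF≡code (t ≐ u) = pr₂≡ (kT≡codeT t) (kT≡codeT u)
  kF≡code ⊥' = ⟪⟫≡pair _ _
  kF≡code (¬' φ) = pr₁≡ (kF≡code φ)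
  kF≡code (φ ∧' ψ) = pr₂≡ (kF≡code φ) (kF≡code ψ)
  kF≡code (φ ∨' ψ) = pr₂≡ (kF≡code φ) (kF≡code ψ)
  kF≡code (φ ⇒' ψ) = pr₂≡ (kF≡code φ) (kF≡code ψ)
  kF≡code (∀' φ) = pr₁≡ (kF≡code φ)
  kF≡code (∃' φ) = pr₁≡ (kF≡code φ)

  ⟪⟫-inj₂ : ∀ {n n′ a b a′ b′} → ⟪ n , ⟪ a , b ⟫ ⟫ ≡ ⟪ n′ , ⟪ a′ , b′ ⟫ ⟫ → a ≡ a′ × b ≡ b′
  ⟪⟫-inj₂ e = ⟪⟫-inj (proj₂ (⟪⟫-inj e))

  private
    tag : ∀ {a b a′ b′} → ⟪ a , b ⟫ ≡ ⟪ a′ , b′ ⟫ → a ≡ a′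
    tag = proj₁ ∘ ⟪⟫-inj

  kT-inj : ∀ t u → kT t ≡ kT u → t ≡ u
  kT-inj (var k) (var l) e = cong var (proj₂ (⟪⟫-inj e))
  kT-inj zr zr e = refl
  kT-inj (S t) (S u) e = cong S (kT-inj t u (proj₂ (⟪⟫-inj e)))
  kT-inj (t ⊕ t′) (u ⊕ u′) e = cong₂ _⊕_ (kT-inj t u (proj₁ (⟪⟫-inj₂ e))) (kT-inj t′ u′ (proj₂ (⟪⟫-inj₂ e)))
  kT-inj (t ⊗ t′) (u ⊗ u′) e = cong₂ _⊗_ (kT-inj t u (proj₁ (⟪⟫-inj₂ e))) (kT-inj t′ u′ (proj₂ (⟪⟫-inj₂ e)))
  kT-inj (var _) zr e with () ← tag e
  kT-inj (var _) (S _) e with () ← tag e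
  kT-inj (var _) (_ ⊕ _) e with () ← tag e
  kT-inj (var _) (_ ⊗ _) e with () ← tag e
  kT-inj zr (var _) e with () ← tag e
  kT-inj zr (S _) e with () ← tag e
  kT-inj zr (_ ⊕ _) e with () ← tag e
  kT-inj zr (_ ⊗ _) e with () ← tag e
  kT-inj (S _) (var _) e with () ← tag e
  kT-inj (S _) zr e with () ← tag e
  kT-inj (S _) (_ ⊕ _) e with () ← tag e
  kT-inj (S _) (_ ⊗ _) e with () ← tag e
  kT-inj (_ ⊕ _) (var _) e with () ← tag e
  kT-inj (_ ⊕ _) zr e with () ← tag e
  kT-inj (_ ⊕ _) (S _) e with () ← tag e
  kT-inj (_ ⊕ _) (_ ⊗ _) e with () ← tag e
  kT-inj (_ ⊗ _) (var _) e with () ← tag e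
  kT-inj (_ ⊗ _) zr e with () ← tag e
  kT-inj (_ ⊗ _) (S _) e with () ← tag e
  kT-inj (_ ⊗ _) (_ ⊕ _) e with () ← tag e

  -- A table of constructor tags keeps the injectivity proof linear in the number of constructors.
  private
    data Head : Formula → Formula → Set where
      h= : ∀ {t u t′ u′} → Head (t ≐ u) (t′ ≐ u′)
      h⊥ : Head ⊥' ⊥'
      h¬ : ∀ {φ φ′} → Head (¬' φ) (¬' φ′)
      h∧ : ∀ {φ ψ φ′ ψ′} → Head (φ ∧' ψ) (φ′ ∧' ψ′)
      h∨ : ∀ {φ ψ φ′ ψ′} → Head (φ ∨' ψ) (φ′ ∨' ψ′)
      h⇒ : ∀ {φ ψ φ′ ψ′} → Head (φ ⇒' ψ) (φ′ ⇒' ψ′)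
      h∀ : ∀ {φ φ′} → Head (∀' φ) (∀' φ′)
      h∃ : ∀ {φ φ′} → Head (∃' φ) (∃' φ′)

    ftag : Formula → ℕ
    ftag (_ ≐ _) = 0
    ftag ⊥' = 1
    ftag (¬' _) = 2
    ftag (_ ∧' _) = 3
    ftag (_ ∨' _) = 4
    ftag (_ ⇒' _) = 5
    ftag (∀' _) = 6
    ftag (∃' _) = 7

    payload : Formula → ℕ
    payload (t ≐ u) = ⟪ kT t , kT u ⟫
    payload ⊥' = 0
    payload (¬' φ) = kF φ
    payload (φ ∧' ψ) = ⟪ kF φ , kF ψ ⟫
    payload (φ ∨' ψ) = ⟪ kF φ , kF ψ ⟫
    payload (φ ⇒' ψ) = ⟪ kF φ , kF ψ ⟫
    payload (∀' φ) = kF φ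
    payload (∃' φ) = kF φ

    kF-tag : ∀ φ → kF φ ≡ ⟪ ftag φ , payload φ ⟫
    kF-tag (_ ≐ _) = refl
    kF-tag ⊥' = refl
    kF-tag (¬' _) = refl
    kF-tag (_ ∧' _) = refl
    kF-tag (_ ∨' _) = refl
    kF-tag (_ ⇒' _) = refl
    kF-tag (∀' _) = refl
    kF-tag (∃' _) = refl

    head : ∀ φ ψ → ftag φ ≡ ftag ψ → Head φ ψ
    head (_ ≐ _) (_ ≐ _) e = h=
    head ⊥' ⊥' e = h⊥
    head (¬' _) (¬' _) e = h¬
    head (_ ∧' _) (_ ∧' _) e = h∧
    head (_ ∨' _) (_ ∨' _) e = h∨
    head (_ ⇒' _) (_ ⇒' _) e = h⇒
    head (∀' _) (∀' _) e = h∀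
    head (∃' _) (∃' _) e = h∃

  kF-inj : ∀ φ ψ → kF φ ≡ kF ψ → φ ≡ ψ
  kF-inj φ ψ e with head φ ψ (tag (trans (sym (kF-tag φ)) (trans e (kF-tag ψ))))
  ... | h= = cong₂ _≐_ (kT-inj _ _ (proj₁ (⟪⟫-inj₂ e))) (kT-inj _ _ (proj₂ (⟪⟫-inj₂ e)))
  ... | h⊥ = refl
  ... | h¬ {φ} {φ′} = cong ¬'_ (kF-inj φ φ′ (proj₂ (⟪⟫-inj e)))
  ... | h∧ {φ} {ψ} {φ′} {ψ′} = cong₂ _∧'_ (kF-inj φ φ′ (proj₁ (⟪⟫-inj₂ e))) (kF-inj ψ ψ′ (proj₂ (⟪⟫-inj₂ e)))
  ... | h∨ {φ} {ψ} {φ′} {ψ′} = cong₂ _∨'_ (kF-inj φ φ′ (proj₁ (⟪⟫-inj₂ e))) (kF-inj ψ ψ′ (proj₂ (⟪⟫-inj₂ e)))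
  ... | h⇒ {φ} {ψ} {φ′} {ψ′} = cong₂ _⇒'_ (kF-inj φ φ′ (proj₁ (⟪⟫-inj₂ e))) (kF-inj ψ ψ′ (proj₂ (⟪⟫-inj₂ e)))
  ... | h∀ {φ} {φ′} = cong ∀' (kF-inj φ φ′ (proj₂ (⟪⟫-inj e)))
  ... | h∃ {φ} {φ′} = cong ∃' (kF-inj φ φ′ (proj₂ (⟪⟫-inj e)))

  _≟F_ : (φ ψ : Formula) → Dec (φ ≡ ψ)
  φ ≟F ψ = map′ (kF-inj φ ψ) (cong kF) (kF φ ≟ kF ψ)

  primes : Formula → List Formula
  primes (t ≐ u) = (t ≐ u) ∷ []
  primes ⊥' = []
  primes (¬' φ) = primes φ
  primes (φ ∧' ψ) = primes φ ++ primes ψ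
  primes (φ ∨' ψ) = primes φ ++ primes ψ
  primes (φ ⇒' ψ) = primes φ ++ primes ψ
  primes (∀' φ) = ∀' φ ∷ []
  primes (∃' φ) = ∃' φ ∷ []

  -- Friedman's translation, with falsity interpreted by R: choosing for R the existence of a witness turns a PA-proof of a
  -- Σ₁-sentence into a witness.
  module Friedman (R : Set) where
    Env : Set
    Env = ℕ → ℕ

    evTerm : Env → Term → ℕ
    evTerm ρ (var k) = ρ k
    evTerm ρ zr = 0
    evTerm ρ (S t) = suc (evTerm ρ t)
    evTerm ρ (t ⊕ u) = evTerm ρ t + evTerm ρ u
    evTerm ρ (t ⊗ u) = evTerm ρ t * evTerm ρ u

    _▷_ : ℕ → Env → Env
    (x ▷ ρ) zero = x
    (x ▷ ρ) (suc k) = ρ k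

    -- Equations, disjunctions and existential formulas are double negated over R, and falsity is R.
    -- This makes every formula stable (`¬¬-stable`), and with it the classical calculus sound.
    ⟦_⟧ : Formula → Env → Set
    ⟦ t ≐ u ⟧ ρ = (evTerm ρ t ≡ evTerm ρ u → R) → R
    ⟦ ⊥' ⟧ ρ = R
    ⟦ ¬' φ ⟧ ρ = ⟦ φ ⟧ ρ → R
    ⟦ φ ∧' ψ ⟧ ρ = ⟦ φ ⟧ ρ × ⟦ ψ ⟧ ρ
    ⟦ φ ∨' ψ ⟧ ρ = (⟦ φ ⟧ ρ → R) → (⟦ ψ ⟧ ρ → R) → R
    ⟦ φ ⇒' ψ ⟧ ρ = ⟦ φ ⟧ ρ → ⟦ ψ ⟧ ρ
    ⟦ ∀' φ ⟧ ρ = ∀ x → ⟦ φ ⟧ (x ▷ ρ)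
    ⟦ ∃' φ ⟧ ρ = (∀ x → ⟦ φ ⟧ (x ▷ ρ) → R) → R

    ¬¬-stable : ∀ φ {ρ} → ((⟦ φ ⟧ ρ → R) → R) → ⟦ φ ⟧ ρ
    ¬¬-stable (t ≐ u) k c = k λ d → d c
    ¬¬-stable ⊥' k = k id
    ¬¬-stable (¬' φ) k p = k λ n → n p
    ¬¬-stable (φ ∧' ψ) k = ¬¬-stable φ (λ c → k (c ∘ proj₁)) , ¬¬-stable ψ (λ c → k (c ∘ proj₂))
    ¬¬-stable (φ ∨' ψ) k c d = k λ o → o c d
    ¬¬-stable (φ ⇒' ψ) k p = ¬¬-stable ψ λ c → k λ f → c (f p)
    ¬¬-stable (∀' φ) k x = ¬¬-stable φ λ c → k λ f → c (f x)
    ¬¬-stable (∃' φ) k c = k λ e → e c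

    private
      _≗▷_ : {ρ ρ′ : Env} (x : ℕ) → (∀ k → ρ k ≡ ρ′ k) → ∀ k → (x ▷ ρ) k ≡ (x ▷ ρ′) k
      (x ≗▷ e) zero = refl
      (x ≗▷ e) (suc k) = e k

    ev-subst : ∀ {ρ ρ′ σ} → (∀ k → ρ′ k ≡ evTerm ρ (σ k)) → ∀ t → evTerm ρ (substT σ t) ≡ evTerm ρ′ t
    ev-subst e (var k) = sym (e k)
    ev-subst e zr = refl
    ev-subst e (S t) = cong suc (ev-subst e t)
    ev-subst e (t ⊕ u) = cong₂ _+_ (ev-subst e t) (ev-subst e u)
    ev-subst e (t ⊗ u) = cong₂ _*_ (ev-subst e t) (ev-subst e u)

    private
      lift-env : ∀ {ρ ρ′ σ} → (∀ k → ρ′ k ≡ evTerm ρ (σ k)) → ∀ x k → (x ▷ ρ′) k ≡ evTerm (x ▷ ρ) (lift σ k)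
      lift-env e x zero = refl
      lift-env {σ = σ} e x (suc k) = trans (e k) (sym (ev-subst (λ _ → refl) (σ k)))

    sem→ : ∀ φ {ρ ρ′ σ} → (∀ k → ρ′ k ≡ evTerm ρ (σ k)) → ⟦ subst σ φ ⟧ ρ → ⟦ φ ⟧ ρ′
    sem← : ∀ φ {ρ ρ′ σ} → (∀ k → ρ′ k ≡ evTerm ρ (σ k)) → ⟦ φ ⟧ ρ′ → ⟦ subst σ φ ⟧ ρ
    sem→ (t ≐ u) e k c = k λ d → c (trans (sym (ev-subst e t)) (trans d (ev-subst e u)))
    sem→ ⊥' e r = r
    sem→ (¬' φ) e k p = k (sem← φ e p)
    sem→ (φ ∧' ψ) e (p , q) = sem→ φ e p , sem→ ψ e q
    sem→ (φ ∨' ψ) e k c d = k (c ∘ sem→ φ e) (d ∘ sem→ ψ e)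
    sem→ (φ ⇒' ψ) e f p = sem→ ψ e (f (sem← φ e p))
    sem→ (∀' φ) e f x = sem→ φ (lift-env e x) (f x)
    sem→ (∃' φ) e k c = k λ x p → c x (sem→ φ (lift-env e x) p)
    sem← (t ≐ u) e k c = k λ d → c (trans (ev-subst e t) (trans d (sym (ev-subst e u))))
    sem← ⊥' e r = r
    sem← (¬' φ) e k p = k (sem→ φ e p)
    sem← (φ ∧' ψ) e (p , q) = sem← φ e p , sem← ψ e q
    sem← (φ ∨' ψ) e k c d = k (c ∘ sem← φ e) (d ∘ sem← ψ e)
    sem← (φ ⇒' ψ) e f p = sem← ψ e (f (sem→ φ e p))
    sem← (∀' φ) e f x = sem← φ (lift-env e x) (f x)
    sem← (∃' φ) e k c = k λ x p → c x (sem← φ (lift-env e x) p)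

    inst→ : ∀ φ t {ρ} → ⟦ inst t φ ⟧ ρ → ⟦ φ ⟧ (evTerm ρ t ▷ ρ)
    inst→ φ t = sem→ φ λ { zero → refl ; (suc k) → refl }

    inst← : ∀ φ t {ρ} → ⟦ φ ⟧ (evTerm ρ t ▷ ρ) → ⟦ inst t φ ⟧ ρ
    inst← φ t = sem← φ λ { zero → refl ; (suc k) → refl }

    env-eq : ∀ φ {ρ ρ′} → (∀ k → ρ k ≡ ρ′ k) → ⟦ φ ⟧ ρ → ⟦ φ ⟧ ρ′
    env-eq (t ≐ u) e k c = k λ d → c (trans (sym (h t)) (trans d (h u)))
      where
      h : ∀ t → evTerm _ t ≡ evTerm _ t
      h (var k) = e k
      h zr = refl
      h (S t) = cong suc (h t)
      h (t ⊕ u) = cong₂ _+_ (h t) (h u)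
      h (t ⊗ u) = cong₂ _*_ (h t) (h u)
    env-eq ⊥' e r = r
    env-eq (¬' φ) e k p = k (env-eq φ (sym ∘ e) p)
    env-eq (φ ∧' ψ) e (p , q) = env-eq φ e p , env-eq ψ e q
    env-eq (φ ∨' ψ) e k c d = k (c ∘ env-eq φ e) (d ∘ env-eq ψ e)
    env-eq (φ ⇒' ψ) e f p = env-eq ψ e (f (env-eq φ (sym ∘ e) p))
    env-eq (∀' φ) e f x = env-eq φ (x ≗▷ e) (f x)
    env-eq (∃' φ) e k c = k λ x p → c x (env-eq φ (x ≗▷ e) p)

    Agree : Env → (Formula → Bool) → Formula → Set
    Agree ρ w ψ = (w ψ ≡ true × ⟦ ψ ⟧ ρ) ⊎ (w ψ ≡ false × (⟦ ψ ⟧ ρ → R))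

    Decides : Env → Bool → Formula → Set
    Decides ρ b φ = (b ≡ true → ⟦ φ ⟧ ρ) × (b ≡ false → ⟦ φ ⟧ ρ → R)

    agree-eval : ∀ {ρ w} φ → All (Agree ρ w) (primes φ) → Decides ρ (evalB w φ) φ
    agree-eval (t ≐ u) (inj₁ (e , p) ∷ []) = (λ _ → p) , λ f → case trans (sym e) f of λ ()
    agree-eval (t ≐ u) (inj₂ (e , p) ∷ []) = (λ f → case trans (sym e) f of λ ()) , λ _ → p
    agree-eval ⊥' a = (λ ()) , λ _ r → r
    agree-eval {w = w} (¬' φ) a with evalB w φ | agree-eval φ a
    ... | true | p , q = (λ ()) , λ _ n → n (p refl)
    ... | false | p , q = (λ _ → q refl) , λ ()
    agree-eval {w = w} (φ ∧' ψ) a with evalB w φ | evalB w ψ | agree-eval φ (Allₚ.++⁻ˡ (primes φ) a) | agree-eval ψ (Allₚ.++⁻ʳ (primes φ) a)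
    ... | true | true | p , _ | q , _ = (λ _ → p refl , q refl) , λ ()
    ... | true | false | p , _ | _ , q = (λ ()) , λ _ (_ , s) → q refl s
    ... | false | _ | _ , p | _ = (λ ()) , λ _ (r , _) → p refl r
    agree-eval {w = w} (φ ∨' ψ) a with evalB w φ | evalB w ψ | agree-eval φ (Allₚ.++⁻ˡ (primes φ) a) | agree-eval ψ (Allₚ.++⁻ʳ (primes φ) a)
    ... | true | _ | p , _ | _ = (λ _ c d → c (p refl)) , λ ()
    ... | false | true | _ | q , _ = (λ _ c d → d (q refl)) , λ ()
    ... | false | false | _ , p | _ , q = (λ ()) , λ _ k → k (p refl) (q refl)
    agree-eval {w = w} (φ ⇒' ψ) a with evalB w φ | evalB w ψ | agree-eval φ (Allₚ.++⁻ˡ (primes φ) a) | agree-eval ψ (Allₚ.++⁻ʳ (primes φ) a)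
    ... | _ | true | _ | q , _ = (λ _ _ → q refl) , λ e → case trans (sym (∨-zeroʳ _)) e of λ ()
    ... | true | false | p , _ | _ , q = (λ ()) , λ _ f → q refl (f (p refl))
    ... | false | false | _ , p | _ = (λ _ r → ¬¬-stable ψ λ _ → p refl r) , λ ()
    agree-eval (∀' φ) (inj₁ (e , p) ∷ []) = (λ _ → p) , λ f → case trans (sym e) f of λ ()
    agree-eval (∀' φ) (inj₂ (e , p) ∷ []) = (λ f → case trans (sym e) f of λ ()) , λ _ → p
    agree-eval (∃' φ) (inj₁ (e , p) ∷ []) = (λ _ → p) , λ f → case trans (sym e) f of λ ()
    agree-eval (∃' φ) (inj₂ (e , p) ∷ []) = (λ f → case trans (sym e) f of λ ()) , λ _ → p

    update : Formula → Bool → (Formula → Bool) → Formula → Bool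
    update p b w q with q ≟F p
    ... | yes _ = b
    ... | no _ = w q

    -- No Boolean valuation reflecting the truth of prime formulas can be computed, but finitely
    -- many instances of excluded middle hold under double negation over R. This suffices for
    -- tautologies, which are checked on Boolean valuations.
    choose : ∀ ρ ps → ((Σ (Formula → Bool) λ w → All (Agree ρ w) ps) → R) → R
    choose ρ [] k = k ((λ _ → true) , [])
    choose ρ (p ∷ ps) k = choose ρ ps λ (w , a) →
      (ρ ⊨¬¬ p) (λ d → k (update p true w , new p true w (inj₁ (refl , d)) ∷ All.map (old p true w (inj₁ (refl , d))) a))
              (λ c → k (update p false w , new p false w (inj₂ (refl , c)) ∷ All.map (old p false w (inj₂ (refl , c))) a))
      where
      _⊨¬¬_ : ∀ ρ p → (⟦ p ⟧ ρ → R) → ((⟦ p ⟧ ρ → R) → R) → R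
      (ρ ⊨¬¬ p) c d = d c
      Val : Formula → Bool → Set
      Val p b = (b ≡ true × ⟦ p ⟧ ρ) ⊎ (b ≡ false × (⟦ p ⟧ ρ → R))
      new : ∀ p b w → Val p b → Agree ρ (update p b w) p
      new p b w v with p ≟F p
      ... | yes _ = v
      ... | no ne = ⊥-elim (ne refl)
      old : ∀ p b w → Val p b → ∀ {q} → Agree ρ w q → Agree ρ (update p b w) q
      old p b w v {q} g with q ≟F p
      ... | yes refl = v
      ... | no _ = g

    sound : ∀ {φ} → PA ⊢ φ → ∀ ρ → ⟦ φ ⟧ ρ
    sound (ax pa1) ρ x k = k λ ()
    sound (ax pa2) ρ x y k c = k λ e → c (suc-injective e)
    sound (ax pa3) ρ x c = c (+-identityʳ x)
    sound (ax pa4) ρ x y c = c (+-suc x y)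
    sound (ax pa5) ρ x c = c (*-zeroʳ x)
    sound (ax pa6) ρ x y c = c (trans (*-suc x y) (+-comm x (x * y)))
    sound (ax (pa-ind φ)) ρ z s = go
      where
      go : ∀ x → ⟦ φ ⟧ (x ▷ ρ)
      go zero = inst→ φ zr z
      go (suc x) = env-eq φ (λ { zero → refl ; (suc k) → refl })
        (sem→ φ {ρ′ = suc x ▷ ρ} (λ { zero → refl ; (suc k) → refl }) (s x (go x)))
    sound (taut {φ} t) ρ = ¬¬-stable φ λ c → choose ρ (primes φ) λ (w , a) → c (proj₁ (agree-eval φ a) (t w))
    sound (∀-elim φ t) ρ f = inst← φ t (f (evTerm ρ t))
    sound (∀-intro φ ψ) ρ f p x = f x (sem← ψ (λ _ → refl) p)
    sound (∃-intro φ t) ρ p c = c (evTerm ρ t) (inst→ φ t p)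
    sound (∃-elim φ ψ) ρ f e = ¬¬-stable ψ λ c → e λ x p → c (sem→ ψ (λ _ → refl) (f x p))
    sound (eq-refl t) ρ c = c refl
    sound (eq-subst φ t u) ρ e p = ¬¬-stable (inst u φ) λ c → e λ d →
      c (inst← φ u (≡subst (λ x → ⟦ φ ⟧ (x ▷ ρ)) d (inst→ φ t p)))
    sound (mp p q) ρ = sound p ρ (sound q ρ)
    sound (gen p) ρ x = sound p (x ▷ ρ)

    private
      ev-cT : ∀ {n} (ρ : Vec ℕ n) {ρ′ : Env} → (∀ i → ρ′ (toℕ i) ≡ lookup ρ i) → ∀ t → evTerm ρ′ (cT t) ≡ evT ρ t
      ev-cT ρ e (`v i) = e i
      ev-cT ρ e (`l k) = num k
        where
        num : ∀ k → evTerm _ (numeral k) ≡ k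
        num zero = refl
        num (suc k) = cong suc (num k)
      ev-cT ρ e (`s t) = cong suc (ev-cT ρ e t)
      ev-cT ρ e (t `+ u) = cong₂ _+_ (ev-cT ρ e t) (ev-cT ρ e u)
      ev-cT ρ e (t `* u) = cong₂ _*_ (ev-cT ρ e t) (ev-cT ρ e u)

      ext-env : ∀ {n} {ρ : Vec ℕ n} {ρ′ : Env} → (∀ i → ρ′ (toℕ i) ≡ lookup ρ i) → ∀ x i → (x ▷ ρ′) (toℕ i) ≡ lookup (x ∷ ρ) i
      ext-env e x Fin.zero = refl
      ext-env e x (Fin.suc i) = e i

      bound-val : ∀ {n} (ρ : Vec ℕ n) {ρ′ : Env} → (∀ i → ρ′ (toℕ i) ≡ lookup ρ i) → ∀ t x z →
        evTerm (z ▷ (x ▷ ρ′)) (shiftT (shiftT (cT t))) ≡ evT ρ t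
      bound-val ρ e t x z = trans (ev-subst {ρ′ = x ▷ _} (λ _ → refl) (shiftT (cT t)))
                            (trans (ev-subst {ρ′ = _} (λ _ → refl) (cT t)) (ev-cT ρ e t))

      ≤→sem : ∀ {n} (ρ : Vec ℕ n) {ρ′ : Env} → (∀ i → ρ′ (toℕ i) ≡ lookup ρ i) → ∀ t x → x ≤ evT ρ t →
        ⟦ var 0 ≤' shiftT (cT t) ⟧ (x ▷ ρ′)
      ≤→sem ρ e t x x≤ k = k (evT ρ t ∸ x) λ c → c (trans (m∸n+n≡m x≤) (sym (bound-val ρ e t x _)))

      sem→≤ : ∀ {n} (ρ : Vec ℕ n) {ρ′ : Env} → (∀ i → ρ′ (toℕ i) ≡ lookup ρ i) → ∀ t x → ¬ (x ≤ evT ρ t) →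
        ⟦ var 0 ≤' shiftT (cT t) ⟧ (x ▷ ρ′) → R
      sem→≤ ρ e t x x≰ k = k λ z c → c λ d → ⊥-elim (x≰ (≤-trans (m≤n+m x z) (≤-reflexive (trans d (bound-val ρ e t x z)))))

    -- On bounded formulas the translation follows their decidable truth for any R. The negative
    -- half is what turns a wrong candidate for a witness into R.
    Δ-sem : ∀ {n} (φ : Δ n) (ρ : Vec ℕ n) {ρ′ : Env} → (∀ i → ρ′ (toℕ i) ≡ lookup ρ i) → Sat φ ρ → ⟦ cΔ φ ⟧ ρ′
    Δ-sem¬ : ∀ {n} (φ : Δ n) (ρ : Vec ℕ n) {ρ′ : Env} → (∀ i → ρ′ (toℕ i) ≡ lookup ρ i) → ¬ Sat φ ρ → ⟦ cΔ φ ⟧ ρ′ → R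
    Δ-sem (t `= u) ρ e p k = k (trans (ev-cT ρ e t) (trans p (sym (ev-cT ρ e u))))
    Δ-sem (φ `∧ ψ) ρ e (p , q) = Δ-sem φ ρ e p , Δ-sem ψ ρ e q
    Δ-sem (φ `∨ ψ) ρ e (inj₁ p) k l = k (Δ-sem φ ρ e p)
    Δ-sem (φ `∨ ψ) ρ e (inj₂ p) k l = l (Δ-sem ψ ρ e p)
    Δ-sem (φ `⇒ ψ) ρ e f with sat? φ ρ
    ... | yes p = λ _ → Δ-sem ψ ρ e (f p)
    ... | no ¬p = λ q → ¬¬-stable (cΔ ψ) λ _ → Δ-sem¬ φ ρ e ¬p q
    Δ-sem (`∀ t φ) ρ e f x b with x ≤? evT ρ t
    ... | yes x≤ = Δ-sem φ (x ∷ ρ) (ext-env e x) (f x x≤)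
    ... | no x≰ = ¬¬-stable (cΔ φ) λ _ → sem→≤ ρ e t x x≰ b
    Δ-sem (`∃ t φ) ρ e (x , x≤ , p) k = k x (≤→sem ρ e t x x≤ , Δ-sem φ (x ∷ ρ) (ext-env e x) p)
    Δ-sem¬ (t `= u) ρ e ¬p k = k λ d → ⊥-elim (¬p (trans (sym (ev-cT ρ e t)) (trans d (ev-cT ρ e u))))
    Δ-sem¬ `⊥ ρ e ¬p r = r
    Δ-sem¬ (φ `∧ ψ) ρ e ¬p (q , r) with sat? φ ρ
    ... | yes p = Δ-sem¬ ψ ρ e (λ s → ¬p (p , s)) r
    ... | no ¬q = Δ-sem¬ φ ρ e ¬q q
    Δ-sem¬ (φ `∨ ψ) ρ e ¬p k = k (Δ-sem¬ φ ρ e (¬p ∘ inj₁)) (Δ-sem¬ ψ ρ e (¬p ∘ inj₂))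
    Δ-sem¬ (φ `⇒ ψ) ρ e ¬p k with sat? φ ρ
    ... | yes p = Δ-sem¬ ψ ρ e (λ q → ¬p λ _ → q) (k (Δ-sem φ ρ e p))
    ... | no ¬q = ⊥-elim (¬p λ p → ⊥-elim (¬q p))
    Δ-sem¬ (`∀ t φ) ρ e ¬p k with decEx≤ (λ x → ¬? (sat? φ (x ∷ ρ))) (evT ρ t)
    ... | yes (x , x≤ , ¬q) = Δ-sem¬ φ (x ∷ ρ) (ext-env e x) ¬q (k x (≤→sem ρ e t x x≤))
    ... | no ¬q = ⊥-elim (¬p λ x x≤ → decidable-stable (sat? φ (x ∷ ρ)) λ ¬r → ¬q (x , x≤ , ¬r))
    Δ-sem¬ (`∃ t φ) ρ e ¬p k = k λ x (b , p) → case x ≤? evT ρ t of λ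
      { (yes x≤) → Δ-sem¬ φ (x ∷ ρ) (ext-env e x) (λ q → ¬p (x , x≤ , q)) p
      ; (no x≰) → sem→≤ ρ e t x x≰ b }

open Codes

-- Polynomial pairing and coding of finite sets

module Definability where
  open import Data.Nat.Divisibility
  open import Data.Nat.Solver using (module +-*-Solver)

  m≤m² : ∀ m → m ≤ m * m
  m≤m² zero = z≤n
  m≤m² m@(suc _) = m≤m*n m m

  opaque
    -- Injective because the value lies between the squares of a + b and of its successor; unlike
    -- `pair` it is a term of arithmetic.
    pp : ℕ → ℕ → ℕ
    pp a b = (a + b) * (a + b) + a

    pp-def : ∀ a b → pp a b ≡ (a + b) * (a + b) + a
    pp-def a b = refl

    pp-≥ˡ : ∀ a b → a ≤ pp a b
    pp-≥ˡ a b = m≤n+m a _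

    pp-≥ʳ : ∀ a b → b ≤ pp a b
    pp-≥ʳ a b = ≤-trans (m≤n+m b a) (≤-trans (m≤m² (a + b)) (m≤m+n _ a))

    pp-lt : ∀ a b a′ b′ → a + b < a′ + b′ → pp a b < pp a′ b′
    pp-lt a b a′ b′ s<s′ = begin-strict
      s * s + a        ≤⟨ +-monoʳ-≤ (s * s) (m≤m+n a b) ⟩
      s * s + s        <⟨ s≤s (≤-reflexive (+-comm (s * s) s)) ⟩
      suc (s + s * s)  ≤⟨ s≤s (+-monoʳ-≤ s (≤-trans (m≤n+m (s * s) s) (≤-reflexive (sym (*-suc s s))))) ⟩
      suc s * suc s    ≤⟨ *-mono-≤ s<s′ s<s′ ⟩
      s′ * s′          ≤⟨ m≤m+n _ a′ ⟩
      s′ * s′ + a′     ∎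
      where
      open ≤-Reasoning
      s s′ : ℕ
      s = a + b
      s′ = a′ + b′

    pp-inj : ∀ {a b a′ b′} → pp a b ≡ pp a′ b′ → a ≡ a′ × b ≡ b′
    pp-inj {a} {b} {a′} {b′} e with <-cmp (a + b) (a′ + b′)
    ... | tri< l _ _ = ⊥-elim (<-irrefl e (pp-lt a b a′ b′ l))
    ... | tri> _ _ g = ⊥-elim (<-irrefl (sym e) (pp-lt a′ b′ a b g))
    ... | tri≈ _ s _ = a≡ , +-cancelˡ-≡ a b b′ (trans s (cong (_+ b′) (sym a≡)))
      where
      a≡ : a ≡ a′
      a≡ = +-cancelˡ-≡ ((a + b) * (a + b)) a a′ (trans e (cong (λ x → x * x + a′) (sym s)))

  -- The moduli of Gödel's β-function. With x in place of its successor the modulus of 0 would be 1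
  -- and divide everything.
  modulus : ℕ → ℕ → ℕ
  modulus x b = suc (suc x * b)

  -- A finite set is coded by a bound m of its members, the product a of their moduli, and the b
  -- used in the moduli. Membership is divisibility of a, with all witnesses bounded by the code.
  Mem : ℕ → ℕ → Set
  Mem x n = ∃ λ m → m ≤ n × ∃ λ a → a ≤ n × ∃ λ b → b ≤ n ×
    n ≡ pp m (pp a b) × x ≤ m × ∃ λ q → q ≤ n × q * modulus x b ≡ a

  Mem-≤ : ∀ {x n} → Mem x n → x ≤ n
  Mem-≤ (m , m≤ , _ , _ , _ , _ , _ , x≤ , _) = ≤-trans x≤ m≤

  private
    ∣fact : ∀ k m → 1 ≤ k → k ≤ m → k ∣ m !
    ∣fact k zero 1≤ k≤ with () ← ≤-trans 1≤ k≤
    ∣fact k (suc m) 1≤ k≤ with m≤n⇒m<n∨m≡n k≤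
    ... | inj₁ (s≤s k<) = ∣n⇒∣m*n (suc m) (∣fact k m 1≤ k<)
    ... | inj₂ refl = m∣m*n (m !)

    -- A common divisor divides (y + 1) times the modulus of x minus (x + 1) times the modulus of y.
    -- This difference is y - x, a divisor of the factorial, so the common divisor divides 1.
    coprime< : ∀ {x y m} → x < y → y ≤ m → Coprime (modulus x (m !)) (modulus y (m !))
    coprime< {x} {y} {m} x<y y≤m {d} (d∣x , d∣y) = ∣1⇒≡1 (∣m+n∣m⇒∣n (≡subst (d ∣_) (+-comm 1 (suc x * b)) d∣x) d∣xb)
      where
      b = m !
      diff : suc y * modulus x b ≡ suc x * modulus y b + (y ∸ x)
      diff = trans (cong (λ z → suc z * modulus x b) (sym (m+[n∸m]≡n (<⇒≤ x<y))))
               (trans (identity x (y ∸ x) b) (cong (λ z → suc x * modulus z b + (y ∸ x)) (m+[n∸m]≡n (<⇒≤ x<y))))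
        where
        open +-*-Solver
        identity : ∀ x e b → suc (x + e) * suc (suc x * b) ≡ suc x * suc (suc (x + e) * b) + e
        identity = solve 3 (λ x e b → (con 1 :+ (x :+ e)) :* (con 1 :+ (con 1 :+ x) :* b)
          := (con 1 :+ x) :* (con 1 :+ (con 1 :+ (x :+ e)) :* b) :+ e) refl
      d∣y-x : d ∣ y ∸ x
      d∣y-x = ∣m+n∣m⇒∣n (≡subst (d ∣_) diff (∣n⇒∣m*n (suc y) d∣x)) (∣n⇒∣m*n (suc x) d∣y)
      d∣xb : d ∣ suc x * b
      d∣xb = ∣n⇒∣m*n (suc x) (∣-trans d∣y-x (∣fact (y ∸ x) m (m<n⇒0<n∸m x<y) (≤-trans (m∸n≤m y x) y≤m)))

    coprime≢ : ∀ {x y m} → x ≢ y → x ≤ m → y ≤ m → Coprime (modulus x (m !)) (modulus y (m !))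
    coprime≢ {x} {y} ne x≤ y≤ with <-cmp x y
    ... | tri< l _ _ = coprime< l y≤
    ... | tri≈ _ e _ = ⊥-elim (ne e)
    ... | tri> _ _ g = Coprimality.sym (coprime< g x≤)

    modProduct : ℕ → List ℕ → ℕ
    modProduct b [] = 1
    modProduct b (x ∷ l) = modulus x b * modProduct b l

    ∈→∣ : ∀ {x b l} → x ∈ l → modulus x b ∣ modProduct b l
    ∈→∣ {l = y ∷ l} (here refl) = m∣m*n (modProduct _ l)
    ∈→∣ {b = b} {y ∷ l} (there p) = ∣n⇒∣m*n (modulus y b) (∈→∣ p)

    ∣→∈ : ∀ {x m} l → x ≤ m → All (_≤ m) l → modulus x (m !) ∣ modProduct (m !) l → x ∈ l
    ∣→∈ {x} {m} [] x≤ [] d with m*n≡0⇒m≡0∨n≡0 (suc x) (suc-injective (∣1⇒≡1 d))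
    ... | inj₂ e = ⊥-elim (<⇒≢ (1≤n! m) (sym e))
      where open import Data.Nat.Properties using (1≤n!)
    ∣→∈ {x} (y ∷ l) x≤ (y≤ ∷ l≤) d with x ≟ y
    ... | yes refl = here refl
    ... | no ne = there (∣→∈ l x≤ l≤ (coprime-divisor (coprime≢ ne x≤ y≤) d))

    all≤sum : ∀ l → All (_≤ sum l) l
    all≤sum [] = []
    all≤sum (x ∷ l) = m≤m+n x _ ∷ All.map (λ p → ≤-trans p (m≤n+m _ x)) (all≤sum l)

  -- With b the factorial of a bound for the members, distinct moduli are coprime; hence the modulus
  -- of x divides the product only if x is one of the members.
  setCode : (l : List ℕ) → ∃ λ n → (∀ x → Mem x n → x ∈ l) × (∀ x → x ∈ l → Mem x n)
  setCode l = n , to , from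
    where
    M = sum l
    b = M !
    a = modProduct b l
    n = pp M (pp a b)
    a≤n : a ≤ n
    a≤n = ≤-trans (pp-≥ˡ a b) (pp-≥ʳ M (pp a b))
    to : ∀ x → Mem x n → x ∈ l
    to x (m , _ , a′ , _ , b′ , _ , e , x≤ , q , _ , eq) with pp-inj {M} {pp a b} {m} e
    ... | refl , e′ with pp-inj {a} {b} {a′} {b′} e′
    ... | refl , refl = ∣→∈ l x≤ (all≤sum l) (divides q (sym eq))
    from : ∀ x → x ∈ l → Mem x n
    from x x∈ with ∈→∣ {x} {b} x∈
    ... | divides q e = M , pp-≥ˡ M _ , a , a≤n , b , ≤-trans (pp-≥ʳ a b) (pp-≥ʳ M (pp a b)) , refl , All.lookup (all≤sum l) x∈ ,
          q , ≤-trans (m≤m*n q (modulus x b)) (≤-trans (≤-reflexive (sym e)) a≤n) , sym e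

  private variable
    k m n : ℕ

  -- Predicates together with the bounded formulas that define them

  record STm (n : ℕ) : Set where
    constructor stm
    field
      tm : Tm n
      fn : Vec ℕ n → ℕ
      ok : ∀ ρ → evT ρ tm ≡ fn ρ
  open STm public

  -- Carrying formula and predicate side by side lets all reasoning about stages use the predicate,
  -- while arithmetic receives the formula.
  record Def (n : ℕ) (P : Vec ℕ n → Set) : Set where
    constructor def
    field
      fm   : Δ n
      to   : ∀ ρ → Sat fm ρ → P ρ
      from : ∀ ρ → P ρ → Sat fm ρ
  open Def public

  y# : Fin n → STm n
  y# i = stm (`v i) (λ ρ → lookup ρ i) (λ _ → refl)

  l# : ℕ → STm n
  l# k = stm (`l k) (λ _ → k) (λ _ → refl)

  s# : STm n → STm n
  s# t = stm (`s (tm t)) (λ ρ → suc (fn t ρ)) (λ ρ → cong suc (ok t ρ))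

  infixl 12 _+#_
  infixl 13 _*#_
  _+#_ _*#_ : STm n → STm n → STm n
  t +# u = stm (tm t `+ tm u) (λ ρ → fn t ρ + fn u ρ) (λ ρ → cong₂ _+_ (ok t ρ) (ok u ρ))
  t *# u = stm (tm t `* tm u) (λ ρ → fn t ρ * fn u ρ) (λ ρ → cong₂ _*_ (ok t ρ) (ok u ρ))

  wk# : STm n → STm (suc n)
  wk# t = stm (wkT (tm t)) (λ ρ → fn t (Vec.tail ρ)) (λ { (x ∷ ρ) → trans (evT-wk x ρ (tm t)) (ok t ρ) })

  pp# : STm n → STm n → STm n
  pp# a b = stm (tm t) (λ ρ → pp (fn a ρ) (fn b ρ)) (λ ρ → trans (ok t ρ) (sym (pp-def (fn a ρ) (fn b ρ))))
    where
    t : STm _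
    t = (a +# b) *# (a +# b) +# a

  private variable
    P Q : Vec ℕ n → Set

  infixr 6 _⇒D_
  infixr 7 _∨D_
  infixr 8 _∧D_
  infix 10 _=D_ _≤D_

  _=D_ : (s t : STm n) → Def n (λ ρ → fn s ρ ≡ fn t ρ)
  s =D t = def (tm s `= tm t) (λ ρ e → trans (sym (ok s ρ)) (trans e (ok t ρ))) (λ ρ e → trans (ok s ρ) (trans e (sym (ok t ρ))))

  ⊥D : Def n (λ _ → ⊥)
  ⊥D = def `⊥ (λ _ ()) (λ _ ())

  _∧D_ : Def n P → Def n Q → Def n (λ ρ → P ρ × Q ρ)
  p ∧D q = def (fm p `∧ fm q) (λ ρ (a , b) → to p ρ a , to q ρ b) (λ ρ (a , b) → from p ρ a , from q ρ b)

  _∨D_ : Def n P → Def n Q → Def n (λ ρ → P ρ ⊎ Q ρ)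
  p ∨D q = def (fm p `∨ fm q) (λ { ρ (inj₁ a) → inj₁ (to p ρ a) ; ρ (inj₂ b) → inj₂ (to q ρ b) })
                              (λ { ρ (inj₁ a) → inj₁ (from p ρ a) ; ρ (inj₂ b) → inj₂ (from q ρ b) })

  _⇒D_ : Def n P → Def n Q → Def n (λ ρ → P ρ → Q ρ)
  p ⇒D q = def (fm p `⇒ fm q) (λ ρ f a → to q ρ (f (from p ρ a))) (λ ρ f a → from q ρ (f (to p ρ a)))

  ∀D : (t : STm n) → Def (suc n) P → Def n (λ ρ → ∀ x → x ≤ fn t ρ → P (x ∷ ρ))
  ∀D t p = def (`∀ (tm t) (fm p))
    (λ ρ f x x≤ → to p (x ∷ ρ) (f x (≤-trans x≤ (≤-reflexive (sym (ok t ρ))))))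
    (λ ρ f x x≤ → from p (x ∷ ρ) (f x (≤-trans x≤ (≤-reflexive (ok t ρ)))))

  ∃D : (t : STm n) → Def (suc n) P → Def n (λ ρ → ∃ λ x → x ≤ fn t ρ × P (x ∷ ρ))
  ∃D t p = def (`∃ (tm t) (fm p))
    (λ ρ (x , x≤ , q) → x , ≤-trans x≤ (≤-reflexive (ok t ρ)) , to p (x ∷ ρ) q)
    (λ ρ (x , x≤ , q) → x , ≤-trans x≤ (≤-reflexive (sym (ok t ρ))) , from p (x ∷ ρ) q)

  convD : (∀ ρ → P ρ → Q ρ) → (∀ ρ → Q ρ → P ρ) → Def n P → Def n Q
  convD f g p = def (fm p) (λ ρ → f ρ ∘ to p ρ) (λ ρ → from p ρ ∘ g ρ)

  decD : Def n P → ∀ ρ → Dec (P ρ)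
  decD p ρ with sat? (fm p) ρ
  ... | yes s = yes (to p ρ s)
  ... | no ¬s = no (¬s ∘ from p ρ)

  _≤D_ : (s t : STm n) → Def n (λ ρ → fn s ρ ≤ fn t ρ)
  s ≤D t = convD (λ ρ (z , _ , e) → ≤-trans (m≤n+m (fn s ρ) z) (≤-reflexive e))
                 (λ ρ s≤t → fn t ρ ∸ fn s ρ , m∸n≤m (fn t ρ) (fn s ρ) , m∸n+n≡m s≤t)
                 (∃D t (y# zero +# wk# s =D wk# t))

  -- Substitutes into a formula built once, so that a named predicate can be used at several places
  -- without being rebuilt or unfolded.
  appD : (p : Def m P) (ts : Vec (STm n) m) → Def n (λ ρ → P (Vec.map (λ t → fn t ρ) ts))
  appD {m} {P = P} p ts = def (sub τ (fm p))
    (λ ρ s → to p _ (≡subst (Sat (fm p)) (e ρ) (sat-sub→ τ (fm p) ρ s)))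
    (λ ρ s → sat-sub← τ (fm p) ρ (≡subst (Sat (fm p)) (sym (e ρ)) (from p _ s)))
    where
    τ : Sub m _
    τ i = tm (lookup ts i)
    e : ∀ ρ → ρ ∘τ τ ≡ Vec.map (λ t → fn t ρ) ts
    e ρ = go ts
      where
      go : ∀ {m} (ts : Vec (STm _) m) → tabulate (λ i → evT ρ (tm (lookup ts i))) ≡ Vec.map (λ t → fn t ρ) ts
      go [] = refl
      go (t ∷ ts) = cong₂ _∷_ (ok t ρ) (go ts)

  anyD : {A : Set} {P : A → Vec ℕ n → Set} → (∀ x → Def n (P x)) → (xs : List A) → Def n (λ ρ → Any (λ x → P x ρ) xs)
  anyD f [] = convD (λ _ ()) (λ _ ()) ⊥D
  anyD f (x ∷ xs) = convD (λ { ρ (inj₁ p) → here p ; ρ (inj₂ p) → there p })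
                          (λ { ρ (here p) → inj₁ p ; ρ (there p) → inj₂ p }) (f x ∨D anyD f xs)

  allD : {A : Set} {P : A → Vec ℕ n → Set} → (∀ x → Def n (P x)) → (xs : List A) → Def n (λ ρ → All (λ x → P x ρ) xs)
  allD f [] = convD (λ _ _ → []) (λ _ _ ()) (⊥D ⇒D ⊥D)
  allD f (x ∷ xs) = convD (λ { ρ (p , q) → p ∷ q }) (λ { ρ (p ∷ q) → p , q }) (f x ∧D allD f xs)

  Bdd : ∀ {k} → ℕ → Vec ℕ k → Set
  Bdd b v = ∀ i → lookup v i ≤ b

  wks : ∀ k → STm n → STm (k + n)
  wks zero t = t
  wks (suc k) t = wk# (wks k t)

  wks-fn : ∀ k (t : STm n) (v : Vec ℕ k) ρ → fn (wks k t) (v Vec.++ ρ) ≡ fn t ρ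
  wks-fn zero t [] ρ = refl
  wks-fn (suc k) t (x ∷ v) ρ = wks-fn k t v ρ

  ∃V : ∀ k (t : STm n) {P : Vec ℕ (k + n) → Set} → Def (k + n) P → Def n (λ ρ → ∃ λ (v : Vec ℕ k) → Bdd (fn t ρ) v × P (v Vec.++ ρ))
  ∃V zero t p = convD (λ ρ q → [] , (λ ()) , q) (λ { ρ ([] , _ , q) → q }) p
  ∃V (suc k) t p = convD
    (λ { ρ (v , b , x , x≤ , q) → x ∷ v , (λ { zero → ≤-trans x≤ (≤-reflexive (wks-fn k t v ρ)) ; (suc i) → b i }) , q })
    (λ { ρ (x ∷ v , b , q) → v , (b ∘ suc) , x , ≤-trans (b zero) (≤-reflexive (sym (wks-fn k t v ρ))) , q })
    (∃V k t (∃D (wks k t) p))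

  ∀V : ∀ k (t : STm n) {P : Vec ℕ (k + n) → Set} → Def (k + n) P → Def n (λ ρ → ∀ (v : Vec ℕ k) → Bdd (fn t ρ) v → P (v Vec.++ ρ))
  ∀V zero t p = convD (λ { ρ q [] _ → q }) (λ ρ f → f [] λ ()) p
  ∀V (suc k) t p = convD
    (λ { ρ f (x ∷ v) b → f v (b ∘ suc) x (≤-trans (b zero) (≤-reflexive (sym (wks-fn k t v ρ)))) })
    (λ { ρ f v b x x≤ → f (x ∷ v) λ { zero → ≤-trans x≤ (≤-reflexive (wks-fn k t v ρ)) ; (suc i) → b i } })
    (∀V k t (∀D (wks k t) p))

  memD : (x w : STm n) → Def n (λ ρ → Mem (fn x ρ) (fn w ρ))
  memD x w = ∃D w (∃D (wk# w) (∃D w₂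
    (w₃ =D pp# m₃ (pp# a₃ b₃) ∧D x₃ ≤D m₃ ∧D ∃D w₃ (y# zero *# s# (s# (wk# x₃) *# wk# b₃) =D wk# a₃))))
    where
    w₂ = wk# (wk# w)
    w₃ = wk# w₂
    x₃ = wk# (wk# (wk# x))
    m₃ = y# (suc (suc zero))
    a₃ = y# (suc zero)
    b₃ = y# zero

open Definability

-- Horn rules over numbers, and databases of derived facts coded by a single number

module HornDatabases where
  data Exp : Set where
    V    : Fin 8 → Exp
    self : Exp
    lit  : ℕ → Exp
    su   : Exp → Exp
    _⸴_  : Exp → Exp → Exp
  infixr 5 _⸴_

  Vals : Set
  Vals = Fin 8 → ℕ

  ev : ℕ → Vals → Exp → ℕ
  ev e η (V i) = η i
  ev e η self = e
  ev e η (lit k) = k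
  ev e η (su x) = suc (ev e η x)
  ev e η (x ⸴ y) = ⟪ ev e η x , ev e η y ⟫

  record Fact : Set where
    constructor fact
    field
      ftag fa fb fc fd : ℕ
  open Fact public

  record Atom : Set where
    constructor atom
    field
      atag : ℕ
      aa ab ac ad : Exp
  open Atom public

  infix 3 _⟸_
  record Rule : Set where
    constructor _⟸_
    field
      concl : Atom
      prems : List Atom
  open Rule public

  evA : ℕ → Vals → Atom → Fact
  evA e η (atom t a b c d) = fact t (ev e η a) (ev e η b) (ev e η c) (ev e η d)

  vals : (a b c d x y z u : ℕ) → Vec ℕ 8
  vals a b c d x y z u = a ∷ b ∷ c ∷ d ∷ x ∷ y ∷ z ∷ u ∷ []

  vals-bdd : ∀ {n a b c d x y z u} → a ≤ n → b ≤ n → c ≤ n → d ≤ n → x ≤ n → y ≤ n → z ≤ n → u ≤ n → Bdd n (vals a b c d x y z u)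
  vals-bdd pa pb pc pd px py pz pu = λ
    { 0F → pa ; 1F → pb ; 2F → pc ; 3F → pd ; 4F → px ; 5F → py ; 6F → pz ; 7F → pu }

  -- A flat expression is evaluated without stored powers of two. All premises in `satRules` and
  -- `negRule` are flat, so there a stored fact counts as a premise whatever else the database
  -- contains.
  flatE : Exp → Bool
  flatE (V _) = true
  flatE self = true
  flatE (lit _) = true
  flatE (su _) = false
  flatE (_ ⸴ _) = false

  flatA : Atom → Bool
  flatA (atom t a b c d) = flatE a ∧ (flatE b ∧ (flatE c ∧ flatE d))

  ArgsLe : ℕ → Fact → Set
  ArgsLe M (fact t a b c d) = a ≤ M × b ≤ M × c ≤ M × d ≤ M

  opaque
    -- Facts get even codes and powers of two (`encP`) odd ones, so that one finite set stores both.
    encF : ℕ → Fact → ℕ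
    encF s (fact t a b c d) = 2 * pp s (pp t (pp a (pp b (pp c d))))

    encF-def : ∀ s t a b c d → encF s (fact t a b c d) ≡ 2 * pp s (pp t (pp a (pp b (pp c d))))
    encF-def s t a b c d = refl

    encP : ℕ → ℕ → ℕ
    encP c p = suc (2 * pp c p)

    encP-def : ∀ c p → encP c p ≡ suc (2 * pp c p)
    encP-def c p = refl

    encF-≥ : ∀ s F → s ≤ encF s F × ftag F ≤ encF s F × ArgsLe (encF s F) F
    encF-≥ s (fact t a b c d) = s≤ (pp-≥ˡ s _) , s≤ t≤ ,
      s≤ a≤ , s≤ b≤ , s≤ (≤-trans (pp-≥ˡ c d) cd≤) , s≤ (≤-trans (pp-≥ʳ c d) cd≤)
      where
      N : ℕ
      N = pp s (pp t (pp a (pp b (pp c d))))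
      s≤ : ∀ {x} → x ≤ N → x ≤ 2 * N
      s≤ p = ≤-trans p (m≤n*m N 2)
      t≤ : t ≤ N
      t≤ = ≤-trans (pp-≥ˡ t (pp a (pp b (pp c d)))) (pp-≥ʳ s _)
      a≤′ : pp a (pp b (pp c d)) ≤ N
      a≤′ = ≤-trans (pp-≥ʳ t (pp a (pp b (pp c d)))) (pp-≥ʳ s _)
      a≤ : a ≤ N
      a≤ = ≤-trans (pp-≥ˡ a (pp b (pp c d))) a≤′
      b≤′ : pp b (pp c d) ≤ N
      b≤′ = ≤-trans (pp-≥ʳ a (pp b (pp c d))) a≤′
      b≤ : b ≤ N
      b≤ = ≤-trans (pp-≥ˡ b (pp c d)) b≤′
      cd≤ : pp c d ≤ N
      cd≤ = ≤-trans (pp-≥ʳ b (pp c d)) b≤′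

    encF-inj : ∀ {s s′ F F′} → encF s F ≡ encF s′ F′ → s ≡ s′ × F ≡ F′
    encF-inj {s} {s′} {fact t a b c d} {fact t′ a′ b′ c′ d′} e
      with pp-inj {s} {pp t (pp a (pp b (pp c d)))} {s′} (*-cancelˡ-≡ _ _ 2 e)
    ... | refl , e₁ with pp-inj {t} {pp a (pp b (pp c d))} {t′} e₁
    ... | refl , e₂ with pp-inj {a} {pp b (pp c d)} {a′} e₂
    ... | refl , e₃ with pp-inj {b} {pp c d} {b′} e₃
    ... | refl , e₄ with pp-inj {c} {d} {c′} {d′} e₄
    ... | refl , refl = refl , refl

    encP-≥ : ∀ c p → c ≤ encP c p × p ≤ encP c p
    encP-≥ c p = ≤-trans (pp-≥ˡ c p) h , ≤-trans (pp-≥ʳ c p) h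
      where
      h : pp c p ≤ suc (2 * pp c p)
      h = m≤n⇒m≤1+n (m≤n*m (pp c p) 2)

    encP-inj : ∀ {c p c′ p′} → encP c p ≡ encP c′ p′ → c ≡ c′ × p ≡ p′
    encP-inj {c} {p} {c′} {p′} e = pp-inj {c} {p} {c′} {p′} (*-cancelˡ-≡ (pp c p) (pp c′ p′) 2 (suc-injective e))

    encF≢encP : ∀ {s F c p} → encF s F ≢ encP c p
    encF≢encP {s} {fact t a b c d} {c′} {p} = even≢odd (pp s (pp t (pp a (pp b (pp c d))))) (pp c′ p)

  StoredAt : ℕ → Fact → ℕ → Set
  StoredAt s F n = Mem (encF s F) n

  Has : ℕ → Fact → Set
  Has n F = ∃ λ s → s ≤ n × StoredAt s F n

  PowIn : ℕ → ℕ → ℕ → Set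
  PowIn c p n = Mem (encP c p) n

  private variable
    m : ℕ

  encF# : (s t a b c d : STm m) → STm m
  encF# s t a b c d = stm (tm u) (λ ρ → encF (fn s ρ) (fact (fn t ρ) (fn a ρ) (fn b ρ) (fn c ρ) (fn d ρ)))
      (λ ρ → trans (ok u ρ) (sym (encF-def _ _ _ _ _ _)))
    where
    u : STm _
    u = l# 2 *# pp# s (pp# t (pp# a (pp# b (pp# c d))))

  encP# : (c p : STm m) → STm m
  encP# c p = stm (tm u) (λ ρ → encP (fn c ρ) (fn p ρ)) (λ ρ → trans (ok u ρ) (sym (encP-def _ _)))
    where
    u : STm _
    u = s# (l# 2 *# pp# c p)

  powInD : (c p n : STm m) → Def m (λ ρ → PowIn (fn c ρ) (fn p ρ) (fn n ρ))
  powInD c p n = memD (encP# c p) n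

  storedD : (s t a b c d n : STm m) →
    Def m (λ ρ → StoredAt (fn s ρ) (fact (fn t ρ) (fn a ρ) (fn b ρ) (fn c ρ) (fn d ρ)) (fn n ρ))
  storedD s t a b c d n = memD (encF# s t a b c d) n

  -- As exponentiation is not a term, the value of a pair is certified by a stored power of two.
  IsE : ℕ → ℕ → Vals → Exp → ℕ → Set
  IsE n e η (V i) z = z ≡ η i
  IsE n e η self z = z ≡ e
  IsE n e η (lit k) z = z ≡ k
  IsE n e η (su x) z = ∃ λ a → a ≤ n × IsE n e η x a × z ≡ suc a
  IsE n e η (x ⸴ y) z = ∃ λ a → a ≤ n × ∃ λ b → b ≤ n × ∃ λ p → p ≤ n ×
    IsE n e η x a × IsE n e η y b × PowIn a p n × z ≡ p * (2 * b + 1)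

  AtStage : ℕ → ℕ → Vals → Atom → ℕ → Set
  AtStage n e η (atom t xa xb xc xd) s = ∃ λ a → a ≤ n × ∃ λ b → b ≤ n × ∃ λ c → c ≤ n × ∃ λ d → d ≤ n ×
    IsE n e η xa a × IsE n e η xb b × IsE n e η xc c × IsE n e η xd d × StoredAt s (fact t a b c d) n

  HasA : ℕ → ℕ → Vals → Atom → Set
  HasA n e η A = ∃ λ s → s ≤ n × AtStage n e η A s

  -- Every premise must be stored at a strictly smaller stage than the conclusion; this excludes
  -- circular justifications.
  Inst : ℕ → ℕ → ℕ → Fact → Rule → Set
  Inst n e s (fact t a b c d) (atom t′ xa xb xc xd ⟸ ps) = ∃ λ (v : Vec ℕ 8) → Bdd n v ×
    (t ≡ t′ × IsE n e (lookup v) xa a × IsE n e (lookup v) xb b × IsE n e (lookup v) xc c × IsE n e (lookup v) xd d) ×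
    All (λ A → ∃ λ s′ → s′ ≤ s × (s′ ≡ s → ⊥) × AtStage n e (lookup v) A s′) ps

  PowOK : ℕ → Set
  PowOK n = ∀ c → c ≤ n → ∀ p → p ≤ n → PowIn c p n →
    (c ≡ 0 × p ≡ 1) ⊎ ∃ λ c′ → c′ ≤ n × ∃ λ p′ → p′ ≤ n × c ≡ suc c′ × p ≡ p′ + p′ × PowIn c′ p′ n

  IsE-ext : ∀ {n e η η′} → (∀ i → η i ≡ η′ i) → ∀ x {z} → IsE n e η x z → IsE n e η′ x z
  IsE-ext h (V i) p = trans p (h i)
  IsE-ext h self p = p
  IsE-ext h (lit k) p = p
  IsE-ext h (su x) (a , a≤ , p , q) = a , a≤ , IsE-ext h x p , q
  IsE-ext h (x ⸴ y) (a , a≤ , b , b≤ , p , p≤ , i , j , r) = a , a≤ , b , b≤ , p , p≤ , IsE-ext h x i , IsE-ext h y j , r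

  AtStage-ext : ∀ {n e η η′} → (∀ i → η i ≡ η′ i) → ∀ A {s} → AtStage n e η A s → AtStage n e η′ A s
  AtStage-ext h (atom t xa xb xc xd) (a , a≤ , b , b≤ , c , c≤ , d , d≤ , p , q , r , s , st) =
    a , a≤ , b , b≤ , c , c≤ , d , d≤ , IsE-ext h xa p , IsE-ext h xb q , IsE-ext h xc r , IsE-ext h xd s , st

  hasD : (t a b c d n : STm m) → Def m (λ ρ → Has (fn n ρ) (fact (fn t ρ) (fn a ρ) (fn b ρ) (fn c ρ) (fn d ρ)))
  hasD t a b c d n = ∃D n (storedD (y# zero) (wk# t) (wk# a) (wk# b) (wk# c) (wk# d) (wk# n))

  isED : (x : Exp) (τ : Fin 8 → STm m) (e n z : STm m) →
    Def m (λ ρ → IsE (fn n ρ) (fn e ρ) (λ i → fn (τ i) ρ) x (fn z ρ))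
  isED (V i) τ e n z = z =D τ i
  isED self τ e n z = z =D e
  isED (lit k) τ e n z = z =D l# k
  isED (su x) τ e n z = ∃D n (isED x (wk# ∘ τ) (wk# e) (wk# n) (y# zero) ∧D wk# z =D s# (y# zero))
  isED (x ⸴ y) τ e n z = ∃D n (∃D (wk# n) (∃D (wk# (wk# n))
    (isED x (w³ ∘ τ) (w³ e) (w³ n) (y# (suc (suc zero))) ∧D
     isED y (w³ ∘ τ) (w³ e) (w³ n) (y# (suc zero)) ∧D
     powInD (y# (suc (suc zero))) (y# zero) (w³ n) ∧D
     w³ z =D y# zero *# (l# 2 *# y# (suc zero) +# l# 1))))
    where
    w³ : STm _ → STm _
    w³ t = wk# (wk# (wk# t))

  atStageD : (A : Atom) (τ : Fin 8 → STm m) (e n s : STm m) →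
    Def m (λ ρ → AtStage (fn n ρ) (fn e ρ) (λ i → fn (τ i) ρ) A (fn s ρ))
  atStageD (atom t xa xb xc xd) τ e n s = ∃D n (∃D (wk# n) (∃D (wk# (wk# n)) (∃D (wk# (wk# (wk# n)))
    (isED xa (w⁴ ∘ τ) (w⁴ e) (w⁴ n) a ∧D isED xb (w⁴ ∘ τ) (w⁴ e) (w⁴ n) b ∧D
     isED xc (w⁴ ∘ τ) (w⁴ e) (w⁴ n) c ∧D isED xd (w⁴ ∘ τ) (w⁴ e) (w⁴ n) d ∧D
     storedD (w⁴ s) (l# t) a b c d (w⁴ n)))))
    where
    w⁴ : STm _ → STm _
    w⁴ t = wk# (wk# (wk# (wk# t)))
    a b c d : STm (4 + _)
    a = y# (suc (suc (suc zero)))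
    b = y# (suc (suc zero))
    c = y# (suc zero)
    d = y# zero

  hasAD : (A : Atom) (τ : Fin 8 → STm m) (e n : STm m) → Def m (λ ρ → HasA (fn n ρ) (fn e ρ) (λ i → fn (τ i) ρ) A)
  hasAD A τ e n = ∃D n (atStageD A (wk# ∘ τ) (wk# e) (wk# n) (y# zero))

  vars# : Fin 8 → STm (8 + m)
  vars# i = y# (i ↑ˡ _)

  private
    vars≡ : (v : Vec ℕ 8) (ρ : Vec ℕ m) → ∀ i → lookup (v Vec.++ ρ) (i ↑ˡ m) ≡ lookup v i
    vars≡ v ρ i = lookup-++ˡ v ρ i

  instD : (r : Rule) (s t a b c d e n : STm m) →
    Def m (λ ρ → Inst (fn n ρ) (fn e ρ) (fn s ρ) (fact (fn t ρ) (fn a ρ) (fn b ρ) (fn c ρ) (fn d ρ)) r)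
  instD {m} (atom t′ xa xb xc xd ⟸ ps) s t a b c d e n = convD
    (λ { ρ (v@(_ ∷ _ ∷ _ ∷ _ ∷ _ ∷ _ ∷ _ ∷ _ ∷ []) , bd , (q , ia , ib , ic , id′) , al) → v , bd ,
         (q , IsE-ext (vars≡ v ρ) xa ia , IsE-ext (vars≡ v ρ) xb ib , IsE-ext (vars≡ v ρ) xc ic , IsE-ext (vars≡ v ρ) xd id′) ,
         All.map (λ { {A} (s′ , s≤ , ne , st) → s′ , s≤ , ne , AtStage-ext (vars≡ v ρ) A st }) al })
    (λ { ρ (v@(_ ∷ _ ∷ _ ∷ _ ∷ _ ∷ _ ∷ _ ∷ _ ∷ []) , bd , (q , ia , ib , ic , id′) , al) → v , bd ,
         (q , IsE-ext (sym ∘ vars≡ v ρ) xa ia , IsE-ext (sym ∘ vars≡ v ρ) xb ib , IsE-ext (sym ∘ vars≡ v ρ) xc ic , IsE-ext (sym ∘ vars≡ v ρ) xd id′) ,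
         All.map (λ { {A} (s′ , s≤ , ne , st) → s′ , s≤ , ne , AtStage-ext (sym ∘ vars≡ v ρ) A st }) al })
    (∃V 8 n ((w t =D l# t′ ∧D isED xa vars# (w e) (w n) (w a) ∧D isED xb vars# (w e) (w n) (w b) ∧D
              isED xc vars# (w e) (w n) (w c) ∧D isED xd vars# (w e) (w n) (w d)) ∧D
             allD (λ A → ∃D (w s) ((y# zero =D wk# (w s) ⇒D ⊥D) ∧D
               atStageD A (wk# ∘ vars#) (wk# (w e)) (wk# (w n)) (y# zero))) ps))
    where
    w : STm m → STm (8 + m)
    w = wks 8

  powOKD : (n : STm m) → Def m (λ ρ → PowOK (fn n ρ))
  powOKD n = ∀D n (∀D (wk# n) (powInD (y# (suc zero)) (y# zero) (w² n) ⇒D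
    ((y# (suc zero) =D l# 0 ∧D y# zero =D l# 1) ∨D
     ∃D (w² n) (∃D (wk# (w² n)) (y# (suc (suc (suc zero))) =D s# (y# (suc zero)) ∧D
       y# (suc (suc zero)) =D y# zero +# y# zero ∧D powInD (y# (suc zero)) (y# zero) (w² (w² n)))))))
    where
    w² : ∀ {m} → STm m → STm (2 + m)
    w² t = wk# (wk# t)

  pow-sound : ∀ {n} → PowOK n → ∀ c p → PowIn c p n → p ≡ 2 ^ c
  pow-sound {n} ok c p i = go c p i
    where
    c≤ : ∀ {c p} → PowIn c p n → c ≤ n
    c≤ {c} {p} i = ≤-trans (proj₁ (encP-≥ c p)) (Mem-≤ i)
    p≤ : ∀ {c p} → PowIn c p n → p ≤ n
    p≤ {c} {p} i = ≤-trans (proj₂ (encP-≥ c p)) (Mem-≤ i)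
    go : ∀ c p → PowIn c p n → p ≡ 2 ^ c
    go c p i with ok c (c≤ i) p (p≤ i) i
    go .0 p i | inj₁ (refl , q) = q
    go .(suc c′) p i | inj₂ (c′ , _ , p′ , _ , refl , q , i′) with go c′ p′ i′
    ... | refl = trans q (cong (p′ +_) (sym (+-identityʳ p′)))

  IsE-sound : ∀ {n e η} → PowOK n → ∀ x {z} → IsE n e η x z → z ≡ ev e η x
  IsE-sound ok (V i) p = p
  IsE-sound ok self p = p
  IsE-sound ok (lit k) p = p
  IsE-sound ok (su x) (a , _ , i , q) = trans q (cong suc (IsE-sound ok x i))
  IsE-sound {e = e} {η} ok (x ⸴ y) (a , _ , b , _ , p , _ , i , j , w , q) =
    trans q (trans (cong₂ (λ p b → p * (2 * b + 1)) (pow-sound ok a p w) (IsE-sound ok y j))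
      (trans (cong (λ a → pair a (ev e η y)) (IsE-sound ok x i)) (sym (⟪⟫≡pair (ev e η x) (ev e η y)))))

  ArgsLe-mono : ∀ {M N} F → M ≤ N → ArgsLe M F → ArgsLe N F
  ArgsLe-mono (fact t a b c d) h (p , q , r , s) = ≤-trans p h , ≤-trans q h , ≤-trans r h , ≤-trans s h

  Stored-≤ : ∀ {s n} F → StoredAt s F n → s ≤ n × ftag F ≤ n × ArgsLe n F
  Stored-≤ {s} F i with encF-≥ s F
  ... | p , q , r = ≤-trans p (Mem-≤ i) , ≤-trans q (Mem-≤ i) , ArgsLe-mono F (Mem-≤ i) r

  Has-≤ : ∀ {n} F → Has n F → ArgsLe n F
  Has-≤ F (s , _ , st) = proj₂ (proj₂ (Stored-≤ F st))

  hasA-flat : ∀ {n e η} A → flatA A ≡ true → Has n (evA e η A) → HasA n e η A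
  hasA-flat {n} {e} {η} A@(atom t xa xb xc xd) f h@(s , s≤ , st) with Has-≤ (evA e η A) h
  ... | pa , pb , pc , pd = s , s≤ , _ , pa , _ , pb , _ , pc , _ , pd ,
      isE xa (∧-fst f) , isE xb (∧-fst (∧-snd {flatE xa} f)) , isE xc (∧-fst (∧-snd {flatE xb} (∧-snd {flatE xa} f))) ,
      isE xd (∧-snd {flatE xc} (∧-snd {flatE xb} (∧-snd {flatE xa} f))) , st
    where
    ∧-fst : ∀ {a b} → a ∧ b ≡ true → a ≡ true
    ∧-fst {true} _ = refl
    ∧-snd : ∀ {a b} → a ∧ b ≡ true → b ≡ true
    ∧-snd {true} q = q
    isE : ∀ x → flatE x ≡ true → IsE n e η x (ev e η x)
    isE (V i) _ = refl
    isE self _ = refl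
    isE (lit k) _ = refl

  module Horn (Rules : List Rule) (baseTags : List ℕ) where

    Justified : ℕ → ℕ → ℕ → Fact → Set
    Justified n e s F = Any (ftag F ≡_) baseTags ⊎ Any (Inst n e s F) Rules

    DB : ℕ → ℕ → Set
    DB n e = PowOK n × (∀ s → s ≤ n → ∀ t → t ≤ n → ∀ a → a ≤ n → ∀ b → b ≤ n → ∀ c → c ≤ n → ∀ d → d ≤ n →
      StoredAt s (fact t a b c d) n → Justified n e s (fact t a b c d))

    dbD : (n e : STm m) → Def m (λ ρ → DB (fn n ρ) (fn e ρ))
    dbD n e = powOKD n ∧D ∀D n (∀D (w 1 n) (∀D (w 2 n) (∀D (w 3 n) (∀D (w 4 n) (∀D (w 5 n)
        (storedD s t a b c d (w 6 n) ⇒D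
          (anyD (λ k → t =D l# k) baseTags ∨D anyD (λ r → instD r s t a b c d (w 6 e) (w 6 n)) Rules)))))))
      where
      w = wks
      d = y# zero
      c = y# (suc zero)
      b = y# (suc (suc zero))
      a = y# (suc (suc (suc zero)))
      t = y# (suc (suc (suc (suc zero))))
      s = y# (suc (suc (suc (suc (suc zero)))))

    data Der (e : ℕ) (B : Fact → Set) : Fact → Set where
      base : ∀ {F} → B F → Der e B F
      rule : ∀ {r} → r ∈ Rules → (v : Vec ℕ 8) → All (λ A → Der e B (evA e (lookup v) A)) (prems r) →
             Der e B (evA e (lookup v) (concl r))

    BaseOf : ℕ → Fact → Set
    BaseOf n F = Any (ftag F ≡_) baseTags × Has n F

    opaque
      -- Well-founded induction on the stage of storage. Facts with a base tag are taken as given,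
      -- so derivability is relative to the base facts found in n.
      db-sound : ∀ {n e} → DB n e → ∀ {F} → Has n F → Der e (BaseOf n) F
      db-sound {n} {e} (pok , jok) {F} (s , _ , st) = <-rec (λ s → ∀ F → StoredAt s F n → Der e (BaseOf n) F) step s F st
        where
        step : ∀ s → (∀ {s′} → s′ < s → ∀ F → StoredAt s′ F n → Der e (BaseOf n) F) → ∀ F → StoredAt s F n → Der e (BaseOf n) F
        step s ih F st with Stored-≤ F st
        ... | s≤ , t≤ , a≤ , b≤ , c≤ , d≤ with jok s s≤ _ t≤ _ a≤ _ b≤ _ c≤ _ d≤ st
        ... | inj₁ bt = base (bt , s , s≤ , st)
        ... | inj₂ an = go an
          where
          prem : ∀ {v} (A : Atom) → (∃ λ s′ → s′ ≤ s × (s′ ≡ s → ⊥) × AtStage n e (lookup v) A s′) → Der e (BaseOf n) (evA e (lookup v) A)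
          prem (atom t xa xb xc xd) (s′ , s′≤ , ne , a , _ , b , _ , c , _ , d , _ , ia , ib , ic , id′ , st′)
            with IsE-sound pok xa ia | IsE-sound pok xb ib | IsE-sound pok xc ic | IsE-sound pok xd id′
          ... | refl | refl | refl | refl = ih (≤∧≢⇒< s′≤ ne) _ st′
          fire : ∀ r → r ∈ Rules → Inst n e s F r → Der e (BaseOf n) F
          fire (atom t′ xa xb xc xd ⟸ ps) r∈ (v , _ , (refl , ia , ib , ic , id′) , al)
            with IsE-sound pok xa ia | IsE-sound pok xb ib | IsE-sound pok xc ic | IsE-sound pok xd id′
          ... | refl | refl | refl | refl = rule r∈ v (All.map (λ {A} → prem {v} A) al)
          go : Any (Inst n e s F) Rules → Der e (BaseOf n) F
          go an with find an
          ... | r , r∈ , ins = fire r r∈ ins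

    module _ {e : ℕ} {B : Fact → Set} (B-tag : ∀ {F} → B F → Any (ftag F ≡_) baseTags) where

      private
        Node : Set
        Node = ℕ × Fact

        Why : List Node → ℕ → ℕ → Fact → Set
        Why l M s F = B F ⊎ ∃ λ r → r ∈ Rules × ∃ λ v → Bdd M v × F ≡ evA e (lookup v) (concl r) ×
          All (λ A → ∃ λ s′ → s′ < s × ArgsLe M (evA e (lookup v) A) × (s′ , evA e (lookup v) A) ∈ l) (prems r)

        OK : List Node → ℕ → Node → Set
        OK l M (s , F) = ArgsLe M F × Der e B F × Why l M s F

        OK-mono : ∀ {l l′ M M′} → (∀ {x} → x ∈ l → x ∈ l′) → M ≤ M′ → ∀ {x} → OK l M x → OK l′ M′ x
        OK-mono h M≤ {s , F} (al , d , inj₁ b) = ArgsLe-mono F M≤ al , d , inj₁ b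
        OK-mono h M≤ {s , F} (al , d , inj₂ (r , r∈ , v , bd , eq , ps)) = ArgsLe-mono F M≤ al , d ,
          inj₂ (r , r∈ , v , (λ i → ≤-trans (bd i) M≤) , eq ,
            All.map (λ { {A} (s′ , s< , al′ , m) → s′ , s< , ArgsLe-mono (evA e (lookup v) A) M≤ al′ , h m }) ps)

        sumF : Fact → ℕ
        sumF (fact t a b c d) = a + (b + (c + d))

        sumF-≥ : ∀ F → ArgsLe (sumF F) F
        sumF-≥ (fact t a b c d) = m≤m+n a _ , ≤-trans (m≤m+n b _) (m≤n+m _ a) ,
          ≤-trans (≤-trans (m≤m+n c d) (m≤n+m _ b)) (m≤n+m _ a) , ≤-trans (≤-trans (m≤n+m d c) (m≤n+m _ b)) (m≤n+m _ a)

        Bdd-sum : ∀ {k} (v : Vec ℕ k) → Bdd (Vec.sum v) v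
        Bdd-sum (x ∷ v) zero = m≤m+n x _
        Bdd-sum (x ∷ v) (suc i) = ≤-trans (Bdd-sum v i) (m≤n+m _ x)

        mutual
          -- The stage of a node exceeds those of its premises. M dominates the arguments and the
          -- rule variables that occur, and so tells which powers of two must be stored.
          build : ∀ {F} → Der e B F → ∃ λ l → ∃ λ M → ∃ λ s → (s , F) ∈ l × (∀ {x} → x ∈ l → OK l M x)
          build {F} d@(base b) = (0 , F) ∷ [] , sumF F , 0 , here refl , λ { (here refl) → sumF-≥ F , d , inj₁ b }
          build d@(rule {r} r∈ v ps) with buildAll {r} v ps
          ... | l , M , H , als , ok = (suc H , F) ∷ l , M′ , suc H , here refl ,
              λ { (here refl) → ArgsLe-mono F (m≤n+m _ (M + Vec.sum v)) (sumF-≥ F) , d ,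
                    inj₂ (r , r∈ , v , (λ i → ≤-trans (Bdd-sum v i) (≤-trans (m≤n+m _ M) (m≤m+n _ (sumF F)))) , refl ,
                      All.map (λ { {A} (s′ , s′≤ , al , mem) → s′ , s≤s s′≤ , ArgsLe-mono (evA e (lookup v) A) M≤ al , there mem }) als)
                ; (there mem) → OK-mono there M≤ (ok mem) }
            where
            F = evA e (lookup v) (concl r)
            M′ = M + Vec.sum v + sumF F
            M≤ : M ≤ M′
            M≤ = ≤-trans (m≤m+n M _) (m≤m+n _ (sumF F))

          buildAll : ∀ {r : Rule} {ps} (v : Vec ℕ 8) → All (λ A → Der e B (evA e (lookup v) A)) ps → ∃ λ l → ∃ λ M → ∃ λ H →
            All (λ A → ∃ λ s → s ≤ H × ArgsLe M (evA e (lookup v) A) × (s , evA e (lookup v) A) ∈ l) ps × (∀ {x} → x ∈ l → OK l M x)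
          buildAll v [] = [] , 0 , 0 , [] , λ ()
          buildAll {r} v (_∷_ {A} d ds) with build d | buildAll {r} v ds
          ... | l , M , s , mem , ok | l′ , M′ , H , als , ok′ = l ++ l′ , M + M′ , s + H ,
            (s , m≤m+n s H , ArgsLe-mono (evA e (lookup v) A) (m≤m+n M M′) (proj₁ (ok mem)) , ∈-++⁺ˡ mem) ∷
            All.map (λ { {A} (s′ , s′≤ , al , mem) → s′ , ≤-trans s′≤ (m≤n+m H s) , ArgsLe-mono (evA e (lookup v) A) (m≤n+m M′ M) al , ∈-++⁺ʳ l mem }) als ,
            λ mem → case ∈-++⁻ l mem of λ
              { (inj₁ p) → OK-mono ∈-++⁺ˡ (m≤m+n M M′) (ok p)
              ; (inj₂ p) → OK-mono (∈-++⁺ʳ l) (m≤n+m M′ M) (ok′ p) }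

        buildList : ∀ {Fs} → All (Der e B) Fs → ∃ λ l → ∃ λ M → All (λ F → ∃ λ s → (s , F) ∈ l) Fs × (∀ {x} → x ∈ l → OK l M x)
        buildList [] = [] , 0 , [] , λ ()
        buildList (d ∷ ds) with build d | buildList ds
        ... | l , M , s , mem , ok | l′ , M′ , als , ok′ = l ++ l′ , M + M′ ,
          (s , ∈-++⁺ˡ mem) ∷ All.map (λ (s′ , mem) → s′ , ∈-++⁺ʳ l mem) als ,
          λ mem → case ∈-++⁻ l mem of λ
            { (inj₁ p) → OK-mono ∈-++⁺ˡ (m≤m+n M M′) (ok p)
            ; (inj₂ p) → OK-mono (∈-++⁺ʳ l) (m≤n+m M′ M) (ok′ p) }

        module Code (l : List Node) (M : ℕ) (ok : ∀ {x} → x ∈ l → OK l M x) where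
          facts pows items : List ℕ
          facts = map (λ (s , F) → encF s F) l
          -- Exponents up to M suffice, since the components of a pair are smaller than the pair and
          -- all pairs that occur are at most M.
          pows = map (λ c → encP c (2 ^ c)) (upTo (suc M))
          items = facts ++ pows

          n : ℕ
          n = proj₁ (setCode items)
          mem→ : ∀ x → Mem x n → x ∈ items
          mem→ = proj₁ (proj₂ (setCode items))
          mem← : ∀ x → x ∈ items → Mem x n
          mem← = proj₂ (proj₂ (setCode items))

          pow← : ∀ {c} → c ≤ M → PowIn c (2 ^ c) n
          pow← c≤ = mem← _ (∈-++⁺ʳ facts (∈-map⁺ (λ c → encP c (2 ^ c)) (∈-upTo⁺ (s≤s c≤))))

          pow≤ : ∀ {c p} → PowIn c p n → c ≤ n × p ≤ n
          pow≤ {c} {p} i = ≤-trans (proj₁ (encP-≥ c p)) (Mem-≤ i) , ≤-trans (proj₂ (encP-≥ c p)) (Mem-≤ i)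

          M≤n : M ≤ n
          M≤n = proj₁ (pow≤ {M} {2 ^ M} (pow← ≤-refl))

          pow→ : ∀ {c p} → PowIn c p n → c ≤ M × p ≡ 2 ^ c
          pow→ {c} {p} i with ∈-++⁻ facts (mem→ _ i)
          ... | inj₁ q with ∈-map⁻ (λ (s , F) → encF s F) q
          ... | (s , F) , _ , e = ⊥-elim (encF≢encP (sym e))
          pow→ {c} {p} i | inj₂ q with ∈-map⁻ (λ c → encP c (2 ^ c)) q
          ... | c′ , c′∈ , e with encP-inj e
          ... | refl , refl = ≤-pred (∈-upTo⁻ c′∈) , refl

          stored← : ∀ {s F} → (s , F) ∈ l → StoredAt s F n
          stored← q = mem← _ (∈-++⁺ˡ (∈-map⁺ (λ (s , F) → encF s F) q))

          stored→ : ∀ {s F} → StoredAt s F n → (s , F) ∈ l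
          stored→ {s} {F} i with ∈-++⁻ facts (mem→ _ i)
          ... | inj₁ q with ∈-map⁻ (λ (s , F) → encF s F) q
          ... | (s′ , F′) , mem , e with encF-inj {s} {s′} {F} {F′} e
          ... | refl , refl = mem
          stored→ {s} {F} i | inj₂ q with ∈-map⁻ (λ c → encP c (2 ^ c)) q
          ... | c , _ , e = ⊥-elim (encF≢encP e)

          isE : ∀ {η} x → ev e η x ≤ M → IsE n e η x (ev e η x)
          isE (V i) le = refl
          isE self le = refl
          isE (lit k) le = refl
          isE {η} (su x) le = ev e η x , ≤-trans le′ M≤n , isE x le′ , refl
            where le′ = ≤-trans (n≤1+n _) le
          isE {η} (x ⸴ y) le = a , ≤-trans a≤ M≤n , b , ≤-trans b≤ M≤n , 2 ^ a , proj₂ (pow≤ {a} (pow← a≤)) ,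
              isE x a≤ , isE y b≤ , pow← a≤ , ⟪⟫≡pair a b
            where
            a = ev e η x
            b = ev e η y
            a≤ = ≤-trans (<⇒≤ (proj₁ (⟪⟫-> a b))) le
            b≤ = ≤-trans (<⇒≤ (proj₂ (⟪⟫-> a b))) le

          atStage : ∀ {s η} A → ArgsLe M (evA e η A) → StoredAt s (evA e η A) n → AtStage n e η A s
          atStage (atom t xa xb xc xd) (p , q , r , u) st = _ , ≤-trans p M≤n , _ , ≤-trans q M≤n , _ , ≤-trans r M≤n , _ , ≤-trans u M≤n ,
            isE xa p , isE xb q , isE xc r , isE xd u , st

          powOK : PowOK n
          powOK zero c≤ p p≤ i = inj₁ (refl , proj₂ (pow→ {0} {p} i))
          powOK (suc c) c≤ p p≤ i with pow→ {suc c} {p} i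
          ... | c≤M , e = inj₂ (c , ≤-trans (n≤1+n c) c≤ , 2 ^ c , proj₂ (pow≤ {c} (pow← c≤′)) , refl ,
                  trans e (cong (2 ^ c +_) (+-identityʳ (2 ^ c))) , pow← c≤′)
            where c≤′ = ≤-trans (n≤1+n c) c≤M

          just : ∀ {s F} → OK l M (s , F) → Justified n e s F
          just (_ , _ , inj₁ b) = inj₁ (B-tag b)
          just {s} (al , _ , inj₂ (r@(atom t xa xb xc xd ⟸ ps) , r∈ , v , bd , refl , als)) = inj₂ (Any.map (λ { refl → i₀ }) r∈)
            where
            i₀ : Inst n e s (evA e (lookup v) (concl r)) r
            i₀ = v , (λ i → ≤-trans (bd i) M≤n) ,
              (refl , isE xa (proj₁ al) , isE xb (proj₁ (proj₂ al)) , isE xc (proj₁ (proj₂ (proj₂ al))) , isE xd (proj₂ (proj₂ (proj₂ al)))) ,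
              All.map (λ { {A} (s′ , s< , al′ , mem) → s′ , <⇒≤ s< , <⇒≢ s< , atStage A al′ (stored← mem) }) als

          db : DB n e
          db = powOK , λ s _ t _ a _ b _ c _ d _ st → just (ok (stored→ {s} {fact t a b c d} st))

          hasA : ∀ {F} η A → evA e η A ≡ F → Has n F → HasA n e η A
          hasA η A refl (s , s≤ , st) = s , s≤ , atStage A (proj₁ (ok (stored→ {s} {evA e η A} st))) st

      -- The last component allows a fact to be recognised through any expression denoting it.
      opaque
        db-exists : ∀ Fs → All (Der e B) Fs → ∃ λ n → DB n e × All (Has n) Fs × (∀ {F} → Has n F → Der e B F) ×
          (∀ {F} η A → evA e η A ≡ F → Has n F → HasA n e η A)
        db-exists Fs ds with buildList ds
        ... | l , M , als , ok = n , db , All.map (λ { {F} (s , mem) → s , proj₁ (Stored-≤ F (stored← mem)) , stored← mem }) als ,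
            (λ { {F} (s , _ , st) → proj₁ (proj₂ (ok (stored→ {s} {F} st))) }) , hasA
          where open Code l M ok

    opaque
      HasA-sound : ∀ {n e η} A → PowOK n → HasA n e η A → Has n (evA e η A)
      HasA-sound (atom t xa xb xc xd) pok (s , s≤ , a , _ , b , _ , c , _ , d , _ , ia , ib , ic , id′ , st)
        with IsE-sound pok xa ia | IsE-sound pok xb ib | IsE-sound pok xc ic | IsE-sound pok xd id′
      ... | refl | refl | refl | refl = s , s≤ , st

open HornDatabases

-- Horn rules for syntax, for provability in T and L, and for interpretations

module RuleSystem where
  data Op : Set where
    ∧ₒ ∨ₒ ⇒ₒ : Op

  opTag : Op → ℕ
  opTag ∧ₒ = 3
  opTag ∨ₒ = 4
  opTag ⇒ₒ = 5

  opB : Op → Bool → Bool → Bool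
  opB ∧ₒ a b = a ∧ b
  opB ∨ₒ a b = a ∨ b
  opB ⇒ₒ a b = not a ∨ b

  b2n : Bool → ℕ
  b2n false = 0
  b2n true = 1

  -- The substitutions occurring in the quantifier and equality axioms, closed under passing below a
  -- binder.
  data SubCode : Set where
    shˢ  : SubCode
    insˢ : Term → SubCode
    lftˢ : SubCode → SubCode

  encS : SubCode → ℕ
  encS shˢ = ⟪ 0 , 0 ⟫
  encS (insˢ t) = ⟪ 1 , kT t ⟫
  encS (lftˢ s) = ⟪ 2 , encS s ⟫

  ⟦_⟧ˢ : SubCode → Subst
  ⟦ shˢ ⟧ˢ k = var (suc k)
  ⟦ insˢ t ⟧ˢ zero = t
  ⟦ insˢ t ⟧ˢ (suc k) = var k
  ⟦ lftˢ s ⟧ˢ = lift ⟦ s ⟧ˢ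

  encV : ∀ {n} → Vec ℕ n → ℕ
  encV [] = 0
  encV (x ∷ xs) = ⟪ x , encV xs ⟫

  mutual
    encPR : ∀ {n} → PR n → ℕ
    encPR pr-zero = ⟪ 0 , 0 ⟫
    encPR pr-succ = ⟪ 1 , 0 ⟫
    encPR (pr-proj i) = ⟪ 2 , toℕ i ⟫
    encPR (pr-comp f gs) = ⟪ 3 , ⟪ encPR f , encPRs gs ⟫ ⟫
    encPR (pr-rec g h) = ⟪ 4 , ⟪ encPR g , encPR h ⟫ ⟫

    encPRs : ∀ {m n} → Vec (PR n) m → ℕ
    encPRs [] = 0
    encPRs (g ∷ gs) = ⟪ encPR g , encPRs gs ⟫

  private
    O a b c d x y z u : Exp
    O = lit 0
    a = V 0F
    b = V 1F
    c = V 2F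
    d = V 3F
    x = V 4F
    y = V 5F
    z = V 6F
    u = V 7F

    varE : Exp → Exp
    varE k = lit 0 ⸴ k
    sE negE allE exE : Exp → Exp
    sE t = lit 2 ⸴ t
    negE t = lit 2 ⸴ t
    allE t = lit 6 ⸴ t
    exE t = lit 7 ⸴ t
    addE mulE eqE andE impE iffE : Exp → Exp → Exp
    addE s t = lit 3 ⸴ s ⸴ t
    mulE s t = lit 4 ⸴ s ⸴ t
    eqE s t = lit 0 ⸴ s ⸴ t
    andE s t = lit 3 ⸴ s ⸴ t
    impE s t = lit 5 ⸴ s ⸴ t
    iffE s t = andE (impE s t) (impE t s)
    binE boxE : Exp → Exp → Exp → Exp
    binE o s t = o ⸴ s ⸴ t
    -- cb, ci, ne are the codes of the numerals of the flag, of the argument and of the matrix.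
    boxE cb ci ne = exE (exE (exE (exE (andE (eqE ci (varE (lit 2))) (andE (eqE ne (varE (lit 1))) (andE (eqE cb (varE O)) self))))))
    zE n0 n1 botE falsE sh : Exp
    zE = lit 1 ⸴ lit 0
    n0 = zE
    n1 = sE zE
    botE = lit 1 ⸴ lit 0
    falsE = eqE zE (sE zE)
    sh = lit 0 ⸴ lit 0
    ins lft : Exp → Exp
    ins t = lit 1 ⸴ t
    lft e = lit 2 ⸴ e

  -- Facts: Tm t is a term; G b x is a formula (b = 0) or the interpretation of a modal formula (b = 1); Num n t is a numeral;
  -- Va, ST, SF are substitution into a variable, a term, a formula; Val b γ x v says that x has truth value v under the
  -- literals in γ; TT is a truth table; Thm b x is provability in T (b = 0) or of the preimage of x in L (b = 1); Ev and Evs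
  -- evaluate primitive recursive functions; F s x is the interpretation of a modal formula of rank at most s; Ref x says that
  -- the literals of the database imply x in T. R, Lit and Ch are not derived: R is an equivalence between formulas, Lit b i v
  -- the literal giving the value v to BoxF b i, and Ch s x says that x is reached from ⊤ by s edges.
  Tm' : Exp → Atom
  Tm' t = atom 0 t O O O
  G' Num' Thm' F' R' Ch' : Exp → Exp → Atom
  G' s t = atom 1 s t O O
  Num' s t = atom 5 s t O O
  Thm' s t = atom 8 s t O O
  F' s t = atom 11 s t O O
  R' s t = atom 13 s t O O
  Ch' s t = atom 15 s t O O
  Ref' : Exp → Atom
  Ref' t = atom 12 t O O O
  Va' ST' SF' Ev' Evs' Lit' : Exp → Exp → Exp → Atom
  Va' r s t = atom 2 r s t O
  ST' r s t = atom 3 r s t O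
  SF' r s t = atom 4 r s t O
  Ev' r s t = atom 9 r s t O
  Evs' r s t = atom 10 r s t O
  Lit' r s t = atom 14 r s t O
  Val' TT' : Exp → Exp → Exp → Exp → Atom
  Val' = atom 6
  TT' = atom 7

  ttRules : List Rule
  ttRules = List.concatMap (λ o → List.concatMap (λ p → List.map (λ q →
    TT' (lit (opTag o)) (lit (b2n p)) (lit (b2n q)) (lit (b2n (opB o p q))) ⟸ []) (true ∷ false ∷ [])) (true ∷ false ∷ [])) (∧ₒ ∷ ∨ₒ ∷ ⇒ₒ ∷ [])

  -- `EN` has no axiom scheme of its own; the tautology ¬⊥ fills the slot, which gives the rule
  -- lists of the three logics the same shape.
  axiomRule : Logic → Rule
  axiomRule EN = Thm' (lit 1) (negE falsE) ⟸ []
  axiomRule ENP = Thm' (lit 1) (negE (boxE n0 a b)) ⟸ Num' falsE a ∷ Num' self b ∷ []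
  axiomRule END = Thm' (lit 1) (negE (andE (boxE n0 a c) (boxE n0 b c))) ⟸ G' (lit 1) x ∷ Num' x a ∷ Num' (negE x) b ∷ Num' self c ∷ []

  termRules subRules valRules thmRules evRules fRules refRules : List Rule
  termRules =
    (Tm' (varE a) ⟸ []) ∷
    (Tm' zE ⟸ []) ∷
    (Tm' (sE a) ⟸ Tm' a ∷ []) ∷
    (Tm' (addE a b) ⟸ Tm' a ∷ Tm' b ∷ []) ∷
    (Tm' (mulE a b) ⟸ Tm' a ∷ Tm' b ∷ []) ∷
    (G' O (eqE a b) ⟸ Tm' a ∷ Tm' b ∷ []) ∷
    (G' O botE ⟸ []) ∷
    (G' O (allE x) ⟸ G' O x ∷ []) ∷
    (G' O (exE x) ⟸ G' O x ∷ []) ∷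
    (G' b (negE x) ⟸ G' b x ∷ []) ∷
    -- The truth-table premise certifies that `a` is the tag of a binary connective.
    (G' b (binE a x y) ⟸ G' b x ∷ G' b y ∷ TT' a c d u ∷ []) ∷
    (G' (lit 1) falsE ⟸ []) ∷
    (G' (lit 1) (boxE n0 a b) ⟸ G' (lit 1) x ∷ Num' x a ∷ Num' self b ∷ []) ∷
    (G' (lit 1) (boxE n1 a b) ⟸ Num' x a ∷ Num' self b ∷ []) ∷
    (Num' O zE ⟸ []) ∷
    (Num' (su a) (sE b) ⟸ Num' a b ∷ []) ∷ []
  subRules =
    (Va' sh a (varE (su a)) ⟸ []) ∷
    (Va' (ins a) O a ⟸ []) ∷
    (Va' (ins a) (su b) (varE b) ⟸ []) ∷
    (Va' (lft a) O (varE O) ⟸ []) ∷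
    (Va' (lft a) (su b) d ⟸ Va' a b c ∷ ST' sh c d ∷ []) ∷
    (ST' a (varE b) c ⟸ Va' a b c ∷ []) ∷
    (ST' a zE zE ⟸ []) ∷
    (ST' a (sE b) (sE c) ⟸ ST' a b c ∷ []) ∷
    (ST' a (addE b x) (addE c y) ⟸ ST' a b c ∷ ST' a x y ∷ []) ∷
    (ST' a (mulE b x) (mulE c y) ⟸ ST' a b c ∷ ST' a x y ∷ []) ∷
    (SF' a (eqE b x) (eqE c y) ⟸ ST' a b c ∷ ST' a x y ∷ []) ∷
    (SF' a botE botE ⟸ []) ∷
    (SF' a (negE b) (negE c) ⟸ SF' a b c ∷ []) ∷
    (SF' a (andE b x) (andE c y) ⟸ SF' a b c ∷ SF' a x y ∷ []) ∷
    (SF' a (binE (lit 4) b x) (binE (lit 4) c y) ⟸ SF' a b c ∷ SF' a x y ∷ []) ∷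
    (SF' a (impE b x) (impE c y) ⟸ SF' a b c ∷ SF' a x y ∷ []) ∷
    (SF' a (allE b) (allE c) ⟸ SF' (lft a) b c ∷ []) ∷
    (SF' a (exE b) (exE c) ⟸ SF' (lft a) b c ∷ []) ∷ []
  valRules =
    (Val' b (andE c x) x (lit 1) ⟸ G' b c ∷ G' b x ∷ []) ∷
    (Val' b (andE c (negE x)) x O ⟸ G' b c ∷ G' b x ∷ []) ∷
    (Val' b (andE c y) x u ⟸ Val' b c x u ∷ G' b y ∷ []) ∷
    (Val' b c (negE x) O ⟸ Val' b c x (lit 1) ∷ []) ∷
    (Val' b c (negE x) (lit 1) ⟸ Val' b c x O ∷ []) ∷
    (Val' b c (binE a x y) u ⟸ Val' b c x d ∷ Val' b c y z ∷ TT' a d z u ∷ []) ∷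
    (Val' O c botE O ⟸ G' O c ∷ []) ∷
    (Val' b c x (lit 1) ⟸ Val' b (andE c y) x (lit 1) ∷ Val' b (andE c (negE y)) x (lit 1) ∷ G' b c ∷ G' b y ∷ G' b x ∷ []) ∷
    -- Contexts are never empty, so a theorem is obtained as what follows both from a formula and
    -- from its negation.
    (Thm' b x ⟸ Val' b y x (lit 1) ∷ Val' b (negE y) x (lit 1) ∷ G' b y ∷ G' b x ∷ []) ∷ []
  thmRules =
    (Thm' O (impE (allE x) y) ⟸ SF' (ins a) x y ∷ Tm' a ∷ G' O x ∷ []) ∷
    (Thm' O (impE (allE (impE z x)) (impE y (allE x))) ⟸ SF' sh y z ∷ G' O x ∷ G' O y ∷ []) ∷
    (Thm' O (impE y (exE x)) ⟸ SF' (ins a) x y ∷ Tm' a ∷ G' O x ∷ []) ∷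
    (Thm' O (impE (allE (impE x z)) (impE (exE x) y)) ⟸ SF' sh y z ∷ G' O x ∷ G' O y ∷ []) ∷
    (Thm' O (eqE a a) ⟸ Tm' a ∷ []) ∷
    (Thm' O (impE (eqE a b) (impE y z)) ⟸ SF' (ins a) x y ∷ SF' (ins b) x z ∷ Tm' a ∷ Tm' b ∷ G' O x ∷ []) ∷
    (Thm' b y ⟸ Thm' b (impE x y) ∷ Thm' b x ∷ G' b y ∷ []) ∷
    (Thm' O (allE x) ⟸ Thm' O x ∷ []) ∷
    -- On the modal side 0 = 1 stands for falsity and has a fixed value; on the side of T it is a
    -- prime formula like any other equation.
    (Val' (lit 1) c falsE O ⟸ G' (lit 1) c ∷ []) ∷
    (Thm' (lit 1) (boxE n0 a b) ⟸ Thm' (lit 1) x ∷ Num' x a ∷ Num' self b ∷ []) ∷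
    (Thm' (lit 1) (iffE (boxE n0 a c) (boxE n0 b c)) ⟸
      Thm' (lit 1) (iffE x y) ∷ G' (lit 1) x ∷ G' (lit 1) y ∷ Num' x a ∷ Num' y b ∷ Num' self c ∷ []) ∷ []
  evRules =
    (Ev' (lit 0 ⸴ lit 0) x O ⟸ []) ∷
    (Ev' (lit 1 ⸴ lit 0) (x ⸴ O) (su x) ⟸ []) ∷
    (Ev' (lit 2 ⸴ O) (x ⸴ y) x ⟸ []) ∷
    (Ev' (lit 2 ⸴ su a) (x ⸴ y) z ⟸ Ev' (lit 2 ⸴ a) y z ∷ []) ∷
    (Ev' (lit 3 ⸴ a ⸴ b) x z ⟸ Evs' b x y ∷ Ev' a y z ∷ []) ∷
    (Evs' O x O ⟸ []) ∷
    (Evs' (a ⸴ b) x (y ⸴ z) ⟸ Ev' a x y ∷ Evs' b x z ∷ []) ∷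
    (Ev' (lit 4 ⸴ a ⸴ b) (O ⸴ x) z ⟸ Ev' a x z ∷ []) ∷
    (Ev' (lit 4 ⸴ a ⸴ b) (su c ⸴ x) z ⟸ Ev' (lit 4 ⸴ a ⸴ b) (c ⸴ x) y ∷ Ev' b (c ⸴ y ⸴ x) z ∷ []) ∷ []
  fRules =
    (F' (su a) falsE ⟸ []) ∷
    -- The variable with index i enters at rank i + 1, so that only finitely many modal formulas
    -- have a given rank.
    (F' (su a) (boxE n1 b c) ⟸ Num' a b ∷ Num' self c ∷ []) ∷
    (F' (su a) x ⟸ F' a x ∷ []) ∷
    (F' (su a) (negE x) ⟸ F' a x ∷ []) ∷
    (F' (su a) (binE z x y) ⟸ F' a x ∷ F' a y ∷ TT' z c d u ∷ []) ∷
    (F' (su a) (boxE n0 b c) ⟸ F' a x ∷ Num' x b ∷ Num' self c ∷ []) ∷ []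
  refRules =
    (Ref' x ⟸ Thm' O x ∷ []) ∷
    (Ref' x ⟸ Ref' (impE (boxE y z u) x) ∷ Lit' a b (lit 1) ∷ Num' a y ∷ Num' b z ∷ Num' self u ∷ G' O x ∷ []) ∷
    (Ref' x ⟸ Ref' (impE (negE (boxE y z u)) x) ∷ Lit' a b O ∷ Num' a y ∷ Num' b z ∷ Num' self u ∷ G' O x ∷ []) ∷ []

  ruleList : PR 1 → Logic → List Rule
  ruleList χ L = (Thm' O x ⟸ Ev' (lit (encPR χ)) (x ⸴ O) (lit 1) ∷ G' O x ∷ []) ∷ axiomRule L ∷
    ttRules ++ termRules ++ subRules ++ valRules ++ thmRules ++ evRules ++ fRules ++ refRules

  -- Opaque, as is satRules, so that the lists are not expanded.
  opaque
    rulesFor : PR 1 → Logic → List Rule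
    rulesFor = ruleList

    rulesFor≡ : ∀ χ L → ruleList χ L ≡ rulesFor χ L
    rulesFor≡ χ L = refl

  iffAtom iffAtom′ : Atom
  iffAtom = Thm' O (iffE a b)
  iffAtom′ = Thm' O (iffE b a)

  -- Conditions required of a verified level; in fRules the variable a is the rank, which is kept below the level.
  satList : List Rule
  satList = fRules ++ ttRules ++
    (R' x z ⟸ R' x y ∷ R' y z ∷ []) ∷
    (Lit' O y (lit 1) ⟸ Lit' O x (lit 1) ∷ R' x y ∷ []) ∷
    (Thm' (lit 1) (iffE x y) ⟸ F' b x ∷ F' c y ∷ R' x y ∷ []) ∷ []

  opaque
    satRules : List Rule
    satRules = satList

    satRules≡ : satList ≡ satRules
    satRules≡ = refl

  -- To be used with u the code of the negation of the formula coded by z.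
  negRule : Rule
  negRule = Thm' (lit 1) (iffE (negE x) y) ⟸ F' b x ∷ F' c y ∷ R' x z ∷ R' u y ∷ []

  baseTags : List ℕ
  baseTags = 13 ∷ 14 ∷ 15 ∷ []

  -- The common interface of formulas with T-provability and modal formulas with L-provability.
  record System : Set₁ where
    field
      X       : Set
      enc     : X → Formula
      enc-inj : ∀ p q → enc p ≡ enc q → p ≡ q
      neg     : X → X
      bin     : Op → X → X → X
      enc-neg : ∀ p → kF (enc (neg p)) ≡ ⟪ 2 , kF (enc p) ⟫
      enc-bin : ∀ o p q → kF (enc (bin o p q)) ≡ ⟪ opTag o , ⟪ kF (enc p) , kF (enc q) ⟫ ⟫
      W       : Set
      E       : W → X → Bool
      E-neg   : ∀ w p → E w (neg p) ≡ not (E w p)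
      E-bin   : ∀ w o p q → E w (bin o p q) ≡ opB o (E w p) (E w q)
      Prov    : X → Set
      cons₂   : ∀ p q r → (∀ w → E w p ≡ true → E w q ≡ true → E w r ≡ true) → Prov p → Prov q → Prov r
      prov⊤   : ∀ p → (∀ w → E w p ≡ true) → Prov p

  binF : Op → Formula → Formula → Formula
  binF ∧ₒ = _∧'_
  binF ∨ₒ = _∨'_
  binF ⇒ₒ = _⇒'_

  binM : Op → MFormula → MFormula → MFormula
  binM ∧ₒ = _∧ₘ_
  binM ∨ₒ = _∨ₘ_
  binM ⇒ₒ = _⇒ₘ_

  cons-bool : ∀ a b c → (a ≡ true → b ≡ true → c ≡ true) → not a ∨ (not b ∨ c) ≡ true
  cons-bool false b c h = refl
  cons-bool true false c h = refl
  cons-bool true true c h = h refl refl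

  formulas : Theory → System
  formulas T = record
    { X = Formula ; enc = id ; enc-inj = λ _ _ → id ; neg = ¬'_ ; bin = binF
    ; enc-neg = λ _ → refl ; enc-bin = λ { ∧ₒ p q → refl ; ∨ₒ p q → refl ; ⇒ₒ p q → refl }
    ; W = Formula → Bool ; E = evalB ; E-neg = λ _ _ → refl ; E-bin = λ { w ∧ₒ p q → refl ; w ∨ₒ p q → refl ; w ⇒ₒ p q → refl }
    ; Prov = T ⊢_ ; cons₂ = λ p q r h pp qq → mp (mp (taut λ w → cons-bool _ _ _ (h w)) pp) qq ; prov⊤ = λ _ → taut }

  module Coding (Mx : Formula) where
    e : ℕ
    e = kF Mx

    -- BoxF 0 is the provability predicate and BoxF 1 interprets the propositional variables; substituting the code of the
    -- matrix for a variable of the matrix makes both self-referential without the diagonal lemma.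
    BoxF : ℕ → ℕ → Formula
    BoxF b i = ∃' (∃' (∃' (∃' (numeral i ≐ var 2 ∧' (numeral e ≐ var 1 ∧' (numeral b ≐ var 0 ∧' Mx))))))

    ff : MFormula → Formula
    ff (pv i) = BoxF 1 i
    ff ⊥ₘ = zr ≐ S zr
    ff (¬ₘ A) = ¬' ff A
    ff (A ∧ₘ B) = ff A ∧' ff B
    ff (A ∨ₘ B) = ff A ∨' ff B
    ff (A ⇒ₘ B) = ff A ⇒' ff B
    ff (□ A) = BoxF 0 (kF (ff A))

    numeral-inj : ∀ {i j} → numeral i ≡ numeral j → i ≡ j
    numeral-inj {zero} {zero} q = refl
    numeral-inj {suc i} {suc j} q = cong suc (numeral-inj (S-injective q))
      where
      S-injective : ∀ {s t} → S s ≡ S t → s ≡ t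
      S-injective refl = refl

    BoxF-inj : ∀ {b i b′ i′} → BoxF b i ≡ BoxF b′ i′ → b ≡ b′ × i ≡ i′
    BoxF-inj {b} {i} {b′} {i′} q = numeral-inj (flag q) , numeral-inj (arg q)
      where
      flag : ∀ {b i b′ i′ e M e′ M′} → ∃' (∃' (∃' (∃' (i ≐ var 2 ∧' (e ≐ var 1 ∧' (b ≐ var 0 ∧' M)))))) ≡
        ∃' (∃' (∃' (∃' (i′ ≐ var 2 ∧' (e′ ≐ var 1 ∧' (b′ ≐ var 0 ∧' M′)))))) → b ≡ b′
      flag refl = refl
      arg : ∀ {b i b′ i′ e M e′ M′} → ∃' (∃' (∃' (∃' (i ≐ var 2 ∧' (e ≐ var 1 ∧' (b ≐ var 0 ∧' M)))))) ≡
        ∃' (∃' (∃' (∃' (i′ ≐ var 2 ∧' (e′ ≐ var 1 ∧' (b′ ≐ var 0 ∧' M′)))))) → i ≡ i′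
      arg refl = refl

    -- By injectivity the code of an interpretation determines the modal formula, and the database
    -- can speak of modal formulas through these codes. The flag separates variables from boxes.
    ff-inj : ∀ A B → ff A ≡ ff B → A ≡ B
    ff-inj (pv i) (pv j) q = cong pv (proj₂ (BoxF-inj q))
    ff-inj ⊥ₘ ⊥ₘ q = refl
    ff-inj (¬ₘ A) (¬ₘ B) q = cong ¬ₘ_ (ff-inj A B (inj¬ q))
      where
      inj¬ : ∀ {φ ψ} → ¬' φ ≡ ¬' ψ → φ ≡ ψ
      inj¬ refl = refl
    ff-inj (A ∧ₘ A′) (B ∧ₘ B′) q = cong₂ _∧ₘ_ (ff-inj A B (proj₁ (inj q))) (ff-inj A′ B′ (proj₂ (inj q)))
      where
      inj : ∀ {φ φ′ ψ ψ′} → φ ∧' φ′ ≡ ψ ∧' ψ′ → φ ≡ ψ × φ′ ≡ ψ′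
      inj refl = refl , refl
    ff-inj (A ∨ₘ A′) (B ∨ₘ B′) q = cong₂ _∨ₘ_ (ff-inj A B (proj₁ (inj q))) (ff-inj A′ B′ (proj₂ (inj q)))
      where
      inj : ∀ {φ φ′ ψ ψ′} → φ ∨' φ′ ≡ ψ ∨' ψ′ → φ ≡ ψ × φ′ ≡ ψ′
      inj refl = refl , refl
    ff-inj (A ⇒ₘ A′) (B ⇒ₘ B′) q = cong₂ _⇒ₘ_ (ff-inj A B (proj₁ (inj q))) (ff-inj A′ B′ (proj₂ (inj q)))
      where
      inj : ∀ {φ φ′ ψ ψ′} → φ ⇒' φ′ ≡ ψ ⇒' ψ′ → φ ≡ ψ × φ′ ≡ ψ′
      inj refl = refl , refl
    ff-inj (□ A) (□ B) q = cong □_ (ff-inj A B (kF-inj _ _ (proj₂ (BoxF-inj q))))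
    ff-inj (pv i) (□ A) q with () ← proj₁ (BoxF-inj q)
    ff-inj (□ A) (pv i) q with () ← proj₁ (BoxF-inj q)

    modal : Logic → System
    modal L = record
      { X = MFormula ; enc = ff ; enc-inj = ff-inj ; neg = ¬ₘ_ ; bin = binM
      ; enc-neg = λ _ → refl ; enc-bin = λ { ∧ₒ p q → refl ; ∨ₒ p q → refl ; ⇒ₒ p q → refl }
      ; W = (ℕ → Bool) × (MFormula → Bool) ; E = λ (v , w) → evalM v w
      ; E-neg = λ _ _ → refl ; E-bin = λ { w ∧ₒ p q → refl ; w ∨ₒ p q → refl ; w ⇒ₒ p q → refl }
      ; Prov = L ⊢ₘ_ ; cons₂ = λ p q r h pp qq → m-mp (m-mp (m-taut λ v w → cons-bool _ _ _ (h (v , w))) pp) qq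
      ; prov⊤ = λ _ h → m-taut λ v w → h (v , w) }

open RuleSystem

-- Soundness of the Horn rules

module RuleSoundness where
  substT-ext : ∀ {σ σ′} → (∀ k → σ k ≡ σ′ k) → ∀ t → substT σ t ≡ substT σ′ t
  substT-ext h (var k) = h k
  substT-ext h zr = refl
  substT-ext h (S t) = cong S (substT-ext h t)
  substT-ext h (t ⊕ u) = cong₂ _⊕_ (substT-ext h t) (substT-ext h u)
  substT-ext h (t ⊗ u) = cong₂ _⊗_ (substT-ext h t) (substT-ext h u)

  subst-ext : ∀ {σ σ′} → (∀ k → σ k ≡ σ′ k) → ∀ φ → subst σ φ ≡ subst σ′ φ
  subst-ext h (t ≐ u) = cong₂ _≐_ (substT-ext h t) (substT-ext h u)
  subst-ext h ⊥' = refl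
  subst-ext h (¬' φ) = cong ¬'_ (subst-ext h φ)
  subst-ext h (φ ∧' ψ) = cong₂ _∧'_ (subst-ext h φ) (subst-ext h ψ)
  subst-ext h (φ ∨' ψ) = cong₂ _∨'_ (subst-ext h φ) (subst-ext h ψ)
  subst-ext h (φ ⇒' ψ) = cong₂ _⇒'_ (subst-ext h φ) (subst-ext h ψ)
  subst-ext h (∀' φ) = cong ∀' (subst-ext (λ { zero → refl ; (suc k) → cong shiftT (h k) }) φ)
  subst-ext h (∃' φ) = cong ∃' (subst-ext (λ { zero → refl ; (suc k) → cong shiftT (h k) }) φ)

  ins≡inst : ∀ t φ → subst ⟦ insˢ t ⟧ˢ φ ≡ inst t φ
  ins≡inst t = subst-ext λ { zero → refl ; (suc k) → refl }

  private
    sTag : SubCode → ℕ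
    sTag shˢ = 0
    sTag (insˢ _) = 1
    sTag (lftˢ _) = 2

    sPay : SubCode → ℕ
    sPay shˢ = 0
    sPay (insˢ t) = kT t
    sPay (lftˢ s) = encS s

    encS-tag : ∀ s → encS s ≡ ⟪ sTag s , sPay s ⟫
    encS-tag shˢ = refl
    encS-tag (insˢ _) = refl
    encS-tag (lftˢ _) = refl

    inv-sh : ∀ {k} σ → ⟪ 0 , k ⟫ ≡ encS σ → σ ≡ shˢ
    inv-sh σ q = go σ (proj₁ (⟪⟫-inj (trans q (encS-tag σ))))
      where
      go : ∀ σ → 0 ≡ sTag σ → σ ≡ shˢ
      go shˢ _ = refl

    inv-ins : ∀ {a} σ → ⟪ 1 , a ⟫ ≡ encS σ → ∃ λ t → σ ≡ insˢ t × a ≡ kT t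
    inv-ins σ q = go σ (⟪⟫-inj (trans q (encS-tag σ)))
      where
      go : ∀ {a} σ → 1 ≡ sTag σ × a ≡ sPay σ → ∃ λ t → σ ≡ insˢ t × a ≡ kT t
      go (insˢ t) (_ , r) = t , refl , r

    inv-lft : ∀ {a} σ → ⟪ 2 , a ⟫ ≡ encS σ → ∃ λ s → σ ≡ lftˢ s × a ≡ encS s
    inv-lft σ q = go σ (⟪⟫-inj (trans q (encS-tag σ)))
      where
      go : ∀ {a} σ → 2 ≡ sTag σ × a ≡ sPay σ → ∃ λ t → σ ≡ lftˢ t × a ≡ encS t
      go (lftˢ t) (_ , r) = t , refl , r

    prTag : ∀ {n} → PR n → ℕ
    prTag pr-zero = 0
    prTag pr-succ = 1
    prTag (pr-proj _) = 2
    prTag (pr-comp _ _) = 3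
    prTag (pr-rec _ _) = 4

    prPay : ∀ {n} → PR n → ℕ
    prPay pr-zero = 0
    prPay pr-succ = 0
    prPay (pr-proj i) = toℕ i
    prPay (pr-comp f gs) = ⟪ encPR f , encPRs gs ⟫
    prPay (pr-rec g h) = ⟪ encPR g , encPR h ⟫

    encPR-tag : ∀ {n} (f : PR n) → encPR f ≡ ⟪ prTag f , prPay f ⟫
    encPR-tag pr-zero = refl
    encPR-tag pr-succ = refl
    encPR-tag (pr-proj _) = refl
    encPR-tag (pr-comp _ _) = refl
    encPR-tag (pr-rec _ _) = refl

    invPR : ∀ {n t p} (f : PR n) → ⟪ t , p ⟫ ≡ encPR f → t ≡ prTag f × p ≡ prPay f
    invPR f q = ⟪⟫-inj (trans q (encPR-tag f))

  rank : MFormula → ℕ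
  rank (pv i) = suc i
  rank ⊥ₘ = 1
  rank (¬ₘ A) = suc (rank A)
  rank (A ∧ₘ B) = suc (rank A ⊔ rank B)
  rank (A ∨ₘ B) = suc (rank A ⊔ rank B)
  rank (A ⇒ₘ B) = suc (rank A ⊔ rank B)
  rank (□ A) = suc (rank A)

  module Prop (P : System) where
    open System P

    CodeOf : ℕ → Set
    CodeOf x = ∃ λ p → x ≡ kF (enc p)

    Theorem : ℕ → Set
    Theorem x = ∃ λ p → x ≡ kF (enc p) × Prov p

    litS : Bool → X → X
    litS true p = p
    litS false p = neg p

    Value : ℕ → ℕ → ℕ → Set
    Value γ x v = ∃ λ g → ∃ λ p → ∃ λ u → γ ≡ kF (enc g) × x ≡ kF (enc p) × v ≡ b2n u × Prov (bin ⇒ₒ g (litS u p))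

    enc≡ : ∀ {p q} → kF (enc p) ≡ kF (enc q) → p ≡ q
    enc≡ h = enc-inj _ _ (kF-inj _ _ h)

    private
      not-true : ∀ {a} → not a ≡ true → a ≡ false
      not-true {false} _ = refl
      not-false : ∀ {a} → a ≡ false → not a ≡ true
      not-false refl = refl

    imp→ : ∀ {w g p} u → E w (bin ⇒ₒ g (litS u p)) ≡ true → E w g ≡ true → E w p ≡ u
    imp→ {w} {g} {p} true h k rewrite E-bin w ⇒ₒ g p | k = h
    imp→ {w} {g} {p} false h k rewrite E-bin w ⇒ₒ g (neg p) | k | E-neg w p = not-true h

    imp← : ∀ {w g p} u → (E w g ≡ true → E w p ≡ u) → E w (bin ⇒ₒ g (litS u p)) ≡ true
    imp← {w} {g} {p} true h rewrite E-bin w ⇒ₒ g p with E w g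
    ... | false = refl
    ... | true = h refl
    imp← {w} {g} {p} false h rewrite E-bin w ⇒ₒ g (neg p) | E-neg w p with E w g
    ... | false = refl
    ... | true = not-false (h refl)

    ∧-true : ∀ {w g p} → E w (bin ∧ₒ g p) ≡ true → E w g ≡ true × E w p ≡ true
    ∧-true {w} {g} {p} h rewrite E-bin w ∧ₒ g p with E w g | E w p
    ... | true | true = refl , refl

    neg-true : ∀ {w p} → E w (neg p) ≡ true → E w p ≡ false
    neg-true {w} {p} h = not-true (trans (sym (E-neg w p)) h)

    bin≡ : ∀ {o x y p q} → x ≡ kF (enc p) → y ≡ kF (enc q) → ⟪ opTag o , ⟪ x , y ⟫ ⟫ ≡ kF (enc (bin o p q))
    bin≡ {o} refl refl = sym (enc-bin o _ _)

    neg≡ : ∀ {x p} → x ≡ kF (enc p) → ⟪ 2 , x ⟫ ≡ kF (enc (neg p))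
    neg≡ refl = sym (enc-neg _)

    code-neg : ∀ {x} → CodeOf x → CodeOf ⟪ 2 , x ⟫
    code-neg (p , q) = neg p , neg≡ q

    code-bin : ∀ {o x y} → CodeOf x → CodeOf y → CodeOf ⟪ opTag o , ⟪ x , y ⟫ ⟫
    code-bin {o} (p , q) (p′ , q′) = bin o p p′ , bin≡ q q′

    val-pos : ∀ {γ x} → CodeOf γ → CodeOf x → Value ⟪ 3 , ⟪ γ , x ⟫ ⟫ x 1
    val-pos (g , q) (p , r) = bin ∧ₒ g p , p , true , bin≡ q r , r , refl , prov⊤ _ λ w → imp← true λ h → proj₂ (∧-true h)

    val-neg : ∀ {γ x} → CodeOf γ → CodeOf x → Value ⟪ 3 , ⟪ γ , ⟪ 2 , x ⟫ ⟫ ⟫ x 0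
    val-neg (g , q) (p , r) = bin ∧ₒ g (neg p) , p , false , bin≡ q (neg≡ r) , r , refl ,
      prov⊤ _ λ w → imp← false λ h → neg-true (proj₂ (∧-true h))

    val-weak : ∀ {γ x y v} → Value γ x v → CodeOf y → Value ⟪ 3 , ⟪ γ , y ⟫ ⟫ x v
    val-weak (g , p , u , q , r , s , h) (p′ , q′) = bin ∧ₒ g p′ , p , u , bin≡ q q′ , r , s ,
      cons₂ _ _ _ (λ w i _ → imp← u λ j → imp→ u i (proj₁ (∧-true j))) h h

    val-not : ∀ {γ x} v u → Value γ x v → v ≡ b2n u → Value γ ⟪ 2 , x ⟫ (b2n (not u))
    val-not v u (g , p , u′ , q , r , s , h) t with b2n-inj u u′ (trans (sym t) s)
      where
      b2n-inj : ∀ u u′ → b2n u ≡ b2n u′ → u ≡ u′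
      b2n-inj false false _ = refl
      b2n-inj true true _ = refl
    ... | refl = g , neg p , not u , q , neg≡ r , refl ,
      cons₂ _ _ _ (λ w i _ → imp← (not u) λ j → trans (E-neg w p) (cong not (imp→ u i j))) h h

    val-bin : ∀ {γ x y d e} o u u′ → Value γ x d → Value γ y e → d ≡ b2n u → e ≡ b2n u′ → Value γ ⟪ opTag o , ⟪ x , y ⟫ ⟫ (b2n (opB o u u′))
    val-bin o u u′ (g , p , v , q , r , s , h) (g′ , p′ , v′ , q′ , r′ , s′ , h′) t t′
      with b2n-inj u v (trans (sym t) s) | b2n-inj u′ v′ (trans (sym t′) s′) | enc≡ (trans (sym q) q′)
      where
      b2n-inj : ∀ u u′ → b2n u ≡ b2n u′ → u ≡ u′
      b2n-inj false false _ = refl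
      b2n-inj true true _ = refl
    ... | refl | refl | refl = g , bin o p p′ , opB o u u′ , q , bin≡ r r′ , refl ,
      cons₂ _ _ _ (λ w i i′ → imp← (opB o u u′) λ j → trans (E-bin w o p p′) (cong₂ (opB o) (imp→ u i j) (imp→ u′ i′ j))) h h′

    private
      val-true : ∀ {γ x} → Value γ x 1 → ∀ g p → γ ≡ kF (enc g) → x ≡ kF (enc p) → Prov (bin ⇒ₒ g p)
      val-true (g , p , true , refl , refl , _ , h) g′ p′ q r with enc≡ q | enc≡ r
      ... | refl | refl = h

    val-split : ∀ {γ x y} → Value ⟪ 3 , ⟪ γ , y ⟫ ⟫ x 1 → Value ⟪ 3 , ⟪ γ , ⟪ 2 , y ⟫ ⟫ ⟫ x 1 → CodeOf γ → CodeOf y → CodeOf x → Value γ x 1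
    val-split h h′ (g , q) (r , s) (p , t) = g , p , true , q , t , refl ,
      cons₂ _ _ _ (λ w i j → imp← true λ k → by-cases w i j k)
        (val-true h (bin ∧ₒ g r) p (bin≡ q s) t) (val-true h′ (bin ∧ₒ g (neg r)) p (bin≡ q (neg≡ s)) t)
      where
      by-cases : ∀ w → E w (bin ⇒ₒ (bin ∧ₒ g r) p) ≡ true → E w (bin ⇒ₒ (bin ∧ₒ g (neg r)) p) ≡ true → E w g ≡ true → E w p ≡ true
      by-cases w i j k rewrite E-bin w ⇒ₒ (bin ∧ₒ g r) p | E-bin w ⇒ₒ (bin ∧ₒ g (neg r)) p | E-bin w ∧ₒ g r | E-bin w ∧ₒ g (neg r)
        | E-neg w r | k with E w r
      ... | true = i
      ... | false = j

    val-thm : ∀ {x y} → Value y x 1 → Value ⟪ 2 , y ⟫ x 1 → CodeOf y → CodeOf x → Theorem x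
    val-thm h h′ (r , s) (p , t) = p , t , cons₂ _ _ _ by-cases (val-true h r p s t) (val-true h′ (neg r) p (neg≡ s) t)
      where
      by-cases : ∀ w → E w (bin ⇒ₒ r p) ≡ true → E w (bin ⇒ₒ (neg r) p) ≡ true → E w p ≡ true
      by-cases w i j rewrite E-bin w ⇒ₒ r p | E-bin w ⇒ₒ (neg r) p | E-neg w r with E w r
      ... | true = i
      ... | false = j

    thm-mp : ∀ {x y} → Theorem ⟪ 5 , ⟪ x , y ⟫ ⟫ → Theorem x → CodeOf y → Theorem y
    thm-mp (i , q , h) (p , r , k) (p′ , s) with enc≡ (trans (sym q) (bin≡ {⇒ₒ} r s))
    ... | refl = p′ , s , cons₂ _ _ _ (λ w h k → imp→ true h k) h k

  module Sound (T : Theory) (χ : PR 1) (χ-ok : ∀ φ → evalPR χ (code φ ∷ []) ≡ 1 → T φ) (L : Logic) (Mx : Formula) (B : Fact → Set) where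
    open Coding Mx

    onB : ℕ → (System → Set) → Set
    onB 0 P = P (formulas T)
    onB 1 P = P (modal L)
    onB _ P = ⊥

    onB-map : ∀ b {P Q : System → Set} → (∀ S → P S → Q S) → onB b P → onB b Q
    onB-map 0 f p = f _ p
    onB-map 1 f p = f _ p

    onB-map₂ : ∀ b {P Q R : System → Set} → (∀ S → P S → Q S → R S) → onB b P → onB b Q → onB b R
    onB-map₂ 0 f p q = f _ p q
    onB-map₂ 1 f p q = f _ p q

    -- Facts about substitution and evaluation (tags 2 to 4, 9 and 10) are read conditionally on
    -- their first argument being a code, which their rules do not check. Base facts, with tags from
    -- 13 on, mean no more than membership in B.
    Holds : Fact → Set
    Holds (fact 0 x _ _ _) = ∃ λ t → x ≡ kT t
    Holds (fact 1 b x _ _) = onB b λ S → Prop.CodeOf S x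
    Holds (fact 2 s k u _) = ∀ σ → s ≡ encS σ → u ≡ kT (⟦ σ ⟧ˢ k)
    Holds (fact 3 s x y _) = ∀ σ → s ≡ encS σ → ∃ λ t → x ≡ kT t × y ≡ kT (substT ⟦ σ ⟧ˢ t)
    Holds (fact 4 s x y _) = ∀ σ → s ≡ encS σ → ∃ λ φ → x ≡ kF φ × y ≡ kF (subst ⟦ σ ⟧ˢ φ)
    Holds (fact 5 k c _ _) = c ≡ kT (numeral k)
    Holds (fact 6 b γ x v) = onB b λ S → Prop.Value S γ x v
    Holds (fact 7 o p q r) = ∃ λ op → ∃ λ u → ∃ λ v → o ≡ opTag op × p ≡ b2n u × q ≡ b2n v × r ≡ b2n (opB op u v)
    Holds (fact 8 b x _ _) = onB b λ S → Prop.Theorem S x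
    Holds (fact 9 c xs v _) = ∀ {n} (f : PR n) ρ → c ≡ encPR f → xs ≡ encV ρ → v ≡ evalPR f ρ
    Holds (fact 10 c xs us _) = ∀ {m n} (gs : Vec (PR n) m) ρ → c ≡ encPRs gs → xs ≡ encV ρ → us ≡ encV (evalPRs gs ρ)
    Holds (fact 11 s x _ _) = ∃ λ A → x ≡ kF (ff A) × rank A ≤ s
    Holds (fact 12 x _ _ _) = ∃ λ φ → x ≡ kF φ ×
      ((∀ b i → B (fact 14 b i 1 0) → T ⊢ BoxF b i) → (∀ b i → B (fact 14 b i 0 0) → T ⊢ ¬' BoxF b i) → T ⊢ φ)
    Holds (fact (suc (suc (suc (suc (suc (suc (suc (suc (suc (suc (suc (suc (suc t))))))))))))) x y z u) = B (fact (13 + t) x y z u)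

    -- The valuation is spelled out as a vector of eight variables so that lookups compute and the
    -- premises can be matched.
    RuleSound : Rule → Set
    RuleSound r = ∀ {a b c d x y z u : ℕ} → let v = a ∷ b ∷ c ∷ d ∷ x ∷ y ∷ z ∷ u ∷ [] in
      All (λ A → Holds (evA e (lookup v) A)) (prems r) → Holds (evA e (lookup v) (concl r))

    tt-sound : All RuleSound ttRules
    tt-sound = (λ _ → ∧ₒ , true , true , refl , refl , refl , refl) ∷ (λ _ → ∧ₒ , true , false , refl , refl , refl , refl) ∷
      (λ _ → ∧ₒ , false , true , refl , refl , refl , refl) ∷ (λ _ → ∧ₒ , false , false , refl , refl , refl , refl) ∷
      (λ _ → ∨ₒ , true , true , refl , refl , refl , refl) ∷ (λ _ → ∨ₒ , true , false , refl , refl , refl , refl) ∷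
      (λ _ → ∨ₒ , false , true , refl , refl , refl , refl) ∷ (λ _ → ∨ₒ , false , false , refl , refl , refl , refl) ∷
      (λ _ → ⇒ₒ , true , true , refl , refl , refl , refl) ∷ (λ _ → ⇒ₒ , true , false , refl , refl , refl , refl) ∷
      (λ _ → ⇒ₒ , false , true , refl , refl , refl , refl) ∷ (λ _ → ⇒ₒ , false , false , refl , refl , refl , refl) ∷ []

    axiom-sound : ∀ L′ → L ≡ L′ → RuleSound (axiomRule L′)
    axiom-sound EN _ [] = ¬ₘ ⊥ₘ , refl , m-taut λ _ _ → refl
    axiom-sound ENP refl (refl ∷ refl ∷ []) = ¬ₘ (□ ⊥ₘ) , refl , m-ax P-ax
    axiom-sound END refl ((A , refl) ∷ refl ∷ refl ∷ refl ∷ []) = ¬ₘ (□ A ∧ₘ □ (¬ₘ A)) , refl , m-ax (D-ax A)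

    term-sound : All RuleSound termRules
    term-sound =
      (λ { [] → var _ , refl }) ∷
      (λ { [] → zr , refl }) ∷
      (λ { ((t , refl) ∷ []) → S t , refl }) ∷
      (λ { ((s , refl) ∷ (t , refl) ∷ []) → s ⊕ t , refl }) ∷
      (λ { ((s , refl) ∷ (t , refl) ∷ []) → s ⊗ t , refl }) ∷
      (λ { ((s , refl) ∷ (t , refl) ∷ []) → s ≐ t , refl }) ∷
      (λ { [] → ⊥' , refl }) ∷
      (λ { ((φ , refl) ∷ []) → ∀' φ , refl }) ∷
      (λ { ((φ , refl) ∷ []) → ∃' φ , refl }) ∷
      (λ { {b = b} (p ∷ []) → onB-map b (λ S → Prop.code-neg S) p }) ∷
      (λ { {b = b} (p ∷ q ∷ (o , _ , _ , refl , _) ∷ []) → onB-map₂ b (λ S → Prop.code-bin S {o}) p q }) ∷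
      (λ { [] → ⊥ₘ , refl }) ∷
      (λ { ((A , refl) ∷ refl ∷ refl ∷ []) → □ A , refl }) ∷
      (λ { {x = x} (refl ∷ refl ∷ []) → pv x , refl }) ∷
      (λ { [] → refl }) ∷
      (λ { (refl ∷ []) → refl }) ∷ []

    sub-sound : All RuleSound subRules
    sub-sound =
      (λ { [] σ q → case inv-sh σ q of λ { refl → refl } }) ∷
      (λ { [] σ q → case inv-ins σ q of λ { (t , refl , r) → r } }) ∷
      (λ { [] σ q → case inv-ins σ q of λ { (t , refl , r) → refl } }) ∷
      (λ { [] σ q → case inv-lft σ q of λ { (t , refl , r) → refl } }) ∷
      (λ { {b = b} (p ∷ q ∷ []) σ r → case inv-lft σ r of λ { (s , refl , i) → case q shˢ refl of λ
             { (t , j , k) → trans k (cong (kT ∘ shiftT) (kT-inj t (⟦ s ⟧ˢ b) (trans (sym j) (p s i)))) } } }) ∷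
      (λ { {b = b} (p ∷ []) σ q → var b , refl , p σ q }) ∷
      (λ { [] σ q → zr , refl , refl }) ∷
      (λ { (p ∷ []) σ q → case p σ q of λ { (t , refl , refl) → S t , refl , refl } }) ∷
      (λ { (p ∷ p′ ∷ []) σ q → case p σ q , p′ σ q of λ { ((t , refl , refl) , t′ , refl , refl) → t ⊕ t′ , refl , refl } }) ∷
      (λ { (p ∷ p′ ∷ []) σ q → case p σ q , p′ σ q of λ { ((t , refl , refl) , t′ , refl , refl) → t ⊗ t′ , refl , refl } }) ∷
      (λ { (p ∷ p′ ∷ []) σ q → case p σ q , p′ σ q of λ { ((t , refl , refl) , t′ , refl , refl) → t ≐ t′ , refl , refl } }) ∷
      (λ { [] σ q → ⊥' , refl , refl }) ∷
      (λ { (p ∷ []) σ q → case p σ q of λ { (t , refl , refl) → ¬' t , refl , refl } }) ∷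
      (λ { (p ∷ p′ ∷ []) σ q → case p σ q , p′ σ q of λ { ((t , refl , refl) , t′ , refl , refl) → t ∧' t′ , refl , refl } }) ∷
      (λ { (p ∷ p′ ∷ []) σ q → case p σ q , p′ σ q of λ { ((t , refl , refl) , t′ , refl , refl) → t ∨' t′ , refl , refl } }) ∷
      (λ { (p ∷ p′ ∷ []) σ q → case p σ q , p′ σ q of λ { ((t , refl , refl) , t′ , refl , refl) → t ⇒' t′ , refl , refl } }) ∷
      (λ { (p ∷ []) σ q → case p (lftˢ σ) (cong ⟪ 2 ,_⟫ q) of λ { (t , refl , refl) → ∀' t , refl , refl } }) ∷
      (λ { (p ∷ []) σ q → case p (lftˢ σ) (cong ⟪ 2 ,_⟫ q) of λ { (t , refl , refl) → ∃' t , refl , refl } }) ∷ []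

    or-true : ∀ a → not a ∨ true ≡ true
    or-true false = refl
    or-true true = refl

    val-sound : All RuleSound valRules
    val-sound =
      (λ { {b = b} (p ∷ q ∷ []) → onB-map₂ b (λ S → Prop.val-pos S) p q }) ∷
      (λ { {b = b} (p ∷ q ∷ []) → onB-map₂ b (λ S → Prop.val-neg S) p q }) ∷
      (λ { {b = b} (p ∷ q ∷ []) → onB-map₂ b (λ S → Prop.val-weak S) p q }) ∷
      (λ { {b = b} (p ∷ []) → onB-map b (λ S h → Prop.val-not S 1 true h refl) p }) ∷
      (λ { {b = b} (p ∷ []) → onB-map b (λ S h → Prop.val-not S 0 false h refl) p }) ∷
      (λ { {b = b} (p ∷ q ∷ (o , u , u′ , refl , r , r′ , refl) ∷ []) → onB-map₂ b (λ S h h′ → Prop.val-bin S o u u′ h h′ r r′) p q }) ∷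
      (λ { ((g , refl) ∷ []) → g , ⊥' , false , refl , refl , refl , taut λ w → or-true (evalB w g) }) ∷
      (λ { {b = b} (p ∷ q ∷ r ∷ s ∷ t ∷ []) → onB-map₂ b (λ S (h , h′) (i , j , k) → Prop.val-split S h h′ i j k)
             (onB-map₂ b (λ _ → _,_) p q) (onB-map₂ b (λ _ → _,_) r (onB-map₂ b (λ _ → _,_) s t)) }) ∷
      (λ { {b = b} (p ∷ q ∷ r ∷ s ∷ []) → onB-map₂ b (λ S (h , h′) (i , j) → Prop.val-thm S h h′ i j)
             (onB-map₂ b (λ _ → _,_) p q) (onB-map₂ b (λ _ → _,_) r s) }) ∷ []

    private
      at-sub : ∀ {x y} σ φ → (∃ λ ψ → x ≡ kF ψ × y ≡ kF (subst σ ψ)) → x ≡ kF φ → y ≡ kF (subst σ φ)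
      at-sub σ φ (ψ , refl , q) r = trans q (cong (kF ∘ subst σ) (kF-inj ψ φ r))

      at-inst : ∀ {x y} t φ → (∃ λ ψ → x ≡ kF ψ × y ≡ kF (subst ⟦ insˢ t ⟧ˢ ψ)) → x ≡ kF φ → y ≡ kF (inst t φ)
      at-inst t φ p q = trans (at-sub ⟦ insˢ t ⟧ˢ φ p q) (cong kF (ins≡inst t φ))

    thm-sound : All RuleSound thmRules
    thm-sound =
      (λ { (p ∷ (t , refl) ∷ (φ , refl) ∷ []) → ∀' φ ⇒' inst t φ ,
             cong (λ y → ⟪ 5 , ⟪ ⟪ 6 , kF φ ⟫ , y ⟫ ⟫) (at-inst t φ (p (insˢ t) refl) refl) , ∀-elim φ t }) ∷
      (λ { (p ∷ (φ , refl) ∷ (ψ , refl) ∷ []) → ∀' (shift ψ ⇒' φ) ⇒' (ψ ⇒' ∀' φ) ,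
             cong (λ y → ⟪ 5 , ⟪ ⟪ 6 , ⟪ 5 , ⟪ y , kF φ ⟫ ⟫ ⟫ , ⟪ 5 , ⟪ kF ψ , ⟪ 6 , kF φ ⟫ ⟫ ⟫ ⟫ ⟫)
               (at-sub ⟦ shˢ ⟧ˢ ψ (p shˢ refl) refl) , ∀-intro φ ψ }) ∷
      (λ { (p ∷ (t , refl) ∷ (φ , refl) ∷ []) → inst t φ ⇒' ∃' φ ,
             cong (λ y → ⟪ 5 , ⟪ y , ⟪ 7 , kF φ ⟫ ⟫ ⟫) (at-inst t φ (p (insˢ t) refl) refl) , ∃-intro φ t }) ∷
      (λ { (p ∷ (φ , refl) ∷ (ψ , refl) ∷ []) → ∀' (φ ⇒' shift ψ) ⇒' (∃' φ ⇒' ψ) ,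
             cong (λ y → ⟪ 5 , ⟪ ⟪ 6 , ⟪ 5 , ⟪ kF φ , y ⟫ ⟫ ⟫ , ⟪ 5 , ⟪ ⟪ 7 , kF φ ⟫ , kF ψ ⟫ ⟫ ⟫ ⟫)
               (at-sub ⟦ shˢ ⟧ˢ ψ (p shˢ refl) refl) , ∃-elim φ ψ }) ∷
      (λ { ((t , refl) ∷ []) → t ≐ t , refl , eq-refl t }) ∷
      (λ { (p ∷ q ∷ (t , refl) ∷ (t′ , refl) ∷ (φ , refl) ∷ []) → t ≐ t′ ⇒' (inst t φ ⇒' inst t′ φ) ,
             cong₂ (λ y z → ⟪ 5 , ⟪ ⟪ 0 , ⟪ kT t , kT t′ ⟫ ⟫ , ⟪ 5 , ⟪ y , z ⟫ ⟫ ⟫ ⟫)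
               (at-inst t φ (p (insˢ t) refl) refl) (at-inst t′ φ (q (insˢ t′) refl) refl) , eq-subst φ t t′ }) ∷
      (λ { {b = b} (p ∷ q ∷ r ∷ []) → onB-map₂ b (λ S (h , h′) k → Prop.thm-mp S h h′ k) (onB-map₂ b (λ _ → _,_) p q) r }) ∷
      (λ { ((φ , refl , p) ∷ []) → ∀' φ , refl , gen p }) ∷
      (λ { ((C , refl) ∷ []) → C , ⊥ₘ , false , refl , refl , refl , m-taut λ v w → or-true (evalM v w C) }) ∷
      (λ { ((A , refl , p) ∷ refl ∷ refl ∷ []) → □ A , refl , m-nec p }) ∷
      (λ { ((C , q , p) ∷ (A , refl) ∷ (A′ , refl) ∷ refl ∷ refl ∷ refl ∷ []) → (□ A) ⇔ₘ (□ A′) , refl ,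
             m-re (≡subst (L ⊢ₘ_) (ff-inj C (A ⇔ₘ A′) (kF-inj _ _ (sym q))) p) }) ∷ []

    private
      ev0 : ∀ {n} (f : PR n) → 0 ≡ prTag f → ∀ ρ → 0 ≡ evalPR f ρ
      ev0 pr-zero _ ρ = refl

      ev1 : ∀ {n x} (f : PR n) → 1 ≡ prTag f → ∀ ρ → ⟪ x , 0 ⟫ ≡ encV ρ → suc x ≡ evalPR f ρ
      ev1 pr-succ _ (y ∷ []) q = cong suc (proj₁ (⟪⟫-inj q))

      ev2 : ∀ {n x y} (f : PR n) → 2 ≡ prTag f × 0 ≡ prPay f → ∀ ρ → ⟪ x , y ⟫ ≡ encV ρ → x ≡ evalPR f ρ
      ev2 (pr-proj zero) _ (y ∷ ρ) q = proj₁ (⟪⟫-inj q)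

      ev2s : ∀ {n x y a z} (f : PR n) → 2 ≡ prTag f × suc a ≡ prPay f → ∀ ρ → ⟪ x , y ⟫ ≡ encV ρ →
        (∀ {n} (f : PR n) ρ → ⟪ 2 , a ⟫ ≡ encPR f → y ≡ encV ρ → z ≡ evalPR f ρ) → z ≡ evalPR f ρ
      ev2s (pr-proj (suc i)) (_ , r) (y ∷ ρ) q h = h (pr-proj i) ρ (cong ⟪ 2 ,_⟫ (suc-injective r)) (proj₂ (⟪⟫-inj q))

      ev3 : ∀ {n a b x y z} (f : PR n) → 3 ≡ prTag f × ⟪ a , b ⟫ ≡ prPay f → ∀ ρ → x ≡ encV ρ →
        (∀ {m n} (gs : Vec (PR n) m) ρ → b ≡ encPRs gs → x ≡ encV ρ → y ≡ encV (evalPRs gs ρ)) →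
        (∀ {n} (f : PR n) ρ → a ≡ encPR f → y ≡ encV ρ → z ≡ evalPR f ρ) → z ≡ evalPR f ρ
      ev3 (pr-comp f gs) (_ , r) ρ q h k = k f (evalPRs gs ρ) (proj₁ (⟪⟫-inj r)) (h gs ρ (proj₂ (⟪⟫-inj r)) q)

      -- Pairs are positive, so 0 codes the empty vector only.
      evs0 : ∀ {m n} (gs : Vec (PR n) m) ρ → 0 ≡ encPRs gs → 0 ≡ encV (evalPRs gs ρ)
      evs0 [] ρ q = refl
      evs0 (g ∷ gs) ρ q = ⊥-elim (n≮0 (≤-trans (proj₁ (⟪⟫-> (encPR g) (encPRs gs))) (≤-reflexive (sym q))))

      evs1 : ∀ {m n a b x y z} (gs : Vec (PR n) m) ρ → ⟪ a , b ⟫ ≡ encPRs gs → x ≡ encV ρ →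
        (∀ {n} (f : PR n) ρ → a ≡ encPR f → x ≡ encV ρ → y ≡ evalPR f ρ) →
        (∀ {m n} (gs : Vec (PR n) m) ρ → b ≡ encPRs gs → x ≡ encV ρ → z ≡ encV (evalPRs gs ρ)) → ⟪ y , z ⟫ ≡ encV (evalPRs gs ρ)
      evs1 {a = a} {b} [] ρ q r h k = ⊥-elim (n≮0 (≤-trans (proj₁ (⟪⟫-> a b)) (≤-reflexive q)))
      evs1 (g ∷ gs) ρ q r h k = cong₂ ⟪_,_⟫ (h g ρ (proj₁ (⟪⟫-inj q)) r) (k gs ρ (proj₂ (⟪⟫-inj q)) r)

      ev4 : ∀ {n a b x z} (f : PR n) → 4 ≡ prTag f × ⟪ a , b ⟫ ≡ prPay f → ∀ ρ → ⟪ 0 , x ⟫ ≡ encV ρ →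
        (∀ {n} (f : PR n) ρ → a ≡ encPR f → x ≡ encV ρ → z ≡ evalPR f ρ) → z ≡ evalPR f ρ
      ev4 (pr-rec g h) (_ , r) (k ∷ ρ) q i with ⟪⟫-inj q
      ... | refl , s = i g ρ (proj₁ (⟪⟫-inj r)) s

      ev4s : ∀ {n a b c x y z} (f : PR n) → 4 ≡ prTag f × ⟪ a , b ⟫ ≡ prPay f → ∀ ρ → ⟪ suc c , x ⟫ ≡ encV ρ →
        (∀ {n} (f : PR n) ρ → ⟪ 4 , ⟪ a , b ⟫ ⟫ ≡ encPR f → ⟪ c , x ⟫ ≡ encV ρ → y ≡ evalPR f ρ) →
        (∀ {n} (f : PR n) ρ → b ≡ encPR f → ⟪ c , ⟪ y , x ⟫ ⟫ ≡ encV ρ → z ≡ evalPR f ρ) → z ≡ evalPR f ρ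
      ev4s {c = c} (pr-rec g h) (_ , r) (k ∷ ρ) q i j with ⟪⟫-inj q
      ... | refl , refl with i (pr-rec g h) (c ∷ ρ) (cong ⟪ 4 ,_⟫ r) refl
      ... | refl = j h (c ∷ _ ∷ ρ) (proj₂ (⟪⟫-inj r)) refl

    ev-sound : All RuleSound evRules
    ev-sound =
      (λ { [] f ρ q r → ev0 f (proj₁ (invPR f q)) ρ }) ∷
      (λ { [] f ρ q r → ev1 f (proj₁ (invPR f q)) ρ r }) ∷
      (λ { [] f ρ q r → ev2 f (invPR f q) ρ r }) ∷
      (λ { (p ∷ []) f ρ q r → ev2s f (invPR f q) ρ r p }) ∷
      (λ { (p ∷ p′ ∷ []) f ρ q r → ev3 f (invPR f q) ρ r p p′ }) ∷
      (λ { [] gs ρ q r → evs0 gs ρ q }) ∷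
      (λ { (p ∷ p′ ∷ []) gs ρ q r → evs1 gs ρ q r p p′ }) ∷
      (λ { (p ∷ []) f ρ q r → ev4 f (invPR f q) ρ r p }) ∷
      (λ { (p ∷ p′ ∷ []) f ρ q r → ev4s f (invPR f q) ρ r p p′ }) ∷ []

    rank-bin : ∀ o {A A′ s} → rank A ≤ s → rank A′ ≤ s → rank (binM o A A′) ≤ suc s
    rank-bin ∧ₒ p q = s≤s (⊔-lub p q)
    rank-bin ∨ₒ p q = s≤s (⊔-lub p q)
    rank-bin ⇒ₒ p q = s≤s (⊔-lub p q)

    f-sound : All RuleSound fRules
    f-sound =
      (λ { [] → ⊥ₘ , refl , s≤s z≤n }) ∷
      (λ { {a = a} (refl ∷ refl ∷ []) → pv a , refl , ≤-refl }) ∷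
      (λ { ((A , q , r) ∷ []) → A , q , m≤n⇒m≤1+n r }) ∷
      (λ { ((A , refl , r) ∷ []) → ¬ₘ A , refl , s≤s r }) ∷
      (λ { ((A , refl , r) ∷ (A′ , refl , r′) ∷ (o , _ , _ , refl , _) ∷ []) → binM o A A′ , sym (System.enc-bin (modal L) o A A′) , rank-bin o r r′ }) ∷
      (λ { ((A , refl , r) ∷ refl ∷ refl ∷ []) → □ A , refl , s≤s r }) ∷ []

    ref-sound : All RuleSound refRules
    ref-sound =
      (λ { ((φ , q , p) ∷ []) → φ , q , λ _ _ → p }) ∷
      (λ { {a = a} {b} ((φ , q , p) ∷ l ∷ refl ∷ refl ∷ refl ∷ (ψ , refl) ∷ []) → ψ , refl ,
             λ h k → mp (≡subst (T ⊢_) (kF-inj _ (BoxF a b ⇒' ψ) (sym q)) (p h k)) (h a b l) }) ∷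
      (λ { {a = a} {b} ((φ , q , p) ∷ l ∷ refl ∷ refl ∷ refl ∷ (ψ , refl) ∷ []) → ψ , refl ,
             λ h k → mp (≡subst (T ⊢_) (kF-inj _ (¬' BoxF a b ⇒' ψ) (sym q)) (p h k)) (k a b l) }) ∷ []

    ax-sound : RuleSound (List.lookup (ruleList χ L) zero)
    ax-sound (p ∷ (φ , refl) ∷ []) = φ , refl , ax (χ-ok φ (sym (p χ (code φ ∷ []) refl (cong ⟪_, 0 ⟫ (kF≡code φ)))))

    rules-sound : All RuleSound (rulesFor χ L)
    rules-sound = ≡subst (All RuleSound) (rulesFor≡ χ L) $ ax-sound ∷ axiom-sound L refl ∷ Allₚ.++⁺ tt-sound (Allₚ.++⁺ term-sound (Allₚ.++⁺ sub-sound
      (Allₚ.++⁺ val-sound (Allₚ.++⁺ thm-sound (Allₚ.++⁺ ev-sound (Allₚ.++⁺ f-sound ref-sound))))))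

    open Horn (rulesFor χ L) baseTags

    opaque
      mutual
        der-sound : (∀ {F} → B F → Any (ftag F ≡_) baseTags) → ∀ {F} → Der e B F → Holds F
        der-sound h {F} (base b) = base-holds F b (h b)
          where
          base-holds : ∀ F → B F → Any (ftag F ≡_) baseTags → Holds F
          base-holds (fact .13 _ _ _ _) p (here refl) = p
          base-holds (fact .14 _ _ _ _) p (there (here refl)) = p
          base-holds (fact .15 _ _ _ _) p (there (there (here refl))) = p
        der-sound h (rule {r} r∈ v@(a ∷ b ∷ c ∷ d ∷ x ∷ y ∷ z ∷ u ∷ []) ps) = All.lookup rules-sound r∈ (der-sounds h v ps)

        der-sounds : (∀ {F} → B F → Any (ftag F ≡_) baseTags) → ∀ v {As} →
          All (λ A → Der e B (evA e (lookup v) A)) As → All (λ A → Holds (evA e (lookup v) A)) As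
        der-sounds h v [] = []
        der-sounds h v (p ∷ ps) = der-sound h p ∷ der-sounds h v ps

open RuleSoundness

-- Derivations of true facts from the Horn rules

module RuleCompleteness where
  open import Data.Maybe using (Maybe; just; nothing)

  module Split {X : Set} (_≟ₓ_ : (p q : X) → Dec (p ≡ q)) where

    Literals : Set
    Literals = List (X × Bool)

    assoc : Literals → X → Bool
    assoc [] p = false
    assoc ((q , u) ∷ l) p with p ≟ₓ q
    ... | yes _ = u
    ... | no _ = assoc l p

    Functional : Literals → Set
    Functional l = ∀ {p u} → (p , u) ∈ l → assoc l p ≡ u

    Dom : Literals → X → Set
    Dom l p = ∃ λ u → (p , u) ∈ l

    dom? : ∀ l p → Dec (Dom l p)
    dom? [] p = no λ ()
    dom? ((q , u) ∷ l) p with p ≟ₓ q | dom? l p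
    ... | yes refl | _ = yes (u , here refl)
    ... | no _ | yes (u , m) = yes (u , there m)
    ... | no ne | no nd = no λ { (_ , here refl) → ne refl ; (u , there m) → nd (u , m) }

    extend : ∀ {l p} u → Functional l → ¬ Dom l p → Functional ((p , u) ∷ l)
    extend {l} {p} u f nd (here refl) with p ≟ₓ p
    ... | yes _ = refl
    ... | no ne = ⊥-elim (ne refl)
    extend {l} {p} u f nd {q} (there m) with q ≟ₓ p
    ... | yes refl = ⊥-elim (nd (_ , m))
    ... | no _ = f m

    -- Serves twice: for truth-table derivations inside the databases, where D is a derivable value,
    -- and for the completeness argument, where D is provability in L under the literals.
    splitAll : (D : Literals → Set) → (∀ p l → D ((p , true) ∷ l) → D ((p , false) ∷ l) → D l) →
      ∀ ps l → Functional l → (∀ l′ → (∀ {x} → x ∈ l → x ∈ l′) → Functional l′ → All (Dom l′) ps → D l′) → D l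
    splitAll D step [] l f h = h l id f []
    splitAll D step (p ∷ ps) l f h with dom? l p
    ... | yes (u , m) = splitAll D step ps l f λ l′ s f′ d → h l′ s f′ ((u , s m) ∷ d)
    ... | no nd = step p l (branch true) (branch false)
      where
      branch : ∀ u → D ((p , u) ∷ l)
      branch u = splitAll D step ps ((p , u) ∷ l) (extend u f nd) λ l′ s f′ d → h l′ (s ∘ there) f′ ((u , s (here refl)) ∷ d)

  -- Rules are addressed by position, so that `refl` selects one while the complete list stays
  -- opaque.
  nth : {A : Set} → List A → ℕ → Maybe A
  nth [] k = nothing
  nth (x ∷ l) zero = just x
  nth (x ∷ l) (suc k) = nth l k

  nth-∈ : {A : Set} → ∀ (l : List A) k {x} → nth l k ≡ just x → x ∈ l
  nth-∈ (x ∷ l) zero refl = here refl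
  nth-∈ (x ∷ l) (suc k) q = there (nth-∈ l k q)

  mprimes : MFormula → List MFormula
  mprimes (pv i) = pv i ∷ []
  mprimes ⊥ₘ = []
  mprimes (¬ₘ A) = mprimes A
  mprimes (A ∧ₘ B) = mprimes A ++ mprimes B
  mprimes (A ∨ₘ B) = mprimes A ++ mprimes B
  mprimes (A ⇒ₘ B) = mprimes A ++ mprimes B
  mprimes (□ A) = □ A ∷ []

  module Complete (χ : PR 1) (L : Logic) (Mx : Formula) (B : Fact → Set) where
    open Coding Mx
    private
      rules : List Rule
      rules = rulesFor χ L
    open Horn rules baseTags

    D : Fact → Set
    D = Der e B

    private
      Block : List Rule → Set
      Block l = ∀ k {r} → nth l k ≡ just r → ∀ v → All (λ A → D (evA e (lookup v) A)) (prems r) → D (evA e (lookup v) (concl r))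

      block : ∀ l → (∀ {r} → r ∈ l → r ∈ ruleList χ L) → Block l
      block l s k {r} q v ps = rule (≡subst (r ∈_) (rulesFor≡ χ L) (s (nth-∈ l k q))) v ps

      ruleTop : Block (ruleList χ L)
      ruleTop = block (ruleList χ L) id
      ruleTT : Block ttRules
      ruleTT = block ttRules (there ∘ there ∘ ∈-++⁺ˡ)
      ruleTm : Block termRules
      ruleTm = block termRules (there ∘ there ∘ ∈-++⁺ʳ ttRules ∘ ∈-++⁺ˡ)
      ruleSub : Block subRules
      ruleSub = block subRules (there ∘ there ∘ ∈-++⁺ʳ ttRules ∘ ∈-++⁺ʳ termRules ∘ ∈-++⁺ˡ)
      ruleVal : Block valRules
      ruleVal = block valRules (there ∘ there ∘ ∈-++⁺ʳ ttRules ∘ ∈-++⁺ʳ termRules ∘ ∈-++⁺ʳ subRules ∘ ∈-++⁺ˡ)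
      ruleThm : Block thmRules
      ruleThm = block thmRules (there ∘ there ∘ ∈-++⁺ʳ ttRules ∘ ∈-++⁺ʳ termRules ∘ ∈-++⁺ʳ subRules ∘ ∈-++⁺ʳ valRules ∘ ∈-++⁺ˡ)
      ruleEv : Block evRules
      ruleEv = block evRules (there ∘ there ∘ ∈-++⁺ʳ ttRules ∘ ∈-++⁺ʳ termRules ∘ ∈-++⁺ʳ subRules ∘ ∈-++⁺ʳ valRules ∘ ∈-++⁺ʳ thmRules ∘ ∈-++⁺ˡ)
      ruleF : Block fRules
      ruleF = block fRules (there ∘ there ∘ ∈-++⁺ʳ ttRules ∘ ∈-++⁺ʳ termRules ∘ ∈-++⁺ʳ subRules ∘ ∈-++⁺ʳ valRules ∘ ∈-++⁺ʳ thmRules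
        ∘ ∈-++⁺ʳ evRules ∘ ∈-++⁺ˡ)
      ruleRef : Block refRules
      ruleRef = block refRules (there ∘ there ∘ ∈-++⁺ʳ ttRules ∘ ∈-++⁺ʳ termRules ∘ ∈-++⁺ʳ subRules ∘ ∈-++⁺ʳ valRules ∘ ∈-++⁺ʳ thmRules
        ∘ ∈-++⁺ʳ evRules ∘ ∈-++⁺ʳ fRules)

    dTT : ∀ o u v → D (fact 7 (opTag o) (b2n u) (b2n v) (b2n (opB o u v)))
    dTT ∧ₒ true true = ruleTT 0 refl (vals 0 0 0 0 0 0 0 0) []
    dTT ∧ₒ true false = ruleTT 1 refl (vals 0 0 0 0 0 0 0 0) []
    dTT ∧ₒ false true = ruleTT 2 refl (vals 0 0 0 0 0 0 0 0) []
    dTT ∧ₒ false false = ruleTT 3 refl (vals 0 0 0 0 0 0 0 0) []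
    dTT ∨ₒ true true = ruleTT 4 refl (vals 0 0 0 0 0 0 0 0) []
    dTT ∨ₒ true false = ruleTT 5 refl (vals 0 0 0 0 0 0 0 0) []
    dTT ∨ₒ false true = ruleTT 6 refl (vals 0 0 0 0 0 0 0 0) []
    dTT ∨ₒ false false = ruleTT 7 refl (vals 0 0 0 0 0 0 0 0) []
    dTT ⇒ₒ true true = ruleTT 8 refl (vals 0 0 0 0 0 0 0 0) []
    dTT ⇒ₒ true false = ruleTT 9 refl (vals 0 0 0 0 0 0 0 0) []
    dTT ⇒ₒ false true = ruleTT 10 refl (vals 0 0 0 0 0 0 0 0) []
    dTT ⇒ₒ false false = ruleTT 11 refl (vals 0 0 0 0 0 0 0 0) []

    dTm : ∀ t → D (fact 0 (kT t) 0 0 0)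
    dTm (var k) = ruleTm 0 refl (vals k 0 0 0 0 0 0 0) []
    dTm zr = ruleTm 1 refl (vals 0 0 0 0 0 0 0 0) []
    dTm (S t) = ruleTm 2 refl (vals (kT t) 0 0 0 0 0 0 0) (dTm t ∷ [])
    dTm (t ⊕ s) = ruleTm 3 refl (vals (kT t) (kT s) 0 0 0 0 0 0) (dTm t ∷ dTm s ∷ [])
    dTm (t ⊗ s) = ruleTm 4 refl (vals (kT t) (kT s) 0 0 0 0 0 0) (dTm t ∷ dTm s ∷ [])

    dGneg : ∀ {b x} → D (fact 1 b x 0 0) → D (fact 1 b ⟪ 2 , x ⟫ 0 0)
    dGneg {b} {x} p = ruleTm 9 refl (vals 0 b 0 0 x 0 0 0) (p ∷ [])

    dGbin : ∀ o {b x y} → D (fact 1 b x 0 0) → D (fact 1 b y 0 0) → D (fact 1 b ⟪ opTag o , ⟪ x , y ⟫ ⟫ 0 0)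
    dGbin o {b} {x} {y} p q = ruleTm 10 refl (vals (opTag o) b 1 1 x y 0 (b2n (opB o true true))) (p ∷ q ∷ dTT o true true ∷ [])

    dG0 : ∀ φ → D (fact 1 0 (kF φ) 0 0)
    dG0 (t ≐ s) = ruleTm 5 refl (vals (kT t) (kT s) 0 0 0 0 0 0) (dTm t ∷ dTm s ∷ [])
    dG0 ⊥' = ruleTm 6 refl (vals 0 0 0 0 0 0 0 0) []
    dG0 (¬' φ) = dGneg (dG0 φ)
    dG0 (φ ∧' ψ) = dGbin ∧ₒ (dG0 φ) (dG0 ψ)
    dG0 (φ ∨' ψ) = dGbin ∨ₒ (dG0 φ) (dG0 ψ)
    dG0 (φ ⇒' ψ) = dGbin ⇒ₒ (dG0 φ) (dG0 ψ)
    dG0 (∀' φ) = ruleTm 7 refl (vals 0 0 0 0 (kF φ) 0 0 0) (dG0 φ ∷ [])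
    dG0 (∃' φ) = ruleTm 8 refl (vals 0 0 0 0 (kF φ) 0 0 0) (dG0 φ ∷ [])

    dNum : ∀ k → D (fact 5 k (kT (numeral k)) 0 0)
    dNum zero = ruleTm 14 refl (vals 0 0 0 0 0 0 0 0) []
    dNum (suc k) = ruleTm 15 refl (vals k (kT (numeral k)) 0 0 0 0 0 0) (dNum k ∷ [])

    private
      kn : ℕ → ℕ
      kn k = kT (numeral k)

    dG1 : ∀ A → D (fact 1 1 (kF (ff A)) 0 0)
    dG1 (pv i) = ruleTm 13 refl (vals (kn i) (kn e) 0 0 i 0 0 0) (dNum i ∷ dNum e ∷ [])
    dG1 ⊥ₘ = ruleTm 11 refl (vals 0 0 0 0 0 0 0 0) []
    dG1 (¬ₘ A) = dGneg (dG1 A)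
    dG1 (A ∧ₘ A′) = dGbin ∧ₒ (dG1 A) (dG1 A′)
    dG1 (A ∨ₘ A′) = dGbin ∨ₒ (dG1 A) (dG1 A′)
    dG1 (A ⇒ₘ A′) = dGbin ⇒ₒ (dG1 A) (dG1 A′)
    dG1 (□ A) = ruleTm 12 refl (vals (kn (kF (ff A))) (kn e) 0 0 (kF (ff A)) 0 0 0) (dG1 A ∷ dNum _ ∷ dNum e ∷ [])

    -- Comes before `dST` because the value of a lifted substitution is a shifted term; `dVa` would
    -- otherwise call `dST` on a term that is not smaller.
    dSTsh : ∀ t → D (fact 3 (encS shˢ) (kT t) (kT (shiftT t)) 0)
    dSTsh (var k) = ruleSub 5 refl (vals (encS shˢ) k (kT (var (suc k))) 0 0 0 0 0)
      (ruleSub 0 refl (vals k 0 0 0 0 0 0 0) [] ∷ [])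
    dSTsh zr = ruleSub 6 refl (vals (encS shˢ) 0 0 0 0 0 0 0) []
    dSTsh (S t) = ruleSub 7 refl (vals (encS shˢ) (kT t) (kT (shiftT t)) 0 0 0 0 0) (dSTsh t ∷ [])
    dSTsh (t ⊕ s) = ruleSub 8 refl (vals (encS shˢ) (kT t) (kT (shiftT t)) 0 (kT s) (kT (shiftT s)) 0 0) (dSTsh t ∷ dSTsh s ∷ [])
    dSTsh (t ⊗ s) = ruleSub 9 refl (vals (encS shˢ) (kT t) (kT (shiftT t)) 0 (kT s) (kT (shiftT s)) 0 0) (dSTsh t ∷ dSTsh s ∷ [])

    dVa : ∀ σ k → D (fact 2 (encS σ) k (kT (⟦ σ ⟧ˢ k)) 0)
    dVa shˢ k = ruleSub 0 refl (vals k 0 0 0 0 0 0 0) []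
    dVa (insˢ t) zero = ruleSub 1 refl (vals (kT t) 0 0 0 0 0 0 0) []
    dVa (insˢ t) (suc k) = ruleSub 2 refl (vals (kT t) k 0 0 0 0 0 0) []
    dVa (lftˢ σ) zero = ruleSub 3 refl (vals (encS σ) 0 0 0 0 0 0 0) []
    dVa (lftˢ σ) (suc k) = ruleSub 4 refl (vals (encS σ) k (kT (⟦ σ ⟧ˢ k)) (kT (shiftT (⟦ σ ⟧ˢ k))) 0 0 0 0) (dVa σ k ∷ dSTsh (⟦ σ ⟧ˢ k) ∷ [])

    dST : ∀ σ t → D (fact 3 (encS σ) (kT t) (kT (substT ⟦ σ ⟧ˢ t)) 0)
    dST σ (var k) = ruleSub 5 refl (vals (encS σ) k (kT (⟦ σ ⟧ˢ k)) 0 0 0 0 0) (dVa σ k ∷ [])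
    dST σ zr = ruleSub 6 refl (vals (encS σ) 0 0 0 0 0 0 0) []
    dST σ (S t) = ruleSub 7 refl (vals (encS σ) (kT t) (kT (substT ⟦ σ ⟧ˢ t)) 0 0 0 0 0) (dST σ t ∷ [])
    dST σ (t ⊕ s) = ruleSub 8 refl (vals (encS σ) (kT t) (kT (substT ⟦ σ ⟧ˢ t)) 0 (kT s) (kT (substT ⟦ σ ⟧ˢ s)) 0 0) (dST σ t ∷ dST σ s ∷ [])
    dST σ (t ⊗ s) = ruleSub 9 refl (vals (encS σ) (kT t) (kT (substT ⟦ σ ⟧ˢ t)) 0 (kT s) (kT (substT ⟦ σ ⟧ˢ s)) 0 0) (dST σ t ∷ dST σ s ∷ [])

    dSF : ∀ σ φ → D (fact 4 (encS σ) (kF φ) (kF (subst ⟦ σ ⟧ˢ φ)) 0)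
    dSF σ (t ≐ s) = ruleSub 10 refl (vals (encS σ) (kT t) (kT (substT ⟦ σ ⟧ˢ t)) 0 (kT s) (kT (substT ⟦ σ ⟧ˢ s)) 0 0) (dST σ t ∷ dST σ s ∷ [])
    dSF σ ⊥' = ruleSub 11 refl (vals (encS σ) 0 0 0 0 0 0 0) []
    dSF σ (¬' φ) = ruleSub 12 refl (vals (encS σ) (kF φ) (kF (subst ⟦ σ ⟧ˢ φ)) 0 0 0 0 0) (dSF σ φ ∷ [])
    dSF σ (φ ∧' ψ) = ruleSub 13 refl (vals (encS σ) (kF φ) (kF (subst ⟦ σ ⟧ˢ φ)) 0 (kF ψ) (kF (subst ⟦ σ ⟧ˢ ψ)) 0 0) (dSF σ φ ∷ dSF σ ψ ∷ [])
    dSF σ (φ ∨' ψ) = ruleSub 14 refl (vals (encS σ) (kF φ) (kF (subst ⟦ σ ⟧ˢ φ)) 0 (kF ψ) (kF (subst ⟦ σ ⟧ˢ ψ)) 0 0) (dSF σ φ ∷ dSF σ ψ ∷ [])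
    dSF σ (φ ⇒' ψ) = ruleSub 15 refl (vals (encS σ) (kF φ) (kF (subst ⟦ σ ⟧ˢ φ)) 0 (kF ψ) (kF (subst ⟦ σ ⟧ˢ ψ)) 0 0) (dSF σ φ ∷ dSF σ ψ ∷ [])
    dSF σ (∀' φ) = ruleSub 16 refl (vals (encS σ) (kF φ) (kF (subst (lift ⟦ σ ⟧ˢ) φ)) 0 0 0 0 0) (dSF (lftˢ σ) φ ∷ [])
    dSF σ (∃' φ) = ruleSub 17 refl (vals (encS σ) (kF φ) (kF (subst (lift ⟦ σ ⟧ˢ) φ)) 0 0 0 0 0) (dSF (lftˢ σ) φ ∷ [])

    dInst : ∀ t φ → D (fact 4 (encS (insˢ t)) (kF φ) (kF (inst t φ)) 0)
    dInst t φ = ≡subst (λ ψ → D (fact 4 (encS (insˢ t)) (kF φ) (kF ψ) 0)) (ins≡inst t φ) (dSF (insˢ t) φ)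

    module Tautologies (P : System) (b : ℕ) (dG : ∀ p → D (fact 1 b (kF (System.enc P p)) 0 0))
                       (_≟ₓ_ : (p q : System.X P) → Dec (p ≡ q)) where
      open System P
      open Split _≟ₓ_
      open Prop P using (litS)

      private
        ⌈_⌉ : X → ℕ
        ⌈ p ⌉ = kF (enc p)

      ctx : X → Literals → X
      ctx g [] = g
      ctx g ((p , u) ∷ l) = bin ∧ₒ (ctx g l) (litS u p)

      V' : X → X → Bool → Set
      V' g p u = D (fact 6 b ⌈ g ⌉ ⌈ p ⌉ (b2n u))

      vNeg : ∀ {g p} u → V' g p u → V' g (neg p) (not u)
      vNeg {g} {p} true v rewrite enc-neg p = ruleVal 3 refl (vals 0 b ⌈ g ⌉ 0 ⌈ p ⌉ 0 0 0) (v ∷ [])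
      vNeg {g} {p} false v rewrite enc-neg p = ruleVal 4 refl (vals 0 b ⌈ g ⌉ 0 ⌈ p ⌉ 0 0 0) (v ∷ [])

      vBin : ∀ o {g p q} u v → V' g p u → V' g q v → V' g (bin o p q) (opB o u v)
      vBin o {g} {p} {q} u v h k rewrite enc-bin o p q =
        ruleVal 5 refl (vals (opTag o) b ⌈ g ⌉ (b2n u) ⌈ p ⌉ ⌈ q ⌉ (b2n v) (b2n (opB o u v))) (h ∷ k ∷ dTT o u v ∷ [])

      vLit : ∀ g l {p u} → (p , u) ∈ l → V' (ctx g l) p u
      vLit g ((p , true) ∷ l) (here refl) rewrite enc-bin ∧ₒ (ctx g l) p =
        ruleVal 0 refl (vals 0 b ⌈ ctx g l ⌉ 0 ⌈ p ⌉ 0 0 0) (dG (ctx g l) ∷ dG p ∷ [])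
      vLit g ((p , false) ∷ l) (here refl) rewrite enc-bin ∧ₒ (ctx g l) (neg p) | enc-neg p =
        ruleVal 1 refl (vals 0 b ⌈ ctx g l ⌉ 0 ⌈ p ⌉ 0 0 0) (dG (ctx g l) ∷ dG p ∷ [])
      vLit g ((q , v) ∷ l) {p} {u} (there m) rewrite enc-bin ∧ₒ (ctx g l) (litS v q) =
        ruleVal 2 refl (vals 0 b ⌈ ctx g l ⌉ 0 ⌈ p ⌉ ⌈ litS v q ⌉ 0 (b2n u)) (vLit g l m ∷ dG (litS v q) ∷ [])

      vSplit : ∀ {g x} p l → V' (ctx g ((p , true) ∷ l)) x true → V' (ctx g ((p , false) ∷ l)) x true → V' (ctx g l) x true
      vSplit {g} {x} p l h k rewrite enc-bin ∧ₒ (ctx g l) p | enc-bin ∧ₒ (ctx g l) (neg p) | enc-neg p =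
        ruleVal 7 refl (vals 0 b ⌈ ctx g l ⌉ 0 ⌈ x ⌉ ⌈ p ⌉ 0 0) (h ∷ k ∷ dG (ctx g l) ∷ dG p ∷ dG x ∷ [])

      vThm : ∀ {x} → (∀ g → V' g x true) → X → D (fact 8 b ⌈ x ⌉ 0 0)
      vThm {x} h g = ruleVal 8 refl (vals 0 b 0 0 ⌈ x ⌉ ⌈ g ⌉ 0 0) (h g ∷ ≡subst (λ y → D (fact 6 b y ⌈ x ⌉ 1)) (enc-neg g) (h (neg g)) ∷ dG g ∷ dG x ∷ [])

      decided : ∀ x ps → X → (∀ g l → Functional l → All (Dom l) ps → V' (ctx g l) x true) → D (fact 8 b ⌈ x ⌉ 0 0)
      decided x ps g₀ h = vThm (λ g → splitAll (λ l → V' (ctx g l) x true) (vSplit {g} {x}) ps [] (λ ()) λ l _ f d → h g l f d) g₀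

    _≟M_ : (A A′ : MFormula) → Dec (A ≡ A′)
    A ≟M A′ = map′ (ff-inj A A′) (cong ff) (ff A ≟F ff A′)

    private
      -- The theory plays no role for the derivability of tautologies.
      module Tₐ = Tautologies (formulas (λ _ → ⊥)) 0 dG0 _≟F_
      module Tₘ = Tautologies (modal L) 1 dG1 _≟M_
      module Sₐ = Split _≟F_
      module Sₘ = Split _≟M_

    dValue : ∀ g l → Sₐ.Functional l → ∀ φ → All (Sₐ.Dom l) (primes φ) → Tₐ.V' (Tₐ.ctx g l) φ (evalB (Sₐ.assoc l) φ)
    dValue g l f φ@(_ ≐ _) ((u , m) ∷ []) = ≡subst (Tₐ.V' (Tₐ.ctx g l) φ) (sym (f m)) (Tₐ.vLit g l m)
    dValue g l f ⊥' d = ruleVal 6 refl (vals 0 0 (kF (Tₐ.ctx g l)) 0 0 0 0 0) (dG0 (Tₐ.ctx g l) ∷ [])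
    dValue g l f (¬' φ) d = Tₐ.vNeg {Tₐ.ctx g l} {φ} _ (dValue g l f φ d)
    dValue g l f (φ ∧' ψ) d = Tₐ.vBin ∧ₒ {Tₐ.ctx g l} {φ} {ψ} _ _ (dValue g l f φ (Allₚ.++⁻ˡ (primes φ) d)) (dValue g l f ψ (Allₚ.++⁻ʳ (primes φ) d))
    dValue g l f (φ ∨' ψ) d = Tₐ.vBin ∨ₒ {Tₐ.ctx g l} {φ} {ψ} _ _ (dValue g l f φ (Allₚ.++⁻ˡ (primes φ) d)) (dValue g l f ψ (Allₚ.++⁻ʳ (primes φ) d))
    dValue g l f (φ ⇒' ψ) d = Tₐ.vBin ⇒ₒ {Tₐ.ctx g l} {φ} {ψ} _ _ (dValue g l f φ (Allₚ.++⁻ˡ (primes φ) d)) (dValue g l f ψ (Allₚ.++⁻ʳ (primes φ) d))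
    dValue g l f φ@(∀' _) ((u , m) ∷ []) = ≡subst (Tₐ.V' (Tₐ.ctx g l) φ) (sym (f m)) (Tₐ.vLit g l m)
    dValue g l f φ@(∃' _) ((u , m) ∷ []) = ≡subst (Tₐ.V' (Tₐ.ctx g l) φ) (sym (f m)) (Tₐ.vLit g l m)

    valM : Sₘ.Literals → MFormula → Bool
    valM l = evalM (λ i → Sₘ.assoc l (pv i)) (λ A → Sₘ.assoc l (□ A))

    dValueM : ∀ g l → Sₘ.Functional l → ∀ A → All (Sₘ.Dom l) (mprimes A) → Tₘ.V' (Tₘ.ctx g l) A (valM l A)
    dValueM g l f A@(pv _) ((u , m) ∷ []) = ≡subst (Tₘ.V' (Tₘ.ctx g l) A) (sym (f m)) (Tₘ.vLit g l m)
    dValueM g l f ⊥ₘ d = ruleThm 8 refl (vals 0 0 (kF (ff (Tₘ.ctx g l))) 0 0 0 0 0) (dG1 (Tₘ.ctx g l) ∷ [])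
    dValueM g l f (¬ₘ A) d = Tₘ.vNeg {Tₘ.ctx g l} {A} _ (dValueM g l f A d)
    dValueM g l f (A ∧ₘ A′) d = Tₘ.vBin ∧ₒ {Tₘ.ctx g l} {A} {A′} _ _ (dValueM g l f A (Allₚ.++⁻ˡ (mprimes A) d)) (dValueM g l f A′ (Allₚ.++⁻ʳ (mprimes A) d))
    dValueM g l f (A ∨ₘ A′) d = Tₘ.vBin ∨ₒ {Tₘ.ctx g l} {A} {A′} _ _ (dValueM g l f A (Allₚ.++⁻ˡ (mprimes A) d)) (dValueM g l f A′ (Allₚ.++⁻ʳ (mprimes A) d))
    dValueM g l f (A ⇒ₘ A′) d = Tₘ.vBin ⇒ₒ {Tₘ.ctx g l} {A} {A′} _ _ (dValueM g l f A (Allₚ.++⁻ˡ (mprimes A) d)) (dValueM g l f A′ (Allₚ.++⁻ʳ (mprimes A) d))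
    dValueM g l f A@(□ _) ((u , m) ∷ []) = ≡subst (Tₘ.V' (Tₘ.ctx g l) A) (sym (f m)) (Tₘ.vLit g l m)

    dTaut : ∀ {φ} → Tautology φ → D (fact 8 0 (kF φ) 0 0)
    dTaut {φ} t = Tₐ.decided φ (primes φ) ⊥' λ g l f d → ≡subst (Tₐ.V' (Tₐ.ctx g l) φ) (t (Sₐ.assoc l)) (dValue g l f φ d)

    dMTaut : ∀ {A} → MTautology A → D (fact 8 1 (kF (ff A)) 0 0)
    dMTaut {A} t = Tₘ.decided A (mprimes A) ⊥ₘ λ g l f d → ≡subst (Tₘ.V' (Tₘ.ctx g l) A) (t _ _) (dValueM g l f A d)

    mutual
      dEv : ∀ {n} (f : PR n) ρ → D (fact 9 (encPR f) (encV ρ) (evalPR f ρ) 0)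
      dEv pr-zero ρ = ruleEv 0 refl (vals 0 0 0 0 (encV ρ) 0 0 0) []
      dEv pr-succ (x ∷ []) = ruleEv 1 refl (vals 0 0 0 0 x 0 0 0) []
      dEv (pr-proj i) ρ = dProj i ρ
      dEv (pr-comp f gs) ρ = ruleEv 4 refl (vals (encPR f) (encPRs gs) 0 0 (encV ρ) (encV (evalPRs gs ρ)) (evalPR f (evalPRs gs ρ)) 0)
        (dEvs gs ρ ∷ dEv f (evalPRs gs ρ) ∷ [])
      dEv (pr-rec g h) (zero ∷ ρ) = ruleEv 7 refl (vals (encPR g) (encPR h) 0 0 (encV ρ) 0 (evalPR g ρ) 0) (dEv g ρ ∷ [])
      dEv (pr-rec g h) (suc k ∷ ρ) = ruleEv 8 refl
        (vals (encPR g) (encPR h) k 0 (encV ρ) (evalPR (pr-rec g h) (k ∷ ρ)) (evalPR (pr-rec g h) (suc k ∷ ρ)) 0)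
        (dEv (pr-rec g h) (k ∷ ρ) ∷ dEv h (k ∷ evalPR (pr-rec g h) (k ∷ ρ) ∷ ρ) ∷ [])

      dProj : ∀ {n} (i : Fin n) ρ → D (fact 9 ⟪ 2 , toℕ i ⟫ (encV ρ) (lookup ρ i) 0)
      dProj zero (x ∷ ρ) = ruleEv 2 refl (vals 0 0 0 0 x (encV ρ) 0 0) []
      dProj (suc i) (x ∷ ρ) = ruleEv 3 refl (vals (toℕ i) 0 0 0 x (encV ρ) (lookup ρ i) 0) (dProj i ρ ∷ [])

      dEvs : ∀ {m n} (gs : Vec (PR n) m) ρ → D (fact 10 (encPRs gs) (encV ρ) (encV (evalPRs gs ρ)) 0)
      dEvs [] ρ = ruleEv 5 refl (vals 0 0 0 0 (encV ρ) 0 0 0) []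
      dEvs (g ∷ gs) ρ = ruleEv 6 refl (vals (encPR g) (encPRs gs) 0 0 (encV ρ) (evalPR g ρ) (encV (evalPRs gs ρ)) 0) (dEv g ρ ∷ dEvs gs ρ ∷ [])

    dThm0 : {T : Theory} → (∀ φ → T φ → evalPR χ (code φ ∷ []) ≡ 1) → ∀ {φ} → T ⊢ φ → D (fact 8 0 (kF φ) 0 0)
    dThm0 h {φ} (ax p) = ruleTop 0 refl (vals 0 0 0 0 (kF φ) 0 0 0)
      (≡subst₂ (λ x v → D (fact 9 (encPR χ) ⟪ x , 0 ⟫ v 0)) (sym (kF≡code φ)) (h φ p) (dEv χ (code φ ∷ [])) ∷ dG0 φ ∷ [])
      where
      ≡subst₂ : ∀ (P : ℕ → ℕ → Set) {x x′ y y′} → x ≡ x′ → y ≡ y′ → P x y → P x′ y′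
      ≡subst₂ P refl refl p = p
    dThm0 h (taut {φ} t) = dTaut {φ} t
    dThm0 h (∀-elim φ t) = ruleThm 0 refl (vals (kT t) 0 0 0 (kF φ) (kF (inst t φ)) 0 0) (dInst t φ ∷ dTm t ∷ dG0 φ ∷ [])
    dThm0 h (∀-intro φ ψ) = ruleThm 1 refl (vals 0 0 0 0 (kF φ) (kF ψ) (kF (shift ψ)) 0) (dSF shˢ ψ ∷ dG0 φ ∷ dG0 ψ ∷ [])
    dThm0 h (∃-intro φ t) = ruleThm 2 refl (vals (kT t) 0 0 0 (kF φ) (kF (inst t φ)) 0 0) (dInst t φ ∷ dTm t ∷ dG0 φ ∷ [])
    dThm0 h (∃-elim φ ψ) = ruleThm 3 refl (vals 0 0 0 0 (kF φ) (kF ψ) (kF (shift ψ)) 0) (dSF shˢ ψ ∷ dG0 φ ∷ dG0 ψ ∷ [])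
    dThm0 h (eq-refl t) = ruleThm 4 refl (vals (kT t) 0 0 0 0 0 0 0) (dTm t ∷ [])
    dThm0 h (eq-subst φ t s) = ruleThm 5 refl (vals (kT t) (kT s) 0 0 (kF φ) (kF (inst t φ)) (kF (inst s φ)) 0)
      (dInst t φ ∷ dInst s φ ∷ dTm t ∷ dTm s ∷ dG0 φ ∷ [])
    dThm0 h (mp {φ} {ψ} p q) = ruleThm 6 refl (vals 0 0 0 0 (kF φ) (kF ψ) 0 0) (dThm0 h p ∷ dThm0 h q ∷ dG0 ψ ∷ [])
    dThm0 h (gen {φ} p) = ruleThm 7 refl (vals 0 0 0 0 (kF φ) 0 0 0) (dThm0 h p ∷ [])

    dExtra : ∀ L′ → L ≡ L′ → ∀ {A} → ExtraAx L′ A → D (fact 8 1 (kF (ff A)) 0 0)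
    dExtra ENP refl P-ax = ruleTop 1 refl (vals (kn (kF (ff ⊥ₘ))) (kn e) 0 0 0 0 0 0) (dNum _ ∷ dNum e ∷ [])
    dExtra END refl (D-ax A) = ruleTop 1 refl (vals (kn (kF (ff A))) (kn (kF (ff (¬ₘ A)))) (kn e) 0 (kF (ff A)) 0 0 0)
      (dG1 A ∷ dNum _ ∷ dNum _ ∷ dNum e ∷ [])

    dThm1 : ∀ {A} → L ⊢ₘ A → D (fact 8 1 (kF (ff A)) 0 0)
    dThm1 (m-taut {A} t) = dMTaut {A} t
    dThm1 (m-ax x) = dExtra L refl x
    dThm1 (m-mp {A} {A′} p q) = ruleThm 6 refl (vals 0 1 0 0 (kF (ff A)) (kF (ff A′)) 0 0) (dThm1 p ∷ dThm1 q ∷ dG1 A′ ∷ [])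
    dThm1 (m-nec {A} p) = ruleThm 9 refl (vals (kn (kF (ff A))) (kn e) 0 0 (kF (ff A)) 0 0 0) (dThm1 p ∷ dNum _ ∷ dNum e ∷ [])
    dThm1 (m-re {A} {A′} p) = ruleThm 10 refl (vals (kn (kF (ff A))) (kn (kF (ff A′))) (kn e) 0 (kF (ff A)) (kF (ff A′)) 0 0)
      (dThm1 p ∷ dG1 A ∷ dG1 A′ ∷ dNum _ ∷ dNum _ ∷ dNum e ∷ [])

    private
      F-bin : ∀ o {s x y} → D (fact 11 s x 0 0) → D (fact 11 s y 0 0) → D (fact 11 (suc s) ⟪ opTag o , ⟪ x , y ⟫ ⟫ 0 0)
      F-bin o {s} {x} {y} p q = ruleF 4 refl (vals s 0 1 1 x y (opTag o) (b2n (opB o true true))) (p ∷ q ∷ dTT o true true ∷ [])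

      F-mono : ∀ {s x} → D (fact 11 s x 0 0) → D (fact 11 (suc s) x 0 0)
      F-mono {s} {x} p = ruleF 2 refl (vals s 0 0 0 x 0 0 0) (p ∷ [])

    dF : ∀ A s → rank A ≤ s → D (fact 11 s (kF (ff A)) 0 0)
    dF (pv i) (suc s) (s≤s r) = go s (≤⇒≤′ r)
      where
      go : ∀ s → i ≤′ s → D (fact 11 (suc s) (kF (ff (pv i))) 0 0)
      go s ≤′-refl = ruleF 1 refl (vals i (kn i) (kn e) 0 0 0 0 0) (dNum i ∷ dNum e ∷ [])
      go (suc s) (≤′-step r) = F-mono (go s r)
    dF ⊥ₘ (suc s) r = ruleF 0 refl (vals s 0 0 0 0 0 0 0) []
    dF (¬ₘ A) (suc s) (s≤s r) = ruleF 3 refl (vals s 0 0 0 (kF (ff A)) 0 0 0) (dF A s r ∷ [])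
    dF (A ∧ₘ A′) (suc s) (s≤s r) = F-bin ∧ₒ (dF A s (m⊔n≤o⇒m≤o _ _ r)) (dF A′ s (m⊔n≤o⇒n≤o _ _ r))
    dF (A ∨ₘ A′) (suc s) (s≤s r) = F-bin ∨ₒ (dF A s (m⊔n≤o⇒m≤o _ _ r)) (dF A′ s (m⊔n≤o⇒n≤o _ _ r))
    dF (A ⇒ₘ A′) (suc s) (s≤s r) = F-bin ⇒ₒ (dF A s (m⊔n≤o⇒m≤o _ _ r)) (dF A′ s (m⊔n≤o⇒n≤o _ _ r))
    dF (□ A) (suc s) (s≤s r) = ruleF 5 refl (vals s (kn (kF (ff A))) (kn e) 0 (kF (ff A)) 0 0 0) (dF A s r ∷ dNum _ ∷ dNum e ∷ [])

    dRef : ∀ {φ} → D (fact 8 0 (kF φ) 0 0) → D (fact 12 (kF φ) 0 0 0)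
    dRef {φ} p = ruleRef 0 refl (vals 0 0 0 0 (kF φ) 0 0 0) (p ∷ [])

    dRef-pos : ∀ b i ψ → D (fact 12 (kF (BoxF b i ⇒' ψ)) 0 0 0) → B (fact 14 b i 1 0) → D (fact 12 (kF ψ) 0 0 0)
    dRef-pos b i ψ p l = ruleRef 1 refl (vals b i 0 0 (kF ψ) (kn b) (kn i) (kn e)) (p ∷ base l ∷ dNum b ∷ dNum i ∷ dNum e ∷ dG0 ψ ∷ [])

    dRef-neg : ∀ b i ψ → D (fact 12 (kF (¬' BoxF b i ⇒' ψ)) 0 0 0) → B (fact 14 b i 0 0) → D (fact 12 (kF ψ) 0 0 0)
    dRef-neg b i ψ p l = ruleRef 2 refl (vals b i 0 0 (kF ψ) (kn b) (kn i) (kn e)) (p ∷ base l ∷ dNum b ∷ dNum i ∷ dNum e ∷ dG0 ψ ∷ [])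

open RuleCompleteness

-- Verified levels, fires and valid stages as bounded predicates

module StagePredicates where
  -- Interpretations render falsity as 0 = 1, so these are the codes of the interpretations of ¬⊥
  -- and ⊥.
  ⊤c ⊥c : ℕ
  ⊤c = kF (¬' (zr ≐ S zr))
  ⊥c = kF (zr ≐ S zr)

  -- Throughout, e stands for the code of the matrix of the provability predicate.
  module Predicates (χ : PR 1) (L : Logic) where
    open Horn (rulesFor χ L) baseTags

    In : ℕ → ℕ → ℕ → Set
    In b x w = x ≤ w × Has w (fact 14 b x 1 0)

    two : ℕ → ℕ → Vals
    two x y = lookup (x ∷ y ∷ 0 ∷ 0 ∷ 0 ∷ 0 ∷ 0 ∷ 0 ∷ [])

    -- The database j contains a T-proof of x ⇔ y or of y ⇔ x.
    Edge : ℕ → ℕ → ℕ → ℕ → Set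
    Edge e j x y = x ≤ j × y ≤ j × DB j e × Has j (fact 1 0 x 0 0) × Has j (fact 1 0 y 0 0) ×
      (HasA j e (two x y) iffAtom ⊎ HasA j e (two x y) iffAtom′)

    SatR : ℕ → ℕ → ℕ → Rule → Set
    SatR h e k r = ∀ (v : Vec ℕ 8) → Bdd h v → suc (lookup v 0F) ≤ k → All (HasA h e (lookup v)) (prems r) → HasA h e (lookup v) (concl r)

    -- Kept apart from `satRules` because the rule needs u to be the code of the negation of z. An
    -- equation between terms says this; a flat premise cannot.
    SatN : ℕ → ℕ → Set
    SatN h e = ∀ (v : Vec ℕ 8) → Bdd h v → lookup v 7F ≡ 4 * (2 * lookup v 6F + 1) → All (HasA h e (lookup v)) (prems negRule) →
      HasA h e (lookup v) (concl negRule)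

    -- The rules for variables and boxes need codes of numerals as premises. With these present,
    -- `fRules` reach every interpretation of rank at most k.
    Numerals : ℕ → ℕ → ℕ → Set
    Numerals e h k = (∃ λ c → c ≤ h × Has h (fact 5 e c 0 0)) × (∀ s → s ≤ k → (∃ λ c → c ≤ h × Has h (fact 5 s c 0 0)) ×
      (∀ x → x ≤ h → Has h (fact 11 s x 0 0) → ∃ λ c → c ≤ h × Has h (fact 5 x c 0 0)))

    Chained : ℕ → ℕ → ℕ → Set
    Chained e h k = (∀ x → x ≤ h → Has h (fact 14 0 x 1 0) → ∃ λ s → s ≤ h × Has h (fact 15 s x 0 0)) ×
      (∀ s → s ≤ h → ∀ x → x ≤ h → Has h (fact 15 s x 0 0) → (s ≡ 0 × x ≡ ⊤c) ⊎
        ∃ λ s′ → s′ ≤ h × ∃ λ y → y ≤ h × ∃ λ j → j ≤ h × s ≡ suc s′ × Has h (fact 15 s′ y 0 0) × suc j ≤ k × Edge e j y x)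

    -- The database h certifies that the T-equivalences found below stage k identify only interpretations of L-equivalent
    -- modal formulas, and its literals Lit 0 x 1 are exactly the x so identified with ⊤.
    VerData : ℕ → ℕ → ℕ → Set
    VerData e h k = k ≤ h × DB h e × All (SatR h e k) satRules × SatN h e × Numerals e h k ×
      (∀ j → j ≤ k → ∀ x → x ≤ k → ∀ y → y ≤ k → suc j ≤ k → Edge e j x y → Has h (fact 13 x y 0 0)) ×
      Has h (fact 14 0 ⊤c 1 0) × Chained e h k

    -- Ver and Fir are records so that they are not expanded.
    record Ver (e h k : ℕ) : Set where
      constructor verified
      field verData : VerData e h k
    open Ver public

    VerEx : ℕ → ℕ → Set
    VerEx e w = ∃ λ k → k ≤ w × Ver e w k

    -- An equivalence with proof j becomes binding at p once a verified level bounded by p exceeds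
    -- j.
    Act : ℕ → ℕ → ℕ → ℕ → Set
    Act e p x y = ∃ λ h → h ≤ p × ∃ λ k → k ≤ p × ∃ λ j → j ≤ p × Ver e h k × suc j ≤ k × Edge e j x y

    -- The literals of the database w are consistent, but T refutes their conjunction.
    FirData : ℕ → ℕ → Set
    FirData e w = DB w e × Has w (fact 12 (kF ⊥') 0 0 0) ×
      (∀ b → b ≤ w → ∀ i → i ≤ w → Has w (fact 14 b i 0 0) → Has w (fact 14 b i 1 0) → ⊥)

    record Fir (e w : ℕ) : Set where
      constructor fired
      field firData : FirData e w
    open Fir public

    -- 4 * (2 * x + 1) = pair 2 x is the code of the negation.
    DPFor : Logic → ℕ → Set
    DPFor EN w = 0 ≡ 0
    DPFor ENP w = In 0 ⊥c w → ⊥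
    DPFor END w = ∀ x → x ≤ w → ∀ y → y ≤ w → y ≡ 4 * (2 * x + 1) → In 0 x w → In 0 y w → ⊥

    -- `Mono` hands on the members of verified stages only. Members of a fire need not persist,
    -- since no stage after a valid fire passes `NoFire`.
    Closure Mono DP Valid VF NoFire : ℕ → ℕ → Set
    Closure e w = ∀ p → p ≤ w → ∀ x → x ≤ w → ∀ y → y ≤ w → Act e p x y → In 0 x w → In 0 y w
    Mono e w = ∀ w′ → w′ ≤ w → ∀ x → x ≤ w′ → VerEx e w′ → In 0 x w′ → In 0 x w
    DP e w = DPFor L w
    Valid e w = Closure e w × Mono e w × DP e w × (VerEx e w ⊎ Fir e w)
    VF e w = Valid e w × Fir e w
    NoFire e w = ∀ w′ → w′ ≤ w → VF e w′ → w′ ≡ w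

    -- A stage counts up to and including the first fire; variables are decided by that fire only.
    Theta : ℕ → ℕ → ℕ → ℕ → Set
    Theta t e u w = In t u w × Valid e w × NoFire e w × (t ≡ 0 ⊎ Fir e w)

    private
      variable m : ℕ

      z0 : STm m
      z0 = l# 0

      two# : STm m → STm m → Fin 8 → STm m
      two# x y = lookup (x ∷ y ∷ z0 ∷ z0 ∷ z0 ∷ z0 ∷ z0 ∷ z0 ∷ [])

      two-fn : (x y : STm m) → ∀ ρ i → fn (two# x y i) ρ ≡ two (fn x ρ) (fn y ρ) i
      two-fn x y ρ 0F = refl
      two-fn x y ρ 1F = refl
      two-fn x y ρ 2F = refl
      two-fn x y ρ 3F = refl
      two-fn x y ρ 4F = refl
      two-fn x y ρ 5F = refl
      two-fn x y ρ 6F = refl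
      two-fn x y ρ 7F = refl

      HasA-ext : ∀ {n e η η′} → (∀ i → η i ≡ η′ i) → ∀ A → HasA n e η A → HasA n e η′ A
      HasA-ext h A (s , s≤ , p) = s , s≤ , AtStage-ext h A p

      iffD : (A : Atom) (x y e j : STm m) → Def m (λ ρ → HasA (fn j ρ) (fn e ρ) (two (fn x ρ) (fn y ρ)) A)
      iffD A x y e j = convD (λ ρ → HasA-ext (two-fn x y ρ) A) (λ ρ → HasA-ext (sym ∘ two-fn x y ρ) A) (hasAD A (two# x y) e j)

      edgeD : (e j x y : STm m) → Def m (λ ρ → Edge (fn e ρ) (fn j ρ) (fn x ρ) (fn y ρ))
      edgeD e j x y = x ≤D j ∧D y ≤D j ∧D dbD j e ∧D hasD (l# 1) z0 x z0 z0 j ∧D hasD (l# 1) z0 y z0 z0 j ∧D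
        (iffD iffAtom x y e j ∨D iffD iffAtom′ x y e j)

      vars≡ : (v : Vec ℕ 8) (ρ : Vec ℕ m) → ∀ i → lookup (v Vec.++ ρ) (i ↑ˡ m) ≡ lookup v i
      vars≡ v ρ i = lookup-++ˡ v ρ i

      satRD : (h e k : STm m) (r : Rule) → Def m (λ ρ → SatR (fn h ρ) (fn e ρ) (fn k ρ) r)
      satRD {m} h e k r = convD
        (λ { ρ f v@(_ ∷ _ ∷ _ ∷ _ ∷ _ ∷ _ ∷ _ ∷ _ ∷ []) bd lt ps →
             HasA-ext {fn h ρ} {fn e ρ} (vars≡ v ρ) (concl r) (f v bd lt (All.map (λ {A} → HasA-ext (sym ∘ vars≡ v ρ) A) ps)) })
        (λ { ρ f v@(_ ∷ _ ∷ _ ∷ _ ∷ _ ∷ _ ∷ _ ∷ _ ∷ []) bd lt ps →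
             HasA-ext {fn h ρ} {fn e ρ} (sym ∘ vars≡ v ρ) (concl r) (f v bd lt (All.map (λ {A} → HasA-ext (vars≡ v ρ) A) ps)) })
        (∀V 8 h (s# (vars# 0F) ≤D wks 8 k ⇒D
          (allD (λ A → hasAD A vars# (wks 8 e) (wks 8 h)) (prems r) ⇒D hasAD (concl r) vars# (wks 8 e) (wks 8 h))))

      satND : (h e : STm m) → Def m (λ ρ → SatN (fn h ρ) (fn e ρ))
      satND {m} h e = convD
        (λ { ρ f v@(_ ∷ _ ∷ _ ∷ _ ∷ _ ∷ _ ∷ _ ∷ _ ∷ []) bd q ps →
             HasA-ext {fn h ρ} {fn e ρ} (vars≡ v ρ) (concl negRule) (f v bd q (All.map (λ {A} → HasA-ext (sym ∘ vars≡ v ρ) A) ps)) })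
        (λ { ρ f v@(_ ∷ _ ∷ _ ∷ _ ∷ _ ∷ _ ∷ _ ∷ _ ∷ []) bd q ps →
             HasA-ext {fn h ρ} {fn e ρ} (sym ∘ vars≡ v ρ) (concl negRule) (f v bd q (All.map (λ {A} → HasA-ext (vars≡ v ρ) A) ps)) })
        (∀V 8 h (vars# 7F =D l# 4 *# (l# 2 *# vars# 6F +# l# 1) ⇒D
          (allD (λ A → hasAD A vars# (wks 8 e) (wks 8 h)) (prems negRule) ⇒D hasAD (concl negRule) vars# (wks 8 e) (wks 8 h))))

      numeralsD : (e h k : STm m) → Def m (λ ρ → Numerals (fn e ρ) (fn h ρ) (fn k ρ))
      numeralsD e h k = ∃D h (hasD (l# 5) (wks 1 e) (y# 0F) z0 z0 (wks 1 h)) ∧D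
        ∀D k (∃D (wks 1 h) (hasD (l# 5) (y# 1F) (y# 0F) z0 z0 (wks 2 h)) ∧D
          ∀D (wks 1 h) (hasD (l# 11) (y# 1F) (y# 0F) z0 z0 (wks 2 h) ⇒D ∃D (wks 2 h) (hasD (l# 5) (y# 1F) (y# 0F) z0 z0 (wks 3 h))))

      chainD : (e h k : STm m) → Def m (λ ρ → Chained (fn e ρ) (fn h ρ) (fn k ρ))
      chainD e h k =
        ∀D h (hasD (l# 14) z0 (y# 0F) (l# 1) z0 (wks 1 h) ⇒D
          ∃D (wks 1 h) (hasD (l# 15) (y# 0F) (y# 1F) z0 z0 (wks 2 h))) ∧D
        ∀D h (∀D (wks 1 h) (hasD (l# 15) (y# 1F) (y# 0F) z0 z0 (wks 2 h) ⇒D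
          ((y# 1F =D z0 ∧D y# 0F =D l# ⊤c) ∨D
           ∃D (wks 2 h) (∃D (wks 3 h) (∃D (wks 4 h) (y# 4F =D s# (y# 2F) ∧D hasD (l# 15) (y# 2F) (y# 1F) z0 z0 (wks 5 h) ∧D
             s# (y# 0F) ≤D wks 5 k ∧D edgeD (wks 5 e) (y# 0F) (y# 1F) (y# 3F)))))))

      verD : (e h k : STm m) → Def m (λ ρ → Ver (fn e ρ) (fn h ρ) (fn k ρ))
      verD e h k = convD (λ _ → verified) (λ _ → verData) $ k ≤D h ∧D dbD h e ∧D allD (satRD h e k) satRules ∧D satND h e ∧D numeralsD e h k ∧D
        ∀D k (∀D (wks 1 k) (∀D (wks 2 k) (s# (y# 2F) ≤D wks 3 k ⇒D (edgeD (wks 3 e) (y# 2F) (y# 1F) (y# 0F) ⇒D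
          hasD (l# 13) (y# 1F) (y# 0F) z0 z0 (wks 3 h))))) ∧D
        hasD (l# 14) z0 (l# ⊤c) (l# 1) z0 h ∧D chainD e h k

    opaque
      inD : Def 3 (λ { (b ∷ x ∷ w ∷ []) → In b x w })
      inD = convD (λ { (_ ∷ _ ∷ _ ∷ []) p → p }) (λ { (_ ∷ _ ∷ _ ∷ []) p → p })
        (y# 1F ≤D y# 2F ∧D hasD (l# 14) (y# 0F) (y# 1F) (l# 1) z0 (y# 2F))

      inRest : Δ 3
      inRest = fm (hasD (l# 14) (y# 0F) (y# 1F) (l# 1) z0 (y# {3} 2F))

      -- Exposes the first conjunct of the opaque formula; arithmetic reads off from it that a
      -- member is bounded by its stage.
      inD-shape : fm inD ≡ fm (y# {3} 1F ≤D y# 2F) `∧ inRest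
      inD-shape = refl

      verD₀ : Def 3 (λ { (h ∷ k ∷ e ∷ []) → Ver e h k })
      verD₀ = convD (λ { (_ ∷ _ ∷ _ ∷ []) p → p }) (λ { (_ ∷ _ ∷ _ ∷ []) p → p }) (verD (y# 2F) (y# 0F) (y# 1F))

      edgeD₀ : Def 4 (λ { (j ∷ x ∷ y ∷ e ∷ []) → Edge e j x y })
      edgeD₀ = convD (λ { (_ ∷ _ ∷ _ ∷ _ ∷ []) p → p }) (λ { (_ ∷ _ ∷ _ ∷ _ ∷ []) p → p }) (edgeD (y# 3F) (y# 0F) (y# 1F) (y# 2F))

      verExD : Def 2 (λ { (w ∷ e ∷ []) → VerEx e w })
      verExD = convD (λ { (_ ∷ _ ∷ []) p → p }) (λ { (_ ∷ _ ∷ []) p → p })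
        (∃D (y# 0F) (appD verD₀ (y# 1F ∷ y# 0F ∷ y# 2F ∷ [])))

      actD : Def 4 (λ { (p ∷ x ∷ y ∷ e ∷ []) → Act e p x y })
      actD = convD (λ { (_ ∷ _ ∷ _ ∷ _ ∷ []) p → p }) (λ { (_ ∷ _ ∷ _ ∷ _ ∷ []) p → p })
        (∃D (y# 0F) (∃D (y# 1F) (∃D (y# 2F) (appD verD₀ (y# 2F ∷ y# 1F ∷ y# 6F ∷ []) ∧D s# (y# 0F) ≤D y# 1F ∧D
          appD edgeD₀ (y# 0F ∷ y# 4F ∷ y# 5F ∷ y# 6F ∷ [])))))

      firD : Def 2 (λ { (w ∷ e ∷ []) → Fir e w })
      firD = convD (λ { (_ ∷ _ ∷ []) p → fired p }) (λ { (_ ∷ _ ∷ []) p → firData p })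
        (dbD (y# 0F) (y# 1F) ∧D hasD (l# 12) (l# (kF ⊥')) z0 z0 z0 (y# 0F) ∧D
         ∀D (y# 0F) (∀D (y# 1F) (hasD (l# 14) (y# 1F) (y# 0F) z0 z0 (y# 2F) ⇒D (hasD (l# 14) (y# 1F) (y# 0F) (l# 1) z0 (y# 2F) ⇒D ⊥D))))

    -- The order of the variables in the following formulas is w, e.

    closureD : Def 2 (λ { (w ∷ e ∷ []) → Closure e w })
    closureD = convD (λ { (_ ∷ _ ∷ []) p → p }) (λ { (_ ∷ _ ∷ []) p → p })
      (∀D (y# 0F) (∀D (y# 1F) (∀D (y# 2F) (appD actD (y# 2F ∷ y# 1F ∷ y# 0F ∷ y# 4F ∷ []) ⇒D
        (appD inD (z0 ∷ y# 1F ∷ y# 3F ∷ []) ⇒D appD inD (z0 ∷ y# 0F ∷ y# 3F ∷ []))))))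

    monoD : Def 2 (λ { (w ∷ e ∷ []) → Mono e w })
    monoD = convD (λ { (_ ∷ _ ∷ []) p → p }) (λ { (_ ∷ _ ∷ []) p → p })
      (∀D (y# 0F) (∀D (y# 0F) (appD verExD (y# 1F ∷ y# 3F ∷ []) ⇒D
        (appD inD (z0 ∷ y# 0F ∷ y# 1F ∷ []) ⇒D appD inD (z0 ∷ y# 0F ∷ y# 2F ∷ [])))))

    dpD : ∀ L → Def 2 (λ { (w ∷ e ∷ []) → DPFor L w })
    dpD EN = convD (λ { (_ ∷ _ ∷ []) p → p }) (λ { (_ ∷ _ ∷ []) p → p }) (z0 =D z0)
    dpD ENP = convD (λ { (_ ∷ _ ∷ []) p → p }) (λ { (_ ∷ _ ∷ []) p → p })
      (appD inD (z0 ∷ l# ⊥c ∷ y# 0F ∷ []) ⇒D ⊥D)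
    dpD END = convD (λ { (_ ∷ _ ∷ []) p → p }) (λ { (_ ∷ _ ∷ []) p → p })
      (∀D (y# 0F) (∀D (y# 1F) (y# 0F =D l# 4 *# (l# 2 *# y# 1F +# l# 1) ⇒D
        (appD inD (z0 ∷ y# 1F ∷ y# 2F ∷ []) ⇒D (appD inD (z0 ∷ y# 0F ∷ y# 2F ∷ []) ⇒D ⊥D)))))

    validD : Def 2 (λ { (w ∷ e ∷ []) → Valid e w })
    validD = convD (λ { (_ ∷ _ ∷ []) p → p }) (λ { (_ ∷ _ ∷ []) p → p })
      (closureD ∧D monoD ∧D dpD L ∧D (verExD ∨D firD))

    vfD : Def 2 (λ { (w ∷ e ∷ []) → VF e w })
    vfD = convD (λ { (_ ∷ _ ∷ []) p → p }) (λ { (_ ∷ _ ∷ []) p → p }) (validD ∧D firD)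

    noFireD : Def 2 (λ { (w ∷ e ∷ []) → NoFire e w })
    noFireD = convD (λ { (_ ∷ _ ∷ []) p → p }) (λ { (_ ∷ _ ∷ []) p → p })
      (∀D (y# 0F) (appD vfD (y# 0F ∷ y# 2F ∷ []) ⇒D y# 0F =D y# 1F))

    thetaD : Def 4 (λ { (t ∷ e ∷ u ∷ w ∷ []) → Theta t e u w })
    thetaD = convD (λ { (_ ∷ _ ∷ _ ∷ _ ∷ []) p → p }) (λ { (_ ∷ _ ∷ _ ∷ _ ∷ []) p → p })
      (appD inD (y# 0F ∷ y# 2F ∷ y# 3F ∷ []) ∧D appD validD (y# 3F ∷ y# 1F ∷ []) ∧D appD noFireD (y# 3F ∷ y# 1F ∷ []) ∧D
       (y# 0F =D z0 ∨D appD firD (y# 3F ∷ y# 1F ∷ [])))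

open StagePredicates

-- What extensions of PA prove about the predicate

module ProvabilityPredicate where
  FV-substT : ∀ {n σ} → (∀ k → k < n → σ k ≡ var k) → ∀ t → FVBelowT n t → substT σ t ≡ t
  FV-substT h (var k) p = h k p
  FV-substT h zr p = refl
  FV-substT h (S t) p = cong S (FV-substT h t p)
  FV-substT h (t ⊕ u) (p , q) = cong₂ _⊕_ (FV-substT h t p) (FV-substT h u q)
  FV-substT h (t ⊗ u) (p , q) = cong₂ _⊗_ (FV-substT h t p) (FV-substT h u q)

  FV-subst : ∀ {n σ} → (∀ k → k < n → σ k ≡ var k) → ∀ φ → FVBelow n φ → subst σ φ ≡ φ
  FV-subst h (t ≐ u) (p , q) = cong₂ _≐_ (FV-substT h t p) (FV-substT h u q)
  FV-subst h ⊥' p = refl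
  FV-subst h (¬' φ) p = cong ¬'_ (FV-subst h φ p)
  FV-subst h (φ ∧' ψ) (p , q) = cong₂ _∧'_ (FV-subst h φ p) (FV-subst h ψ q)
  FV-subst h (φ ∨' ψ) (p , q) = cong₂ _∨'_ (FV-subst h φ p) (FV-subst h ψ q)
  FV-subst h (φ ⇒' ψ) (p , q) = cong₂ _⇒'_ (FV-subst h φ p) (FV-subst h ψ q)
  FV-subst h (∀' φ) p = cong ∀' (FV-subst (λ { zero _ → refl ; (suc k) (s≤s l) → cong shiftT (h k l) }) φ p)
  FV-subst h (∃' φ) p = cong ∃' (FV-subst (λ { zero _ → refl ; (suc k) (s≤s l) → cong shiftT (h k l) }) φ p)

  sentence-subst : ∀ {σ} φ → Sentence φ → subst σ φ ≡ φ
  sentence-subst = FV-subst λ _ ()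

  module Predicate (χ : PR 1) (L : Logic) where
    open Predicates χ L public

    Θ : Δ 4
    Θ = fm thetaD

    Mx : Formula
    Mx = cΔ Θ

    open Coding Mx public

    Body : ℕ → ℕ → Δ 4
    Body b i = `l i `= `v 2F `∧ (`l e `= `v 1F `∧ (`l b `= `v 0F `∧ Θ))

    BoxF-sentence : ∀ b i → Sentence (BoxF b i)
    BoxF-sentence b i = cΔ-FV (Body b i)

    module Inside (U : Theory) (ext : Extends PA U) where
      open Arith U ext public

      private variable
        m n : ℕ
        γ : Formula

      In' : Tm n → Tm n → Tm n → Δ n
      In' b i t = sub (consτ b (consτ i λ _ → t)) (fm inD)

      At : ∀ {P} → Def 2 P → Tm n → Δ n
      At D t = sub (consτ t λ _ → `l e) (fm D)

      Mt : ℕ → ℕ → Tm n → Δ n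
      Mt b i t = sub (consτ (`l b) (consτ (`l e) (consτ (`l i) λ _ → t))) Θ

      Rest : ℕ → Tm n → Δ n
      Rest b t = At validD t `∧ (At noFireD t `∧ (`l b `= `l 0 `∨ At firD t))

      Mt≡ : ∀ b i (t : Tm n) → Mt b i t ≡ In' (`l b) (`l i) t `∧ Rest b t
      Mt≡ b i t = cong₂ _`∧_ (flat₃ (fm inD)) (cong₂ _`∧_ (flat₂ (fm validD)) (cong₂ _`∧_ (flat₂ (fm noFireD))
          (cong (`l b `= `l 0 `∨_) (flat₂ (fm firD)))))
        where
        flat₃ : (φ : Δ 3) → sub (consτ (`l b) (consτ (`l e) (consτ (`l i) λ _ → t))) (sub (λ k → tm (lookup (y# 0F ∷ y# 2F ∷ y# 3F ∷ []) k)) φ) ≡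
          sub (consτ (`l b) (consτ (`l i) λ _ → t)) φ
        flat₃ φ = trans (sub-sub _ _ φ) (sub-ext (λ { 0F → refl ; 1F → refl ; 2F → refl }) φ)
        flat₂ : (φ : Δ 2) → sub (consτ (`l b) (consτ (`l e) (consτ (`l i) λ _ → t))) (sub (λ k → tm (lookup (y# 3F ∷ y# 1F ∷ []) k)) φ) ≡
          sub (consτ t λ _ → `l e) φ
        flat₂ φ = trans (sub-sub _ _ φ) (sub-ext (λ { 0F → refl ; 1F → refl }) φ)

      ∀-instτ : (τ : Sub m n) (t : Tm m) (s : Tm n) (φ : Δ (suc m)) → γ ⊩ cΔ (sub τ (`∀ t φ)) → γ ⊩ s ≼ subT τ t → γ ⊩ cΔ (sub (consτ s τ) φ)
      ∀-instτ τ t s φ p q = conv (cong cΔ (trans (sub-sub [ s ]τ (liftτ τ) φ)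
        (sub-ext (λ { zero → refl ; (suc i) → []-wk s (τ i) }) φ))) (∀-inst (subT τ t) s (sub (liftτ τ) φ) p q)

      private
        flat : {k : ℕ} (τ : Sub m n) (υ : Sub k m) (τ′ : Sub k n) → (∀ i → subT τ (υ i) ≡ τ′ i) → (φ : Δ k) → cΔ (sub τ (sub υ φ)) ≡ cΔ (sub τ′ φ)
        flat τ υ τ′ h φ = cong cΔ (trans (sub-sub τ υ φ) (sub-ext h φ))

      true-at : (φ : Δ m) (ρ : Vec ℕ m) → Sat φ ρ → U ⊢ cΔ {n} (sub (litτ ρ) φ)
      true-at φ ρ p = conv⊢ (trans (sym (closed (cl ρ φ) (λ ()))) (cong cΔ (trans (sub-sub (λ ()) (litτ ρ) φ) (sub-ext (λ _ → refl) φ)))) (Δ-true φ ρ p)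

      ∃⁴-intro : (φ : Δ 4) (t v u w : Tm n) → γ ⊩ cΔ (sub (consτ t (consτ v (consτ u λ _ → w))) φ) → γ ⊩ ∃' (∃' (∃' (∃' (cΔ φ))))
      ∃⁴-intro {n} φ t v u w p = ∃i (cT w) (conv (sym e₁) (∃i (cT u) (conv (sym e₂) (∃i (cT v) (conv (sym e₃) (∃i (cT t) (conv (sym e₄) p)))))))
        where
        τ₁ : Sub 4 (3 + n)
        τ₁ = liftτ (liftτ (liftτ λ _ → w))
        τ₂ : Sub (3 + n) (2 + n)
        τ₂ = liftτ (liftτ [ u ]τ)
        τ₃ : Sub (2 + n) (1 + n)
        τ₃ = liftτ [ v ]τ
        e₁ : inst (cT w) (∃' (∃' (∃' (cΔ φ)))) ≡ ∃' (∃' (∃' (cΔ (sub τ₁ φ))))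
        e₁ = cong (∃' ∘ ∃' ∘ ∃') (cΔ-sub (lift-match (lift-match (lift-match λ { zero → refl }))) φ)
        e₂ : inst (cT u) (∃' (∃' (cΔ (sub τ₁ φ)))) ≡ ∃' (∃' (cΔ (sub τ₂ (sub τ₁ φ))))
        e₂ = cong (∃' ∘ ∃') (cΔ-sub (lift-match (lift-match λ { zero → refl ; (suc i) → refl })) (sub τ₁ φ))
        e₃ : inst (cT v) (∃' (cΔ (sub τ₂ (sub τ₁ φ)))) ≡ ∃' (cΔ (sub τ₃ (sub τ₂ (sub τ₁ φ))))
        e₃ = cong ∃' (cΔ-sub (lift-match λ { zero → refl ; (suc i) → refl }) (sub τ₂ (sub τ₁ φ)))
        pt : ∀ i → subT [ t ]τ (subT τ₃ (subT τ₂ (τ₁ i))) ≡ consτ t (consτ v (consτ u λ _ → w)) i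
        pt 0F = refl
        pt 1F = []-wk t v
        pt 2F = trans (cong (subT [ t ]τ) (trans (subT-wk [ v ]τ (wkT u)) (cong wkT ([]-wk v u)))) ([]-wk t u)
        pt 3F = trans (cong (λ x → subT [ t ]τ (subT τ₃ x)) (trans (subT-wk (liftτ [ u ]τ) (wkT (wkT w)))
            (cong wkT (trans (subT-wk [ u ]τ (wkT w)) (cong wkT ([]-wk u w))))))
          (trans (cong (subT [ t ]τ) (trans (subT-wk [ v ]τ (wkT w)) (cong wkT ([]-wk v w)))) ([]-wk t w))
        e₄ : inst (cT t) (cΔ (sub τ₃ (sub τ₂ (sub τ₁ φ)))) ≡ cΔ (sub (consτ t (consτ v (consτ u λ _ → w))) φ)
        e₄ = trans (cΔ-inst t _) (cong cΔ (trans (cong (λ x → sub [ t ]τ (sub τ₃ x)) (sub-sub τ₂ τ₁ φ))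
               (trans (cong (sub [ t ]τ) (sub-sub τ₃ _ φ)) (trans (sub-sub [ t ]τ _ φ) (sub-ext pt φ)))))

      box-intro : ∀ b i (t : Tm n) → γ ⊩ cΔ (Mt b i t) → γ ⊩ BoxF b i
      box-intro b i t p = ∃⁴-intro (Body b i) (`l b) (`l e) (`l i) t (pair' (refl' _) (pair' (refl' _) (pair' (refl' _) p)))

      box-true : ∀ b i w → Theta b e i w → U ⊢ BoxF b i
      box-true b i w p = mp (box-intro {0} b i (`l w) (K (conv⊢ (cong cΔ (sub-ext (λ { 0F → refl ; 1F → refl ; 2F → refl ; 3F → refl }) Θ))
        (true-at {n = 0} Θ (b ∷ e ∷ i ∷ w ∷ []) (from thetaD _ p))))) (eq-refl zr)

      -- The four quantifiers are opened and the matrix is rewritten along the three equations, one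
      -- at a time, until the stage is the only unknown. The conclusion is a sentence so that it
      -- survives the shifts.
      box-elim : ∀ b i ψ → Sentence ψ → U ⊢ cΔ (Mt {1} b i x₀) ⇒' ψ → U ⊢ BoxF b i ⇒' ψ
      box-elim b i ψ sψ p = ∃-left (sh (∃-left (sh (∃-left (sh (∃-left (sh (cut at-w (conv⊢ e₁ (mp (∀-elim _ (var 3)) (gen p)))))))))))
        where
        sh : ∀ {φ} → U ⊢ φ ⇒' ψ → U ⊢ φ ⇒' shift ψ
        sh {φ} = conv⊢ (cong (φ ⇒'_) (sym (sentence-subst ψ sψ)))
        e₁ : inst (var 3) (cΔ (Mt {1} b i x₀) ⇒' ψ) ≡ cΔ (Mt {4} b i (`v 3F)) ⇒' ψ
        e₁ = cong₂ _⇒'_ (trans (cΔ-sub {τ = λ _ → `v 3F} (λ { zero → refl }) (Mt {1} b i x₀))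
               (flat _ _ _ (λ { 0F → refl ; 1F → refl ; 2F → refl ; 3F → refl }) Θ)) (sentence-subst ψ sψ)
        Γ : Formula
        Γ = cΔ (Body b i)
        τ₀ τ₁ τ₂ : Sub 4 5
        τ₀ = consτ x₀ (consτ (`v 2F) (consτ (`v 3F) λ _ → `v (suc 3F)))
        τ₁ = consτ (`l b) (consτ x₀ (consτ (`v 3F) λ _ → `v (suc 3F)))
        τ₂ = consτ (`l b) (consτ (`l e) (consτ x₀ λ _ → `v (suc 3F)))
        step : (τ : Sub 4 5) (s t : Tm 4) (υ υ′ : Sub 4 4) → (∀ k → subT [ s ]τ (τ k) ≡ υ k) → (∀ k → subT [ t ]τ (τ k) ≡ υ′ k) →
          Γ ⊩ cT s ≐ cT t → Γ ⊩ cΔ (sub υ Θ) → Γ ⊩ cΔ (sub υ′ Θ)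
        step τ s t υ υ′ h h′ q r = conv (flat [ t ]τ τ υ′ h′ Θ) (rep (sub τ Θ) s t q (conv (sym (flat [ s ]τ τ υ h Θ)) r))
        at-w : Γ ⊩ cΔ (Mt {4} b i (`v 3F))
        at-w = step τ₂ (`v 2F) (`l i) (consτ (`l b) (consτ (`l e) (consτ (`v 2F) λ _ → `v 3F))) _
                 (λ { 0F → refl ; 1F → refl ; 2F → refl ; 3F → refl }) (λ { 0F → refl ; 1F → refl ; 2F → refl ; 3F → refl })
                 (sym' {4} (`l i) (`v 2F) (pr₁ hyp))
          (step τ₁ (`v 1F) (`l e) (consτ (`l b) (consτ (`v 1F) (consτ (`v 2F) λ _ → `v 3F))) _
                 (λ { 0F → refl ; 1F → refl ; 2F → refl ; 3F → refl }) (λ { 0F → refl ; 1F → refl ; 2F → refl ; 3F → refl })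
                 (sym' {4} (`l e) (`v 1F) (pr₁ (pr₂ hyp)))
          (step τ₀ (`v 0F) (`l b) `v _
                 (λ { 0F → refl ; 1F → refl ; 2F → refl ; 3F → refl }) (λ { 0F → refl ; 1F → refl ; 2F → refl ; 3F → refl })
                 (sym' {4} (`l b) (`v 0F) (pr₁ (pr₂ (pr₂ hyp))))
                 (conv (cong cΔ (sym (sub-id Θ))) (pr₂ (pr₂ (pr₂ hyp))))))

      private
        M : ℕ → ℕ → Δ 1
        M b i = Mt b i x₀

        M-false : ∀ {b i j} → ¬ Theta b e i j → U ⊢ cΔ (sub [ `l j ]τ (M b i)) ⇒' ⊥'
        M-false {b} {i} {j} ¬p = conv⊢ (cong (_⇒' ⊥') (sym (flat [ `l j ]τ _ (litτ (b ∷ e ∷ i ∷ j ∷ []))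
          (λ { 0F → refl ; 1F → refl ; 2F → refl ; 3F → refl }) Θ))) (Δ-false Θ (b ∷ e ∷ i ∷ j ∷ []) (¬p ∘ to thetaD _))

        theta? : ∀ b i w → Dec (Theta b e i w)
        theta? b i w = decD thetaD (b ∷ e ∷ i ∷ w ∷ [])

      parts : ∀ {b i} (t : Tm n) → γ ⊩ cΔ (Mt b i t) → γ ⊩ cΔ (In' (`l b) (`l i) t) ∧' cΔ (Rest b t)
      parts {b = b} {i} t = conv (cong cΔ (Mt≡ b i t))

      noFire-inst : (s t : Tm n) → γ ⊩ cΔ (At noFireD t) → γ ⊩ s ≼ t → γ ⊩ cΔ (At vfD s) ⇒' cT s ≐ cT t
      noFire-inst s t p q = conv (cong (_⇒' cT s ≐ cT t) (flat _ _ (consτ s λ _ → `l e) (λ { 0F → refl ; 1F → refl }) (fm vfD)))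
        (∀-instτ (consτ t λ _ → `l e) (`v 0F) s (fm (appD vfD (y# {3} 0F ∷ y# 2F ∷ [])) `⇒ `v 0F `= `v 1F) p q)

      -- After a fire at n the predicate holds only at stages up to n.
      box-refute : ∀ b i n → VF e n → (∀ w → w ≤ n → ¬ Theta b e i w) → U ⊢ ¬' BoxF b i
      box-refute b i n vf no-w = ¬i (box-elim b i ⊥' tt (standard-or-large (M b i) ⊥' n (λ j j≤ → M-false (no-w j j≤))
        (lam (cut (at-numeral (M b i) n (sym' {1} (`l n) x₀ w≡n) (pr₂ hyp)) (M-false (no-w n ≤-refl))))))
        where
        w≡n : _≼_ {1} (`l n) x₀ ∧' cΔ (M b i) ⊩ numeral n ≐ var 0
        w≡n = app (noFire-inst {1} (`l n) x₀ (pr₁ (pr₂ (pr₂ (parts x₀ (pr₂ hyp))))) (pr₁ hyp))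
          (K (conv⊢ (cong cΔ (sub-ext (λ { 0F → refl ; 1F → refl }) (fm vfD))) (true-at {n = 1} (fm vfD) (n ∷ e ∷ []) (from vfD _ vf))))

      -- Past N the numbers p, x and y all lie below the stage, so its closure condition applies to
      -- the given certificate. Each earlier stage is decided: either the theory refutes it, or it
      -- is genuine and `std` proves the conclusion outright.
      box-E : ∀ x y p → Act e p x y → ((∃ λ w → Theta 0 e x w) → U ⊢ BoxF 0 y) → U ⊢ BoxF 0 x ⇒' BoxF 0 y
      box-E x y p act std = box-elim 0 x (BoxF 0 y) (BoxF-sentence 0 y)
        (standard-or-large (M 0 x) (BoxF 0 y) N small (lam (box-intro {1} 0 y x₀ (conv (cong cΔ (sym (Mt≡ {1} 0 y x₀)))
          (pair' new (pr₂ (parts x₀ (pr₂ hyp))))))))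
        where
        N : ℕ
        N = p + (x + y)
        small : ∀ j → j ≤ N → U ⊢ cΔ (sub [ `l j ]τ (M 0 x)) ⇒' BoxF 0 y
        small j _ = decided (theta? 0 x j)
          where
          decided : Dec (Theta 0 e x j) → U ⊢ cΔ (sub [ `l j ]τ (M 0 x)) ⇒' BoxF 0 y
          decided (yes th) = K (std (j , th))
          decided (no ¬th) = abs (M-false ¬th)
        Γ : Formula
        Γ = _≼_ {1} (`l N) x₀ ∧' cΔ (M 0 x)
        τ : Sub 2 1
        τ = consτ x₀ λ _ → `l e
        step : Δ 5
        step = fm (appD actD (y# {5} 2F ∷ y# 1F ∷ y# 0F ∷ y# (suc 3F) ∷ [])) `⇒
          (fm (appD inD (l# 0 ∷ y# {5} 1F ∷ y# 3F ∷ [])) `⇒ fm (appD inD (l# 0 ∷ y# {5} 0F ∷ y# 3F ∷ [])))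
        new : Γ ⊩ cΔ (In' {1} (`l 0) (`l y) x₀)
        new = conv (flat _ _ _ (λ { 0F → refl ; 1F → refl ; 2F → refl }) (fm inD)) (app (app
          (∀-instτ (consτ (`l x) (consτ (`l p) τ)) (`v 2F) (`l y) step
            (∀-instτ (consτ (`l p) τ) (`v 1F) (`l x) (`∀ (`v 2F) step)
              (∀-instτ τ (`v 0F) (`l p) (`∀ (`v 1F) (`∀ (`v 2F) step)) (pr₁ (pr₁ (pr₂ (parts x₀ (pr₂ hyp)))))
                (le-down {1} x₀ (≤⇒≤′ (m≤m+n p (x + y))) (pr₁ hyp)))
              (le-down {1} x₀ (≤⇒≤′ (≤-trans (m≤m+n x y) (m≤n+m _ p))) (pr₁ hyp)))
            (le-down {1} x₀ (≤⇒≤′ (≤-trans (m≤n+m y x) (m≤n+m _ p))) (pr₁ hyp)))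
          (K (conv⊢ (sym (flat _ _ (litτ (p ∷ x ∷ y ∷ e ∷ [])) (λ { 0F → refl ; 1F → refl ; 2F → refl ; 3F → refl }) (fm actD)))
            (true-at {n = 1} (fm actD) (p ∷ x ∷ y ∷ e ∷ []) (from actD _ act)))))
          (conv (sym (flat _ _ _ (λ { 0F → refl ; 1F → refl ; 2F → refl }) (fm inD))) (pr₁ (parts x₀ (pr₂ hyp)))))

      private
        V-of : ∀ {b i} (t : Tm n) → γ ⊩ cΔ (Mt b i t) → γ ⊩ cΔ (At validD t)
        V-of t p = pr₁ (pr₂ (parts t p))

      in-≤ : ∀ {b i} (t : Tm n) → γ ⊩ cΔ (In' b i t) → γ ⊩ i ≼ t
      in-≤ {b = b} {i} t p = cut (pr₁ (conv (cong (λ φ → cΔ (sub (consτ b (consτ i λ _ → t)) φ)) inD-shape) p))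
        (∃-left (conv (sym (≼-shift i t)) (≼i x₀ (wkT i) (wkT t) (conv refl (pr₂ hyp)))))

      box-P : L ≡ ENP → U ⊢ ¬' BoxF 0 ⊥c
      box-P refl = ¬i (box-elim 0 ⊥c ⊥' tt (app (pr₁ (pr₂ (pr₂ (V-of x₀ hyp))))
        (conv (sym (flat _ _ _ (λ { 0F → refl ; 1F → refl ; 2F → refl }) (fm inD))) (pr₁ (parts {1} x₀ hyp)))))

      box-ex : ∀ b i → U ⊢ BoxF b i ⇒' ∃' (cΔ (M b i))
      box-ex b i = box-elim b i (∃' (cΔ (M b i))) (cΔ-FV (M b i)) (conv⊢ (cong (_⇒' ∃' (cΔ (M b i)))
        (trans (cΔ-sub {τ = λ _ → x₀ {0}} (λ { zero → refl }) (M b i)) (flat _ _ _ (λ { 0F → refl ; 1F → refl ; 2F → refl ; 3F → refl }) Θ)))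
        (∃-intro (cΔ (M b i)) (var 0)))

      -- If s is verified, its members pass to t by `Mono`. If s is a fire, `NoFire` at t makes both
      -- stages equal.
      move : ∀ {a c} (s t : Tm n) → γ ⊩ cΔ (Mt 0 a s) → γ ⊩ cΔ (Mt 0 c t) → γ ⊩ s ≼ t → γ ⊩ cΔ (In' (`l 0) (`l a) t)
      move {γ = γ} {a} {c} s t p q le = case' (pr₂ (pr₂ (pr₂ (V-of s p)))) ver fir
        where
        step : Δ 4
        step = fm (appD verExD (y# {4} 1F ∷ y# 3F ∷ [])) `⇒ (fm (appD inD (l# 0 ∷ y# {4} 0F ∷ y# 1F ∷ [])) `⇒
          fm (appD inD (l# 0 ∷ y# {4} 0F ∷ y# 2F ∷ [])))
        ver : γ ∧' cΔ (At verExD s) ⊩ cΔ (In' (`l 0) (`l a) t)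
        ver = conv (flat _ _ _ (λ { 0F → refl ; 1F → refl ; 2F → refl }) (fm inD)) (app (app
          (∀-instτ (consτ s (consτ t λ _ → `l e)) (`v 0F) (`l a) step
            (∀-instτ (consτ t λ _ → `l e) (`v 0F) s (`∀ (`v 0F) step) (pr₁ (pr₂ (cut (pr₁ hyp) (V-of t q)))) (cut (pr₁ hyp) le))
            (cut (pr₁ hyp) (in-≤ s (pr₁ (parts s p)))))
          (conv (sym (flat _ _ _ (λ { 0F → refl ; 1F → refl }) (fm verExD))) (pr₂ hyp)))
          (conv (sym (flat _ _ _ (λ { 0F → refl ; 1F → refl ; 2F → refl }) (fm inD))) (cut (pr₁ hyp) (pr₁ (parts s p)))))
        fir : γ ∧' cΔ (At firD s) ⊩ cΔ (In' (`l 0) (`l a) t)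
        fir = conv (flat [ t ]τ _ _ (λ { 0F → refl ; 1F → refl ; 2F → refl }) (fm inD))
          (rep (In' (`l 0) (`l a) x₀) s t
            (app (noFire-inst s t (cut (pr₁ hyp) (pr₁ (pr₂ (pr₂ (parts t q))))) (cut (pr₁ hyp) le)) (pair' (cut (pr₁ hyp) (V-of s p)) (pr₂ hyp)))
            (conv (sym (flat [ s ]τ _ _ (λ { 0F → refl ; 1F → refl ; 2F → refl }) (fm inD))) (cut (pr₁ hyp) (pr₁ (parts s p)))))

      -- The two boxes may hold at different stages. The order being total, `move` brings both
      -- members to the later stage, where D is violated.
      box-D : L ≡ END → ∀ x y → y ≡ 4 * (2 * x + 1) → U ⊢ BoxF 0 x ⇒' (BoxF 0 y ⇒' ⊥')
      box-D refl x y y≡ = box-elim 0 x (BoxF 0 y ⇒' ⊥') (BoxF-sentence 0 y , tt)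
        (lam (∃e (cut (pr₂ hyp) (box-ex 0 y)) (case' (K (total {2} x₀ x₁))
          (clash x₀ (move {2} x₁ x₀ (cut (pr₁ hyp) P₁) (cut (pr₁ hyp) P₀) (pr₂ hyp)) (pr₁ (parts x₀ (cut (pr₁ hyp) P₀))) (V-of x₀ (cut (pr₁ hyp) P₀)))
          (clash x₁ (pr₁ (parts x₁ (cut (pr₁ hyp) P₁))) (move {2} x₀ x₁ (cut (pr₁ hyp) P₀) (cut (pr₁ hyp) P₁) (pr₂ hyp)) (V-of x₁ (cut (pr₁ hyp) P₁))))))
        where
        Γ : Formula
        Γ = shift (cΔ (M 0 x) ∧' BoxF 0 y) ∧' cΔ (M 0 y)
        P₀ : Γ ⊩ cΔ (Mt {2} 0 y x₀)
        P₀ = conv (trans (sym (FV-subst {σ = var} (λ _ _ → refl) (cΔ (M 0 y)) (cΔ-FV (M 0 y))))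
          (trans (cΔ-sub {τ = λ _ → x₀} (λ { zero → refl }) (M 0 y)) (flat _ _ _ (λ { 0F → refl ; 1F → refl ; 2F → refl ; 3F → refl }) Θ))) (pr₂ hyp)
        P₁ : Γ ⊩ cΔ (Mt {2} 0 x x₁)
        P₁ = conv (trans (cΔ-shift (M 0 x)) (flat _ _ _ (λ { 0F → refl ; 1F → refl ; 2F → refl ; 3F → refl }) Θ)) (pr₁ (pr₁ hyp))
        check : Δ 4
        check = `v 0F `= `l 4 `* (`l 2 `* `v 1F `+ `l 1) `⇒ (fm (appD inD (l# 0 ∷ y# {4} 1F ∷ y# 2F ∷ [])) `⇒
          (fm (appD inD (l# 0 ∷ y# {4} 0F ∷ y# 2F ∷ [])) `⇒ `⊥))
        clash : ∀ {γ} (t : Tm 2) → γ ⊩ cΔ (In' (`l 0) (`l x) t) → γ ⊩ cΔ (In' (`l 0) (`l y) t) → γ ⊩ cΔ (At validD t) → γ ⊩ ⊥'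
        clash {γ} t p q v = app (app (app
          (∀-instτ (consτ (`l x) (consτ t λ _ → `l e)) (`v 1F) (`l y) check
            (∀-instτ (consτ t λ _ → `l e) (`v 0F) (`l x) (`∀ (`v 1F) check) (pr₁ (pr₂ (pr₂ v))) (in-≤ t p)) (in-≤ t q))
          (K (true-at {n = 2} (`l y `= `l 4 `* (`l 2 `* `l x `+ `l 1)) [] y≡)))
          (conv (sym (flat _ _ _ (λ { 0F → refl ; 1F → refl ; 2F → refl }) (fm inD))) p))
          (conv (sym (flat _ _ _ (λ { 0F → refl ; 1F → refl ; 2F → refl }) (fm inD))) q)

open ProvabilityPredicate

-- Links between formulas at a level, and what a verified level certifies

module VerifiedLevels where
  open import Data.Maybe using (just)

  iff→≡ : ∀ a b → (not a ∨ b) ∧ (not b ∨ a) ≡ true → a ≡ b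
  iff→≡ true true _ = refl
  iff→≡ false false _ = refl

  ≡→iff : ∀ {a b} → a ≡ b → (not a ∨ b) ∧ (not b ∨ a) ≡ true
  ≡→iff {false} refl = refl
  ≡→iff {true} refl = refl

  -- Representatives for the equivalence relation generated by a list of pairs.
  rep : List (ℕ × ℕ) → ℕ → ℕ
  rep [] x = x
  rep ((a , b) ∷ l) x with rep l x ≟ rep l b
  ... | yes _ = rep l a
  ... | no _ = rep l x

  rep-cong : ∀ p l {x y} → rep l x ≡ rep l y → rep (p ∷ l) x ≡ rep (p ∷ l) y
  rep-cong (a , b) l {x} {y} q with rep l x ≟ rep l b | rep l y ≟ rep l b
  ... | yes _ | yes _ = refl
  ... | yes r | no s = ⊥-elim (s (trans (sym q) r))
  ... | no r | yes s = ⊥-elim (r (trans q s))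
  ... | no _ | no _ = q

  rep-edge : ∀ l {a b} → (a , b) ∈ l → rep l a ≡ rep l b
  rep-edge ((a , b) ∷ l) (here refl) with rep l a ≟ rep l b | rep l b ≟ rep l b
  ... | yes _ | yes _ = refl
  ... | no _ | yes _ = refl
  ... | _ | no s = ⊥-elim (s refl)
  rep-edge (p ∷ l) (there m) = rep-cong p l (rep-edge l m)

  rep-path : (P : ℕ → ℕ → Set) → (∀ {x} → P x x) → (∀ {x y} → P x y → P y x) → (∀ {x y z} → P x y → P y z → P x z) →
    ∀ l → (∀ {a b} → (a , b) ∈ l → P a b) → ∀ {x y} → rep l x ≡ rep l y → P x y
  rep-path P r s t [] h refl = r
  rep-path P r s t ((a , b) ∷ l) h {x} {y} q with rep l x ≟ rep l b | rep l y ≟ rep l b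
  ... | yes u | yes v = rep-path P r s t l (h ∘ there) (trans u (sym v))
  ... | yes u | no _ = t (rep-path P r s t l (h ∘ there) u) (t (s (h (here refl))) (rep-path P r s t l (h ∘ there) q))
  ... | no _ | yes v = t (rep-path P r s t l (h ∘ there) q) (t (h (here refl)) (s (rep-path P r s t l (h ∘ there) v)))
  ... | no _ | no _ = rep-path P r s t l (h ∘ there) q

  ⊤ₘ : MFormula
  ⊤ₘ = ¬ₘ ⊥ₘ

  module Levels (T : Theory) (χ : PR 1) (χ-in : ∀ φ → T φ → evalPR χ (code φ ∷ []) ≡ 1)
    (χ-out : ∀ φ → evalPR χ (code φ ∷ []) ≡ 1 → T φ) (L : Logic) (Mx : Formula) where
    open Coding Mx public
    open Predicates χ L public
    open Horn (rulesFor χ L) baseTags public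

    consT : ∀ φ ψ ξ → (∀ w → evalB w φ ≡ true → evalB w ψ ≡ true → evalB w ξ ≡ true) → T ⊢ φ → T ⊢ ψ → T ⊢ ξ
    consT = System.cons₂ (formulas T)

    consL : ∀ A B C → (∀ v w → evalM v w A ≡ true → evalM v w B ≡ true → evalM v w C ≡ true) → L ⊢ₘ A → L ⊢ₘ B → L ⊢ₘ C
    consL A B C h = System.cons₂ (modal L) A B C (λ (v , w) → h v w)

    iffT-sym : ∀ {φ ψ} → T ⊢ φ ⇔' ψ → T ⊢ ψ ⇔' φ
    iffT-sym {φ} {ψ} p = consT (φ ⇔' ψ) (φ ⇔' ψ) (ψ ⇔' φ) (λ w h _ → ≡→iff (sym (iff→≡ (evalB w φ) (evalB w ψ) h))) p p

    iffT-trans : ∀ {φ ψ ξ} → T ⊢ φ ⇔' ψ → T ⊢ ψ ⇔' ξ → T ⊢ φ ⇔' ξ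
    iffT-trans {φ} {ψ} {ξ} = consT (φ ⇔' ψ) (ψ ⇔' ξ) (φ ⇔' ξ)
      (λ w h k → ≡→iff (trans (iff→≡ (evalB w φ) (evalB w ψ) h) (iff→≡ (evalB w ψ) (evalB w ξ) k)))

    Hold : ℕ → Fact → Set
    Hold n = Sound.Holds T χ χ-out L Mx (BaseOf n)

    opaque
      hold : ∀ {n} → DB n e → ∀ {F} → Has n F → Hold n F
      hold {n} db h = Sound.der-sound T χ χ-out L Mx (BaseOf n) proj₁ (db-sound db h)

    modal-thm : ∀ {n} → DB n e → ∀ A → Has n (fact 8 1 (kF (ff A)) 0 0) → L ⊢ₘ A
    modal-thm db A h with hold db h
    ... | C , q , p = ≡subst (L ⊢ₘ_) (ff-inj C A (kF-inj _ _ (sym q))) p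

    edge-sound : ∀ {j x y} → Edge e j x y → ∃ λ φ → ∃ λ ψ → x ≡ kF φ × y ≡ kF ψ × T ⊢ φ ⇔' ψ
    edge-sound {j} {x} {y} (_ , _ , db , gx , gy , iff) with hold db gx | hold db gy
    ... | φ , refl | ψ , refl = φ , ψ , refl , refl , go iff
      where
      go : HasA j e (two x y) iffAtom ⊎ HasA j e (two x y) iffAtom′ → T ⊢ φ ⇔' ψ
      go (inj₁ h) with hold db (HasA-sound {e = e} {η = two x y} iffAtom (proj₁ db) h)
      ... | ξ , q , p = ≡subst (T ⊢_) (kF-inj ξ (φ ⇔' ψ) (sym q)) p
      go (inj₂ h) with hold db (HasA-sound {e = e} {η = two x y} iffAtom′ (proj₁ db) h)
      ... | ξ , q , p = iffT-sym (≡subst (T ⊢_) (kF-inj ξ (ψ ⇔' φ) (sym q)) p)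

    edge-sym : ∀ {j x y} → Edge e j x y → Edge e j y x
    edge-sym (x≤ , y≤ , db , gx , gy , inj₁ h) = y≤ , x≤ , db , gy , gx , inj₂ h
    edge-sym (x≤ , y≤ , db , gx , gy , inj₂ h) = y≤ , x≤ , db , gy , gx , inj₁ h

    edge-exists : ∀ {φ ψ} → T ⊢ φ ⇔' ψ → ∃ λ j → Edge e j (kF φ) (kF ψ)
    edge-exists {φ} {ψ} p with db-exists {e} {λ _ → ⊥} (λ ()) (fact 1 0 (kF φ) 0 0 ∷ fact 1 0 (kF ψ) 0 0 ∷ fact 8 0 (kF (φ ⇔' ψ)) 0 0 ∷ [])
        (C.dG0 φ ∷ C.dG0 ψ ∷ C.dThm0 χ-in p ∷ [])
      where module C = Complete χ L Mx (λ _ → ⊥)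
    ... | j , db , gx ∷ gy ∷ th ∷ [] , _ , hasA = j , proj₁ (proj₂ (Has-≤ _ gx)) , proj₁ (proj₂ (Has-≤ _ gy)) , db , gx , gy ,
      inj₁ (hasA (two (kF φ) (kF ψ)) iffAtom refl th)

    -- T-equivalence restricted to proofs below k and closed under chaining. The restriction leaves
    -- finitely many edges, so that the representatives `rp` decide it.
    data Path (k : ℕ) : ℕ → ℕ → Set where
      []  : ∀ {x} → Path k x x
      via : ∀ {j x y z} → suc j ≤ k → Edge e j x y → Path k y z → Path k x z

    path-trans : ∀ {k x y z} → Path k x y → Path k y z → Path k x z
    path-trans [] q = q
    path-trans (via l d p) q = via l d (path-trans p q)

    path-sym : ∀ {k x y} → Path k x y → Path k y x
    path-sym [] = []
    path-sym (via l d p) = path-trans (path-sym p) (via l (edge-sym d) [])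

    path-mono : ∀ {k k′ x y} → k ≤ k′ → Path k x y → Path k′ x y
    path-mono h [] = []
    path-mono h (via l d p) = via (≤-trans l h) d (path-mono h p)

    path-sound : ∀ {k y} φ → Path k (kF φ) y → ∃ λ ψ → y ≡ kF ψ × T ⊢ φ ⇔' ψ
    path-sound φ p = go φ p refl
      where
      go : ∀ {k x y} φ → Path k x y → x ≡ kF φ → ∃ λ ψ → y ≡ kF ψ × T ⊢ φ ⇔' ψ
      go φ [] q = φ , q , taut λ w → ≡→iff {evalB w φ} refl
      go φ (via l d p) q with edge-sound d
      ... | φ′ , ψ , r , s , t with kF-inj φ′ φ (trans (sym r) q)
      ... | refl with go ψ p s
      ... | ξ , u , v = ξ , u , iffT-trans t v

    -- An edge mentions only codes bounded by its proof. Hence the class of a code is bounded by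
    -- that code together with k, which keeps stages finite.
    path-end : ∀ {k x y} → Path k x y → x ≡ y ⊎ (x ≤ k × y ≤ k)
    path-end [] = inj₁ refl
    path-end (via l d@(x≤ , y≤ , _) p) with path-end p
    ... | inj₁ refl = inj₂ (≤-trans x≤ (<⇒≤ l) , ≤-trans y≤ (<⇒≤ l))
    ... | inj₂ (_ , z≤) = inj₂ (≤-trans x≤ (<⇒≤ l) , z≤)

    opaque
      edge? : ∀ k x y → Dec (∃ λ j → j ≤ k × (suc j ≤ k × Edge e j x y))
      edge? k x y = decEx≤ (λ j → (suc j ≤? k) ×-dec decD edgeD₀ (j ∷ x ∷ y ∷ e ∷ [])) k

      edges : ℕ → List (ℕ × ℕ)
      edges k = filter (λ (x , y) → edge? k x y) (cartesianProduct (upTo (suc k)) (upTo (suc k)))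

      rp : ℕ → ℕ → ℕ
      rp k = rep (edges k)

      rp-edge : ∀ {k j x y} → suc j ≤ k → Edge e j x y → rp k x ≡ rp k y
      rp-edge {k} {j} {x} {y} l d@(x≤ , y≤ , _) = rep-edge (edges k) (∈-filter⁺ (λ (x , y) → edge? k x y)
        (∈-cartesianProduct⁺ (∈-upTo⁺ (s≤s (≤-trans x≤ (<⇒≤ l)))) (∈-upTo⁺ (s≤s (≤-trans y≤ (<⇒≤ l))))) (j , <⇒≤ l , l , d))

      path→rp : ∀ {k x y} → Path k x y → rp k x ≡ rp k y
      path→rp [] = refl
      path→rp (via l d p) = trans (rp-edge l d) (path→rp p)

      rp→path : ∀ {k x y} → rp k x ≡ rp k y → Path k x y
      rp→path {k} = rep-path (Path k) [] path-sym path-trans (edges k) one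
        where
        one : ∀ {a b} → (a , b) ∈ edges k → Path k a b
        one m with proj₂ (∈-filter⁻ (λ (x , y) → edge? k x y) {xs = cartesianProduct (upTo (suc k)) (upTo (suc k))} m)
        ... | j , _ , l , d = via l d []

    -- Numerals have codes larger than their values, and these numerals sit inside the boxes. Thus
    -- an interpretation with code at most k has rank at most k and is among those recognised at
    -- level k.
    rank≤code : ∀ A → rank A ≤ kF (ff A)
    rank≤code = go
      where
      p₁ : ∀ a b → a < ⟪ a , b ⟫
      p₁ a b = proj₁ (⟪⟫-> a b)
      p₂ : ∀ a b → b < ⟪ a , b ⟫
      p₂ a b = proj₂ (⟪⟫-> a b)
      n<kn : ∀ i → i < kT (numeral i)
      n<kn zero = ≤-trans (s≤s z≤n) (p₁ 1 0)
      n<kn (suc i) = ≤-trans (s≤s (n<kn i)) (p₂ 2 _)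
      box-> : ∀ b i → kT (numeral i) < kF (BoxF b i)
      box-> b i = <-trans (p₁ _ _) (<-trans (p₂ 0 _) (<-trans (p₁ _ _) (<-trans (p₂ 3 _)
        (<-trans (p₂ 7 _) (<-trans (p₂ 7 _) (<-trans (p₂ 7 _) (p₂ 7 _)))))))
      bin-> : ∀ o {a b x y} → a ≤ x → b ≤ y → suc (a ⊔ b) ≤ ⟪ o , ⟪ x , y ⟫ ⟫
      bin-> o {x = x} {y} p q = ≤-trans (s≤s (⊔-lub (≤-trans p (<⇒≤ (p₁ x y))) (≤-trans q (<⇒≤ (p₂ x y))))) (p₂ o _)
      go : ∀ A → rank A ≤ kF (ff A)
      go (pv i) = ≤-trans (n<kn i) (<⇒≤ (box-> 1 i))
      go ⊥ₘ = ≤-trans (s≤s z≤n) (p₂ 0 _)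
      go (¬ₘ A) = ≤-trans (s≤s (go A)) (p₂ 2 _)
      go (A ∧ₘ A′) = bin-> 3 (go A) (go A′)
      go (A ∨ₘ A′) = bin-> 4 (go A) (go A′)
      go (A ⇒ₘ A′) = bin-> 5 (go A) (go A′)
      go (□ A) = ≤-trans (s≤s (go A)) (≤-trans (n<kn (kF (ff A))) (<⇒≤ (box-> 0 (kF (ff A)))))

    ff-neg : ∀ A {ψ} → ff A ≡ ¬' ψ → ∃ λ C → A ≡ ¬ₘ C × ff C ≡ ψ
    ff-neg (¬ₘ C) refl = C , refl , refl

    module Verified {h k : ℕ} (ver′ : Ver e h k) where
      private
        ver : VerData e h k
        ver = verData ver′
        k≤h : k ≤ h
        k≤h = proj₁ ver
        db : DB h e
        db = proj₁ (proj₂ ver)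
        sats : All (SatR h e k) satRules
        sats = proj₁ (proj₂ (proj₂ ver))
        satN : SatN h e
        satN = proj₁ (proj₂ (proj₂ (proj₂ ver)))
        nums : Numerals e h k
        nums = proj₁ (proj₂ (proj₂ (proj₂ (proj₂ ver))))
        edgeR : ∀ j → j ≤ k → ∀ x → x ≤ k → ∀ y → y ≤ k → suc j ≤ k → Edge e j x y → Has h (fact 13 x y 0 0)
        edgeR = proj₁ (proj₂ (proj₂ (proj₂ (proj₂ (proj₂ ver)))))
        in⊤ : Has h (fact 14 0 ⊤c 1 0)
        in⊤ = proj₁ (proj₂ (proj₂ (proj₂ (proj₂ (proj₂ (proj₂ ver))))))
        chained : Chained e h k
        chained = proj₂ (proj₂ (proj₂ (proj₂ (proj₂ (proj₂ (proj₂ ver))))))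

        premises : ∀ v {As} → All (λ A → flatA A ≡ true × Has h (evA e (lookup v) A)) As → All (HasA h e (lookup v)) As
        premises v [] = []
        premises v (_∷_ {A} (f , p) ps) = hasA-flat A f p ∷ premises v ps

        fire : ∀ i {r} → nth satList i ≡ just r → ∀ v → Bdd h v → suc (lookup v zero) ≤ k →
          All (λ A → flatA A ≡ true × Has h (evA e (lookup v) A)) (prems r) → Has h (evA e (lookup v) (concl r))
        fire i {r} q v bd l ps = HasA-sound {e = e} {η = lookup v} (concl r) (proj₁ db) (All.lookup sats (≡subst (r ∈_) satRules≡ (nth-∈ satList i q)) v bd l (premises v ps))

        fireN : ∀ v → Bdd h v → lookup v 7F ≡ 4 * (2 * lookup v 6F + 1) →
          All (λ A → flatA A ≡ true × Has h (evA e (lookup v) A)) (prems negRule) → Has h (evA e (lookup v) (concl negRule))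
        fireN v bd q ps = HasA-sound {e = e} {η = lookup v} (concl negRule) (proj₁ db) (satN v bd q (premises v ps))

        F-≤ : ∀ {s x} → Has h (fact 11 s x 0 0) → s ≤ h × x ≤ h
        F-≤ p = proj₁ (Has-≤ _ p) , proj₁ (proj₂ (Has-≤ _ p))

        hasNum : ∀ {n c} → Has h (fact 5 n c 0 0) → n ≤ h × c ≤ h × c ≡ kT (numeral n)
        hasNum p = proj₁ (Has-≤ _ p) , proj₁ (proj₂ (Has-≤ _ p)) , hold db p

        hasTT : 1 ≤ k → ∀ o → Has h (fact 7 (opTag o) 1 1 (b2n (opB o true true)))
        hasTT 1≤k ∧ₒ = (fire 6 refl (vals 0 0 0 0 0 0 0 0) (vals-bdd z≤n z≤n z≤n z≤n z≤n z≤n z≤n z≤n) 1≤k [])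
        hasTT 1≤k ∨ₒ = (fire 10 refl (vals 0 0 0 0 0 0 0 0) (vals-bdd z≤n z≤n z≤n z≤n z≤n z≤n z≤n z≤n) 1≤k [])
        hasTT 1≤k ⇒ₒ = (fire 14 refl (vals 0 0 0 0 0 0 0 0) (vals-bdd z≤n z≤n z≤n z≤n z≤n z≤n z≤n z≤n) 1≤k [])

        F-bin : ∀ o {s x y} → suc s ≤ k → Has h (fact 11 s x 0 0) → Has h (fact 11 s y 0 0) → Has h (fact 11 (suc s) ⟪ opTag o , ⟪ x , y ⟫ ⟫ 0 0)
        F-bin o {s} {x} {y} l p q with hasTT (≤-trans (s≤s z≤n) l) o
        ... | t = (fire 4 refl v (vals-bdd (proj₁ (F-≤ p)) z≤n (proj₁ (proj₂ t≤)) (proj₁ (proj₂ t≤)) (proj₂ (F-≤ p)) (proj₂ (F-≤ q)) (proj₁ t≤) (proj₂ (proj₂ (proj₂ t≤)))) l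
              ((refl , p) ∷ (refl , q) ∷ (refl , t) ∷ []))
          where
          v = vals s 0 1 1 x y (opTag o) (b2n (opB o true true))
          t≤ = Has-≤ _ t

        hasF : ∀ A s → rank A ≤ s → s ≤ k → Has h (fact 11 s (kF (ff A)) 0 0)
        hasF (pv i) (suc s) (s≤s r) l = go s (≤⇒≤′ r) l
          where
          go : ∀ s → i ≤′ s → suc s ≤ k → Has h (fact 11 (suc s) (kF (ff (pv i))) 0 0)
          go s ≤′-refl l with proj₁ (proj₂ nums i (<⇒≤ l)) | proj₁ nums
          ... | c , _ , nc | d , _ , nd with hasNum nc | hasNum nd
          ... | i≤ , c≤ , refl | _ , d≤ , refl = (fire 1 refl v (vals-bdd i≤ c≤ d≤ z≤n z≤n z≤n z≤n z≤n) l
                ((refl , nc) ∷ (refl , nd) ∷ []))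
            where v = vals i c d 0 0 0 0 0
          go (suc s) (≤′-step r) l with go s r (<⇒≤ l)
          ... | p = (fire 2 refl v (vals-bdd (proj₁ (F-≤ p)) z≤n z≤n z≤n (proj₂ (F-≤ p)) z≤n z≤n z≤n) l ((refl , p) ∷ []))
            where v = vals (suc s) 0 0 0 (kF (ff (pv i))) 0 0 0
        hasF ⊥ₘ (suc s) r l = (fire 0 refl (vals s 0 0 0 0 0 0 0) (vals-bdd (≤-trans (<⇒≤ l) k≤h) z≤n z≤n z≤n z≤n z≤n z≤n z≤n) l [])
        hasF (¬ₘ A) (suc s) (s≤s r) l with hasF A s r (<⇒≤ l)
        ... | p = (fire 3 refl v (vals-bdd (proj₁ (F-≤ p)) z≤n z≤n z≤n (proj₂ (F-≤ p)) z≤n z≤n z≤n) l ((refl , p) ∷ []))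
          where v = vals s 0 0 0 (kF (ff A)) 0 0 0
        hasF (A ∧ₘ A′) (suc s) (s≤s r) l = F-bin ∧ₒ l (hasF A s (m⊔n≤o⇒m≤o _ _ r) (<⇒≤ l)) (hasF A′ s (m⊔n≤o⇒n≤o _ _ r) (<⇒≤ l))
        hasF (A ∨ₘ A′) (suc s) (s≤s r) l = F-bin ∨ₒ l (hasF A s (m⊔n≤o⇒m≤o _ _ r) (<⇒≤ l)) (hasF A′ s (m⊔n≤o⇒n≤o _ _ r) (<⇒≤ l))
        hasF (A ⇒ₘ A′) (suc s) (s≤s r) l = F-bin ⇒ₒ l (hasF A s (m⊔n≤o⇒m≤o _ _ r) (<⇒≤ l)) (hasF A′ s (m⊔n≤o⇒n≤o _ _ r) (<⇒≤ l))
        hasF (□ A) (suc s) (s≤s r) l with hasF A s r (<⇒≤ l)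
        ... | p with proj₂ (proj₂ nums s (<⇒≤ l)) _ (proj₂ (F-≤ p)) p | proj₁ nums
        ... | c , _ , nc | d , _ , nd with hasNum nc | hasNum nd
        ... | x≤ , c≤ , refl | _ , d≤ , refl = (fire 5 refl v (vals-bdd (proj₁ (F-≤ p)) c≤ d≤ z≤n x≤ z≤n z≤n z≤n) l
              ((refl , p) ∷ (refl , nc) ∷ (refl , nd) ∷ []))
          where v = vals s c d 0 (kF (ff A)) 0 0 0

        R-≤ : ∀ {x y} → Has h (fact 13 x y 0 0) → x ≤ h × y ≤ h
        R-≤ p = proj₁ (Has-≤ _ p) , proj₁ (proj₂ (Has-≤ _ p))

        edge-R : ∀ {j x y} → suc j ≤ k → Edge e j x y → Has h (fact 13 x y 0 0)
        edge-R l d@(x≤ , y≤ , _) = edgeR _ (<⇒≤ l) _ (≤-trans x≤ (<⇒≤ l)) _ (≤-trans y≤ (<⇒≤ l)) l d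

        path-R : ∀ {x y} → Path k x y → x ≡ y ⊎ (Has h (fact 13 x y 0 0) × 1 ≤ k × x ≤ k × y ≤ k)
        path-R [] = inj₁ refl
        path-R {x} {z} (via {y = y} l d@(x≤ , y≤ , _) p) with path-R p
        ... | inj₁ refl = inj₂ (edge-R l d , ≤-trans (s≤s z≤n) l , ≤-trans x≤ (<⇒≤ l) , ≤-trans y≤ (<⇒≤ l))
        ... | inj₂ (q , 1≤k , _ , z≤) = inj₂ ((fire 18 refl v
              (vals-bdd z≤n z≤n z≤n z≤n (proj₁ (R-≤ r)) (proj₂ (R-≤ r)) (proj₂ (R-≤ q)) z≤n) 1≤k
              ((refl , r) ∷ (refl , q) ∷ [])) , 1≤k , ≤-trans x≤ (<⇒≤ l) , z≤)
          where
          v = vals 0 0 0 0 x y z 0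
          r = edge-R l d

      -- No claim about the level is assumed: the database itself contains a derivation in L, which
      -- soundness of the rules turns into a genuine one.
      iff-of : ∀ A A′ → Path k (kF (ff A)) (kF (ff A′)) → L ⊢ₘ A ⇔ₘ A′
      iff-of A A′ p with path-R p
      ... | inj₁ q = ≡subst (λ C → L ⊢ₘ A ⇔ₘ C) (ff-inj A A′ (kF-inj _ _ q)) (m-taut λ v w → ≡→iff {evalM v w A} refl)
      ... | inj₂ (r , 1≤k , x≤ , y≤) = modal-thm db (A ⇔ₘ A′) ((fire 20 refl v
            (vals-bdd z≤n k≤h k≤h z≤n (proj₁ (R-≤ r)) (proj₂ (R-≤ r)) z≤n z≤n) 1≤k
            ((refl , hasF A k (≤-trans (rank≤code A) x≤) ≤-refl) ∷
             (refl , hasF A′ k (≤-trans (rank≤code A′) y≤) ≤-refl) ∷ (refl , r) ∷ [])))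
        where v = vals 0 k k 0 (kF (ff A)) (kF (ff A′)) 0 0

      -- If one of the paths is trivial, z is itself the code of an interpretation and `iff-of`
      -- suffices. Two nontrivial paths are the case for which `SatN` is imposed.
      neg-of : ∀ A A′ {z} → Path k (kF (ff A)) z → Path k ⟪ 2 , z ⟫ (kF (ff A′)) → L ⊢ₘ (¬ₘ A) ⇔ₘ A′
      neg-of A A′ {z} p q with path-R p | path-R q
      ... | inj₁ refl | _ = iff-of (¬ₘ A) A′ q
      ... | inj₂ _ | inj₁ r with path-sound (ff A) p
      ... | ψ , refl , _ with ff-neg A′ {ψ} (kF-inj _ (¬' ψ) (sym r))
      ... | C , refl , refl = consL (A ⇔ₘ C) (A ⇔ₘ C) ((¬ₘ A) ⇔ₘ (¬ₘ C))
        (λ v w h _ → ≡→iff (cong not (iff→≡ (evalM v w A) (evalM v w C) h))) (iff-of A C p) (iff-of A C p)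
      neg-of A A′ {z} p q | inj₂ (r , 1≤k , x≤ , _) | inj₂ (r′ , _ , _ , y≤) = modal-thm db ((¬ₘ A) ⇔ₘ A′) ((fireN v
            (vals-bdd z≤n k≤h k≤h z≤n (proj₁ (R-≤ r)) (proj₂ (R-≤ r′)) (proj₂ (R-≤ r)) (proj₁ (R-≤ r′))) (⟪⟫≡pair 2 z)
            ((refl , hasF A k (≤-trans (rank≤code A) x≤) ≤-refl) ∷
             (refl , hasF A′ k (≤-trans (rank≤code A′) y≤) ≤-refl) ∷ (refl , r) ∷ (refl , r′) ∷ [])))
        where v = vals 0 k k 0 (kF (ff A)) (kF (ff A′)) z ⟪ 2 , z ⟫

      in-path : ∀ {x} → In 0 x h → Path k ⊤c x
      in-path {x} (x≤ , p) with proj₁ chained x x≤ p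
      ... | s , s≤ , c = go s x c
        where
        go : ∀ s x → Has h (fact 15 s x 0 0) → Path k ⊤c x
        go s x c with proj₂ chained s (proj₁ (Has-≤ _ c)) x (proj₁ (proj₂ (Has-≤ _ c))) c
        ... | inj₁ (_ , refl) = []
        ... | inj₂ (s′ , _ , y , _ , j , _ , refl , c′ , l , d) = path-trans (go s′ y c′) (via l d [])

      in-closed : ∀ {x y} → Path k x y → In 0 x h → In 0 y h
      in-closed [] p = p
      in-closed {x} (via {y = y} l d p) (x≤ , q) = in-closed p (proj₂ (R-≤ r) , (fire 19 refl v
          (vals-bdd z≤n z≤n z≤n z≤n x≤ (proj₂ (R-≤ r)) z≤n z≤n) (≤-trans (s≤s z≤n) l)
          ((refl , q) ∷ (refl , r) ∷ [])))
        where
        v = vals 0 0 0 0 x y 0 0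
        r = edge-R l d

      in-of : ∀ {x} → Path k ⊤c x → In 0 x h
      in-of p = in-closed p (proj₁ (proj₂ (Has-≤ _ in⊤)) , in⊤)

open VerifiedLevels

-- Absence of fires and existence of valid stages

module FirstStages where
  module Stages (T : Theory) (χ : PR 1) (χ-in : ∀ φ → T φ → evalPR χ (code φ ∷ []) ≡ 1)
    (χ-out : ∀ φ → evalPR χ (code φ ∷ []) ≡ 1 → T φ) (con : Consistent T) (T⊤ : T ⊢ ¬' (zr ≐ S zr)) (L : Logic) (Mx : Formula)
    (box-true : ∀ b i w → Predicates.Theta χ L b (kF Mx) i w → T ⊢ Coding.BoxF Mx b i)
    (box-refute : ∀ b i n → Predicates.VF χ L (kF Mx) n → (∀ w → w ≤ n → ¬ Predicates.Theta χ L b (kF Mx) i w) → T ⊢ ¬' Coding.BoxF Mx b i)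
    where
    open Levels T χ χ-in χ-out L Mx public

    -- At the first fire T proves all literals of the scenario, which T refutes.
    no-fire : ∀ n → ¬ VF e n
    no-fire = <-rec (λ n → ¬ VF e n) step
      where
      step : ∀ n → (∀ {m} → m < n → ¬ VF e m) → ¬ VF e n
      step n ih vf@(valid@(_ , mono , _) , fir@(fired (db , ref , excl))) = con (≡subst (T ⊢_) (sym (kF-inj _ _ (proj₁ (proj₂ held)))) (proj₂ (proj₂ held) pos neg))
        where
        held = hold db ref
        quiet : NoFire e n
        quiet w w≤ f with m≤n⇒m<n∨m≡n w≤
        ... | inj₁ w<n = ⊥-elim (ih w<n f)
        ... | inj₂ w≡n = w≡n
        pos : ∀ b i → BaseOf n (fact 14 b i 1 0) → T ⊢ BoxF b i
        pos b i (_ , h) = box-true b i n ((proj₁ (proj₂ (Has-≤ _ h)) , h) , valid , quiet , inj₂ fir)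
        neg : ∀ b i → BaseOf n (fact 14 b i 0 0) → T ⊢ ¬' BoxF b i
        neg b i (_ , h) = box-refute b i n vf λ w w≤ th → no-theta w w≤ th
          where
          absent : ∀ b → b ≤ n → Has n (fact 14 b i 0 0) → In b i n → ⊥
          absent b b≤ h (_ , h′) = excl b b≤ i (proj₁ (proj₂ (Has-≤ _ h))) h h′
          no-theta : ∀ w → w ≤ n → ¬ Theta b e i w
          no-theta w w≤ (here-w , v , _ , t) with m≤n⇒m<n∨m≡n w≤
          ... | inj₂ refl = absent b (proj₁ (Has-≤ _ h)) h here-w
          ... | inj₁ w<n with proj₂ (proj₂ (proj₂ v)) | t
          ... | inj₂ f | _ = ih w<n (v , f)
          ... | inj₁ _ | inj₂ f = ih w<n (v , f)
          -- An earlier verified stage containing i would hand it on to n by `Mono`, where the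
          -- negative literal excludes it.
          ... | inj₁ ver | inj₁ refl = absent 0 z≤n h (mono w w≤ i (proj₁ here-w) ver here-w)

    path-provable : ∀ {k} φ → Path k ⊤c (kF φ) → T ⊢ φ
    path-provable φ p with path-sound (¬' (zr ≐ S zr)) p
    ... | ψ , q , r with kF-inj φ ψ q
    ... | refl = consT (¬' (zr ≐ S zr)) (¬' (zr ≐ S zr) ⇔' φ) φ (λ w h k → trans (sym (iff→≡ (not (w (zr ≐ S zr))) (evalB w φ) k)) h) T⊤ r

    theta-path : ∀ {x w} → Theta 0 e x w → ∃ λ k → Path k ⊤c x
    theta-path {x} {w} (i , v@(_ , _ , _ , inj₁ (k , _ , ver)) , _ , _) = k , Verified.in-path ver i
    theta-path {x} {w} (i , v@(_ , _ , _ , inj₂ f) , _ , _) = ⊥-elim (no-fire w (v , f))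

    dp-provable : ∀ {h} L′ → (∀ x → In 0 x h → ∃ λ φ → x ≡ kF φ × T ⊢ φ) → DPFor L′ h
    dp-provable EN f = refl
    dp-provable ENP f i with f ⊥c i
    ... | φ , q , p with kF-inj (zr ≐ S zr) φ q
    ... | refl = con (consT φ (¬' φ) ⊥' (λ w a b → trans (sym (cong not a)) b) p T⊤)
    dp-provable END f x _ y _ refl i j with f x i | f y j
    ... | φ , refl , p | ψ , q , r with kF-inj (¬' φ) ψ (trans (⟪⟫≡pair 2 (kF φ)) q)
    ... | refl = con (consT φ (¬' φ) ⊥' (λ w a b → trans (sym (cong not a)) b) p r)

    later? : ∀ n k → Dec (∃ λ h → h ≤ n × ∃ λ k′ → k′ ≤ n × (suc k ≤ k′ × Ver e h k′))
    later? n k = decEx≤ (λ h → decEx≤ (λ k′ → (suc k ≤? k′) ×-dec decD verD₀ (h ∷ k′ ∷ e ∷ [])) n) n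

    -- All that is imposed on h stems from levels at most k, which h already incorporates. P and D
    -- hold because the members are theorems of the consistent theory T.
    valid-if-last : ∀ {h k} → Ver e h k → ¬ (∃ λ h′ → h′ ≤ h × ∃ λ k′ → k′ ≤ h × (suc k ≤ k′ × Ver e h′ k′)) → Valid e h
    valid-if-last {h} {k} ver last = closure , mono , dp-provable L provable , inj₁ (k , proj₁ (verData ver) , ver)
      where
      module W = Verified ver
      below : ∀ {h′ k′} → h′ ≤ h → k′ ≤ h → Ver e h′ k′ → k′ ≤ k
      below {h′} {k′} h≤ k≤ v = ≮⇒≥ λ k<k′ → last (h′ , h≤ , k′ , k≤ , k<k′ , v)
      closure : Closure e h
      closure p p≤ x _ y _ (h′ , h≤ , k′ , k≤ , j , _ , v , l , d) i =
        W.in-closed (via (≤-trans l (below (≤-trans h≤ p≤) (≤-trans k≤ p≤) v)) d []) i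
      mono : Mono e h
      mono w w≤ x _ (k′ , k≤ , v) i = W.in-of (path-mono (below w≤ (≤-trans k≤ w≤) v) (Verified.in-path v i))
      provable : ∀ x → In 0 x h → ∃ λ φ → x ≡ kF φ × T ⊢ φ
      provable x i with path-sound (¬' (zr ≐ S zr)) (W.in-path i)
      ... | φ , refl , _ = φ , refl , path-provable φ (W.in-path i)

    -- Passing to a stage of higher level not above h never raises the stage and raises the level,
    -- so h ∸ k drops and the search ends.
    valid-stage : ∀ fuel {h k} → h ∸ k ≤ fuel → Ver e h k → ∃ λ h′ → ∃ λ k′ → k ≤ k′ × Ver e h′ k′ × Valid e h′
    valid-stage fuel {h} {k} le ver = go fuel le (later? h k)
      where
      go : ∀ fuel → h ∸ k ≤ fuel → Dec (∃ λ h′ → h′ ≤ h × ∃ λ k′ → k′ ≤ h × (suc k ≤ k′ × Ver e h′ k′)) →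
        ∃ λ h′ → ∃ λ k′ → k ≤ k′ × Ver e h′ k′ × Valid e h′
      go fuel le (no last) = h , k , ≤-refl , ver , valid-if-last ver last
      go zero le (yes (h′ , h≤ , k′ , k≤ , k< , v)) = ⊥-elim (<⇒≱ k< (≤-trans k≤ (m∸n≡0⇒m≤n (n≤0⇒n≡0 le))))
      go (suc fuel) le (yes (h′ , h≤ , k′ , k≤ , k< , v)) with valid-stage fuel {h′} {k′}
        (≤-pred (≤-trans (≤-<-trans (∸-monoˡ-≤ k′ h≤) (∸-monoʳ-< k< k≤)) le)) v
      ... | h″ , k″ , k≤″ , v″ , valid = h″ , k″ , ≤-trans (<⇒≤ k<) k≤″ , v″ , valid

open FirstStages

-- Construction of a verified stage from the claim about its level

module LevelVerification where
  ofRank : ℕ → List MFormula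
  ofRank zero = []
  ofRank (suc n) = ⊥ₘ ∷ List.map pv (upTo (suc n)) ++ List.map ¬ₘ_ l ++ List.map □_ l ++
    cartesianProductWith _∧ₘ_ l l ++ cartesianProductWith _∨ₘ_ l l ++ cartesianProductWith _⇒ₘ_ l l
    where
    l : List MFormula
    l = ofRank n

  ofRank-∈ : ∀ A n → rank A ≤ n → A ∈ ofRank n
  ofRank-∈ (pv i) (suc n) (s≤s r) = there (∈-++⁺ˡ (∈-map⁺ pv (∈-upTo⁺ (s≤s r))))
  ofRank-∈ ⊥ₘ (suc n) r = here refl
  ofRank-∈ (¬ₘ A) (suc n) (s≤s r) = there (∈-++⁺ʳ (List.map pv (upTo (suc n))) (∈-++⁺ˡ (∈-map⁺ ¬ₘ_ (ofRank-∈ A n r))))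
  ofRank-∈ (□ A) (suc n) (s≤s r) = there (∈-++⁺ʳ (List.map pv (upTo (suc n))) (∈-++⁺ʳ (List.map ¬ₘ_ (ofRank n))
    (∈-++⁺ˡ (∈-map⁺ □_ (ofRank-∈ A n r)))))
  ofRank-∈ (A ∧ₘ B) (suc n) (s≤s r) = there (∈-++⁺ʳ (List.map pv (upTo (suc n))) (∈-++⁺ʳ (List.map ¬ₘ_ (ofRank n))
    (∈-++⁺ʳ (List.map □_ (ofRank n)) (∈-++⁺ˡ (∈-cartesianProductWith⁺ _∧ₘ_ (ofRank-∈ A n (m⊔n≤o⇒m≤o _ _ r)) (ofRank-∈ B n (m⊔n≤o⇒n≤o _ _ r)))))))
  ofRank-∈ (A ∨ₘ B) (suc n) (s≤s r) = there (∈-++⁺ʳ (List.map pv (upTo (suc n))) (∈-++⁺ʳ (List.map ¬ₘ_ (ofRank n))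
    (∈-++⁺ʳ (List.map □_ (ofRank n)) (∈-++⁺ʳ (cartesianProductWith _∧ₘ_ (ofRank n) (ofRank n))
      (∈-++⁺ˡ (∈-cartesianProductWith⁺ _∨ₘ_ (ofRank-∈ A n (m⊔n≤o⇒m≤o _ _ r)) (ofRank-∈ B n (m⊔n≤o⇒n≤o _ _ r))))))))
  ofRank-∈ (A ⇒ₘ B) (suc n) (s≤s r) = there (∈-++⁺ʳ (List.map pv (upTo (suc n))) (∈-++⁺ʳ (List.map ¬ₘ_ (ofRank n))
    (∈-++⁺ʳ (List.map □_ (ofRank n)) (∈-++⁺ʳ (cartesianProductWith _∧ₘ_ (ofRank n) (ofRank n))
      (∈-++⁺ʳ (cartesianProductWith _∨ₘ_ (ofRank n) (ofRank n))
        (∈-cartesianProductWith⁺ _⇒ₘ_ (ofRank-∈ A n (m⊔n≤o⇒m≤o _ _ r)) (ofRank-∈ B n (m⊔n≤o⇒n≤o _ _ r))))))))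

  -- Collects derivations only for the instances where the decidable condition holds, since only
  -- there is a derivation at hand.
  select : {X : Set} {D : Fact → Set} {P : X → Set} → (∀ x → Dec (P x)) → (f : X → Fact) → (∀ x → P x → D (f x)) → (xs : List X) →
    ∃ λ l → All D l × (∀ {x} → x ∈ xs → P x → f x ∈ l)
  select P? f d [] = [] , [] , λ ()
  select {P = P} P? f d (x ∷ xs) with select {P = P} P? f d xs | P? x
  ... | l , al , h | yes p = f x ∷ l , d x p ∷ al , λ { (here refl) _ → here refl ; (there m) q → there (h m q) }
  ... | l , al , h | no ¬p = l , al , λ { (here refl) q → ⊥-elim (¬p q) ; (there m) q → h m q }

  module Verification (T : Theory) (χ : PR 1) (χ-in : ∀ φ → T φ → evalPR χ (code φ ∷ []) ≡ 1)
    (χ-out : ∀ φ → evalPR χ (code φ ∷ []) ≡ 1 → T φ) (L : Logic) (Mx : Formula) where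
    open Levels T χ χ-in χ-out L Mx

    Claim : ℕ → Set
    Claim k = (∀ A B → Path k (kF (ff A)) (kF (ff B)) → L ⊢ₘ A ⇔ₘ B) ×
      (∀ A B z → Path k (kF (ff A)) z → Path k ⟪ 2 , z ⟫ (kF (ff B)) → L ⊢ₘ (¬ₘ A) ⇔ₘ B)

    module _ (k : ℕ) (claim : Claim k) where
      private
        Related : ℕ × ℕ → Set
        Related (x , y) = rp k x ≡ rp k y

        related? : ∀ p → Dec (Related p)
        related? (x , y) = rp k x ≟ rp k y

        pairs : List (ℕ × ℕ)
        pairs = filter related? (cartesianProduct (upTo (suc k)) (upTo (suc k)))

        Top : ℕ → Set
        Top x = rp k x ≡ rp k ⊤c

        top? : ∀ x → Dec (Top x)
        top? x = rp k x ≟ rp k ⊤c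

        tops : List ℕ
        -- The bound makes room for ⊤ itself, whose code may exceed k; all other members are at most
        -- k.
        tops = filter top? (upTo (suc (k + ⊤c)))

        len : ∀ {x} → Path k x ⊤c → ℕ
        len [] = 0
        len (via _ _ p) = suc (len p)

        chain : ∀ {x} → Path k x ⊤c → List Fact
        chain [] = fact 15 0 ⊤c 0 0 ∷ []
        chain {x} p@(via _ _ q) = fact 15 (len p) x 0 0 ∷ chain q

        chain-head : ∀ {x} (p : Path k x ⊤c) → fact 15 (len p) x 0 0 ∈ chain p
        chain-head [] = here refl
        chain-head (via _ _ _) = here refl

        Pred : List Fact → ℕ → ℕ → Set
        Pred l s x = (s ≡ 0 × x ≡ ⊤c) ⊎ ∃ λ s′ → ∃ λ y → ∃ λ j → s ≡ suc s′ × fact 15 s′ y 0 0 ∈ l × suc j ≤ k × Edge e j y x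

        Pred-mono : ∀ {l l′ s x} → (∀ {F} → F ∈ l → F ∈ l′) → Pred l s x → Pred l′ s x
        Pred-mono h (inj₁ p) = inj₁ p
        Pred-mono h (inj₂ (s′ , y , j , q , m , r)) = inj₂ (s′ , y , j , q , h m , r)

        chain-pred : ∀ {x} (p : Path k x ⊤c) {s y} → fact 15 s y 0 0 ∈ chain p → Pred (chain p) s y
        chain-pred [] (here refl) = inj₁ (refl , refl)
        chain-pred (via l d p) (here refl) = inj₂ (_ , _ , _ , refl , there (chain-head p) , l , edge-sym d)
        chain-pred (via l d p) (there m) = Pred-mono there (chain-pred p m)

        chains : ∀ l → All Top l → List Fact
        chains [] [] = []
        chains (x ∷ l) (q ∷ qs) = chain (rp→path {k} {x} {⊤c} q) ++ chains l qs

        chains-∈ : ∀ l (qs : All Top l) {x} → x ∈ l → ∃ λ s → fact 15 s x 0 0 ∈ chains l qs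
        chains-∈ (x ∷ l) (q ∷ qs) (here refl) = _ , ∈-++⁺ˡ (chain-head (rp→path {k} {x} {⊤c} q))
        chains-∈ (x ∷ l) (q ∷ qs) (there m) with chains-∈ l qs m
        ... | s , m′ = s , ∈-++⁺ʳ (chain (rp→path {k} {x} {⊤c} q)) m′

        chains-pred : ∀ l (qs : All Top l) {s y} → fact 15 s y 0 0 ∈ chains l qs → Pred (chains l qs) s y
        chains-pred (x ∷ l) (q ∷ qs) m with ∈-++⁻ (chain (rp→path {k} {x} {⊤c} q)) m
        ... | inj₁ m′ = Pred-mono ∈-++⁺ˡ (chain-pred (rp→path {k} {x} {⊤c} q) m′)
        ... | inj₂ m′ = Pred-mono (∈-++⁺ʳ (chain (rp→path {k} {x} {⊤c} q))) (chains-pred l qs m′)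

        tops-Top : All Top tops
        tops-Top = Allₚ.all-filter top? (upTo (suc (k + ⊤c)))

        Rs Ls Cs Bl : List Fact
        Rs = List.map (λ (x , y) → fact 13 x y 0 0) pairs
        Ls = List.map (λ x → fact 14 0 x 1 0) tops
        Cs = chains tops tops-Top
        Bl = Rs ++ (Ls ++ Cs)

        B : Fact → Set
        B F = F ∈ Bl

        chain-tag : ∀ {x} (p : Path k x ⊤c) {F} → F ∈ chain p → ftag F ≡ 15
        chain-tag [] (here refl) = refl
        chain-tag (via _ _ p) (here refl) = refl
        chain-tag (via _ _ p) (there m) = chain-tag p m

        Cs-tag : ∀ l (qs : All Top l) {F} → F ∈ chains l qs → ftag F ≡ 15
        Cs-tag (x ∷ l) (q ∷ qs) m with ∈-++⁻ (chain (rp→path {k} {x} {⊤c} q)) m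
        ... | inj₁ m′ = chain-tag (rp→path {k} {x} {⊤c} q) m′
        ... | inj₂ m′ = Cs-tag l qs m′

        data Kind : Fact → Set where
          isR : ∀ {x y} → (x , y) ∈ pairs → Kind (fact 13 x y 0 0)
          isL : ∀ {x} → x ∈ tops → Kind (fact 14 0 x 1 0)
          isC : ∀ {F} → ftag F ≡ 15 → F ∈ Cs → Kind F

        kind : ∀ {F} → F ∈ Bl → Kind F
        kind m with ∈-++⁻ Rs m
        ... | inj₁ m₁ with ∈-map⁻ (λ (x , y) → fact 13 x y 0 0) m₁
        ... | (x , y) , p , refl = isR p
        kind m | inj₂ m₁ with ∈-++⁻ Ls m₁
        ... | inj₂ m₂ = isC (Cs-tag tops tops-Top m₂) m₂
        ... | inj₁ m₂ with ∈-map⁻ (λ x → fact 14 0 x 1 0) m₂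
        ... | x , p , refl = isL p

        B-tag : ∀ {F} → B F → Any (ftag F ≡_) baseTags
        B-tag m with kind m
        ... | isR _ = here refl
        ... | isL _ = there (here refl)
        ... | isC q _ = there (there (here q))

        inv-R : ∀ {x y} → B (fact 13 x y 0 0) → x ≤ k × y ≤ k × Related (x , y)
        inv-R m with kind m
        ... | isC () _
        ... | isR p with ∈-filter⁻ related? {xs = cartesianProduct (upTo (suc k)) (upTo (suc k))} p
        ... | q , r with ∈-cartesianProduct⁻ (upTo (suc k)) (upTo (suc k)) q
        ... | a , b = ≤-pred (∈-upTo⁻ a) , ≤-pred (∈-upTo⁻ b) , r

        R-in : ∀ {x y} → x ≤ k → y ≤ k → Related (x , y) → B (fact 13 x y 0 0)
        R-in x≤ y≤ r = ∈-++⁺ˡ (∈-map⁺ (λ (x , y) → fact 13 x y 0 0)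
          (∈-filter⁺ related? (∈-cartesianProduct⁺ (∈-upTo⁺ (s≤s x≤)) (∈-upTo⁺ (s≤s y≤))) r))

        inv-L : ∀ {x} → B (fact 14 0 x 1 0) → x ∈ tops
        inv-L m with kind m
        ... | isL p = p
        ... | isC () _

        L-in : ∀ {x} → x ≤ k + ⊤c → Top x → B (fact 14 0 x 1 0)
        L-in x≤ r = ∈-++⁺ʳ Rs (∈-++⁺ˡ (∈-map⁺ (λ x → fact 14 0 x 1 0) (∈-filter⁺ top? (∈-upTo⁺ (s≤s x≤)) r)))

        inv-C : ∀ {s x} → B (fact 15 s x 0 0) → fact 15 s x 0 0 ∈ Cs
        inv-C m with kind m
        ... | isC _ p = p

        module C = Complete χ L Mx B

        D : Fact → Set
        D = Der e B

        Fk : List MFormula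
        Fk = ofRank k

        kn : ℕ → ℕ
        kn n = kT (numeral n)

        ffacts = select {D = D} {P = λ (s , A) → rank A ≤ s} (λ (s , A) → rank A ≤? s) (λ (s , A) → fact 11 s (kF (ff A)) 0 0)
          (λ (s , A) r → C.dF A s r) (cartesianProduct (upTo (suc k)) Fk)
        nums₁ = select {D = D} {P = λ n → 0 ≡ 0} (λ _ → yes refl) (λ n → fact 5 n (kn n) 0 0) (λ n _ → C.dNum n) (upTo (suc k))
        nums₂ = select {D = D} {P = λ A → 0 ≡ 0} (λ _ → yes refl) (λ A → fact 5 (kF (ff A)) (kn (kF (ff A))) 0 0) (λ A _ → C.dNum _) Fk
        -- Here the claim enters: the proofs in L that it provides are written into the database as
        -- derivations. The same happens in `negs` with its second half.
        iffs = select {D = D} {P = λ (A , A′) → Related (kF (ff A) , kF (ff A′))} (λ (A , A′) → related? (kF (ff A) , kF (ff A′)))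
          (λ (A , A′) → fact 8 1 (kF (ff (A ⇔ₘ A′))) 0 0)
          (λ (A , A′) r → C.dThm1 (proj₁ claim A A′ (rp→path r))) (cartesianProduct Fk Fk)

        NegRel : MFormula × MFormula → Set
        NegRel (A , A′) = ∃ λ z → z ≤ k × (Related (kF (ff A) , z) × Related (⟪ 2 , z ⟫ , kF (ff A′)))

        negs = select {D = D} {P = NegRel} (λ (A , A′) → decEx≤ (λ z → related? (kF (ff A) , z) ×-dec related? (⟪ 2 , z ⟫ , kF (ff A′))) k)
          (λ (A , A′) → fact 8 1 (kF (ff ((¬ₘ A) ⇔ₘ A′))) 0 0)
          (λ (A , A′) (z , _ , r , r′) → C.dThm1 (proj₂ claim A A′ z (rp→path r) (rp→path r′))) (cartesianProduct Fk Fk)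

        ttf : Op → Bool → Bool → Fact
        ttf o u v = fact 7 (opTag o) (b2n u) (b2n v) (b2n (opB o u v))

        bools : List Bool
        bools = true ∷ false ∷ []

        allB : ∀ u → u ∈ bools
        allB true = here refl
        allB false = there (here refl)

        ops : List Op
        ops = ∧ₒ ∷ ∨ₒ ∷ ⇒ₒ ∷ []

        allO : ∀ o → o ∈ ops
        allO ∧ₒ = here refl
        allO ∨ₒ = there (here refl)
        allO ⇒ₒ = there (there (here refl))

        tts = select {D = D} {P = λ _ → 0 ≡ 0} (λ _ → yes refl) (λ (o , u , v) → ttf o u v) (λ (o , u , v) _ → C.dTT o u v)
          (cartesianProduct ops (cartesianProduct bools bools))

        Fs : List Fact
        Fs = Bl ++ (fact 5 e (kn e) 0 0 ∷ (proj₁ ffacts ++ (proj₁ nums₁ ++ (proj₁ nums₂ ++ (proj₁ iffs ++ (proj₁ negs ++ proj₁ tts))))))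

        Fs-der : All D Fs
        Fs-der = Allₚ.++⁺ (All.tabulate base) (C.dNum e ∷ Allₚ.++⁺ (proj₁ (proj₂ ffacts)) (Allₚ.++⁺ (proj₁ (proj₂ nums₁)) (Allₚ.++⁺ (proj₁ (proj₂ nums₂))
          (Allₚ.++⁺ (proj₁ (proj₂ iffs)) (Allₚ.++⁺ (proj₁ (proj₂ negs)) (proj₁ (proj₂ tts)))))))

      module From (h : ℕ) (db : DB h e) (has : All (Has h) Fs) (der : ∀ {F} → Has h F → D F)
          (hasA : ∀ {F} η A → evA e η A ≡ F → Has h F → HasA h e η A) where
        holds : ∀ {F} → Has h F → Sound.Holds T χ χ-out L Mx B F
        holds p = Sound.der-sound T χ χ-out L Mx B B-tag (der p)

        has-B : ∀ {F} → B F → Has h F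
        has-B m = All.lookup has (∈-++⁺ˡ m)

        rest : ∀ {F} → F ∈ _ → Has h F
        rest m = All.lookup has (∈-++⁺ʳ Bl m)

        has-F : ∀ A s → rank A ≤ s → s ≤ k → Has h (fact 11 s (kF (ff A)) 0 0)
        has-F A s r s≤ = rest (there (∈-++⁺ˡ (proj₂ (proj₂ ffacts) (∈-cartesianProduct⁺ (∈-upTo⁺ (s≤s s≤)) (ofRank-∈ A k (≤-trans r s≤))) r)))

        has-N₁ : ∀ n → n ≤ k → Has h (fact 5 n (kn n) 0 0)
        has-N₁ n l = rest (there (∈-++⁺ʳ (proj₁ ffacts) (∈-++⁺ˡ (proj₂ (proj₂ nums₁) (∈-upTo⁺ (s≤s l)) refl))))

        has-N₂ : ∀ A → rank A ≤ k → Has h (fact 5 (kF (ff A)) (kn (kF (ff A))) 0 0)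
        has-N₂ A r = rest (there (∈-++⁺ʳ (proj₁ ffacts) (∈-++⁺ʳ (proj₁ nums₁) (∈-++⁺ˡ (proj₂ (proj₂ nums₂) (ofRank-∈ A k r) refl)))))

        has-iff : ∀ A A′ → rank A ≤ k → rank A′ ≤ k → Related (kF (ff A) , kF (ff A′)) → Has h (fact 8 1 (kF (ff (A ⇔ₘ A′))) 0 0)
        has-iff A A′ r r′ q = rest (there (∈-++⁺ʳ (proj₁ ffacts) (∈-++⁺ʳ (proj₁ nums₁) (∈-++⁺ʳ (proj₁ nums₂) (∈-++⁺ˡ
          (proj₂ (proj₂ iffs) (∈-cartesianProduct⁺ (ofRank-∈ A k r) (ofRank-∈ A′ k r′)) q))))))

        has-neg : ∀ A A′ → rank A ≤ k → rank A′ ≤ k → NegRel (A , A′) → Has h (fact 8 1 (kF (ff ((¬ₘ A) ⇔ₘ A′))) 0 0)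
        has-neg A A′ r r′ q = rest (there (∈-++⁺ʳ (proj₁ ffacts) (∈-++⁺ʳ (proj₁ nums₁) (∈-++⁺ʳ (proj₁ nums₂) (∈-++⁺ʳ (proj₁ iffs) (∈-++⁺ˡ
          (proj₂ (proj₂ negs) (∈-cartesianProduct⁺ (ofRank-∈ A k r) (ofRank-∈ A′ k r′)) q)))))))

        has-tt : ∀ o u v → Has h (ttf o u v)
        has-tt o u v = rest (there (∈-++⁺ʳ (proj₁ ffacts) (∈-++⁺ʳ (proj₁ nums₁) (∈-++⁺ʳ (proj₁ nums₂) (∈-++⁺ʳ (proj₁ iffs) (∈-++⁺ʳ (proj₁ negs)
          (proj₂ (proj₂ tts) (∈-cartesianProduct⁺ (allO o) (∈-cartesianProduct⁺ (allB u) (allB v))) refl)))))))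

        k≤h : k ≤ h
        k≤h = proj₁ (Has-≤ _ (has-N₁ k ≤-refl))

        small : ∀ A → kF (ff A) ≤ k → rank A ≤ k
        small A l = ≤-trans (rank≤code A) l

        SatV : Rule → Set
        SatV r = ∀ {a b c d x y z u} → suc a ≤ k → All (λ A → Has h (evA e (lookup (vals a b c d x y z u)) A)) (prems r) →
          Has h (evA e (lookup (vals a b c d x y z u)) (concl r))

        satV : ∀ {r} → SatV r → SatR h e k r
        satV {r} f v@(_ ∷ _ ∷ _ ∷ _ ∷ _ ∷ _ ∷ _ ∷ _ ∷ []) _ l ps =
          hasA (lookup v) (concl r) refl (f l (All.map (λ {A} → HasA-sound {e = e} {η = lookup v} A (proj₁ db)) ps))

        bin-F : ∀ o A A′ {a} → rank A ≤ a → rank A′ ≤ a → suc a ≤ k → Has h (fact 11 (suc a) ⟪ opTag o , ⟪ kF (ff A) , kF (ff A′) ⟫ ⟫ 0 0)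
        bin-F ∧ₒ A A′ r r′ l = has-F (A ∧ₘ A′) _ (s≤s (⊔-lub r r′)) l
        bin-F ∨ₒ A A′ r r′ l = has-F (A ∨ₘ A′) _ (s≤s (⊔-lub r r′)) l
        bin-F ⇒ₒ A A′ r r′ l = has-F (A ⇒ₘ A′) _ (s≤s (⊔-lub r r′)) l

        trans-R : ∀ {x y z} → Has h (fact 13 x y 0 0) → Has h (fact 13 y z 0 0) → Has h (fact 13 x z 0 0)
        trans-R p q with inv-R (holds p) | inv-R (holds q)
        ... | x≤ , _ , r | _ , z≤ , r′ = has-B (R-in x≤ z≤ (trans r r′))

        lit-R : ∀ {x y} → Has h (fact 14 0 x 1 0) → Has h (fact 13 x y 0 0) → Has h (fact 14 0 y 1 0)
        lit-R p q with inv-R (holds q)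
        ... | _ , y≤ , r = has-B (L-in (≤-trans y≤ (m≤m+n k ⊤c)) (trans (sym r) (All.lookup tops-Top (inv-L (holds p)))))

        iff-R : ∀ {b c x y} → Has h (fact 11 b x 0 0) → Has h (fact 11 c y 0 0) → Has h (fact 13 x y 0 0) →
          Has h (fact 8 1 ⟪ 3 , ⟪ ⟪ 5 , ⟪ x , y ⟫ ⟫ , ⟪ 5 , ⟪ y , x ⟫ ⟫ ⟫ ⟫ 0 0)
        iff-R p q r with holds p | holds q | inv-R (holds r)
        ... | A , refl , _ | A′ , refl , _ | x≤ , y≤ , t = has-iff A A′ (small A x≤) (small A′ y≤) t

        neg-R : ∀ {b c x y z u} → u ≡ 4 * (2 * z + 1) → Has h (fact 11 b x 0 0) → Has h (fact 11 c y 0 0) → Has h (fact 13 x z 0 0) → Has h (fact 13 u y 0 0) →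
          Has h (fact 8 1 ⟪ 3 , ⟪ ⟪ 5 , ⟪ ⟪ 2 , x ⟫ , y ⟫ ⟫ , ⟪ 5 , ⟪ y , ⟪ 2 , x ⟫ ⟫ ⟫ ⟫ ⟫ 0 0)
        neg-R {z = z} w p q r s with holds p | holds q | inv-R (holds r) | inv-R (holds s)
        ... | A , refl , _ | A′ , refl , _ | x≤ , z≤ , t | _ , y≤ , t′ = has-neg A A′ (small A x≤) (small A′ y≤)
          (z , z≤ , t , trans (cong (rp k) (trans (⟪⟫≡pair 2 z) (sym w))) t′)

        satVs : All SatV satList
        satVs =
          (λ { l [] → has-F ⊥ₘ _ (s≤s z≤n) l }) ∷
          (λ { {a} l (p ∷ q ∷ []) → case holds p , holds q of λ { (refl , refl) → has-F (pv a) _ ≤-refl l } }) ∷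
          (λ { l (p ∷ []) → case holds p of λ { (A , refl , r) → has-F A _ (m≤n⇒m≤1+n r) l } }) ∷
          (λ { l (p ∷ []) → case holds p of λ { (A , refl , r) → has-F (¬ₘ A) _ (s≤s r) l } }) ∷
          (λ { l (p ∷ q ∷ t ∷ []) → case holds p , holds q , holds t of λ
            { ((A , refl , r) , (A′ , refl , r′) , (o , _ , _ , refl , _)) → bin-F o A A′ r r′ l } }) ∷
          (λ { l (p ∷ q ∷ t ∷ []) → case holds p , holds q , holds t of λ
            { ((A , refl , r) , refl , refl) → has-F (□ A) _ (s≤s r) l } }) ∷
          (λ _ _ → has-tt ∧ₒ true true) ∷ (λ _ _ → has-tt ∧ₒ true false) ∷
          (λ _ _ → has-tt ∧ₒ false true) ∷ (λ _ _ → has-tt ∧ₒ false false) ∷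
          (λ _ _ → has-tt ∨ₒ true true) ∷ (λ _ _ → has-tt ∨ₒ true false) ∷
          (λ _ _ → has-tt ∨ₒ false true) ∷ (λ _ _ → has-tt ∨ₒ false false) ∷
          (λ _ _ → has-tt ⇒ₒ true true) ∷ (λ _ _ → has-tt ⇒ₒ true false) ∷
          (λ _ _ → has-tt ⇒ₒ false true) ∷ (λ _ _ → has-tt ⇒ₒ false false) ∷
          (λ { _ (p ∷ q ∷ []) → trans-R p q }) ∷
          (λ { _ (p ∷ q ∷ []) → lit-R p q }) ∷
          (λ { _ (p ∷ q ∷ r ∷ []) → iff-R p q r }) ∷ []

        sats : All (SatR h e k) satList
        sats = All.map (λ {r} → satV {r}) satVs

        satN : SatN h e
        satN v@(_ ∷ _ ∷ _ ∷ _ ∷ _ ∷ _ ∷ _ ∷ _ ∷ []) _ w ps with All.map (λ {A} → HasA-sound {e = e} {η = lookup v} A (proj₁ db)) ps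
        ... | p ∷ q ∷ r ∷ s ∷ [] = hasA (lookup v) (concl negRule) refl (neg-R w p q r s)

        numerals : Numerals e h k
        numerals = (kn e , proj₁ (proj₂ (Has-≤ _ ne)) , ne) , λ s s≤ → (kn s , proj₁ (proj₂ (Has-≤ _ (has-N₁ s s≤))) , has-N₁ s s≤) ,
            λ x _ p → of-F s≤ (holds p)
          where
          ne : Has h (fact 5 e (kn e) 0 0)
          ne = rest (here refl)
          of-F : ∀ {s x} → s ≤ k → (∃ λ A → x ≡ kF (ff A) × rank A ≤ s) → ∃ λ c → c ≤ h × Has h (fact 5 x c 0 0)
          of-F s≤ (A , refl , r) = _ , proj₁ (proj₂ (Has-≤ _ (has-N₂ A (≤-trans r s≤)))) , has-N₂ A (≤-trans r s≤)

        edgeR : ∀ j → j ≤ k → ∀ x → x ≤ k → ∀ y → y ≤ k → suc j ≤ k → Edge e j x y → Has h (fact 13 x y 0 0)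
        edgeR j _ x x≤ y y≤ l d = has-B (R-in x≤ y≤ (rp-edge l d))

        has-C : ∀ {s x} → fact 15 s x 0 0 ∈ Cs → Has h (fact 15 s x 0 0)
        has-C m = has-B (∈-++⁺ʳ Rs (∈-++⁺ʳ Ls m))

        chained : Chained e h k
        chained = (λ x _ p → from-top (chains-∈ tops tops-Top (inv-L (holds p)))) , λ s _ x _ p → from-pred (chains-pred tops tops-Top (inv-C (holds p)))
          where
          from-top : ∀ {x} → (∃ λ s → fact 15 s x 0 0 ∈ Cs) → ∃ λ s → s ≤ h × Has h (fact 15 s x 0 0)
          from-top (s , m) = s , proj₁ (Has-≤ _ (has-C m)) , has-C m
          from-pred : ∀ {s x} → Pred Cs s x → (s ≡ 0 × x ≡ ⊤c) ⊎
            ∃ λ s′ → s′ ≤ h × ∃ λ y → y ≤ h × ∃ λ j → j ≤ h × s ≡ suc s′ × Has h (fact 15 s′ y 0 0) × suc j ≤ k × Edge e j y x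
          from-pred (inj₁ p) = inj₁ p
          from-pred (inj₂ (s′ , y , j , q , m , l , d)) = inj₂ (s′ , proj₁ (Has-≤ _ (has-C m)) , y , proj₁ (proj₂ (Has-≤ _ (has-C m))) ,
            j , ≤-trans (<⇒≤ l) k≤h , q , has-C m , l , d)

        ver : Ver e h k
        ver = verified (k≤h , db , ≡subst (All (SatR h e k)) satRules≡ sats , satN , numerals , edgeR , has-B (L-in (m≤n+m ⊤c k) refl) , chained)

      opaque
        ver-exists : ∃ λ h → Ver e h k
        ver-exists = let (h , db , has , der , hasA) = db-exists {e} {B} B-tag Fs Fs-der in h , From.ver h db has der hasA

open LevelVerification

-- From proofs in T of interpretations to proofs in L

module ModalCompleteness where
  boxes : List MFormula → List MFormula
  boxes [] = []
  boxes (□ A ∷ ps) = A ∷ boxes ps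
  boxes (_ ∷ ps) = boxes ps

  vars : List MFormula → List ℕ
  vars [] = []
  vars (pv i ∷ ps) = i ∷ vars ps
  vars (_ ∷ ps) = vars ps

  boxes-∈ : ∀ {A} ps → □ A ∈ ps → A ∈ boxes ps
  boxes-∈ (□ A ∷ ps) (here refl) = here refl
  boxes-∈ (□ _ ∷ ps) (there m) = there (boxes-∈ ps m)
  boxes-∈ (pv _ ∷ ps) (there m) = boxes-∈ ps m
  boxes-∈ (⊥ₘ ∷ ps) (there m) = boxes-∈ ps m
  boxes-∈ (¬ₘ _ ∷ ps) (there m) = boxes-∈ ps m
  boxes-∈ (_ ∧ₘ _ ∷ ps) (there m) = boxes-∈ ps m
  boxes-∈ (_ ∨ₘ _ ∷ ps) (there m) = boxes-∈ ps m
  boxes-∈ (_ ⇒ₘ _ ∷ ps) (there m) = boxes-∈ ps m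

  ∈-boxes : ∀ {A} ps → A ∈ boxes ps → □ A ∈ ps
  ∈-boxes (□ A ∷ ps) (here refl) = here refl
  ∈-boxes (□ _ ∷ ps) (there m) = there (∈-boxes ps m)
  ∈-boxes (pv _ ∷ ps) m = there (∈-boxes ps m)
  ∈-boxes (⊥ₘ ∷ ps) m = there (∈-boxes ps m)
  ∈-boxes (¬ₘ _ ∷ ps) m = there (∈-boxes ps m)
  ∈-boxes (_ ∧ₘ _ ∷ ps) m = there (∈-boxes ps m)
  ∈-boxes (_ ∨ₘ _ ∷ ps) m = there (∈-boxes ps m)
  ∈-boxes (_ ⇒ₘ _ ∷ ps) m = there (∈-boxes ps m)

  vars-∈ : ∀ {i} ps → pv i ∈ ps → i ∈ vars ps
  vars-∈ (pv i ∷ ps) (here refl) = here refl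
  vars-∈ (pv _ ∷ ps) (there m) = there (vars-∈ ps m)
  vars-∈ (□ _ ∷ ps) (there m) = vars-∈ ps m
  vars-∈ (⊥ₘ ∷ ps) (there m) = vars-∈ ps m
  vars-∈ (¬ₘ _ ∷ ps) (there m) = vars-∈ ps m
  vars-∈ (_ ∧ₘ _ ∷ ps) (there m) = vars-∈ ps m
  vars-∈ (_ ∨ₘ _ ∷ ps) (there m) = vars-∈ ps m
  vars-∈ (_ ⇒ₘ _ ∷ ps) (there m) = vars-∈ ps m

  data Atomic : MFormula → Set where
    aV : ∀ i → Atomic (pv i)
    aB : ∀ A → Atomic (□ A)

  mprimes-atomic : ∀ A → All Atomic (mprimes A)
  mprimes-atomic (pv i) = aV i ∷ []
  mprimes-atomic ⊥ₘ = []
  mprimes-atomic (¬ₘ A) = mprimes-atomic A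
  mprimes-atomic (A ∧ₘ B) = Allₚ.++⁺ (mprimes-atomic A) (mprimes-atomic B)
  mprimes-atomic (A ∨ₘ B) = Allₚ.++⁺ (mprimes-atomic A) (mprimes-atomic B)
  mprimes-atomic (A ⇒ₘ B) = Allₚ.++⁺ (mprimes-atomic A) (mprimes-atomic B)
  mprimes-atomic (□ A) = aB A ∷ []

  eval-agree : ∀ {v w v′ w′} A → All (λ p → evalM v w p ≡ evalM v′ w′ p) (mprimes A) → evalM v w A ≡ evalM v′ w′ A
  eval-agree (pv i) (q ∷ []) = q
  eval-agree ⊥ₘ q = refl
  eval-agree (¬ₘ A) q = cong not (eval-agree A q)
  eval-agree (A ∧ₘ B) q = cong₂ _∧_ (eval-agree A (Allₚ.++⁻ˡ (mprimes A) q)) (eval-agree B (Allₚ.++⁻ʳ (mprimes A) q))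
  eval-agree (A ∨ₘ B) q = cong₂ _∨_ (eval-agree A (Allₚ.++⁻ˡ (mprimes A) q)) (eval-agree B (Allₚ.++⁻ʳ (mprimes A) q))
  eval-agree (A ⇒ₘ B) q = cong₂ (λ a b → not a ∨ b) (eval-agree A (Allₚ.++⁻ˡ (mprimes A) q)) (eval-agree B (Allₚ.++⁻ʳ (mprimes A) q))
  eval-agree (□ A) (q ∷ []) = q

  module Completeness (T : Theory) (χ : PR 1) (χ-in : ∀ φ → T φ → evalPR χ (code φ ∷ []) ≡ 1)
    (χ-out : ∀ φ → evalPR χ (code φ ∷ []) ≡ 1 → T φ) (con : Consistent T) (T⊤ : T ⊢ ¬' (zr ≐ S zr)) (L : Logic) (Mx : Formula)
    (box-true : ∀ b i w → Predicates.Theta χ L b (kF Mx) i w → T ⊢ Coding.BoxF Mx b i)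
    (box-refute : ∀ b i n → Predicates.VF χ L (kF Mx) n → (∀ w → w ≤ n → ¬ Predicates.Theta χ L b (kF Mx) i w) → T ⊢ ¬' Coding.BoxF Mx b i)
    where
    open Stages T χ χ-in χ-out con T⊤ L Mx box-true box-refute public
    open Verification T χ χ-in χ-out L Mx using (Claim; ver-exists) public

    open Split (Complete._≟M_ χ L Mx (λ _ → ⊥))

    eval-ff : ∀ {W w} → W (zr ≐ S zr) ≡ false → ∀ A → All (λ p → evalB W (ff p) ≡ w p) (mprimes A) →
      evalB W (ff A) ≡ evalM (w ∘ pv) (w ∘ □_) A
    eval-ff h (pv i) (q ∷ []) = q
    eval-ff h ⊥ₘ q = h
    eval-ff h (¬ₘ A) q = cong not (eval-ff h A q)
    eval-ff h (A ∧ₘ B) q = cong₂ _∧_ (eval-ff h A (Allₚ.++⁻ˡ (mprimes A) q)) (eval-ff h B (Allₚ.++⁻ʳ (mprimes A) q))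
    eval-ff h (A ∨ₘ B) q = cong₂ _∨_ (eval-ff h A (Allₚ.++⁻ˡ (mprimes A) q)) (eval-ff h B (Allₚ.++⁻ʳ (mprimes A) q))
    eval-ff h (A ⇒ₘ B) q = cong₂ (λ a b → not a ∨ b) (eval-ff h A (Allₚ.++⁻ˡ (mprimes A) q)) (eval-ff h B (Allₚ.++⁻ʳ (mprimes A) q))
    eval-ff h (□ A) (q ∷ []) = q

    literalM : Bool → MFormula → MFormula
    literalM true p = p
    literalM false p = ¬ₘ p

    conj : Literals → MFormula
    conj [] = ⊤ₘ
    conj ((p , u) ∷ l) = literalM u p ∧ₘ conj l

    conj-true : ∀ {v w l p u} → evalM v w (conj l) ≡ true → (p , u) ∈ l → evalM v w p ≡ u
    conj-true {v} {w} {(p , true) ∷ l} h (here refl) with evalM v w p | h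
    ... | true | _ = refl
    conj-true {v} {w} {(p , false) ∷ l} h (here refl) with evalM v w p | h
    ... | false | _ = refl
    conj-true {v} {w} {(q , u) ∷ l} h (there m) with evalM v w (literalM u q) | h
    ... | true | h′ = conj-true {l = l} h′ m

    imp-true : ∀ {a b} → (a ≡ true → b ≡ true) → not a ∨ b ≡ true
    imp-true {false} h = refl
    imp-true {true} h = h refl

    both : ∀ {a b} → a ≡ true → b ≡ true → a ∧ b ≡ true
    both refl refl = refl

    module Step (k : ℕ) (claim : Claim k) (C : MFormula) (tC : T ⊢ ff C) (race : ∀ h k′ → suc k ≤ k′ → Ver e h k′ → L ⊢ₘ C) where

      ps : List MFormula
      ps = mprimes C

      D : Literals → Set
      D l = L ⊢ₘ conj l ⇒ₘ C

      D-split : ∀ p l → D ((p , true) ∷ l) → D ((p , false) ∷ l) → D l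
      D-split p l = consL _ _ _ λ v w → bool (evalM v w p) (evalM v w (conj l)) (evalM v w C)
        where
        bool : ∀ a b c → not (a ∧ b) ∨ c ≡ true → not (not a ∧ b) ∨ c ≡ true → not b ∨ c ≡ true
        bool false b c _ h = h
        bool true b c h _ = h

      module Scenario (l : Literals) (fun : Functional l) (dom : All (Dom l) ps) where

        w : MFormula → Bool
        w = assoc l

        lit∈ : ∀ {p} → p ∈ ps → (p , w p) ∈ l
        lit∈ {p} m with All.lookup dom m
        ... | u , n = ≡subst (λ b → (p , b) ∈ l) (sym (fun n)) n

        refuted : ∀ A B → (∀ v w → evalM v w A ≡ true → evalM v w B ≡ true → evalM v w (conj l) ≡ true → ⊥) → L ⊢ₘ A → L ⊢ₘ B → D l
        refuted A B h = consL A B (conj l ⇒ₘ C) λ v w a b → imp-true λ c → ⊥-elim (h v w a b c)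

        if-true : evalM (w ∘ pv) (w ∘ □_) C ≡ true → D l
        if-true q = m-taut λ v w′ → imp-true λ c → trans (eval-agree C (All.tabulate λ {p} m →
          trans (conj-true {l = l} c (lit∈ m)) (sym (atom-val (All.lookup (mprimes-atomic C) m))))) q
          where
          atom-val : ∀ {p} → Atomic p → evalM (w ∘ pv) (w ∘ □_) p ≡ w p
          atom-val (aV i) = refl
          atom-val (aB A) = refl

        code' : MFormula → ℕ
        code' A = kF (ff A)

        -- Formulas whose box the assignment makes true. ⊤ is added because a valid stage contains
        -- the members of earlier verified stages, and these are all linked to ⊤.
        Tru : List MFormula
        Tru = ⊤ₘ ∷ filter (λ A → w (□ A) Bool.≟ true) (boxes ps)

        Same : ℕ → MFormula → Set
        Same x A = rp k x ≡ rp k (code' A)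

        InX : ℕ → Set
        InX x = Any (Same x) Tru

        inX? : ∀ x → Dec (InX x)
        inX? x = Any.any? (λ A → rp k x ≟ rp k (code' A)) Tru

        -- A code linked to a member of `Tru` is the code of that member or at most k, so `bd`
        -- bounds everything the fire has to put in.
        bd : ℕ
        bd = k + sum (List.map code' Tru)

        ≤sum : ∀ {x} l → x ∈ l → x ≤ sum l
        ≤sum (x ∷ l) (here refl) = m≤m+n x _
        ≤sum (y ∷ l) (there m) = ≤-trans (≤sum l m) (m≤n+m _ y)

        Tru-≤ : ∀ {A} → A ∈ Tru → code' A ≤ bd
        Tru-≤ m = ≤-trans (≤sum _ (∈-map⁺ code' m)) (m≤n+m _ k)

        ⊤≤bd : ⊤c ≤ bd
        ⊤≤bd = Tru-≤ (here refl)

        -- Q is needed for the member ⊤ₘ, whose box need not be an atom of C.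
        tru-box : ∀ {A} → A ∈ Tru → ∃ λ Q → L ⊢ₘ Q × (∀ v w → evalM v w Q ≡ true → evalM v w (conj l) ≡ true → evalM v w (□ A) ≡ true)
        tru-box (here refl) = □ ⊤ₘ , m-nec (m-taut λ _ _ → refl) , λ v w h _ → h
        tru-box {A} (there m) with ∈-filter⁻ (λ A → w (□ A) Bool.≟ true) {xs = boxes ps} m
        ... | n , q = ⊤ₘ , m-taut (λ _ _ → refl) , λ v w′ _ c → trans (conj-true {l = l} c (lit∈ (∈-boxes ps n))) q

        Clash : MFormula → Set
        Clash A = w (□ A) ≡ false × InX (code' A)

        clash? : Dec (Any Clash (boxes ps))
        clash? = Any.any? (λ A → (w (□ A) Bool.≟ false) ×-dec inX? (code' A)) (boxes ps)

        -- By the claim and the rule RE the two boxes are equivalent in L, yet the literals give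
        -- them different values; so L refutes the assignment.
        if-clash : Any Clash (boxes ps) → D l
        if-clash a with find a
        ... | A , m , q , x with find x
        ... | A′ , m′ , s with tru-box m′
        ... | Q , pV , hV = refuted Q (□ A ⇔ₘ □ A′) (λ v w a b c → contra (iff→≡ (w A) (w A′) b) (hV v w a c)
                (trans (conj-true {l = l} c (lit∈ (∈-boxes ps m))) q)) pV (m-re (proj₁ claim A A′ (rp→path s)))
          where
          contra : ∀ {a b} → a ≡ b → b ≡ true → a ≡ false → ⊥
          contra refl refl ()

        DPok : Logic → Set
        DPok EN = 0 ≡ 0
        DPok ENP = ¬ InX ⊥c
        DPok END = ∀ x → x ≤ bd → InX x → InX (4 * (2 * x + 1)) → ⊥

        -- A violation among the linked codes is traced back to boxes of modal formulas by the
        -- claim, whereupon the axiom refutes the assignment. For D the code x need not belong to an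
        -- interpretation; the second half of the claim bridges it.
        dp-check : ∀ L′ → L ≡ L′ → DPok L′ ⊎ D l
        dp-check EN q = inj₁ refl
        dp-check ENP refl with inX? ⊥c
        ... | no ¬p = inj₁ ¬p
        ... | yes p with find p
        ... | A , m , s with tru-box m
        ... | Q , pV , hV = inj₂ (refuted Q (¬ₘ (□ ⊥ₘ) ∧ₘ (□ ⊥ₘ ⇔ₘ □ A)) (λ v w a b c → contra (w ⊥ₘ) (w A) b (hV v w a c)) pV
                (consL _ _ _ (λ v w → both) (m-ax P-ax) (m-re (proj₁ claim ⊥ₘ A (rp→path s)))))
          where
          contra : ∀ a b → not a ∧ ((not a ∨ b) ∧ (not b ∨ a)) ≡ true → b ≡ true → ⊥
          contra false true () _
        dp-check END refl with decEx≤ (λ x → inX? x ×-dec inX? (4 * (2 * x + 1))) bd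
        ... | no ¬p = inj₁ λ x l p q → ¬p (x , l , p , q)
        ... | yes (x , _ , p , q) with find p | find q
        ... | A , m , s | A′ , m′ , s′ with tru-box m | tru-box m′
        ... | Q , pV , hV | Q′ , pV′ , hV′ = inj₂ (refuted (Q ∧ₘ Q′) (¬ₘ (□ A ∧ₘ □ (¬ₘ A)) ∧ₘ (□ (¬ₘ A) ⇔ₘ □ A′))
              (λ v w a b c → contra (w A) (w (¬ₘ A)) (w A′) b (hV v w (fst a) c) (hV′ v w (snd (evalM v w Q) a) c))
              (consL _ _ _ (λ v w → both) pV pV′)
              (consL _ _ _ (λ v w → both) (m-ax (D-ax A))
                (m-re (proj₂ claim A A′ x (path-sym (rp→path s)) (rp→path (trans (cong (rp k) (⟪⟫≡pair 2 x)) s′))))))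
          where
          contra : ∀ a b c → not (a ∧ b) ∧ ((not b ∨ c) ∧ (not c ∨ b)) ≡ true → a ≡ true → c ≡ true → ⊥
          contra true true true () _ _
          contra true false true () _ _
          fst : ∀ {a b} → a ∧ b ≡ true → a ≡ true
          fst {true} _ = refl
          snd : ∀ a {b} → a ∧ b ≡ true → b ≡ true
          snd true h = h

        module Burn (C-false : evalM (w ∘ pv) (w ∘ □_) C ≡ false) (no-clash : ¬ Any Clash (boxes ps)) (dp : DPok L) where

          Ls Ns Vs Bl : List Fact
          Ls = List.map (λ x → fact 14 0 x 1 0) (filter inX? (upTo (suc bd)))
          Ns = List.map (λ A → fact 14 0 (code' A) 0 0) (filter (λ A → w (□ A) Bool.≟ false) (boxes ps))
          Vs = List.map (λ i → fact 14 1 i (b2n (w (pv i))) 0) (vars ps)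
          Bl = Ls ++ (Ns ++ Vs)

          B : Fact → Set
          B F = F ∈ Bl

          data Kind : Fact → Set where
            isIn  : ∀ {x} → x ≤ bd → InX x → Kind (fact 14 0 x 1 0)
            isOut : ∀ {A} → A ∈ boxes ps → w (□ A) ≡ false → Kind (fact 14 0 (code' A) 0 0)
            isVar : ∀ i → Kind (fact 14 1 i (b2n (w (pv i))) 0)

          kind : ∀ {F} → B F → Kind F
          kind m with ∈-++⁻ Ls m
          ... | inj₁ m₁ with ∈-map⁻ (λ x → fact 14 0 x 1 0) m₁
          ... | x , p , refl with ∈-filter⁻ inX? {xs = upTo (suc bd)} p
          ... | q , r = isIn (≤-pred (∈-upTo⁻ q)) r
          kind m | inj₂ m₁ with ∈-++⁻ Ns m₁
          ... | inj₂ m₂ with ∈-map⁻ (λ i → fact 14 1 i (b2n (w (pv i))) 0) m₂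
          ... | i , _ , refl = isVar i
          kind m | inj₂ m₁ | inj₁ m₂ with ∈-map⁻ (λ A → fact 14 0 (code' A) 0 0) m₂
          ... | A , p , refl with ∈-filter⁻ (λ A → w (□ A) Bool.≟ false) {xs = boxes ps} p
          ... | q , r = isOut q r

          B-tag : ∀ {F} → B F → Any (ftag F ≡_) baseTags
          B-tag m with kind m
          ... | isIn _ _ = there (here refl)
          ... | isOut _ _ = there (here refl)
          ... | isVar _ = there (here refl)

          in-B : ∀ {x} → x ≤ bd → InX x → B (fact 14 0 x 1 0)
          in-B l p = ∈-++⁺ˡ (∈-map⁺ (λ x → fact 14 0 x 1 0) (∈-filter⁺ inX? (∈-upTo⁺ (s≤s l)) p))

          out-B : ∀ {A} → □ A ∈ ps → w (□ A) ≡ false → B (fact 14 0 (code' A) 0 0)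
          out-B m q = ∈-++⁺ʳ Ls (∈-++⁺ˡ (∈-map⁺ (λ A → fact 14 0 (code' A) 0 0) (∈-filter⁺ (λ A → w (□ A) Bool.≟ false) (boxes-∈ ps m) q)))

          var-B : ∀ {i} → pv i ∈ ps → B (fact 14 1 i (b2n (w (pv i))) 0)
          var-B m = ∈-++⁺ʳ Ls (∈-++⁺ʳ Ns (∈-map⁺ (λ i → fact 14 1 i (b2n (w (pv i))) 0) (vars-∈ ps m)))

          inv-in : ∀ {x} → B (fact 14 0 x 1 0) → InX x
          inv-in m with kind m
          ... | isIn _ p = p

          exclusive : ∀ {b i} → B (fact 14 b i 0 0) → B (fact 14 b i 1 0) → ⊥
          exclusive m m′ = go (kind m) (kind m′) refl refl
            where
            b2n≢ : ∀ u → b2n u ≡ 0 → b2n u ≡ 1 → ⊥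
            b2n≢ false _ ()
            b2n≢ true () _
            go : ∀ {b i F G} → Kind F → Kind G → F ≡ fact 14 b i 0 0 → G ≡ fact 14 b i 1 0 → ⊥
            go (isOut {A} m q) (isIn _ x) refl refl = no-clash (any-of m (q , x))
              where
              any-of : ∀ {A l} → A ∈ l → Clash A → Any Clash l
              any-of (here refl) c = here c
              any-of (there m) c = there (any-of m c)
            go (isVar i) (isVar j) q r = b2n≢ (w (pv i)) (cong fc q) (trans (cong (λ x → b2n (w (pv x))) (trans (cong fb q) (sym (cong fb r)))) (cong fc r))
            go (isVar i) (isIn _ _) q refl = case cong fa q of λ ()
            go (isIn _ _) _ () _
            go (isOut _ _) (isOut _ _) _ ()
            go (isOut _ _) (isVar j) refl r = case cong fa r of λ ()
            go (isVar i) (isOut _ _) _ ()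

          module K = Complete χ L Mx B

          litF : Bool → Formula → Formula
          litF true φ = φ
          litF false φ = ¬' φ

          -- Implications are nested with one literal in front of each, matching the `Ref` rules,
          -- which remove one literal at a time.
          refF : List MFormula → Formula
          refF [] = ⊥'
          refF (p ∷ qs) = litF (w p) (ff p) ⇒' refF qs

          refF-true : ∀ {W} qs → ¬ All (λ p → evalB W (ff p) ≡ w p) qs → evalB W (refF qs) ≡ true
          refF-true [] h = ⊥-elim (h [])
          refF-true {W} (p ∷ qs) h = imp-true λ a → refF-true qs λ al → h (lit-val (w p) a ∷ al)
            where
            lit-val : ∀ u → evalB W (litF u (ff p)) ≡ true → evalB W (ff p) ≡ u
            lit-val true a = a
            lit-val false a with evalB W (ff p) | a
            ... | false | _ = refl

          -- A Boolean valuation that agrees with all the literals would falsify `ff C`, which T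
          -- proves. As Boolean valuations do not know that 0 = 1 fails, `T⊤` is a further premise.
          T-ref : T ⊢ refF ps
          T-ref = consT (ff C) (¬' (zr ≐ S zr)) (refF ps) (λ W a b → refF-true ps λ al →
            case trans (sym a) (trans (eval-ff {W} {w} (not-true b) C al) C-false) of λ ()) tC T⊤
            where
            not-true : ∀ {a} → not a ≡ true → a ≡ false
            not-true {false} _ = refl

          discharge : ∀ qs → (∀ {p} → p ∈ qs → p ∈ ps) → All Atomic qs → Der e B (fact 12 (kF (refF qs)) 0 0 0) → Der e B (fact 12 (kF ⊥') 0 0 0)
          discharge [] s a d = d
          discharge (p ∷ qs) s (aV i ∷ as) d = discharge qs (s ∘ there) as (one (w (pv i)) d (var-B (s (here refl))))
            where
            one : ∀ u → Der e B (fact 12 (kF (litF u (BoxF 1 i) ⇒' refF qs)) 0 0 0) → B (fact 14 1 i (b2n u) 0) → Der e B (fact 12 (kF (refF qs)) 0 0 0)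
            one true d m = K.dRef-pos 1 i (refF qs) d m
            one false d m = K.dRef-neg 1 i (refF qs) d m
          discharge (p ∷ qs) s (aB A ∷ as) d = discharge qs (s ∘ there) as (one (w (□ A)) refl d)
            where
            one : ∀ u → w (□ A) ≡ u → Der e B (fact 12 (kF (litF u (BoxF 0 (code' A)) ⇒' refF qs)) 0 0 0) → Der e B (fact 12 (kF (refF qs)) 0 0 0)
            one true q d = K.dRef-pos 0 (code' A) (refF qs) d (in-B (Tru-≤ A∈) (here-of A∈))
              where
              A∈ : A ∈ Tru
              A∈ = there (∈-filter⁺ (λ A → w (□ A) Bool.≟ true) (boxes-∈ ps (s (here refl))) q)
              here-of : ∀ {A l} → A ∈ l → Any (Same (code' A)) l
              here-of (here refl) = here refl
              here-of (there m) = there (here-of m)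
            one false q d = K.dRef-neg 0 (code' A) (refF qs) d (out-B (s (here refl)) q)

          facts : List Fact
          facts = fact 12 (kF ⊥') 0 0 0 ∷ Bl

          facts-der : All (Der e B) facts
          facts-der = discharge ps id (mprimes-atomic C) (K.dRef {refF ps} (K.dThm0 χ-in T-ref)) ∷ All.tabulate base

          module At (n : ℕ) (db : DB n e) (has : All (Has n) facts) (der : ∀ {F} → Has n F → Der e B F) where

            holds : ∀ {F} → Has n F → Sound.Holds T χ χ-out L Mx B F
            holds p = Sound.der-sound T χ χ-out L Mx B B-tag (der p)

            has-B : ∀ {F} → B F → Has n F
            has-B m = All.lookup has (there m)

            in-n : ∀ {x} → x ≤ bd → InX x → In 0 x n
            in-n l p = let h = has-B (in-B l p) in proj₁ (proj₂ (Has-≤ _ h)) , h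

            n-in : ∀ {x} → In 0 x n → InX x
            n-in (_ , h) = inv-in (holds h)

            -- With no level above k verified up to n, everything imposed on n comes from level k,
            -- and the positive box literals form a union of classes of that level.
            fires : ¬ (∃ λ h → h ≤ n × ∃ λ k′ → k′ ≤ n × (suc k ≤ k′ × Ver e h k′)) → VF e n
            fires last = (closure , mono , dp-of L dp , inj₂ fir) , fir
              where
              below : ∀ {h k′} → h ≤ n → k′ ≤ n → Ver e h k′ → k′ ≤ k
              below {h} {k′} h≤ k≤ v = ≮⇒≥ λ k<k′ → last (h , h≤ , k′ , k≤ , k<k′ , v)
              move : ∀ {x y} → rp k x ≡ rp k y → InX x → InX y
              move q = Any.map (trans (sym q))
              closure : Closure e n
              closure p p≤ x _ y _ (h , h≤ , k′ , k≤ , j , _ , v , l , d@(_ , y≤ , _)) i =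
                in-n (≤-trans y≤ (≤-trans (<⇒≤ l′) (m≤m+n k _))) (move (rp-edge l′ d) (n-in i))
                where
                l′ : suc j ≤ k
                l′ = ≤-trans l (below (≤-trans h≤ p≤) (≤-trans k≤ p≤) v)
              mono : Mono e n
              mono w′ w≤ x _ (k′ , k≤ , v) i = in-n (x≤ (path-end path)) (here (sym (path→rp path)))
                where
                path : Path k ⊤c x
                path = path-mono (below w≤ (≤-trans k≤ w≤) v) (Verified.in-path v i)
                x≤ : ⊤c ≡ x ⊎ (⊤c ≤ k × x ≤ k) → x ≤ bd
                x≤ (inj₁ refl) = ⊤≤bd
                x≤ (inj₂ (_ , l)) = ≤-trans l (m≤m+n k _)
              dp-of : ∀ L′ → DPok L′ → DPFor L′ n
              dp-of EN _ = refl
              dp-of ENP h i = h (n-in i)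
              dp-of END h x _ y _ refl i j = h x (x≤bd i) (n-in i) (n-in j)
                where
                x≤bd : ∀ {x} → In 0 x n → x ≤ bd
                x≤bd (_ , p) with kind (holds p)
                ... | isIn l _ = l
              fir : Fir e n
              fir = fired (db , All.head has , λ b _ i _ p q → exclusive (holds p) (holds q))

          -- The database for the assignment would be a valid fire, which is impossible, unless a
          -- verified level above k occurs up to n. In that case `race` proves C.
          burn : D l
          burn = let (n , db , has , der , _) = db-exists {e} {B} B-tag facts facts-der in finish n db has der (later? n k)
            where
            finish : ∀ n → DB n e → All (Has n) facts → (∀ {F} → Has n F → Der e B F) →
              Dec (∃ λ h → h ≤ n × ∃ λ k′ → k′ ≤ n × (suc k ≤ k′ × Ver e h k′)) → D l
            finish n db has der (yes (h , _ , k′ , _ , k< , v)) = consL C C (conj l ⇒ₘ C) (λ v w c _ → imp-true λ _ → c) (race h k′ k< v) (race h k′ k< v)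
            finish n db has der (no last) = ⊥-elim (no-fire n (At.fires n db has der last))

        decided : D l
        decided = by-value _ refl
          where
          by-clash : evalM (w ∘ pv) (w ∘ □_) C ≡ false → DPok L → Dec (Any Clash (boxes ps)) → D l
          by-clash q dp (yes a) = if-clash a
          by-clash q dp (no ¬a) = Burn.burn q ¬a dp
          by-dp : evalM (w ∘ pv) (w ∘ □_) C ≡ false → DPok L ⊎ D l → D l
          by-dp q (inj₁ dp) = by-clash q dp clash?
          by-dp q (inj₂ d) = d
          by-value : ∀ u → evalM (w ∘ pv) (w ∘ □_) C ≡ u → D l
          by-value true q = if-true q
          by-value false q = by-dp q (dp-check L refl)

      provable : L ⊢ₘ C
      provable = consL (conj [] ⇒ₘ C) (conj [] ⇒ₘ C) C (λ v w h _ → h)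
        (splitAll D D-split ps [] (λ ()) λ l _ f d → Scenario.decided l f d) (splitAll D D-split ps [] (λ ()) λ l _ f d → Scenario.decided l f d)

    -- Level 0 has no edges, so linked codes are equal. A path of level k + 1 yields a proof in T,
    -- which `Step` at level k turns into one in L; any higher verified level that interferes
    -- certifies the same equivalence.
    claims : ∀ k → Claim k
    claims zero = (λ A B p → iff₀ A B (same p)) , λ A B z p q → iff₀ (¬ₘ A) B (trans (cong ⟪ 2 ,_⟫ (same p)) (same q))
      where
      same : ∀ {x y} → Path 0 x y → x ≡ y
      same [] = refl
      iff₀ : ∀ A B → kF (ff A) ≡ kF (ff B) → L ⊢ₘ A ⇔ₘ B
      iff₀ A B q = ≡subst (λ X → L ⊢ₘ A ⇔ₘ X) (ff-inj A B (kF-inj _ _ q)) (m-taut λ v w → ≡→iff {evalM v w A} refl)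
    claims (suc k) = iff , neg
      where
      iff : ∀ A B → Path (suc k) (kF (ff A)) (kF (ff B)) → L ⊢ₘ A ⇔ₘ B
      iff A B p = Step.provable k (claims k) (A ⇔ₘ B) (T-iff (path-sound (ff A) p)) λ h k′ l v → Verified.iff-of v A B (path-mono l p)
        where
        T-iff : (∃ λ ψ → kF (ff B) ≡ kF ψ × T ⊢ ff A ⇔' ψ) → T ⊢ ff A ⇔' ff B
        T-iff (ψ , q , t) = ≡subst (λ ξ → T ⊢ ff A ⇔' ξ) (sym (kF-inj _ _ q)) t
      neg : ∀ A B z → Path (suc k) (kF (ff A)) z → Path (suc k) ⟪ 2 , z ⟫ (kF (ff B)) → L ⊢ₘ (¬ₘ A) ⇔ₘ B
      neg A B z p q = Step.provable k (claims k) ((¬ₘ A) ⇔ₘ B) (T-neg (path-sound (ff A) p)) λ h k′ l v → Verified.neg-of v A B (path-mono l p) (path-mono l q)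
        where
        T-neg : (∃ λ ζ → z ≡ kF ζ × T ⊢ ff A ⇔' ζ) → T ⊢ ¬' ff A ⇔' ff B
        T-neg (ζ , refl , t) = finish (path-sound (¬' ζ) q)
          where
          finish : (∃ λ ψ → kF (ff B) ≡ kF ψ × T ⊢ ¬' ζ ⇔' ψ) → T ⊢ ¬' ff A ⇔' ff B
          finish (ψ , r , u) = ≡subst (λ ξ → T ⊢ ¬' ff A ⇔' ξ) (sym (kF-inj _ _ r)) (iffT-trans
            (consT (ff A ⇔' ζ) (ff A ⇔' ζ) (¬' ff A ⇔' ¬' ζ) (λ W h _ → ≡→iff (cong not (iff→≡ (evalB W (ff A)) (evalB W ζ) h))) t t) u)

open ModalCompleteness

-- The provability predicate and the interpretation for a given theory and logic

module Final (T : Theory) (χ : PR 1) (χ-in : ∀ φ → T φ → evalPR χ (code φ ∷ []) ≡ 1)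
  (χ-out : ∀ φ → evalPR χ (code φ ∷ []) ≡ 1 → T φ) (con : Consistent T) (ext : Extends PA T) (L : Logic) where
  private
    module P = Predicate χ L
    module IT = P.Inside T ext
    module IP = P.Inside PA (λ _ p → p)

  T⊤ : T ⊢ ¬' (zr ≐ S zr)
  T⊤ = IT.¬i (IT.numeral-≢ 0 1 λ ())

  open Completeness T χ χ-in χ-out con T⊤ L P.Mx IT.box-true IT.box-refute

  -- `BoxF 0` with its argument left open. Since constants enter through equations, instantiation
  -- gives back `BoxF 0` as the same formula, whose code the rules recognise through `self`.
  Pr : Formula
  Pr = ∃' (∃' (∃' (∃' (var 4 ≐ var 2 ∧' (numeral e ≐ var 1 ∧' (zr ≐ var 0 ∧' P.Mx))))))

  Pr-Σ₁ : Σ₁ Pr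
  Pr-Σ₁ = s-ex (s-ex (s-ex (s-ex (s-d₀ (d-and (d-eq _ _) (d-and (d-eq _ _) (d-and (d-eq _ _) (cΔ-Δ₀ P.Θ))))))))

  Pr-FV : FVBelow 1 Pr
  Pr-FV = (≤-refl , s≤s (s≤s (s≤s z≤n))) , (numeral-FV 5 e , s≤s (s≤s z≤n)) , (_ , s≤s z≤n) ,
    -- The matrix lives in scope 4; embedding the scope into 5 by `inject₁` leaves the formula
    -- unchanged.
    ≡subst (FVBelow 5) (trans (sym (cΔ-sub {σ = var} {τ = λ i → `v (Fin.inject₁ i)} (λ i → cong var (sym (Finₚ.toℕ-inject₁ i))) P.Θ))
      (FV-subst {σ = var} (λ _ _ → refl) P.Mx (cΔ-FV P.Θ))) (cΔ-FV (sub (λ i → `v (Fin.inject₁ i)) P.Θ))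

  Pr-inst : ∀ i → inst (numeral i) Pr ≡ BoxF 0 i
  Pr-inst i = trans (sym (ins≡inst (numeral i) Pr)) (go ⟦ insˢ (numeral i) ⟧ˢ refl)
    where
    shift⁴ : shiftT (shiftT (shiftT (shiftT (numeral i)))) ≡ numeral i
    shift⁴ = trans (cong (shiftT ∘ shiftT ∘ shiftT) (substT-numeral _ i)) (trans (cong (shiftT ∘ shiftT) (substT-numeral _ i))
      (trans (cong shiftT (substT-numeral _ i)) (substT-numeral _ i)))
    go : ∀ (σ : Subst) → σ 0 ≡ numeral i → subst σ Pr ≡ BoxF 0 i
    go σ q = cong (∃' ∘ ∃' ∘ ∃' ∘ ∃') (cong₂ _∧'_ (cong (_≐ var 2) (trans (cong (shiftT ∘ shiftT ∘ shiftT ∘ shiftT) q) shift⁴))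
      (cong₂ _∧'_ (cong (_≐ var 1) (substT-numeral _ e)) (cong (zr ≐ var 0 ∧'_)
        (FV-subst (λ { 0 _ → refl ; 1 _ → refl ; 2 _ → refl ; 3 _ → refl
          ; (suc (suc (suc (suc _)))) (s≤s (s≤s (s≤s (s≤s ())))) }) P.Mx (cΔ-FV P.Θ)))))

  Pr≡ : ∀ φ → Pr ⟨ φ ⟩ ≡ BoxF 0 (kF φ)
  Pr≡ φ = trans (Pr-inst (code φ)) (cong (BoxF 0) (sym (kF≡code φ)))

  iff-⊤ : ∀ {φ} → T ⊢ φ → T ⊢ ¬' (zr ≐ S zr) ⇔' φ
  iff-⊤ {φ} = consT (¬' (zr ≐ S zr)) φ (¬' (zr ≐ S zr) ⇔' φ) (λ w a b → ≡→iff (trans a (sym b))) T⊤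

  -- A proof of φ gives an edge from ⊤ to φ, and a valid verified stage whose level exceeds that
  -- edge contains φ.
  stage : ∀ {φ} → T ⊢ φ → ∃ λ w → Theta 0 e (kF φ) w
  stage {φ} p =
    let (j , edge) = edge-exists (iff-⊤ p)
        (h , ver) = ver-exists (suc j) (claims (suc j))
        (h′ , k′ , k≤ , ver′ , valid) = valid-stage (h ∸ suc j) ≤-refl ver
    in h′ , Verified.in-of ver′ (via k≤ edge []) , valid , (λ w _ vf → ⊥-elim (no-fire w vf)) , inj₁ refl

  theta-sound : ∀ φ → (∃ λ w → Theta 0 e (kF φ) w) → T ⊢ φ
  theta-sound φ (w , th) = path-provable φ (proj₂ (theta-path th))

  box-mono : ∀ {φ ψ} → T ⊢ φ ⇔' ψ → T ⊢ BoxF 0 (kF φ) ⇒' BoxF 0 (kF ψ)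
  box-mono {φ} {ψ} p =
    let (j , edge) = edge-exists p
        (h , ver) = ver-exists (suc j) (claims (suc j))
    -- The sum bounds both the verified stage h and its level.
    in IT.box-E (kF φ) (kF ψ) (h + suc j)
        (h , m≤m+n h _ , suc j , m≤n+m _ h , j , ≤-trans (n≤1+n j) (m≤n+m _ h) , ver , ≤-refl , edge)
        λ th → let (w , th′) = stage {ψ} (consT φ (φ ⇔' ψ) ψ (λ W a b → trans (sym (iff→≡ (evalB W φ) (evalB W ψ) b)) a) (theta-sound φ th) p)
               in IT.box-true 0 (kF ψ) w th′

  nec : ∀ {φ} → T ⊢ φ → PA ⊢ Pr ⟨ φ ⟩
  nec {φ} p = ≡subst (PA ⊢_) (sym (Pr≡ φ)) (let (w , th) = stage p in IP.box-true 0 (kF φ) w th)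

  conec : ∀ φ → PA ⊢ Pr ⟨ φ ⟩ → T ⊢ φ
  conec φ p = theta-sound φ (extract (Fr.sound (≡subst (PA ⊢_) (Pr≡ φ) p) (λ _ → 0)))
    where
    R : Set
    R = ∃ λ w → Theta 0 e (kF φ) w
    module Fr = Friedman R
    ev-num : ∀ {ρ} k → Fr.evTerm ρ (numeral k) ≡ k
    ev-num zero = refl
    ev-num (suc k) = cong suc (ev-num k)
    found : ∀ {t v u w} → 0 ≡ t → e ≡ v → kF φ ≡ u → Dec (Sat P.Θ (t ∷ v ∷ u ∷ w ∷ [])) → Fr.⟦_⟧ P.Mx (t Fr.▷ (v Fr.▷ (u Fr.▷ (w Fr.▷ λ _ → 0)))) → R
    -- A true matrix exhibits the stage; a false one yields R from its translation, so no appeal to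
    -- the truth of the PA-theorem is made.
    found {w = w} refl refl refl (yes s) _ = w , to P.thetaD _ s
    found {t} {v} {u} {w} _ _ _ (no ¬s) m = Fr.Δ-sem¬ P.Θ (t ∷ v ∷ u ∷ w ∷ []) (λ { 0F → refl ; 1F → refl ; 2F → refl ; 3F → refl }) ¬s m
    extract : Fr.⟦_⟧ (BoxF 0 (kF φ)) (λ _ → 0) → R
    extract k₀ = k₀ λ w k₁ → k₁ λ u k₂ → k₂ λ v k₃ → k₃ λ t (a , b , c , m) → a λ a′ → b λ b′ → c λ c′ →
      found c′ (trans (sym (ev-num e)) b′) (trans (sym (ev-num (kF φ))) a′) (sat? P.Θ (t ∷ v ∷ u ∷ w ∷ [])) m

  condE : ConditionE T Pr
  condE φ ψ p = ≡subst (T ⊢_) (cong₂ _⇔'_ (sym (Pr≡ φ)) (sym (Pr≡ ψ)))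
    (mp (IT.pair' (IT.K (box-mono p)) (IT.K (box-mono (iffT-sym p)))) (eq-refl zr))

  eval-interp : ∀ {w} f → w (zr ≐ S zr) ≡ false → ∀ A →
    evalB w (interp Pr f A) ≡ evalM (λ i → evalB w (val f i)) (λ B → evalB w (Pr ⟨ interp Pr f B ⟩)) A
  eval-interp f h (pv i) = refl
  eval-interp f h ⊥ₘ = h
  eval-interp f h (¬ₘ A) = cong not (eval-interp f h A)
  eval-interp f h (A ∧ₘ B) = cong₂ _∧_ (eval-interp f h A) (eval-interp f h B)
  eval-interp f h (A ∨ₘ B) = cong₂ _∨_ (eval-interp f h A) (eval-interp f h B)
  eval-interp f h (A ⇒ₘ B) = cong₂ (λ a b → not a ∨ b) (eval-interp f h A) (eval-interp f h B)
  eval-interp f h (□ A) = refl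

  extra-sound : ∀ L′ → L ≡ L′ → ∀ f {A} → ExtraAx L′ A → T ⊢ interp Pr f A
  extra-sound ENP q f P-ax = ≡subst (λ φ → T ⊢ ¬' φ) (sym (Pr≡ (zr ≐ S zr))) (IT.box-P q)
  extra-sound END q f (D-ax A) = ≡subst (T ⊢_) (cong₂ (λ φ ψ → ¬' (φ ∧' ψ)) (sym (Pr≡ φ)) (sym (Pr≡ (¬' φ))))
    (IT.¬i (IT.app (IT.app (IT.K (IT.box-D q (kF φ) (kF (¬' φ)) (⟪⟫≡pair 2 (kF φ)))) (IT.pr₁ IT.hyp)) (IT.pr₂ IT.hyp)))
    where
    φ : Formula
    φ = interp Pr f A

  sound : ∀ A f → L ⊢ₘ A → T ⊢ interp Pr f A
  -- Interpreted falsity is the prime formula 0 = 1, so the image of a modal tautology is a Boolean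
  -- consequence of `T⊤` rather than a tautology.
  sound A f (m-taut t) = consT (¬' (zr ≐ S zr)) (¬' (zr ≐ S zr)) (interp Pr f A)
    (λ w a _ → trans (eval-interp f (not-true a) A) (t _ _)) T⊤ T⊤
    where
    not-true : ∀ {a} → not a ≡ true → a ≡ false
    not-true {false} _ = refl
  sound A f (m-ax x) = extra-sound L refl f x
  sound A f (m-mp {B} p q) = mp (sound (B ⇒ₘ A) f p) (sound B f q)
  sound .(□ A) f (m-nec {A} p) = ext _ (nec (sound A f p))
  sound _ f (m-re {A} {B} p) = condE (interp Pr f A) (interp Pr f B) (sound (A ⇔ₘ B) f p)

  f₀ : Valuation
  f₀ = record { val = BoxF 1 ; val-sent = P.BoxF-sentence 1 }

  interp≡ff : ∀ A → interp Pr f₀ A ≡ ff A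
  interp≡ff (pv i) = refl
  interp≡ff ⊥ₘ = refl
  interp≡ff (¬ₘ A) = cong ¬'_ (interp≡ff A)
  interp≡ff (A ∧ₘ B) = cong₂ _∧'_ (interp≡ff A) (interp≡ff B)
  interp≡ff (A ∨ₘ B) = cong₂ _∨'_ (interp≡ff A) (interp≡ff B)
  interp≡ff (A ⇒ₘ B) = cong₂ _⇒'_ (interp≡ff A) (interp≡ff B)
  interp≡ff (□ A) = trans (Pr≡ (interp Pr f₀ A)) (cong (BoxF 0 ∘ kF) (interp≡ff A))

  -- Provability in T is an edge from ⊤ to the interpretation of A. Both ends are interpretations,
  -- so the claim for the level just above that edge applies.
  complete : ∀ A → T ⊢ interp Pr f₀ A → L ⊢ₘ A
  complete A p =
    let (j , edge) = edge-exists (iff-⊤ (≡subst (T ⊢_) (interp≡ff A) p))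
        iff = proj₁ (claims (suc j)) ⊤ₘ A (via ≤-refl edge [])
    in consL (⊤ₘ ⇔ₘ A) (⊤ₘ ⇔ₘ A) A (λ v w h _ → sym (iff→≡ true (evalM v w A) h)) iff iff

theorem3p3 : (T : Theory) → PrimRecAxiomatized T → Consistent T → Extends PA T →
    (L : Logic) →
    Σ Formula λ Pr →
    Σ₁ Pr × IsProvabilityPredicate T Pr × ConditionE T Pr ×
    ((A : MFormula) (f : Valuation) → L ⊢ₘ A → T ⊢ interp Pr f A) ×
    Σ Valuation λ f → (A : MFormula) → (L ⊢ₘ A → T ⊢ interp Pr f A) × (T ⊢ interp Pr f A → L ⊢ₘ A)
theorem3p3 T (χ , spec) con ext L = Pr , Pr-Σ₁ , (Pr-FV , λ φ → nec , conec φ) , condE , sound ,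
    f₀ , λ A → sound A f₀ , complete A
  where open Final T χ (λ φ → proj₁ (spec φ)) (λ φ → proj₂ (spec φ)) con ext L
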